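{- There is a randomized algorithm that, given a constant $k\ge 2$, $k$ independent uniformly random vectors $w^1,\ldots,w^k\in[m]^n$, with $n\le m\le\mathrm{poly}(n)$ and $m$ being a multiple of $n$, and a target $t$ (that may be adversarially chosen depending on the lists), finds $s_i\in w^i$ (for $i=1,\ldots,k$) satisfying $\sum_{i=1}^k s_i=t$, if they exist, with constant probability using $\tilde{O}(n^{k-0.5})$ time and $O(\log n)$ space.
   Context: $[m]=\{1,\ldots,m\}$. Here $s_i\in w^i$ means that $s_i$ is one of the $n$ entries of the vector (list) $w^i$, and $t$ is an integer. The input is accessed by random read-only access and is not counted in the space usage. No random access to a read-only string of random bits is assumed (the algorithm may toss coins, but storing them counts towards its space). The notation $\tilde{O}(T)$ means $O(T\cdot\mathrm{polylog}(T))$. "With constant probability" means with probability at least some positive constant. -}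

module Defs where

open import Data.Bool.Base using (Bool; true; false; if_then_else_)
open import Data.Fin.Base using (Fin; toℕ)
open import Data.Integer.Base as ℤ using (ℤ; +_; -[1+_]; ∣_∣)
import Data.Integer.Properties as ℤ
open import Data.List.Base
  using (List; []; _∷_; _∷ʳ_; length; map; filter; allFin
        ; cartesianProduct; cartesianProductWith)
open import Data.List.Membership.Propositional using (_∈_; find; lose)
open import Data.List.Membership.DecPropositional using (_∈?_)
open import Data.List.Relation.Binary.Pointwise as Pointwise using (Pointwise; []; _∷_)
open import Data.List.Relation.Unary.Any using (Any; any?)
open import Data.Nat.Base
open import Data.Nat.ListAction using (sum)
open import Data.Nat.Logarithm using (⌊log₂_⌋)
open import Data.Nat.Properties using (_≟_)
open import Data.Product using (∃; ∃₂; _×_; _,_)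
open import Data.Vec.Base as Vec using (Vec; lookup; _[_]≔_; replicate)
open import Relation.Binary.PropositionalEquality using (_≡_)
open import Relation.Nullary.Decidable using (Dec; map′; _×-dec_; _→-dec_)
open import Relation.Unary using (Decidable)

------------------------------------------------------------------------
-- Asymptotics

_∈O_ : (ℕ → ℕ) → (ℕ → ℕ) → Set
f ∈O g = ∃₂ λ C n₀ → ∀ n → n₀ ≤ n → f n ≤ C * g n

-- f ∈Õ√ g  says  f = Õ(√g), i.e. f = O(√g · log^c √g) for some c.  Both sides
-- are squared to stay within ℕ; log g = 2 log √g, so the constant factor is
-- absorbed by O, and squaring only doubles the unspecified exponent c.
_∈Õ√_ : (ℕ → ℕ) → (ℕ → ℕ) → Set
f ∈Õ√ g = ∃ λ c → (λ n → f n ^ 2) ∈O (λ n → g n * ⌊log₂ g n ⌋ ^ c)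

------------------------------------------------------------------------
-- k-SUM

-- Fin m represents [m] = {1,…,m} via i ↦ suc (toℕ i).
Vectors : (k n m : ℕ) → Set
Vectors k n m = Vec (Vec (Fin m) n) k

entries : ∀ {k n m} → Vectors k n m → List (List ℕ)
entries w = map (λ v → map (λ i → suc (toℕ i)) (Vec.toList v)) (Vec.toList w)

record Instance : Set where
  constructor mkInstance
  field
    k n m  : ℕ
    lists  : List (List ℕ)
    target : ℤ

instanceOf : ∀ {k n m} → Vectors k n m → ℤ → Instance
instanceOf {k} {n} {m} w t = mkInstance k n m (entries w) t

Solution : Instance → List ℕ → Set
Solution I s = Pointwise _∈_ s lists × + sum s ≡ target
  where open Instance I

Solvable : Instance → Set
Solvable I = ∃ (Solution I)

------------------------------------------------------------------------
-- Randomized random-access machine with read-only input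
--
-- Programs are structured and have finitely many registers holding natural
-- numbers.  Every instruction takes unit time.  Register contents are charged
-- by bit length (see `space`), so within O(log n) space all operands are
-- O(log n)-bit words, as in the word RAM.

module _ (R : ℕ) where

  data Expr : Set where
    const                        : ℕ → Expr
    _⊕_ _⊖_ _⊗_ _⊘_ _⊛_          : Fin R → Fin R → Expr
    paramK paramN paramM         : Expr
    entry                        : Fin R → Fin R → Expr
    targetSign                   : Expr
    targetDigit                  : Fin R → Expr
    coin                         : Expr

  data Cmd : Set where
    _≔_        : Fin R → Expr → Cmd
    emit       : Fin R → Cmd
    skip       : Cmd
    _⨟_        : Cmd → Cmd → Cmd
    ifNonZero_then_else_ : Fin R → Cmd → Cmd → Cmd
    whileNonZero_loop_   : Fin R → Cmd → Cmd

-- The number of registers and the program are fixed before k, n, m, w, t.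
record Algorithm : Set where
  constructor algorithm
  field
    registers : ℕ
    program   : Cmd registers

quot rem : ℕ → ℕ → ℕ
quot x zero    = 0
quot x (suc y) = x / suc y
rem x zero    = 0
rem x (suc y) = x % suc y

nth : ∀ {A : Set} → A → List A → ℕ → A
nth d []       _       = d
nth d (x ∷ _)  zero    = x
nth d (_ ∷ xs) (suc i) = nth d xs i

sign : ℤ → ℕ
sign (+ _)    = 0
sign -[1+ _ ] = 1

-- The target is an arbitrary integer and need not fit into O(log n) bits, so
-- it is read digit by digit: the digit of weight 2 ^ p of |t|, or the
-- end marker 2 beyond the leading digit.
digit : ℕ → ℤ → ℕ
digit p t = if 2 ^ p ≤ᵇ ∣ t ∣ then rem (quot ∣ t ∣ (2 ^ p)) 2 else 2

bit : Bool → ℕ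
bit false = 0
bit true  = 1

Store : ℕ → Set
Store R = Vec ℕ R

-- Entries are addressed from 0; out-of-range reads return 0.
eval : ∀ {R} → Instance → Bool → Store R → Expr R → ℕ
eval I b ρ (const c)       = c
eval I b ρ (x ⊕ y)         = lookup ρ x + lookup ρ y
eval I b ρ (x ⊖ y)         = lookup ρ x ∸ lookup ρ y
eval I b ρ (x ⊗ y)         = lookup ρ x * lookup ρ y
eval I b ρ (x ⊘ y)         = quot (lookup ρ x) (lookup ρ y)
eval I b ρ (x ⊛ y)         = rem (lookup ρ x) (lookup ρ y)
eval I b ρ paramK          = Instance.k I
eval I b ρ paramN          = Instance.n I
eval I b ρ paramM          = Instance.m I
eval I b ρ (entry x y)     = nth 0 (nth [] (Instance.lists I) (lookup ρ x)) (lookup ρ y)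
eval I b ρ targetSign      = sign (Instance.target I)
eval I b ρ (targetDigit x) = digit (lookup ρ x) (Instance.target I)
eval I b ρ coin            = bit b

-- `control` lists the commands still to be executed.  Its length is bounded by
-- the nesting depth of the program, so it encodes a program counter with
-- finitely many values.  `output` is write-only.
record Config (R : ℕ) : Set where
  constructor ⟨_,_,_⟩
  field
    control : List (Cmd R)
    store   : Store R
    output  : List ℕ

-- Each step is handed one fresh coin toss, which is lost unless the step is an
-- assignment of `coin`; past tosses cannot be re-read.
step : ∀ {R} → Instance → Config R → Bool → Config R
step I ⟨ [] , ρ , o ⟩ b = ⟨ [] , ρ , o ⟩
step I ⟨ (x ≔ e) ∷ K , ρ , o ⟩ b = ⟨ K , ρ [ x ]≔ eval I b ρ e , o ⟩
step I ⟨ emit x ∷ K , ρ , o ⟩ b = ⟨ K , ρ , o ∷ʳ lookup ρ x ⟩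
step I ⟨ skip ∷ K , ρ , o ⟩ b = ⟨ K , ρ , o ⟩
step I ⟨ (c ⨟ d) ∷ K , ρ , o ⟩ b = ⟨ c ∷ d ∷ K , ρ , o ⟩
step I ⟨ (ifNonZero x then c else d) ∷ K , ρ , o ⟩ b with lookup ρ x
... | zero  = ⟨ d ∷ K , ρ , o ⟩
... | suc _ = ⟨ c ∷ K , ρ , o ⟩
step I ⟨ (whileNonZero x loop c) ∷ K , ρ , o ⟩ b with lookup ρ x
... | zero  = ⟨ K , ρ , o ⟩
... | suc _ = ⟨ c ∷ (whileNonZero x loop c) ∷ K , ρ , o ⟩

steps : ∀ {R} → Instance → Config R → List Bool → Config R
steps I κ []       = κ
steps I κ (b ∷ bs) = steps I (step I κ b) bs

module _ (A : Algorithm) where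
  open Algorithm A
  open Config

  initial : Config registers
  initial = ⟨ program ∷ [] , replicate registers 0 , [] ⟩

  run : Instance → List Bool → Config registers
  run I = steps I initial

  -- Total number of bits held in the registers.
  space : Config registers → ℕ
  space κ = Vec.sum (Vec.map (λ v → suc ⌊log₂ v ⌋) (store κ))

  RunsInTime : Instance → ℕ → Set
  RunsInTime I T = (coins : Vec Bool T) → control (run I (Vec.toList coins)) ≡ []

  -- Quantifying over coin lists of every length covers every configuration
  -- that occurs during a run.
  RunsInSpace : Instance → ℕ → Set
  RunsInSpace I S = (coins : List Bool) → space (run I coins) ≤ S

  -- A solution is output if one exists.
  Succeeds : Instance → List Bool → Set
  Succeeds I coins = Solvable I → Solution I (output (run I coins))

------------------------------------------------------------------------
-- Decidability, needed for counting

solution? : ∀ I → Decidable (Solution I)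
solution? I s =
  Pointwise.decidable (_∈?_ _≟_) s (Instance.lists I)
  ×-dec (+ sum s ℤ.≟ Instance.target I)

choice? : ∀ {P : List ℕ → Set} → Decidable P → (vs : List (List ℕ)) →
          Dec (∃ λ s → Pointwise _∈_ s vs × P s)
choice? P? [] = map′ (λ p → [] , [] , p) (λ { ([] , [] , p) → p }) (P? [])
choice? {P} P? (v ∷ vs) = map′ to from (any? rest? v)
  where
  Rest : ℕ → Set
  Rest x = ∃ λ s → Pointwise _∈_ s vs × P (x ∷ s)

  rest? : Decidable Rest
  rest? x = choice? (λ s → P? (x ∷ s)) vs

  to : Any Rest v → ∃ λ s → Pointwise _∈_ s (v ∷ vs) × P s
  to any = let (x , x∈v , s , s∈vs , p) = find any in x ∷ s , x∈v ∷ s∈vs , p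

  from : (∃ λ s → Pointwise _∈_ s (v ∷ vs) × P s) → Any Rest v
  from (x ∷ s , x∈v ∷ s∈vs , p) = lose x∈v (s , s∈vs , p)

solvable? : ∀ I → Dec (Solvable I)
solvable? I = choice? (λ s → + sum s ℤ.≟ Instance.target I) (Instance.lists I)

succeeds? : ∀ A I → Decidable (Succeeds A I)
succeeds? A I coins = solvable? I →-dec solution? I _

------------------------------------------------------------------------
-- Finite uniform probability

-- All vectors of length n over the listed alphabet.
words : ∀ {A : Set} → List A → (n : ℕ) → List (Vec A n)
words xs zero    = Vec.[] ∷ []
words xs (suc n) = cartesianProductWith Vec._∷_ xs (words xs n)

-- Pr[ P ] ≥ 1 / L for a uniformly random element of Ω (L = 0 is impossible for
-- nonempty Ω).
ProbAtLeast1/ : ∀ {A : Set} {P : A → Set} → ℕ → List A → Decidable P → Set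
ProbAtLeast1/ L Ω P? = length Ω ≤ L * length (filter P? Ω)

-- w uniform on ([m]^n)^k together with T independent fair coin tosses.
sampleSpace : (k n m T : ℕ) → List (Vectors k n m × Vec Bool T)
sampleSpace k n m T =
  cartesianProduct (words (words (allFin m) n) k) (words (true ∷ false ∷ []) T)

SucceedsWithProb≥1/ : ℕ → Algorithm → (k n m T : ℕ) → (Vectors k n m → ℤ) → Set
SucceedsWithProb≥1/ L A k n m T t =
  ProbAtLeast1/ L (sampleSpace k n m T)
    (λ (w , coins) → succeeds? A (instanceOf w (t w)) (Vec.toList coins))

{-# OPTIONS --safe #-}
module Submission where

-- Guess the entries of all lists but the first two; for each of the n^(k-2)
-- guesses a 2-SUM instance remains.  Reduce it modulo a random number of buckets
-- and walk along the hash values, following Floyd's cycle detection: a walk from a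
-- random start meets the wanted pair as a collision with probability about
-- ℓ²/n for walks of length ℓ ≈ √n / log² n, so about n polylog n walks suffice.
-- The hash is read off the random input itself, shifted by random offsets, which
-- replaces the random oracle; only a few counters are ever stored.

open import Defs
open import Data.Bool.Base using (Bool; true; false; if_then_else_; T; _∧_; _∨_; not)
open import Data.Empty using (⊥; ⊥-elim)
open import Data.Fin.Base as Fin using (Fin; toℕ; fromℕ<)
open import Data.Integer.Base as ℤ using (ℤ)
open import Data.List.Base as List using (List; []; _∷_; _++_; length; allFin)
open import Data.Nat.Base
open import Data.Nat.ListAction using (sum)
open import Data.Nat.Properties
open import Data.Nat.DivMod
open import Data.Nat.Divisibility using (_∣_; divides)
open import Data.Nat.Logarithm using (⌊log₂_⌋; ⌊log₂⌋-mono-≤; ⌊log₂[2^n]⌋≡n)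
open import Data.Nat.Tactic.RingSolver using (solve-∀)
open import Data.Product using (Σ; Σ-syntax; ∃; _×_; _,_; proj₁; proj₂)
open import Data.Sum.Base using (_⊎_; inj₁; inj₂)
open import Data.Unit.Base using (⊤; tt)
open import Data.Vec.Base as Vec using (Vec; []; _∷_; lookup; _[_]≔_)
open import Function.Base using (_∘_; id; case_of_; _$_)
open import Relation.Binary.PropositionalEquality
open import Relation.Nullary using (¬_; Dec; yes; no; does; contradiction)
import Data.Fin.Properties as Fin
import Data.List.Properties as List
import Data.Vec.Properties as Vec
open import Relation.Nullary.Decidable using (_×-dec_; ¬?; from-yes)
open import Relation.Binary.Definitions using (tri<; tri≈; tri>)
open import Data.Nat.Induction using (<-rec)
open import Data.List.Membership.Propositional using (_∈_)
open import Data.List.Relation.Unary.Any using (here; there)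
open import Data.List.Relation.Binary.Pointwise using (Pointwise; []; _∷_)

-- The target may be chosen after the lists, so the wanted pair is not independent of the hash read
-- off list 1. What is shown instead is that with probability at least 1/2 the lists 1 and 2 serve
-- every pair of positions at once; the remaining lists stay arbitrary. The union bound runs over
-- about n² pairs, so a single pair may fail only with polynomially small probability. This is why a
-- seed has 8 lg n bits: it selects a subset of the G entries of each row, their sum modulo n is the
-- oracle value, distinct nonzero seeds behave as pairwise independent oracles, and Chebyshev's
-- inequality over about n^8 seeds gives the small failure probability. To keep buckets and oracle
-- independent, the buckets read list 1 only in its first half after rotation, and the oracle rows
-- lie behind it. For a uniformly random oracle, a walk of length 2ℓ meets the pair at one of ℓ²
-- disjoint pairs of times, each with probability at least 1/(2n²). All probabilities are
-- inequalities between products of natural numbers, which avoids division.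

private variable
  𝒜 ℬ Φ Ψ : Set

-- Finite sums and indicators.

∑ : List 𝒜 → (𝒜 → ℕ) → ℕ
∑ []       f = 0
∑ (x ∷ xs) f = f x + ∑ xs f

syntax ∑ xs (λ x → e) = ∑[ x ∈ xs ] e
infix 5 ∑

∑-cong : ∀ (xs : List 𝒜) {f g : 𝒜 → ℕ} → (∀ x → f x ≡ g x) → ∑ xs f ≡ ∑ xs g
∑-cong []       eq = refl
∑-cong (x ∷ xs) eq = cong₂ _+_ (eq x) (∑-cong xs eq)

∑-mono : ∀ (xs : List 𝒜) {f g : 𝒜 → ℕ} → (∀ x → f x ≤ g x) → ∑ xs f ≤ ∑ xs g
∑-mono []       le = z≤n
∑-mono (x ∷ xs) le = +-mono-≤ (le x) (∑-mono xs le)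

interchange : ∀ a b c d → (a + b) + (c + d) ≡ (a + c) + (b + d)
interchange = solve-∀

∑-+ : ∀ (xs : List 𝒜) f g → ∑ xs (λ x → f x + g x) ≡ ∑ xs f + ∑ xs g
∑-+ []       f g = refl
∑-+ (x ∷ xs) f g =
  trans (cong (f x + g x +_) (∑-+ xs f g)) (interchange (f x) (g x) (∑ xs f) (∑ xs g))

∑-*ˡ : ∀ (xs : List 𝒜) c f → ∑ xs (λ x → c * f x) ≡ c * ∑ xs f
∑-*ˡ []       c f = sym (*-zeroʳ c)
∑-*ˡ (x ∷ xs) c f =
  trans (cong (c * f x +_) (∑-*ˡ xs c f)) (sym (*-distribˡ-+ c (f x) (∑ xs f)))

∑-*ʳ : ∀ (xs : List 𝒜) c f → ∑ xs (λ x → f x * c) ≡ ∑ xs f * c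
∑-*ʳ xs c f =
  trans (∑-cong xs (λ x → *-comm (f x) c)) (trans (∑-*ˡ xs c f) (*-comm c (∑ xs f)))

∑-const : ∀ (xs : List 𝒜) c → ∑ xs (λ _ → c) ≡ length xs * c
∑-const []       c = refl
∑-const (x ∷ xs) c = cong (c +_) (∑-const xs c)

∑-zero : ∀ (xs : List 𝒜) {f : 𝒜 → ℕ} → (∀ x → f x ≡ 0) → ∑ xs f ≡ 0
∑-zero xs eq = trans (∑-cong xs eq) (trans (∑-const xs 0) (*-zeroʳ (length xs)))

∑-swap : ∀ (xs : List 𝒜) (ys : List ℬ) (f : 𝒜 → ℬ → ℕ) →
  ∑ xs (λ x → ∑ ys (f x)) ≡ ∑ ys (λ y → ∑ xs (λ x → f x y))
∑-swap []       ys f = sym (∑-zero ys (λ _ → refl))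
∑-swap (x ∷ xs) ys f =
  trans (cong (∑ ys (f x) +_) (∑-swap xs ys f))
        (sym (∑-+ ys (f x) (λ y → ∑ xs (λ x → f x y))))

∑-++ : ∀ (xs ys : List 𝒜) f → ∑ (xs ++ ys) f ≡ ∑ xs f + ∑ ys f
∑-++ []       ys f = refl
∑-++ (x ∷ xs) ys f =
  trans (cong (f x +_) (∑-++ xs ys f)) (sym (+-assoc (f x) (∑ xs f) (∑ ys f)))

∑-map : ∀ (h : 𝒜 → ℬ) xs f → ∑ (List.map h xs) f ≡ ∑ xs (f ∘ h)
∑-map h []       f = refl
∑-map h (x ∷ xs) f = cong (f (h x) +_) (∑-map h xs f)

∑-cartesianProductWith : ∀ {C : Set} (h : 𝒜 → ℬ → C) xs ys f →
  ∑ (List.cartesianProductWith h xs ys) f ≡ ∑ xs (λ x → ∑ ys (λ y → f (h x y)))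
∑-cartesianProductWith h []       ys f = refl
∑-cartesianProductWith h (x ∷ xs) ys f =
  trans (∑-++ (List.map (h x) ys) (List.cartesianProductWith h xs ys) f)
        (cong₂ _+_ (∑-map (h x) ys f) (∑-cartesianProductWith h xs ys f))

∑-≤ : ∀ (xs : List 𝒜) {f : 𝒜 → ℕ} c → (∀ x → f x ≤ c) → ∑ xs f ≤ length xs * c
∑-≤ xs c le = ≤-trans (∑-mono xs le) (≤-reflexive (∑-const xs c))

∑-* : ∀ (xs : List 𝒜) (ys : List ℬ) f g →
  ∑ xs f * ∑ ys g ≡ ∑ xs (λ x → ∑ ys (λ y → f x * g y))
∑-* xs ys f g = trans (sym (∑-*ʳ xs (∑ ys g) f))
  (∑-cong xs (λ x → sym (∑-*ˡ ys (f x) g)))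

length-∑ : ∀ (xs : List 𝒜) → length xs ≡ ∑ xs (λ _ → 1)
length-∑ xs = trans (sym (*-identityʳ (length xs))) (sym (∑-const xs 1))

𝟙 : Dec Φ → ℕ
𝟙 (yes _) = 1
𝟙 (no  _) = 0

𝟙≤1 : (d : Dec Φ) → 𝟙 d ≤ 1
𝟙≤1 (yes _) = ≤-refl
𝟙≤1 (no  _) = z≤n

𝟙-yes : (d : Dec Φ) → Φ → 𝟙 d ≡ 1
𝟙-yes (yes _) x = refl
𝟙-yes (no ¬x) x = contradiction x ¬x

𝟙-no : (d : Dec Φ) → ¬ Φ → 𝟙 d ≡ 0
𝟙-no (yes x) ¬x = contradiction x ¬x
𝟙-no (no _)  ¬x = refl

𝟙-pos : (d : Dec Φ) → 0 < 𝟙 d → Φ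
𝟙-pos (yes x) _ = x

𝟙-×-zero : (d : Dec Φ) (e : Dec Ψ) → 𝟙 d * 𝟙 e ≡ 0 → Φ → ¬ Ψ
𝟙-×-zero (yes _) (no ¬y) eq x = ¬y
𝟙-×-zero (no ¬x) e       eq x = contradiction x ¬x

𝟙-mono : (d : Dec Φ) (e : Dec Ψ) → (Φ → Ψ) → 𝟙 d ≤ 𝟙 e
𝟙-mono (yes x) e f = ≤-reflexive (sym (𝟙-yes e (f x)))
𝟙-mono (no _)  e f = z≤n

𝟙-cong : (d : Dec Φ) (e : Dec Ψ) → (Φ → Ψ) → (Ψ → Φ) → 𝟙 d ≡ 𝟙 e
𝟙-cong d e f g = ≤-antisym (𝟙-mono d e f) (𝟙-mono e d g)

𝟙-idem : (d : Dec Φ) → 𝟙 d * 𝟙 d ≡ 𝟙 d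
𝟙-idem (yes _) = refl
𝟙-idem (no _)  = refl

𝟙-≤-when : (d : Dec Φ) {a b : ℕ} → (Φ → a ≤ b) → 𝟙 d * a ≤ 𝟙 d * b
𝟙-≤-when (yes x) le = *-monoʳ-≤ 1 (le x)
𝟙-≤-when (no _)  le = z≤n


length-filter : ∀ {P : 𝒜 → Set} (P? : ∀ x → Dec (P x)) xs →
  length (List.filter P? xs) ≡ ∑ xs (λ x → 𝟙 (P? x))
length-filter P? []       = refl
length-filter P? (x ∷ xs) with P? x
... | yes _ = cong suc (length-filter P? xs)
... | no  _ = length-filter P? xs

∑-allFin-suc : ∀ n (f : Fin (suc n) → ℕ) →
  ∑ (allFin (suc n)) f ≡ f Fin.zero + ∑ (allFin n) (f ∘ Fin.suc)
∑-allFin-suc n f = cong (f Fin.zero +_)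
  (trans (cong (λ xs → ∑ xs f) (sym (List.map-tabulate id Fin.suc)))
         (∑-map Fin.suc (allFin n) f))

length-allFin : ∀ n → length (allFin n) ≡ n
length-allFin n = List.length-tabulate {n = n} id

∑-allFin-const : ∀ n c → ∑ (allFin n) (λ _ → c) ≡ n * c
∑-allFin-const n c = trans (∑-const (allFin n) c) (cong (_* c) (length-allFin n))

∑-≟ : ∀ {n} (i : Fin n) (f : Fin n → ℕ) → ∑ (allFin n) (λ a → 𝟙 (i Fin.≟ a) * f a) ≡ f i
∑-≟ {suc n} Fin.zero f = trans (∑-allFin-suc n (λ a → 𝟙 (Fin.zero Fin.≟ a) * f a))
  (trans (cong₂ _+_ (*-identityˡ (f Fin.zero))
                    (∑-zero (allFin n) (λ a → cong (_* f (Fin.suc a)) (𝟙-no (Fin.zero Fin.≟ Fin.suc a) λ ()))))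
         (+-identityʳ (f Fin.zero)))
∑-≟ {suc n} (Fin.suc i) f = trans (∑-allFin-suc n (λ a → 𝟙 (Fin.suc i Fin.≟ a) * f a))
  (trans (cong₂ _+_ (cong (_* f Fin.zero) (𝟙-no (Fin.suc i Fin.≟ Fin.zero) λ ()))
           (∑-cong (allFin n) (λ a → cong (_* f (Fin.suc a))
             (𝟙-cong (Fin.suc i Fin.≟ Fin.suc a) (i Fin.≟ a) Fin.suc-injective (cong Fin.suc)))))
         (∑-≟ i (f ∘ Fin.suc)))

∑-𝟙≟ : ∀ {n} (i : Fin n) → ∑ (allFin n) (λ a → 𝟙 (i Fin.≟ a)) ≡ 1
∑-𝟙≟ {n} i = trans (∑-cong (allFin n) (λ a → sym (*-identityʳ (𝟙 (i Fin.≟ a))))) (∑-≟ i (λ _ → 1))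

term≤∑ : ∀ {n} (i : Fin n) (f : Fin n → ℕ) → f i ≤ ∑ (allFin n) f
term≤∑ {n} i f = ≤-trans (≤-reflexive (sym (∑-≟ i f)))
  (∑-mono (allFin n) (λ a → ≤-trans (*-monoˡ-≤ (f a) (𝟙≤1 (i Fin.≟ a))) (≤-reflexive (*-identityˡ (f a)))))

∑-unique : ∀ n (f : Fin n → ℕ) {c} → (∀ a → f a ≤ c) →
  (∀ a b → 0 < f a → 0 < f b → a ≡ b) → ∑ (allFin n) f ≤ c
∑-unique zero    f le un = z≤n
∑-unique (suc n) f {c} le un rewrite ∑-allFin-suc n f with f Fin.zero in eq
... | zero  = ∑-unique n (f ∘ Fin.suc) (le ∘ Fin.suc)
                (λ a b p q → Fin.suc-injective (un (Fin.suc a) (Fin.suc b) p q))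
... | suc v = ≤-trans (≤-reflexive (trans (cong (suc v +_) (∑-zero (allFin n) rest)) (+-identityʳ (suc v))))
                      (≤-trans (≤-reflexive (sym eq)) (le Fin.zero))
  where
  rest : ∀ a → f (Fin.suc a) ≡ 0
  rest a with f (Fin.suc a) in eqa
  ... | zero  = refl
  ... | suc _ with () ← un Fin.zero (Fin.suc a) (subst (0 <_) (sym eq) z<s) (subst (0 <_) (sym eqa) z<s)

∑-bijection : ∀ {n} (φ ψ : Fin n → Fin n) → (∀ a → ψ (φ a) ≡ a) → (∀ b → φ (ψ b) ≡ b) →
  ∀ (f : Fin n → ℕ) → ∑ (allFin n) (f ∘ φ) ≡ ∑ (allFin n) f
∑-bijection {n} φ ψ ψφ φψ f = begin
  ∑ (allFin n) (λ a → f (φ a))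
    ≡⟨ ∑-cong (allFin n) (λ a → sym (∑-≟ (φ a) f)) ⟩
  ∑ (allFin n) (λ a → ∑ (allFin n) (λ b → 𝟙 (φ a Fin.≟ b) * f b))
    ≡⟨ ∑-swap (allFin n) (allFin n) (λ a b → 𝟙 (φ a Fin.≟ b) * f b) ⟩
  ∑ (allFin n) (λ b → ∑ (allFin n) (λ a → 𝟙 (φ a Fin.≟ b) * f b))
    ≡⟨ ∑-cong (allFin n) (λ b → trans (∑-*ʳ (allFin n) (f b) _)
         (cong (_* f b) (trans (∑-cong (allFin n) (λ a → 𝟙-cong (φ a Fin.≟ b) (ψ b Fin.≟ a)
            (λ e → trans (cong ψ (sym e)) (ψφ a)) (λ e → trans (cong φ (sym e)) (φψ b)))) (∑-𝟙≟ (ψ b))))) ⟩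
  ∑ (allFin n) (λ b → 1 * f b)
    ≡⟨ ∑-cong (allFin n) (λ b → *-identityˡ (f b)) ⟩
  ∑ (allFin n) f ∎
  where open ≡-Reasoning

-- Sums over words and power estimates.

∑-words-suc : ∀ (xs : List 𝒜) n (F : Vec 𝒜 (suc n) → ℕ) →
  ∑ (words xs (suc n)) F ≡ ∑ xs (λ a → ∑ (words xs n) (λ v → F (a ∷ v)))
∑-words-suc xs n F = ∑-cartesianProductWith _∷_ xs (words xs n) F

length-words : ∀ (xs : List 𝒜) n → length (words xs n) ≡ length xs ^ n
length-words xs zero    = refl
length-words xs (suc n) = begin
  length (words xs (suc n))                  ≡⟨ length-∑ (words xs (suc n)) ⟩
  ∑ (words xs (suc n)) (λ _ → 1)             ≡⟨ ∑-words-suc xs n (λ _ → 1) ⟩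
  ∑ xs (λ _ → ∑ (words xs n) (λ _ → 1))      ≡⟨ ∑-const xs _ ⟩
  length xs * ∑ (words xs n) (λ _ → 1)       ≡⟨ cong (length xs *_) (trans (sym (length-∑ (words xs n))) (length-words xs n)) ⟩
  length xs * length xs ^ n                  ∎
  where open ≡-Reasoning

-- Both sides count pairs of a word and a letter: the letter overwritten at `u` ranges freely over
-- `xs`, which gives the factor.
∑-words-resample : ∀ (xs : List 𝒜) n (u : Fin n) (F : Vec 𝒜 n → ℕ) →
  ∑ (words xs n) (λ h → ∑ xs (λ v → F (h [ u ]≔ v))) ≡ length xs * ∑ (words xs n) F
∑-words-resample xs (suc n) Fin.zero F = begin
  ∑ (words xs (suc n)) (λ h → ∑ xs (λ v → F (h [ Fin.zero ]≔ v)))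
    ≡⟨ ∑-words-suc xs n _ ⟩
  ∑ xs (λ a → ∑ (words xs n) (λ h → ∑ xs (λ v → F (v ∷ h))))
    ≡⟨ ∑-const xs _ ⟩
  length xs * ∑ (words xs n) (λ h → ∑ xs (λ v → F (v ∷ h)))
    ≡⟨ cong (length xs *_) (trans (∑-swap (words xs n) xs (λ h v → F (v ∷ h))) (sym (∑-words-suc xs n F))) ⟩
  length xs * ∑ (words xs (suc n)) F ∎
  where open ≡-Reasoning
∑-words-resample xs (suc n) (Fin.suc u) F = begin
  ∑ (words xs (suc n)) (λ h → ∑ xs (λ v → F (h [ Fin.suc u ]≔ v)))
    ≡⟨ ∑-words-suc xs n _ ⟩
  ∑ xs (λ a → ∑ (words xs n) (λ h → ∑ xs (λ v → F (a ∷ (h [ u ]≔ v)))))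
    ≡⟨ ∑-cong xs (λ a → ∑-words-resample xs n u (λ h → F (a ∷ h))) ⟩
  ∑ xs (λ a → length xs * ∑ (words xs n) (λ h → F (a ∷ h)))
    ≡⟨ trans (∑-*ˡ xs (length xs) _) (cong (length xs *_) (sym (∑-words-suc xs n F))) ⟩
  length xs * ∑ (words xs (suc n)) F ∎
  where open ≡-Reasoning

-- A coordinatewise change of variables, where preservation of sums stands for bijectivity of each
-- `φ p`. It allows adding position-dependent amounts to a uniformly random list.
∑-words-reindex : ∀ {n} (xs : List 𝒜) (φ : Fin n → 𝒜 → 𝒜) →
  (∀ p f → ∑ xs (f ∘ φ p) ≡ ∑ xs f) → ∀ F →
  ∑ (words xs n) (λ w → F (Vec.tabulate (λ p → φ p (lookup w p)))) ≡ ∑ (words xs n) F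
∑-words-reindex {n = zero}  xs φ inv F = refl
∑-words-reindex {n = suc n} xs φ inv F = begin
  ∑ (words xs (suc n)) (λ w → F (Vec.tabulate (λ p → φ p (lookup w p))))
    ≡⟨ ∑-words-suc xs n _ ⟩
  ∑ xs (λ a → ∑ (words xs n) (λ w → F (φ Fin.zero a ∷ Vec.tabulate (λ p → φ (Fin.suc p) (lookup w p)))))
    ≡⟨ ∑-cong xs (λ a → ∑-words-reindex xs (φ ∘ Fin.suc) (inv ∘ Fin.suc) (λ w → F (φ Fin.zero a ∷ w))) ⟩
  ∑ xs (λ a → ∑ (words xs n) (λ w → F (φ Fin.zero a ∷ w)))
    ≡⟨ inv Fin.zero (λ b → ∑ (words xs n) (λ w → F (b ∷ w))) ⟩
  ∑ xs (λ a → ∑ (words xs n) (λ w → F (a ∷ w)))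
    ≡⟨ sym (∑-words-suc xs n F) ⟩
  ∑ (words xs (suc n)) F ∎
  where open ≡-Reasoning

∑-words-++ : ∀ (xs : List 𝒜) m n (F : Vec 𝒜 (m + n) → ℕ) →
  ∑ (words xs (m + n)) F ≡ ∑ (words xs m) (λ u → ∑ (words xs n) (λ v → F (u Vec.++ v)))
∑-words-++ xs zero    n F = sym (+-identityʳ _)
∑-words-++ xs (suc m) n F = begin
  ∑ (words xs (suc m + n)) F
    ≡⟨ ∑-words-suc xs (m + n) F ⟩
  ∑ xs (λ a → ∑ (words xs (m + n)) (λ v → F (a ∷ v)))
    ≡⟨ ∑-cong xs (λ a → ∑-words-++ xs m n (λ v → F (a ∷ v))) ⟩
  ∑ xs (λ a → ∑ (words xs m) (λ u → ∑ (words xs n) (λ v → F (a ∷ u Vec.++ v))))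
    ≡⟨ sym (∑-words-suc xs m _) ⟩
  ∑ (words xs (suc m)) (λ u → ∑ (words xs n) (λ v → F (u Vec.++ v))) ∎
  where open ≡-Reasoning

∑-words-∏ : ∀ (xs : List 𝒜) n (φ : 𝒜 → ℕ) →
  ∑ (words xs n) (λ v → Vec.foldr′ _*_ 1 (Vec.map φ v)) ≡ ∑ xs φ ^ n
∑-words-∏ xs zero    φ = refl
∑-words-∏ xs (suc n) φ = begin
  ∑ (words xs (suc n)) (λ v → Vec.foldr′ _*_ 1 (Vec.map φ v))
    ≡⟨ ∑-words-suc xs n _ ⟩
  ∑ xs (λ a → ∑ (words xs n) (λ v → φ a * Vec.foldr′ _*_ 1 (Vec.map φ v)))
    ≡⟨ sym (∑-* xs (words xs n) φ _) ⟩
  ∑ xs φ * ∑ (words xs n) (λ v → Vec.foldr′ _*_ 1 (Vec.map φ v))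
    ≡⟨ cong (∑ xs φ *_) (∑-words-∏ xs n φ) ⟩
  ∑ xs φ * ∑ xs φ ^ n ∎
  where open ≡-Reasoning

∑-restrict : ∀ (Ω : List 𝒜) (d : Dec Φ) (e : Dec Ψ) s ℬ (f : 𝒜 → ℕ) →
  (Φ → Ψ → s * ∑ Ω f ≤ ℬ) → s * ∑ Ω (λ w → 𝟙 d * 𝟙 e * f w) ≤ ℬ
∑-restrict Ω (yes x) (yes y) s ℬ f le =
  ≤-trans (≤-reflexive (cong (s *_) (∑-cong Ω (λ w → *-identityˡ (f w))))) (le x y)
∑-restrict Ω (yes _) (no _) s ℬ f le =
  ≤-trans (≤-reflexive (trans (cong (s *_) (∑-zero Ω (λ _ → refl))) (*-zeroʳ s))) z≤n
∑-restrict Ω (no _) e s ℬ f le =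
  ≤-trans (≤-reflexive (trans (cong (s *_) (∑-zero Ω (λ _ → refl))) (*-zeroʳ s))) z≤n

-- Bernoulli's inequality (1 - d/n)^r ≥ 1 - rd/n.
bernoulli : ∀ n d r → n ^ suc r ≤ (n ∸ d) ^ r * n + r * d * n ^ r
bernoulli n d zero    = ≤-reflexive (trans (*-identityʳ n) (sym (trans (+-identityʳ _) (*-identityˡ n))))
bernoulli n d (suc r) = begin
  n * n ^ suc r
    ≤⟨ *-monoʳ-≤ n (bernoulli n d r) ⟩
  n * ((n ∸ d) ^ r * n + r * d * n ^ r)
    ≡⟨ lemma₁ n ((n ∸ d) ^ r) d r (n ^ r) ⟩
  n * ((n ∸ d) ^ r * n) + r * d * (n * n ^ r)
    ≤⟨ +-monoˡ-≤ _ (*-monoˡ-≤ ((n ∸ d) ^ r * n) (m≤n+m∸n n d)) ⟩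
  (d + (n ∸ d)) * ((n ∸ d) ^ r * n) + r * d * (n * n ^ r)
    ≡⟨ lemma₂ n (n ∸ d) ((n ∸ d) ^ r) d r (n ^ r) ⟩
  (n ∸ d) * (n ∸ d) ^ r * n + d * ((n ∸ d) ^ r * n) + r * d * (n * n ^ r)
    ≤⟨ +-monoˡ-≤ _ (+-monoʳ-≤ ((n ∸ d) * (n ∸ d) ^ r * n) (*-monoʳ-≤ d (*-monoˡ-≤ n (^-monoˡ-≤ r (m∸n≤m n d))))) ⟩
  (n ∸ d) * (n ∸ d) ^ r * n + d * (n ^ r * n) + r * d * (n * n ^ r)
    ≡⟨ lemma₃ n ((n ∸ d) * (n ∸ d) ^ r) d r (n ^ r) ⟩
  (n ∸ d) * (n ∸ d) ^ r * n + suc r * d * (n * n ^ r) ∎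
  where
  open ≤-Reasoning
  lemma₁ : ∀ n e d r p → n * (e * n + r * d * p) ≡ n * (e * n) + r * d * (n * p)
  lemma₁ = solve-∀
  lemma₂ : ∀ n e f d r p → (d + e) * (f * n) + r * d * (n * p) ≡ e * f * n + d * (f * n) + r * d * (n * p)
  lemma₂ = solve-∀
  lemma₃ : ∀ n g d r p → g * n + d * (p * n) + r * d * (n * p) ≡ g * n + (d + r * d) * (n * p)
  lemma₃ = solve-∀

-- Bernoulli with `r d / n ≤ 1/2`; adding `n * n ^ r` on both sides avoids the subtraction. It
-- bounds the loss of a long walk by a factor 2, and with other constants it also controls `growth`
-- and `fourth-power-step`.
half-power : ∀ n d r → 2 * (r * d) ≤ n → n ^ r ≤ 2 * (n ∸ d) ^ r
half-power zero    d zero    le = s≤s z≤n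
half-power zero    d (suc r) le = z≤n
half-power n@(suc _) d r le = *-cancelʳ-≤ (n ^ r) (2 * (n ∸ d) ^ r) n
  (+-cancelʳ-≤ (n * n ^ r) (n ^ r * n) (2 * (n ∸ d) ^ r * n) (begin
    n ^ r * n + n * n ^ r
      ≡⟨ lemma₁ n (n ^ r) ⟩
    2 * n ^ suc r
      ≤⟨ *-monoʳ-≤ 2 (bernoulli n d r) ⟩
    2 * ((n ∸ d) ^ r * n + r * d * n ^ r)
      ≡⟨ lemma₂ n ((n ∸ d) ^ r) (r * d) (n ^ r) ⟩
    2 * (n ∸ d) ^ r * n + 2 * (r * d) * n ^ r
      ≤⟨ +-monoʳ-≤ _ (*-monoˡ-≤ (n ^ r) le) ⟩
    2 * (n ∸ d) ^ r * n + n * n ^ r ∎))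
  where
  open ≤-Reasoning
  lemma₁ : ∀ n p → p * n + n * p ≡ 2 * (n * p)
  lemma₁ = solve-∀
  lemma₂ : ∀ n e s p → 2 * (e * n + s * p) ≡ 2 * e * n + 2 * s * p
  lemma₂ = solve-∀

-- Walks along a random oracle.

-- The walk steps from a vertex x to h (β x), where h is a uniformly random map
-- from buckets to vertices; it starts at h ⋆.

module Walk {n N : ℕ} (β : Fin n → Fin N) (⋆ : Fin N) where

  Oracle : Set
  Oracle = Vec (Fin n) N

  bucket : Oracle → ℕ → Fin N
  bucket h zero    = ⋆
  bucket h (suc c) = β (lookup h (bucket h c))

  vertex : Oracle → ℕ → Fin n
  vertex h c = lookup h (bucket h c)

  Fresh : Oracle → ℕ → Fin N → Set
  Fresh h zero    u = ⋆ ≢ u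
  Fresh h (suc c) u = Fresh h c u × bucket h (suc c) ≢ u

  -- As long as the buckets are distinct, the oracle has not been read before at the last of them,
  -- so its value there can be redrawn without changing the walk so far.
  Distinct : Oracle → ℕ → Set
  Distinct h zero    = ⊤
  Distinct h (suc c) = Distinct h c × Fresh h c (bucket h (suc c))

  fresh? : ∀ h c u → Dec (Fresh h c u)
  fresh? h zero    u = ¬? (⋆ Fin.≟ u)
  fresh? h (suc c) u = fresh? h c u ×-dec ¬? (bucket h (suc c) Fin.≟ u)

  distinct? : ∀ h c → Dec (Distinct h c)
  distinct? h zero    = yes tt
  distinct? h (suc c) = distinct? h c ×-dec fresh? h c (bucket h (suc c))

  Fresh⇒≢ : ∀ h c {u d} → Fresh h c u → d ≤ c → bucket h d ≢ u
  Fresh⇒≢ h zero    fr       z≤n = fr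
  Fresh⇒≢ h (suc c) (fr , x) d≤  with m≤n⇒m<n∨m≡n d≤
  ... | inj₁ (s≤s d≤c) = Fresh⇒≢ h c fr d≤c
  ... | inj₂ refl      = x

  Distinct⇒≢ : ∀ h c {d} → Distinct h c → d < c → bucket h d ≢ bucket h c
  Distinct⇒≢ h (suc c) (_ , fr) (s≤s d≤c) = Fresh⇒≢ h c fr d≤c

  Distinct-≤ : ∀ h c {d} → Distinct h c → d ≤ c → Distinct h d
  Distinct-≤ h zero    di z≤n = di
  Distinct-≤ h (suc c) di d≤ with m≤n⇒m<n∨m≡n d≤
  ... | inj₁ (s≤s d≤c) = Distinct-≤ h c (proj₁ di) d≤c
  ... | inj₂ refl      = di

  Fresh-cong : ∀ h h′ c {u} → (∀ {d} → d ≤ c → bucket h′ d ≡ bucket h d) → Fresh h c u → Fresh h′ c u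
  Fresh-cong h h′ zero    eq fr       = fr
  Fresh-cong h h′ (suc c) eq (fr , x) = Fresh-cong h h′ c (eq ∘ m≤n⇒m≤1+n) fr , x ∘ trans (sym (eq ≤-refl))

  Distinct-cong : ∀ h h′ c → (∀ {d} → d ≤ c → bucket h′ d ≡ bucket h d) → Distinct h c → Distinct h′ c
  Distinct-cong h h′ zero    eq di        = tt
  Distinct-cong h h′ (suc c) eq (di , fr) =
    Distinct-cong h h′ c (eq ∘ m≤n⇒m≤1+n) di ,
    subst (Fresh h′ c) (sym (eq ≤-refl)) (Fresh-cong h h′ c (eq ∘ m≤n⇒m≤1+n) fr)

  resample : Oracle → ℕ → Fin n → Oracle
  resample h c v = h [ bucket h c ]≔ v

  bucket-resample : ∀ h c v → Distinct h c → ∀ {d} → d ≤ c → bucket (resample h c v) d ≡ bucket h d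
  bucket-resample h c v di {zero}  d≤c = refl
  bucket-resample h c v di {suc d} d<c = cong β (begin
    lookup (resample h c v) (bucket (resample h c v) d)
      ≡⟨ cong (lookup (resample h c v)) (bucket-resample h c v di (<⇒≤ d<c)) ⟩
    lookup (resample h c v) (bucket h d)
      ≡⟨ Vec.lookup∘update′ (Distinct⇒≢ h c di d<c) h v ⟩
    lookup h (bucket h d) ∎)
    where open ≡-Reasoning

  vertex-resample-< : ∀ h c v → Distinct h c → ∀ {d} → d < c → vertex (resample h c v) d ≡ vertex h d
  vertex-resample-< h c v di d<c =
    trans (cong (lookup (resample h c v)) (bucket-resample h c v di (<⇒≤ d<c)))
          (Vec.lookup∘update′ (Distinct⇒≢ h c di d<c) h v)

  vertex-resample : ∀ h c v → Distinct h c → vertex (resample h c v) c ≡ v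
  vertex-resample h c v di =
    trans (cong (lookup (resample h c v)) (bucket-resample h c v di ≤-refl))
          (Vec.lookup∘update (bucket h c) h v)

  oracles : List Oracle
  oracles = words (allFin n) N

  # : {P : Oracle → Set} → (∀ h → Dec (P h)) → ℕ
  # P? = ∑ oracles (λ h → 𝟙 (P? h))

  module _ {P : Oracle → Set} (P? : ∀ h → Dec (P h)) (c : ℕ)
           (P⇒Distinct : ∀ {h} → P h → Distinct h c)
           (P-resample : ∀ h v → P h → P (resample h c v)) where

    private
      at? : ∀ u h → Dec (P h × bucket h c ≡ u)
      at? u h = P? h ×-dec (bucket h c Fin.≟ u)

      at-update : ∀ u h v → P h × bucket h c ≡ u →
                  P (h [ u ]≔ v) × bucket (h [ u ]≔ v) c ≡ u
      at-update u h v (p , refl) = P-resample h v p , bucket-resample h c v (P⇒Distinct p) ≤-refl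

      -- Writing the old value back undoes the update, and is itself an update of the kind treated
      -- by `at-update`.
      at-restore : ∀ u h v → P (h [ u ]≔ v) × bucket (h [ u ]≔ v) c ≡ u → P h × bucket h c ≡ u
      at-restore u h v at = subst (λ g → P g × bucket g c ≡ u)
        (trans (Vec.[]≔-idempotent h u) (Vec.[]≔-lookup h u))
        (at-update u (h [ u ]≔ v) (lookup h u) at)

      -- Conditioning on which bucket is the last one turns an oracle-dependent position into a
      -- fixed one, where `∑-words-resample` applies.
      split-at : ∀ (F : Oracle → Fin N → ℕ) →
        ∑ oracles (λ h → 𝟙 (P? h) * F h (bucket h c)) ≡
        ∑ (allFin N) (λ u → ∑ oracles (λ h → 𝟙 (at? u h) * F h u))
      split-at F = begin
        ∑ oracles (λ h → 𝟙 (P? h) * F h (bucket h c))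
          ≡⟨ ∑-cong oracles (λ h → sym (trans (∑-*ˡ (allFin N) (𝟙 (P? h)) _)
               (cong (𝟙 (P? h) *_) (∑-≟ (bucket h c) (F h))))) ⟩
        ∑ oracles (λ h → ∑ (allFin N) (λ u → 𝟙 (P? h) * (𝟙 (bucket h c Fin.≟ u) * F h u)))
          ≡⟨ ∑-swap oracles (allFin N) (λ h u → 𝟙 (P? h) * (𝟙 (bucket h c Fin.≟ u) * F h u)) ⟩
        ∑ (allFin N) (λ u → ∑ oracles (λ h → 𝟙 (P? h) * (𝟙 (bucket h c Fin.≟ u) * F h u)))
          ≡⟨ ∑-cong (allFin N) (λ u → ∑-cong oracles (λ h →
               trans (sym (*-assoc (𝟙 (P? h)) _ _)) (cong (_* F h u) (𝟙-× (P? h) (bucket h c Fin.≟ u))))) ⟩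
        ∑ (allFin N) (λ u → ∑ oracles (λ h → 𝟙 (at? u h) * F h u)) ∎
        where
        open ≡-Reasoning
        𝟙-× : ∀ {X Y : Set} (d : Dec X) (e : Dec Y) → 𝟙 d * 𝟙 e ≡ 𝟙 (d ×-dec e)
        𝟙-× (yes _) (yes _) = refl
        𝟙-× (yes _) (no _)  = refl
        𝟙-× (no _)  e       = refl

    -- Deferred decisions: the value of h at the last bucket is still uniform.
    ∑-resample : ∀ (F : Oracle → ℕ) →
      ∑ oracles (λ h → 𝟙 (P? h) * ∑ (allFin n) (λ v → F (resample h c v))) ≡
      n * ∑ oracles (λ h → 𝟙 (P? h) * F h)
    ∑-resample F = begin
      ∑ oracles (λ h → 𝟙 (P? h) * ∑ (allFin n) (λ v → F (resample h c v)))
        ≡⟨ split-at (λ h u → ∑ (allFin n) (λ v → F (h [ u ]≔ v))) ⟩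
      ∑ (allFin N) (λ u → ∑ oracles (λ h → 𝟙 (at? u h) * ∑ (allFin n) (λ v → F (h [ u ]≔ v))))
        ≡⟨ ∑-cong (allFin N) (λ u → ∑-cong oracles (λ h → trans
             (sym (∑-*ˡ (allFin n) (𝟙 (at? u h)) _))
             (∑-cong (allFin n) (λ v → cong (_* F (h [ u ]≔ v))
               (𝟙-cong (at? u h) (at? u (h [ u ]≔ v)) (at-update u h v) (at-restore u h v)))))) ⟩
      ∑ (allFin N) (λ u → ∑ oracles (λ h → ∑ (allFin n) (λ v → 𝟙 (at? u (h [ u ]≔ v)) * F (h [ u ]≔ v))))
        ≡⟨ ∑-cong (allFin N) (λ u → trans (∑-words-resample (allFin n) N u (λ h → 𝟙 (at? u h) * F h))
             (cong (_* ∑ oracles (λ h → 𝟙 (at? u h) * F h)) (length-allFin n))) ⟩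
      ∑ (allFin N) (λ u → n * ∑ oracles (λ h → 𝟙 (at? u h) * F h))
        ≡⟨ trans (∑-*ˡ (allFin N) n _) (cong (n *_) (sym (split-at (λ h _ → F h)))) ⟩
      n * ∑ oracles (λ h → 𝟙 (P? h) * F h) ∎
      where open ≡-Reasoning

    #-extend : {P′ : Oracle → Set} (P′? : ∀ h → Dec (P′ h))
               {R : Oracle → Fin n → Set} (R? : ∀ h v → Dec (R h v)) →
               (∀ h v → P h → R h v → R (resample h c v) v) →
               (∀ h → P h → R h (vertex h c) → P′ h) →
               ∀ q → (∀ h → P h → q ≤ ∑ (allFin n) (λ v → 𝟙 (R? h v))) →
               q * # P? ≤ n * # P′?
    #-extend P′? {R} R? R-resample PR⇒P′ q many = begin
      q * # P?
        ≡⟨ trans (sym (∑-*ˡ oracles q _)) (∑-cong oracles (λ h → *-comm q (𝟙 (P? h)))) ⟩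
      ∑ oracles (λ h → 𝟙 (P? h) * q)
        ≤⟨ ∑-mono oracles (λ h → 𝟙-≤-when (P? h) (λ p → ≤-trans (many h p)
             (∑-mono (allFin n) (λ v → 𝟙-mono (R? h v) (R? (resample h c v) (vertex (resample h c v) c))
               (λ r → subst (R (resample h c v)) (sym (vertex-resample h c v (P⇒Distinct p))) (R-resample h v p r)))))) ⟩
      -- The chain rule of probability: given `P`, the oracle value at the last bucket is uniform,
      -- and at least `q` of its `n` values satisfy `R`.
      ∑ oracles (λ h → 𝟙 (P? h) * ∑ (allFin n) (λ v → 𝟙 (R? (resample h c v) (vertex (resample h c v) c))))
        ≡⟨ ∑-resample (λ h → 𝟙 (R? h (vertex h c))) ⟩
      n * ∑ oracles (λ h → 𝟙 (P? h) * 𝟙 (R? h (vertex h c)))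
        ≤⟨ *-monoʳ-≤ n (∑-mono oracles (λ h → combine (P? h) (R? h (vertex h c)) (P′? h) (PR⇒P′ h))) ⟩
      n * # P′? ∎
      where
      open ≤-Reasoning
      combine : ∀ {X Y Z : Set} (d : Dec X) (e : Dec Y) (f : Dec Z) → (X → Y → Z) → 𝟙 d * 𝟙 e ≤ 𝟙 f
      combine (yes x) (yes y) f g = ≤-reflexive (sym (𝟙-yes f (g x y)))
      combine (yes _) (no _)  f g = z≤n
      combine (no _)  e       f g = z≤n

  module Collision (⋆∉β : ∀ x → ⋆ ≢ β x)
                   (μ : ℕ) (load : ∀ u → ∑ (allFin n) (λ x → 𝟙 (u Fin.≟ β x)) ≤ μ)
                   (i j : Fin n) (βi≡βj : β i ≡ β j) (i≢j : i ≢ j) where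

    -- Each of the `suc c` buckets visited so far contains at most `μ` vertices, and only these are
    -- ruled out.
    fresh-vertices : ∀ h c → n ∸ suc c * μ ≤ ∑ (allFin n) (λ v → 𝟙 (fresh? h c (β v)))
    fresh-vertices h c = m≤n+o⇒m∸n≤o n (suc c * μ) (begin
      n
        ≡⟨ trans (sym (*-identityʳ n)) (sym (∑-allFin-const n 1)) ⟩
      ∑ (allFin n) (λ v → 1)
        ≤⟨ ∑-mono (allFin n) (λ v → covered c (β v)) ⟩
      ∑ (allFin n) (λ v → hits c (β v) + 𝟙 (fresh? h c (β v)))
        ≡⟨ ∑-+ (allFin n) _ _ ⟩
      ∑ (allFin n) (λ v → hits c (β v)) + _
        ≤⟨ +-monoˡ-≤ _ (hits≤ c) ⟩
      suc c * μ + ∑ (allFin n) (λ v → 𝟙 (fresh? h c (β v))) ∎)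
      where
      open ≤-Reasoning
      hits : ℕ → Fin N → ℕ
      hits zero    u = 𝟙 (⋆ Fin.≟ u)
      hits (suc c) u = 𝟙 (bucket h (suc c) Fin.≟ u) + hits c u
      covered : ∀ c u → 1 ≤ hits c u + 𝟙 (fresh? h c u)
      covered zero u with ⋆ Fin.≟ u
      ... | yes _ = s≤s z≤n
      ... | no _  = s≤s z≤n
      covered (suc c) u with bucket h (suc c) Fin.≟ u | fresh? h c u | covered c u
      ... | yes _ | _     | _  = s≤s z≤n
      ... | no _  | yes _ | le = le
      ... | no _  | no _  | le = le
      hits≤ : ∀ c → ∑ (allFin n) (λ v → hits c (β v)) ≤ suc c * μ
      hits≤ zero    = ≤-trans (load ⋆) (≤-reflexive (sym (+-identityʳ μ)))
      hits≤ (suc c) = ≤-trans (≤-reflexive (∑-+ (allFin n) _ _)) (+-mono-≤ (load (bucket h (suc c))) (hits≤ c))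

    -- Until time `c` the walk must also keep clear of the common bucket of `i` and `j`; otherwise
    -- drawing the vertex `i` would lead into a bucket already seen.
    Avoids : ℕ → Oracle → Set
    Avoids c h = Distinct h c × Fresh h c (β i)

    avoids? : ∀ c h → Dec (Avoids c h)
    avoids? c h = distinct? h c ×-dec fresh? h c (β i)

    Visits : ℕ → ℕ → Oracle → Set
    Visits a b h = Distinct h b × vertex h a ≡ i

    visits? : ∀ a b h → Dec (Visits a b h)
    visits? a b h = distinct? h b ×-dec (vertex h a Fin.≟ i)

    Collides : ℕ → ℕ → Oracle → Set
    Collides a b h = Visits a b h × vertex h b ≡ j

    collides? : ∀ a b h → Dec (Collides a b h)
    collides? a b h = visits? a b h ×-dec (vertex h b Fin.≟ j)

    private
      Distinct-resample : ∀ h c v → Distinct h c → Distinct (resample h c v) c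
      Distinct-resample h c v di = Distinct-cong h _ c (bucket-resample h c v di) di

      Fresh-resample : ∀ h c v → Distinct h c → ∀ {u} → Fresh h c u → Fresh (resample h c v) c u
      Fresh-resample h c v di = Fresh-cong h _ c (bucket-resample h c v di)

      avoids-resample : ∀ c h v → Avoids c h → Avoids c (resample h c v)
      avoids-resample c h v (di , fr) = Distinct-resample h c v di , Fresh-resample h c v di fr

      visits-resample : ∀ {a b} → a < b → ∀ h v → Visits a b h → Visits a b (resample h b v)
      visits-resample {b = b} a<b h v (di , eq) =
        Distinct-resample h b v di , trans (vertex-resample-< h b v di a<b) eq

      exactly-one : ∀ (w : Fin n) → 1 ≤ ∑ (allFin n) (λ v → 𝟙 (v Fin.≟ w))
      exactly-one w = ≤-reflexive (trans (sym (∑-𝟙≟ w))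
        (∑-cong (allFin n) (λ v → 𝟙-cong (w Fin.≟ v) (v Fin.≟ w) sym sym)))

    avoids-suc : ∀ c → (n ∸ suc (suc c) * μ) * # (avoids? c) ≤ n * # (avoids? (suc c))
    avoids-suc c = #-extend (avoids? c) c proj₁ (avoids-resample c) (avoids? (suc c))
      (λ h v → fresh? h c (β v) ×-dec ¬? (β v Fin.≟ β i))
      (λ h v p r → Fresh-resample h c v (proj₁ p) (proj₁ r) , proj₂ r)
      (λ h p r → (proj₁ p , proj₁ r) , (proj₂ p , proj₂ r))
      -- The bucket of `i` is excluded besides the `suc c` visited ones.
      (n ∸ suc (suc c) * μ)
      (λ h _ → begin
        n ∸ (μ + suc c * μ)
          ≡⟨ trans (cong (n ∸_) (+-comm μ (suc c * μ))) (sym (∸-+-assoc n (suc c * μ) μ)) ⟩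
        n ∸ suc c * μ ∸ μ
          ≤⟨ m≤n+o⇒m∸n≤o (n ∸ suc c * μ) μ (≤-trans (fresh-vertices h c) (≤-trans
               (∑-mono (allFin n) (λ v → split (fresh? h c (β v)) (β v Fin.≟ β i) (β i Fin.≟ β v) sym))
               (≤-trans (≤-reflexive (∑-+ (allFin n) _ _)) (+-monoˡ-≤ _ (load (β i)))))) ⟩
        ∑ (allFin n) (λ v → 𝟙 (fresh? h c (β v) ×-dec ¬? (β v Fin.≟ β i))) ∎)
      where
      open ≤-Reasoning
      split : ∀ {X Y Z : Set} (d : Dec X) (e : Dec Y) (f : Dec Z) → (Y → Z) → 𝟙 d ≤ 𝟙 f + 𝟙 (d ×-dec ¬? e)
      split (no _)  e       f g = z≤n
      split (yes _) (yes y) f g = ≤-trans (≤-reflexive (sym (𝟙-yes f (g y)))) (m≤m+n (𝟙 f) _)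
      split (yes _) (no _)  f g = m≤n+m 1 (𝟙 f)

    visits-start : ∀ a → 1 * # (avoids? a) ≤ n * # (visits? a (suc a))
    visits-start a = #-extend (avoids? a) a proj₁ (avoids-resample a) (visits? a (suc a))
      (λ h v → v Fin.≟ i) (λ _ _ _ r → r)
      (λ { h (di , fr) eq → (di , subst (λ v → Fresh h a (β v)) (sym eq) fr) , eq })
      1 (λ _ _ → exactly-one i)

    visits-suc : ∀ {a b} → a < b → (n ∸ suc b * μ) * # (visits? a b) ≤ n * # (visits? a (suc b))
    visits-suc {a} {b} a<b = #-extend (visits? a b) b proj₁ (visits-resample a<b) (visits? a (suc b))
      (λ h v → fresh? h b (β v))
      (λ h v p r → Fresh-resample h b v (proj₁ p) r)
      (λ { h (di , eq) fr → (di , fr) , eq })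
      (n ∸ suc b * μ) (λ h _ → fresh-vertices h b)

    visits⇒collides : ∀ {a b} → a < b → 1 * # (visits? a b) ≤ n * # (collides? a b)
    visits⇒collides {a} {b} a<b = #-extend (visits? a b) b proj₁ (visits-resample a<b) (collides? a b)
      (λ h v → v Fin.≟ j) (λ _ _ _ r → r) (λ h p r → p , r) 1 (λ _ _ → exactly-one j)

    private
      chain : ∀ q r x y z → r * x ≤ z * y → q * r * x ≤ q * z * y
      chain q r x y z le = begin
        q * r * x   ≡⟨ *-assoc q r x ⟩
        q * (r * x) ≤⟨ *-monoʳ-≤ q le ⟩
        q * (z * y) ≡⟨ sym (*-assoc q z y) ⟩
        q * z * y   ∎
        where open ≤-Reasoning

      compose : ∀ q r x y z A B → r * x ≤ A * y → q * y ≤ B * z → q * r * x ≤ B * A * z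
      compose q r x y z A B le₁ le₂ = begin
        q * r * x   ≡⟨ *-assoc q r x ⟩
        q * (r * x) ≤⟨ *-monoʳ-≤ q le₁ ⟩
        q * (A * y) ≡⟨ swap q A y ⟩
        A * (q * y) ≤⟨ *-monoʳ-≤ A le₂ ⟩
        A * (B * z) ≡⟨ swap′ A B z ⟩
        B * A * z   ∎
        where
        open ≤-Reasoning
        swap : ∀ q A y → q * (A * y) ≡ A * (q * y)
        swap = solve-∀
        swap′ : ∀ A B z → A * (B * z) ≡ B * A * z
        swap′ = solve-∀

    module _ {M : ℕ} where
      private
        q : ℕ
        q = n ∸ M * μ

        q≤ : ∀ {c} → c ≤ M → q ≤ n ∸ c * μ
        q≤ c≤M = ∸-monoʳ-≤ n (*-monoˡ-≤ μ c≤M)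

      avoids-many : ∀ a → a < M → q ^ a * n ^ N ≤ n ^ a * # (avoids? a)
      -- At time 0 every oracle qualifies, as no vertex lies in the start bucket.
      avoids-many zero    _   = *-monoʳ-≤ 1 (≤-reflexive (begin
        n ^ N                        ≡⟨ trans (cong (_^ N) (sym (length-allFin n))) (sym (length-words (allFin n) N)) ⟩
        length oracles               ≡⟨ length-∑ oracles ⟩
        ∑ oracles (λ _ → 1)          ≡⟨ ∑-cong oracles (λ h → sym (𝟙-yes (avoids? 0 h) (tt , ⋆∉β i))) ⟩
        # (avoids? 0)                ∎))
        where open ≡-Reasoning
      avoids-many (suc a) a<M = compose q (q ^ a) (n ^ N) (# (avoids? a)) (# (avoids? (suc a))) (n ^ a) n
        (avoids-many a (<-trans (n<1+n a) a<M))
        (≤-trans (*-monoˡ-≤ (# (avoids? a)) (q≤ a<M)) (avoids-suc a))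

      visits-many : ∀ a b → a ≤ b → b < M → q ^ b * n ^ N ≤ n ^ suc b * # (visits? a (suc b))
      visits-many a b a≤b b<M with m≤n⇒m<n∨m≡n a≤b
      ... | inj₂ refl =
        ≤-trans (≤-reflexive (cong (_* n ^ N) (sym (*-identityˡ (q ^ a)))))
          (compose 1 (q ^ a) (n ^ N) (# (avoids? a)) (# (visits? a (suc a))) (n ^ a) n
            (avoids-many a b<M) (visits-start a))
      visits-many a (suc b) a≤b b<M | inj₁ (s≤s a≤b′) =
        compose q (q ^ b) (n ^ N) (# (visits? a (suc b))) (# (visits? a (suc (suc b)))) (n ^ suc b) n
          (visits-many a b a≤b′ (<-trans (n<1+n b) b<M))
          (≤-trans (*-monoˡ-≤ (# (visits? a (suc b))) (q≤ b<M)) (visits-suc (s≤s a≤b′)))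

      -- Drawing `i` and drawing `j` cost a factor `1 / n` each. Every other draw avoids the
      -- forbidden vertices with probability at least `q / n`, and `M² μ ≤ n / 2` keeps the product
      -- of these above 1/2.
      collides-many : 2 * (M * (M * μ)) ≤ n → ∀ a b → a < b → b ≤ M →
        n ^ N ≤ 2 * (n * n) * # (collides? a b)
      collides-many small a (suc b) (s≤s a≤b) b<M = *-cancelˡ-≤ (n ^ b) {{m^n≢0 n b {{n≢0}}}} (begin
        n ^ b * n ^ N
          ≤⟨ *-monoˡ-≤ (n ^ N) (half-power n (M * μ) b
               (≤-trans (*-monoʳ-≤ 2 (*-monoˡ-≤ (M * μ) (<⇒≤ b<M))) small)) ⟩
        2 * q ^ b * n ^ N
          ≤⟨ chain 2 (q ^ b) (n ^ N) (# (collides? a (suc b))) (n * n ^ suc b)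
               (≤-trans (≤-reflexive (cong (_* n ^ N) (sym (*-identityˡ (q ^ b)))))
                 (compose 1 (q ^ b) (n ^ N) (# (visits? a (suc b))) (# (collides? a (suc b))) (n ^ suc b) n
                   (visits-many a b a≤b b<M) (visits⇒collides (s≤s a≤b)))) ⟩
        2 * (n * n ^ suc b) * # (collides? a (suc b))
          ≡⟨ lemma n (n ^ b) (# (collides? a (suc b))) ⟩
        n ^ b * (2 * (n * n) * # (collides? a (suc b))) ∎)
        where
        open ≤-Reasoning
        n≢0 : NonZero n
        n≢0 = >-nonZero (≤-trans (s≤s z≤n) (Fin.toℕ<n i))
        lemma : ∀ n p x → 2 * (n * (n * p)) * x ≡ p * (2 * (n * n) * x)
        lemma = solve-∀

-- Floyd's cycle detection on a rho-shaped walk.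

module Floyd {V : Set} (F : V → V) (x : ℕ → V) (x-suc : ∀ c → x (suc c) ≡ F (x c))
             (a l : ℕ) where

  private
    λ′ b : ℕ
    λ′ = suc l
    b = a + λ′

  -- The shape of a rho: `x a` at the end of the tail and `x b` at the end of the cycle are the two
  -- predecessors of `x (suc a)`, where the cycle of length `λ′` is entered.
  module _ (x-injective : ∀ {c d} → c ≤ b → d ≤ b → x c ≡ x d → c ≡ d)
           (x-repeats : x (suc b) ≡ x (suc a)) where

    private
      shift : ∀ d {c e} → x c ≡ x e → x (d + c) ≡ x (d + e)
      shift zero    eq = eq
      shift (suc d) eq = trans (x-suc _) (trans (cong F (shift d eq)) (sym (x-suc _)))

      period : ∀ c → a < c → x (c + λ′) ≡ x c
      period c a<c = subst (λ e → x (e + λ′) ≡ x e) (m∸n+n≡m a<c)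
        (trans (cong x (lemma (c ∸ suc a) a l)) (shift (c ∸ suc a) x-repeats))
        where
        lemma : ∀ d a l → d + suc a + suc l ≡ d + suc (a + suc l)
        lemma = solve-∀

      periods : ∀ g c → a < c → x (c + g * λ′) ≡ x c
      periods zero    c a<c = cong x (+-identityʳ c)
      periods (suc g) c a<c = trans (cong x (lemma c l (g * λ′)))
        (trans (period (c + g * λ′) (≤-trans a<c (m≤m+n c _))) (periods g c a<c))
        where
        lemma : ∀ c l k → c + (suc l + k) ≡ c + k + suc l
        lemma = solve-∀

      -- An index beyond the tail is reduced into the first round of the cycle, `a < rep N ≤ b`.
      rep quo : ℕ → ℕ
      rep N = suc a + (N ∸ suc a) % λ′
      quo N = (N ∸ suc a) / λ′

      rep≤b : ∀ N → rep N ≤ b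
      rep≤b N = ≤-trans (+-monoʳ-≤ (suc a) (s≤s⁻¹ (m%n<n (N ∸ suc a) λ′)))
                        (≤-reflexive (sym (+-suc a l)))

      rep-spec : ∀ N → a < N → N ≡ rep N + quo N * λ′
      rep-spec N a<N = begin
        N                                     ≡⟨ sym (m+[n∸m]≡n a<N) ⟩
        suc a + (N ∸ suc a)                   ≡⟨ cong (suc a +_) (m≡m%n+[m/n]*n (N ∸ suc a) λ′) ⟩
        suc a + ((N ∸ suc a) % λ′ + quo N * λ′) ≡⟨ sym (+-assoc (suc a) _ _) ⟩
        rep N + quo N * λ′                    ∎
        where open ≡-Reasoning

      x-rep : ∀ N → a < N → x N ≡ x (rep N)
      x-rep N a<N = trans (cong x (rep-spec N a<N)) (periods (quo N) (rep N) (s≤s (m≤m+n a _)))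

      -- Beyond the tail, indices of equal vertices agree modulo the cycle length, which applied to
      -- `c` and `2c` leaves `c` a multiple of it. A vertex at an index `c ≤ a` is never met again.
      meeting-multiple : ∀ c → 0 < c → x c ≡ x (c + c) → Σ[ g ∈ ℕ ] c ≡ g * λ′
      meeting-multiple c 0<c eq with c ≤? a
      ... | no c≰a = quo (c + c) ∸ quo c , (begin
        c                                    ≡⟨ sym (m+n∸n≡m c (quo c * λ′)) ⟩
        c + quo c * λ′ ∸ quo c * λ′          ≡⟨ cong (_∸ quo c * λ′) (+-cancelˡ-≡ (rep c) _ _ (begin
          rep c + (c + quo c * λ′)           ≡⟨ swap (rep c) c _ ⟩
          c + (rep c + quo c * λ′)           ≡⟨ cong (c +_) (sym (rep-spec c a<c)) ⟩
          c + c                              ≡⟨ rep-spec (c + c) a<2c ⟩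
          rep (c + c) + quo (c + c) * λ′     ≡⟨ cong (_+ quo (c + c) * λ′) (sym reps) ⟩
          rep c + quo (c + c) * λ′           ∎)) ⟩
        quo (c + c) * λ′ ∸ quo c * λ′        ≡⟨ sym (*-distribʳ-∸ λ′ (quo (c + c)) (quo c)) ⟩
        (quo (c + c) ∸ quo c) * λ′           ∎)
        where
        open ≡-Reasoning
        a<c = ≰⇒> c≰a
        a<2c = ≤-trans a<c (m≤m+n c c)
        reps : rep c ≡ rep (c + c)
        reps = x-injective (rep≤b c) (rep≤b (c + c)) (trans (sym (x-rep c a<c)) (trans eq (x-rep (c + c) a<2c)))
        swap : ∀ r c k → r + (c + k) ≡ c + (r + k)
        swap = solve-∀
      ... | yes c≤a with c + c ≤? a
      ...   | yes 2c≤a = contradiction (x-injective (≤-trans c≤a (m≤m+n a λ′)) (≤-trans 2c≤a (m≤m+n a λ′)) eq)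
                                       (<⇒≢ (m<m+n c 0<c))
      ...   | no 2c≰a  = contradiction (x-injective (≤-trans c≤a (m≤m+n a λ′)) (rep≤b (c + c)) (trans eq (x-rep (c + c) (≰⇒> 2c≰a))))
                                       (<⇒≢ (s≤s (≤-trans c≤a (m≤m+n a _))))

    meeting : Σ[ c ∈ ℕ ] 0 < c × c ≤ b × x c ≡ x (c + c)
    meeting = c , z<s , c≤b , sym (periods (suc (a / λ′)) c a<c)
      where
      -- The first multiple of the cycle length beyond `a`; it is at most `b`.
      c = suc (a / λ′) * λ′
      a<c : a < c
      a<c = subst (_< c) (sym (m≡m%n+[m/n]*n a λ′)) (+-monoˡ-< (a / λ′ * λ′) (m%n<n a λ′))
      c≤b : c ≤ b
      c≤b = ≤-trans (+-monoʳ-≤ λ′ (m/n*n≤m a λ′)) (≤-reflexive (+-comm λ′ a))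

    -- As `c` is a multiple of the cycle length, a walker sent from the meeting point stands on
    -- `x b` after `a` steps. A walker sent from the start then stands on `x a`, so the two reach
    -- the pair at the same moment.
    meeting⇒collision : ∀ c → 0 < c → x c ≡ x (c + c) → x (c + a) ≡ x b
    meeting⇒collision c 0<c eq with meeting-multiple c 0<c eq
    ... | zero  , refl with () ← 0<c
    ... | suc g , refl = trans (cong x (lemma a l (g * λ′))) (periods g b (m<m+n a z<s))
      where
      lemma : ∀ a l k → suc l + k + a ≡ a + suc l + k
      lemma = solve-∀

-- The probability that a walk finds a given pair.

module Rho {n N : ℕ} (β : Fin n → Fin N) (⋆ : Fin N) (i j : Fin n) where
  open Walk β ⋆

  Rho : Oracle → ℕ → ℕ → Set
  Rho h a b = (Distinct h b × vertex h a ≡ i) × vertex h b ≡ j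

  rho? : ∀ h a b → Dec (Rho h a b)
  rho? h a b = (distinct? h b ×-dec (vertex h a Fin.≟ i)) ×-dec (vertex h b Fin.≟ j)

  -- Taking `a` below `ℓ` and the second time in the next window of length `ℓ` yields their order
  -- for free and still leaves `ℓ²` events.
  Finds : ℕ → Oracle → Set
  Finds ℓ h = Σ[ a ∈ Fin ℓ ] Σ[ b ∈ Fin ℓ ] Rho h (toℕ a) (ℓ + toℕ b)

  finds? : ∀ ℓ h → Dec (Finds ℓ h)
  finds? ℓ h = Fin.any? (λ a → Fin.any? (λ b → rho? h (toℕ a) (ℓ + toℕ b)))

  next : Oracle → Fin n → Fin n
  next h x = lookup h (β x)

  Distinct-injective : ∀ h c {d e} → Distinct h c → d ≤ c → e ≤ c → bucket h d ≡ bucket h e → d ≡ e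
  Distinct-injective h c {d} {e} di d≤c e≤c eq with <-cmp d e
  ... | tri≈ _ d≡e _ = d≡e
  ... | tri< d<e _ _ = contradiction eq (Distinct⇒≢ h e (Distinct-≤ h c di e≤c) d<e)
  ... | tri> _ _ e<d = contradiction (sym eq) (Distinct⇒≢ h d (Distinct-≤ h c di d≤c) e<d)

  module _ (βi≡βj : β i ≡ β j) (i≢j : i ≢ j) where
    private
      rho-bucket : ∀ h a b → Rho h a b → bucket h (suc a) ≡ bucket h (suc b)
      rho-bucket h a b ((_ , eqi) , eqj) = trans (cong β eqi) (trans βi≡βj (cong β (sym eqj)))

      rho-≮ : ∀ h a b a′ b′ → a < b → Rho h a b → Rho h a′ b′ → ¬ b < b′
      rho-≮ h a b a′ b′ a<b r ((di′ , _) , _) b<b′ =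
        <⇒≢ a<b (suc-injective (Distinct-injective h b′ di′ (≤-trans a<b (<⇒≤ b<b′)) b<b′ (rho-bucket h a b r)))

    -- The pair makes bucket `suc b` a repetition, so no longer walk has distinct buckets, which
    -- fixes `b`; then `a` is the only time before it at the vertex `i`. Hence the events for
    -- different times are disjoint and their counts add up.
    rho-unique : ∀ h {a b a′ b′} → a < b → a′ < b′ → Rho h a b → Rho h a′ b′ → a ≡ a′ × b ≡ b′
    rho-unique h {a} {b} {a′} {b′} a<b a′<b′ r r′ with <-cmp b b′
    ... | tri< b<b′ _ _ = contradiction b<b′ (rho-≮ h a b a′ b′ a<b r r′)
    ... | tri> _ _ b′<b = contradiction b′<b (rho-≮ h a′ b′ a b a′<b′ r′ r)
    ... | tri≈ _ refl _ = suc-injective (Distinct-injective h b (proj₁ (proj₁ r)) a<b a′<b′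
                            (cong β (trans (proj₂ (proj₁ r)) (sym (proj₂ (proj₁ r′)))))) , refl

    rho-≢j : ∀ h a b → a < b → Rho h a b → ∀ {c} → c < b → vertex h c ≢ j
    rho-≢j h a b a<b ((di , eqi) , _) c<b eq
      with refl ← suc-injective (Distinct-injective h b di c<b a<b (trans (cong β eq) (trans (sym βi≡βj) (cong β (sym eqi)))))
      = i≢j (trans (sym eqi) eq)

    rho-injective : ∀ h a b → a < b → Rho h a b → ∀ {c d} → c ≤ b → d ≤ b → vertex h c ≡ vertex h d → c ≡ d
    rho-injective h a b a<b r c≤b d≤b eq with m≤n⇒m<n∨m≡n c≤b | m≤n⇒m<n∨m≡n d≤b
    ... | inj₁ c<b  | inj₁ d<b  = suc-injective (Distinct-injective h b (proj₁ (proj₁ r)) c<b d<b (cong β eq))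
    ... | inj₂ refl | inj₂ refl = refl
    ... | inj₁ c<b  | inj₂ refl = contradiction (trans eq (proj₂ r)) (rho-≢j h a b a<b r c<b)
    ... | inj₂ refl | inj₁ d<b  = contradiction (trans (sym eq) (proj₂ r)) (rho-≢j h a b a<b r d<b)

    private
      a<ℓ+b : ∀ {ℓ} (a b : Fin ℓ) → toℕ a < ℓ + toℕ b
      a<ℓ+b {ℓ} a b = ≤-trans (Fin.toℕ<n a) (m≤m+n ℓ (toℕ b))

    ∑-rho≤finds : ∀ ℓ h → ∑ (allFin ℓ) (λ a → ∑ (allFin ℓ) (λ b → 𝟙 (rho? h (toℕ a) (ℓ + toℕ b)))) ≤ 𝟙 (finds? ℓ h)
    ∑-rho≤finds ℓ h with finds? ℓ h
    ... | no none = ≤-reflexive (∑-zero (allFin ℓ) (λ a → ∑-zero (allFin ℓ) (λ b →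
                      𝟙-no (rho? h (toℕ a) (ℓ + toℕ b)) (λ r → none (a , b , r)))))
    ... | yes (a₀ , b₀ , r₀) = begin
      ∑ (allFin ℓ) (λ a → ∑ (allFin ℓ) (λ b → 𝟙 (rho? h (toℕ a) (ℓ + toℕ b))))
        ≤⟨ ∑-mono (allFin ℓ) (λ a → ∑-mono (allFin ℓ) (λ b → pin a b)) ⟩
      ∑ (allFin ℓ) (λ a → ∑ (allFin ℓ) (λ b → 𝟙 (a₀ Fin.≟ a) * 𝟙 (b₀ Fin.≟ b)))
        ≡⟨ sym (∑-* (allFin ℓ) (allFin ℓ) _ _) ⟩
      ∑ (allFin ℓ) (λ a → 𝟙 (a₀ Fin.≟ a)) * ∑ (allFin ℓ) (λ b → 𝟙 (b₀ Fin.≟ b))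
        ≡⟨ cong₂ _*_ (∑-𝟙≟ a₀) (∑-𝟙≟ b₀) ⟩
      1 ∎
      where
      open ≤-Reasoning
      pin : ∀ a b → 𝟙 (rho? h (toℕ a) (ℓ + toℕ b)) ≤ 𝟙 (a₀ Fin.≟ a) * 𝟙 (b₀ Fin.≟ b)
      pin a b with rho? h (toℕ a) (ℓ + toℕ b)
      ... | no _  = z≤n
      ... | yes r with rho-unique h (a<ℓ+b a₀ b₀) (a<ℓ+b a b) r₀ r
      ...   | ea , eb = ≤-reflexive (sym (cong₂ _*_ (𝟙-yes (a₀ Fin.≟ a) (Fin.toℕ-injective ea))
                          (𝟙-yes (b₀ Fin.≟ b) (Fin.toℕ-injective (+-cancelˡ-≡ ℓ _ _ eb)))))

    finds-many : (∀ x → ⋆ ≢ β x) → ∀ μ → (∀ u → ∑ (allFin n) (λ x → 𝟙 (u Fin.≟ β x)) ≤ μ) →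
      ∀ ℓ → 2 * ((ℓ + ℓ) * ((ℓ + ℓ) * μ)) ≤ n →
      ℓ * ℓ * n ^ N ≤ 2 * (n * n) * # (finds? ℓ)
    finds-many ⋆∉β μ load ℓ small = begin
      ℓ * ℓ * n ^ N
        ≡⟨ trans (*-assoc ℓ ℓ (n ^ N)) (sym (trans (∑-allFin-const ℓ _) (cong (ℓ *_) (∑-allFin-const ℓ (n ^ N))))) ⟩
      ∑ (allFin ℓ) (λ a → ∑ (allFin ℓ) (λ b → n ^ N))
        ≤⟨ ∑-mono (allFin ℓ) (λ a → ∑-mono (allFin ℓ) (λ b →
             collides-many small (toℕ a) (ℓ + toℕ b) (a<ℓ+b a b) (+-monoʳ-≤ ℓ (<⇒≤ (Fin.toℕ<n b))))) ⟩
      ∑ (allFin ℓ) (λ a → ∑ (allFin ℓ) (λ b → 2 * (n * n) * # (λ h → rho? h (toℕ a) (ℓ + toℕ b))))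
        ≡⟨ trans (∑-cong (allFin ℓ) (λ a → ∑-*ˡ (allFin ℓ) (2 * (n * n)) _)) (∑-*ˡ (allFin ℓ) (2 * (n * n)) _) ⟩
      2 * (n * n) * ∑ (allFin ℓ) (λ a → ∑ (allFin ℓ) (λ b → ∑ oracles (λ h → 𝟙 (rho? h (toℕ a) (ℓ + toℕ b)))))
        ≤⟨ *-monoʳ-≤ (2 * (n * n)) (begin
             _ ≡⟨ ∑-cong (allFin ℓ) (λ a → ∑-swap (allFin ℓ) oracles (λ b h → 𝟙 (rho? h (toℕ a) (ℓ + toℕ b)))) ⟩
             _ ≡⟨ ∑-swap (allFin ℓ) oracles (λ a h → ∑ (allFin ℓ) (λ b → 𝟙 (rho? h (toℕ a) (ℓ + toℕ b)))) ⟩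
             _ ≤⟨ ∑-mono oracles (∑-rho≤finds ℓ) ⟩
             # (finds? ℓ) ∎) ⟩
      2 * (n * n) * # (finds? ℓ) ∎
      where
      open ≤-Reasoning
      open Collision ⋆∉β μ load i j βi≡βj i≢j

    -- The last component speaks of every meeting time `c` because the program keeps the latest
    -- meeting it has seen, which need not be the first.
    finds⇒ : ∀ ℓ h → Finds ℓ h → Σ[ a ∈ ℕ ] a < ℓ + ℓ × vertex h a ≡ i ×
      (Σ[ c ∈ ℕ ] 0 < c × c ≤ ℓ + ℓ × vertex h c ≡ vertex h (c + c)) ×
      (∀ c → 0 < c → vertex h c ≡ vertex h (c + c) → vertex h (c + a) ≡ j)
    finds⇒ ℓ h (a , b , r) =
      toℕ a , ≤-trans (Fin.toℕ<n a) (m≤m+n ℓ ℓ) , proj₂ (proj₁ r) ,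
      (let c , 0<c , c≤b , eq = meeting x-injective x-repeats
       in c , 0<c , ≤-trans c≤b (≤-trans (≤-reflexive b≡) (+-monoʳ-≤ ℓ (<⇒≤ (Fin.toℕ<n b)))) , eq) ,
      (λ c 0<c eq → trans (meeting⇒collision x-injective x-repeats c 0<c eq)
                          (trans (cong (vertex h) b≡) (proj₂ r)))
      where
      l = ℓ + toℕ b ∸ suc (toℕ a)
      open Floyd (next h) (vertex h) (λ _ → refl) (toℕ a) l
      b≡ : toℕ a + suc l ≡ ℓ + toℕ b
      b≡ = trans (+-suc (toℕ a) l) (m+[n∸m]≡n (a<ℓ+b a b))
      x-injective : ∀ {c d} → c ≤ toℕ a + suc l → d ≤ toℕ a + suc l → vertex h c ≡ vertex h d → c ≡ d
      x-injective c≤ d≤ = rho-injective h (toℕ a) (ℓ + toℕ b) (a<ℓ+b a b) r (≤-trans c≤ (≤-reflexive b≡)) (≤-trans d≤ (≤-reflexive b≡))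
      x-repeats : vertex h (suc (toℕ a + suc l)) ≡ vertex h (suc (toℕ a))
      x-repeats = trans (cong (λ e → vertex h (suc e)) b≡) (cong (lookup h) (sym (rho-bucket h (toℕ a) (ℓ + toℕ b) r)))

-- Chebyshev's inequality for pairwise independent indicators.

am-gm : ∀ x y → 2 * (x * y) ≤ x * x + y * y
am-gm x y with ≤-total x y
... | inj₁ x≤y = subst (λ z → 2 * (x * z) ≤ x * x + z * z) (m+[n∸m]≡n x≤y) (≤-trans (m≤m+n _ _) (≤-reflexive (lemma x (y ∸ x))))
  where
  lemma : ∀ x e → 2 * (x * (x + e)) + e * e ≡ x * x + (x + e) * (x + e)
  lemma = solve-∀
... | inj₂ y≤x = subst (λ z → 2 * (z * y) ≤ z * z + y * y) (m+[n∸m]≡n y≤x) (≤-trans (m≤m+n _ _) (≤-reflexive (lemma y (x ∸ y))))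
  where
  lemma : ∀ y e → 2 * ((y + e) * y) + e * e ≡ (y + e) * (y + e) + y * y
  lemma = solve-∀

-- 4 (x - y)² ≥ y² whenever x ≤ y/2, with both sides moved so that no subtraction occurs.
am-gm-far : ∀ x y → 2 * x ≤ y → 4 * (2 * (x * y)) + y * y ≤ 4 * (x * x + y * y)
am-gm-far x y le = subst (λ z → 4 * (2 * (x * z)) + z * z ≤ 4 * (x * x + z * z)) (m+[n∸m]≡n le)
  (≤-trans (m≤m+n _ _) (≤-reflexive (lemma x (y ∸ 2 * x))))
  where
  lemma : ∀ x e → (4 * (2 * (x * (2 * x + e))) + (2 * x + e) * (2 * x + e)) + (4 * (x * e) + 3 * (e * e)) ≡
                  4 * (x * x + (2 * x + e) * (2 * x + e))
  lemma = solve-∀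

-- Chebyshev's inequality for a sum of pairwise independent indicators I S that
-- all have the same conditional mean P w / N.

module Chebyshev {W : Set} (Ω : List W) (s N : ℕ) (I : Fin s → W → ℕ) (Q P : W → ℕ)
  (I-idem : ∀ S w → I S w * I S w ≡ I S w)
  (mean  : ∀ S → N * ∑ Ω (λ w → Q w * I S w) ≡ ∑ Ω (λ w → Q w * P w))
  (meanP : ∀ S → N * ∑ Ω (λ w → Q w * (P w * I S w)) ≡ ∑ Ω (λ w → Q w * (P w * P w)))
  (pairs : ∀ S S′ → S ≢ S′ → N * (N * ∑ Ω (λ w → Q w * (I S w * I S′ w))) ≡ ∑ Ω (λ w → Q w * (P w * P w)))
  where

  X : W → ℕ
  X w = ∑ (allFin s) (λ S → I S w)

  -- The count `X w` is at most half of its conditional mean `s * P w / N`.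
  rare? : ∀ w → Dec (2 * (N * X w) ≤ s * P w)
  rare? w = 2 * (N * X w) ≤? s * P w

  private
    P₂ P₁ : ℕ
    P₂ = ∑ Ω (λ w → Q w * (P w * P w))
    P₁ = ∑ Ω (λ w → Q w * P w)

    -- Pairwise independence says nothing about the diagonal; there idempotence reduces the second
    -- moment to the first, which is the extra term.
    pair-bound : ∀ S S′ → N * (N * ∑ Ω (λ w → Q w * (I S w * I S′ w))) ≤ P₂ + 𝟙 (S Fin.≟ S′) * (N * P₁)
    pair-bound S S′ with S Fin.≟ S′
    ... | no S≢S′  = ≤-trans (≤-reflexive (pairs S S′ S≢S′)) (m≤m+n P₂ _)
    ... | yes refl = ≤-trans (≤-reflexive (begin
      N * (N * ∑ Ω (λ w → Q w * (I S w * I S w)))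
        ≡⟨ cong (λ z → N * (N * z)) (∑-cong Ω (λ w → cong (Q w *_) (I-idem S w))) ⟩
      N * (N * ∑ Ω (λ w → Q w * I S w))
        ≡⟨ cong (N *_) (mean S) ⟩
      N * P₁
        ≡⟨ sym (*-identityˡ (N * P₁)) ⟩
      1 * (N * P₁) ∎)) (m≤n+m _ P₂)
      where open ≡-Reasoning

    second-moment : ∑ Ω (λ w → Q w * (N * X w * (N * X w))) ≤ s * (s * P₂) + s * (N * P₁)
    second-moment = begin
      ∑ Ω (λ w → Q w * (N * X w * (N * X w)))
        ≡⟨ ∑-cong Ω expand ⟩
      ∑ Ω (λ w → ∑ (allFin s) (λ S → ∑ (allFin s) (λ S′ → N * N * (Q w * (I S w * I S′ w)))))
        ≡⟨ ∑-swap Ω (allFin s) (λ w S → ∑ (allFin s) (λ S′ → N * N * (Q w * (I S w * I S′ w)))) ⟩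
      ∑ (allFin s) (λ S → ∑ Ω (λ w → ∑ (allFin s) (λ S′ → N * N * (Q w * (I S w * I S′ w)))))
        ≡⟨ ∑-cong (allFin s) (λ S → trans (∑-swap Ω (allFin s) (λ w S′ → N * N * (Q w * (I S w * I S′ w))))
             (∑-cong (allFin s) (λ S′ → trans (∑-*ˡ Ω (N * N) (λ w → Q w * (I S w * I S′ w))) (*-assoc N N _)))) ⟩
      ∑ (allFin s) (λ S → ∑ (allFin s) (λ S′ → N * (N * ∑ Ω (λ w → Q w * (I S w * I S′ w)))))
        ≤⟨ ∑-mono (allFin s) (λ S → ≤-trans (∑-mono (allFin s) (pair-bound S)) (≤-reflexive (
             trans (∑-+ (allFin s) (λ _ → P₂) _) (cong₂ _+_ (∑-allFin-const s P₂) (∑-≟ S (λ _ → N * P₁)))))) ⟩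
      ∑ (allFin s) (λ S → s * P₂ + N * P₁)
        ≡⟨ trans (∑-allFin-const s _) (*-distribˡ-+ s (s * P₂) (N * P₁)) ⟩
      s * (s * P₂) + s * (N * P₁) ∎
      where
      open ≤-Reasoning
      rearrange : ∀ q n i → q * (n * i * (n * i)) ≡ (n * n * q) * (i * i)
      rearrange = solve-∀
      regroup : ∀ m q i j → m * q * (i * j) ≡ m * (q * (i * j))
      regroup = solve-∀
      expand : ∀ w → Q w * (N * X w * (N * X w)) ≡
               ∑ (allFin s) (λ S → ∑ (allFin s) (λ S′ → N * N * (Q w * (I S w * I S′ w))))
      expand w = trans (rearrange (Q w) N (X w)) (trans (cong (N * N * Q w *_) (∑-* (allFin s) (allFin s) _ _))
        (trans (sym (∑-*ˡ (allFin s) (N * N * Q w) _)) (∑-cong (allFin s) (λ S →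
          trans (sym (∑-*ˡ (allFin s) (N * N * Q w) _)) (∑-cong (allFin s) (λ S′ →
            regroup (N * N) (Q w) (I S w) (I S′ w)))))))

    cross : ∑ Ω (λ w → Q w * (N * X w * (s * P w))) ≡ s * (s * P₂)
    cross = begin
      ∑ Ω (λ w → Q w * (N * X w * (s * P w)))
        ≡⟨ ∑-cong Ω expand ⟩
      ∑ Ω (λ w → ∑ (allFin s) (λ S → s * N * (Q w * (P w * I S w))))
        ≡⟨ ∑-swap Ω (allFin s) (λ w S → s * N * (Q w * (P w * I S w))) ⟩
      ∑ (allFin s) (λ S → ∑ Ω (λ w → s * N * (Q w * (P w * I S w))))
        ≡⟨ ∑-cong (allFin s) (λ S → trans (∑-*ˡ Ω (s * N) _) (trans (*-assoc s N _) (cong (s *_) (meanP S)))) ⟩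
      ∑ (allFin s) (λ S → s * P₂)
        ≡⟨ ∑-allFin-const s (s * P₂) ⟩
      s * (s * P₂) ∎
      where
      open ≡-Reasoning
      rearrange : ∀ q n x s p → q * (n * x * (s * p)) ≡ (s * n * (q * p)) * x
      rearrange = solve-∀
      regroup : ∀ m q p i → m * (q * p) * i ≡ m * (q * (p * i))
      regroup = solve-∀
      expand : ∀ w → Q w * (N * X w * (s * P w)) ≡ ∑ (allFin s) (λ S → s * N * (Q w * (P w * I S w)))
      expand w = trans (rearrange (Q w) N (X w) s (P w)) (trans (sym (∑-*ˡ (allFin s) (s * N * (Q w * P w)) _))
        (∑-cong (allFin s) (λ S → regroup (s * N) (Q w) (P w) (I S w))))

    square : ∑ Ω (λ w → Q w * (s * P w * (s * P w))) ≡ s * (s * P₂)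
    square = trans (∑-cong Ω (λ w → rearrange (Q w) s (P w)))
      (trans (∑-*ˡ Ω (s * s) _) (*-assoc s s P₂))
      where
      rearrange : ∀ q s p → q * (s * p * (s * p)) ≡ s * s * (q * (p * p))
      rearrange = solve-∀

  -- For rare `w` the square of `N X - s P` is at least `(s P)² / 4`, while weighted by `Q` these
  -- squares sum to at most `s N` times the first moment. The cross term is added on both sides
  -- instead of being subtracted.
  chebyshev : ∑ Ω (λ w → Q w * 𝟙 (rare? w) * (s * P w * (s * P w))) ≤ 4 * (s * (N * ∑ Ω (λ w → Q w * P w)))
  chebyshev = +-cancelˡ-≤ (4 * (2 * (s * (s * P₂)))) _ _ (begin
    4 * (2 * (s * (s * P₂))) + ∑ Ω (λ w → Q w * 𝟙 (rare? w) * (s * P w * (s * P w)))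
      ≡⟨ cong (_+ ∑ Ω (λ w → Q w * 𝟙 (rare? w) * (s * P w * (s * P w)))) (trans (sym (*-assoc 4 2 (s * (s * P₂)))) (trans (cong (8 *_) (sym cross)) (sym (∑-*ˡ Ω 8 _)))) ⟩
    ∑ Ω (λ w → 8 * (Q w * (N * X w * (s * P w)))) + ∑ Ω (λ w → Q w * 𝟙 (rare? w) * (s * P w * (s * P w)))
      ≡⟨ sym (∑-+ Ω _ _) ⟩
    ∑ Ω (λ w → 8 * (Q w * (N * X w * (s * P w))) + Q w * 𝟙 (rare? w) * (s * P w * (s * P w)))
      ≤⟨ ∑-mono Ω (λ w → pointwise (Q w) (N * X w) (s * P w) (rare? w)) ⟩
    ∑ Ω (λ w → 4 * (Q w * (N * X w * (N * X w)) + Q w * (s * P w * (s * P w))))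
      ≡⟨ trans (∑-*ˡ Ω 4 _) (cong (4 *_) (∑-+ Ω _ _)) ⟩
    4 * (∑ Ω (λ w → Q w * (N * X w * (N * X w))) + ∑ Ω (λ w → Q w * (s * P w * (s * P w))))
      ≤⟨ *-monoʳ-≤ 4 (+-mono-≤ second-moment (≤-reflexive square)) ⟩
    4 * (s * (s * P₂) + s * (N * P₁) + s * (s * P₂))
      ≡⟨ rearrange (s * (s * P₂)) (s * (N * P₁)) ⟩
    4 * (2 * (s * (s * P₂))) + 4 * (s * (N * P₁)) ∎)
    where
    open ≤-Reasoning
    rearrange : ∀ a b → 4 * (a + b + a) ≡ 4 * (2 * a) + 4 * b
    rearrange = solve-∀
    lemma₁ : ∀ q x y → 8 * (q * (x * y)) + q * 1 * (y * y) ≡ q * (4 * (2 * (x * y)) + y * y)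
    lemma₁ = solve-∀
    lemma₀ : ∀ q x y → 8 * (q * (x * y)) + q * 0 * (y * y) ≡ q * (4 * (2 * (x * y)))
    lemma₀ = solve-∀
    lemma₂ : ∀ q x y → q * (4 * (x * x + y * y)) ≡ 4 * (q * (x * x) + q * (y * y))
    lemma₂ = solve-∀
    pointwise : ∀ q x y (d : Dec (2 * x ≤ y)) →
      8 * (q * (x * y)) + q * 𝟙 d * (y * y) ≤ 4 * (q * (x * x) + q * (y * y))
    pointwise q x y (yes le) = ≤-trans (≤-reflexive (lemma₁ q x y))
      (≤-trans (*-monoʳ-≤ q (am-gm-far x y le)) (≤-reflexive (lemma₂ q x y)))
    pointwise q x y (no _) = ≤-trans (≤-reflexive (lemma₀ q x y))
      (≤-trans (*-monoʳ-≤ q (*-monoʳ-≤ 4 (am-gm x y))) (≤-reflexive (lemma₂ q x y)))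

  -- Here `λ′ / κ` is a lower bound on the success probability `P w / N` wherever `Q` is positive,
  -- so `chebyshev` may be divided by `(s P)²`; the first moment is bounded crudely through `P ≤ N`.
  rare-bound : ∀ λ′ κ → 0 < s → 0 < N → (∀ w → Q w ≤ 1) → (∀ w → P w ≤ N) →
    (∀ w → 0 < Q w → λ′ * N ≤ κ * P w) →
    s * (λ′ * λ′) * ∑ Ω (λ w → Q w * 𝟙 (rare? w)) ≤ 4 * (κ * κ) * length Ω
  rare-bound λ′ κ 0<s 0<N Q≤1 P≤N many = *-cancelˡ-≤ (s * (N * N)) {{nz}} (begin
    s * (N * N) * (s * (λ′ * λ′) * ∑ Ω (λ w → Q w * 𝟙 (rare? w)))
      ≡⟨ trans (sym (*-assoc (s * (N * N)) (s * (λ′ * λ′)) _)) (sym (∑-*ˡ Ω (s * (N * N) * (s * (λ′ * λ′))) _)) ⟩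
    ∑ Ω (λ w → s * (N * N) * (s * (λ′ * λ′)) * (Q w * 𝟙 (rare? w)))
      ≤⟨ ∑-mono Ω pointwise ⟩
    ∑ Ω (λ w → κ * κ * (Q w * 𝟙 (rare? w) * (s * P w * (s * P w))))
      ≡⟨ ∑-*ˡ Ω (κ * κ) _ ⟩
    κ * κ * ∑ Ω (λ w → Q w * 𝟙 (rare? w) * (s * P w * (s * P w)))
      ≤⟨ *-monoʳ-≤ (κ * κ) (≤-trans chebyshev (*-monoʳ-≤ 4 (*-monoʳ-≤ s (*-monoʳ-≤ N
           (∑-≤ Ω N (λ w → ≤-trans (*-mono-≤ (Q≤1 w) (P≤N w)) (≤-reflexive (*-identityˡ N)))))))) ⟩
    κ * κ * (4 * (s * (N * (length Ω * N))))
      ≡⟨ rearrange (κ * κ) s N (length Ω) ⟩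
    s * (N * N) * (4 * (κ * κ) * length Ω) ∎)
    where
    open ≤-Reasoning
    nz : NonZero (s * (N * N))
    nz = >-nonZero (*-mono-≤ 0<s (*-mono-≤ 0<N 0<N))
    rearrange : ∀ k s n l → k * (4 * (s * (n * (l * n)))) ≡ s * (n * n) * (4 * k * l)
    rearrange = solve-∀
    lemma₁ : ∀ s n l q → s * (n * n) * (s * (l * l)) * q ≡ q * (s * s) * (l * n * (l * n))
    lemma₁ = solve-∀
    lemma₂ : ∀ s p k q → q * (s * s) * (k * p * (k * p)) ≡ k * k * (q * (s * p * (s * p)))
    lemma₂ = solve-∀
    pointwise : ∀ w → s * (N * N) * (s * (λ′ * λ′)) * (Q w * 𝟙 (rare? w)) ≤
                      κ * κ * (Q w * 𝟙 (rare? w) * (s * P w * (s * P w)))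
    pointwise w with Q w | many w
    ... | zero  | _  = ≤-trans (≤-reflexive (*-zeroʳ (s * (N * N) * (s * (λ′ * λ′))))) z≤n
    ... | suc q | le = ≤-trans (≤-reflexive (lemma₁ s N λ′ (suc q * 𝟙 (rare? w))))
      (≤-trans (*-monoʳ-≤ (suc q * 𝟙 (rare? w) * (s * s)) (*-mono-≤ (le z<s) (le z<s)))
               (≤-reflexive (lemma₂ s (P w) κ (suc q * 𝟙 (rare? w)))))

-- Entries, residues and rotations.

nth-map : ∀ {A B : Set} (d : B) (f : A → B) {n} (v : Vec A n) p →
  nth d (List.map f (Vec.toList v)) (toℕ p) ≡ f (lookup v p)
nth-map d f (x ∷ v) Fin.zero    = refl
nth-map d f (x ∷ v) (Fin.suc p) = nth-map d f v p

nth-map-< : ∀ {A B : Set} (d : B) (f : A → B) {n} (v : Vec A n) {p} (p<n : p < n) →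
  nth d (List.map f (Vec.toList v)) p ≡ f (lookup v (fromℕ< p<n))
nth-map-< d f v p<n = trans (cong (nth d (List.map f (Vec.toList v))) (sym (Fin.toℕ-fromℕ< p<n))) (nth-map d f v _)

value : ∀ {m n} → Vec (Fin m) n → ℕ → ℕ
value w = nth 0 (List.map (λ i → suc (toℕ i)) (Vec.toList w))

rem≡% : ∀ x n .{{_ : NonZero n}} → rem x n ≡ x % n
rem≡% x (suc n) = refl

rem-< : ∀ x n .{{_ : NonZero n}} → rem x n < n
rem-< x n@(suc _) = m%n<n x n

rem-0 : ∀ n → rem 0 n ≡ 0
rem-0 zero    = refl
rem-0 (suc n) = refl

rem-small : ∀ {x n} → x < n → rem x n ≡ x
rem-small {x} {suc n} x<n = m<n⇒m%n≡m x<n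

rem-+ : ∀ x y n → rem (rem x n + y) n ≡ rem (x + y) n
rem-+ x y zero      = refl
rem-+ x y n@(suc _) = begin
  (x % n + y) % n           ≡⟨ %-distribˡ-+ (x % n) y n ⟩
  (x % n % n + y % n) % n   ≡⟨ cong (λ z → (z + y % n) % n) (m%n%n≡m%n x n) ⟩
  (x % n + y % n) % n       ≡⟨ sym (%-distribˡ-+ x y n) ⟩
  (x + y) % n               ∎
  where open ≡-Reasoning

rem-+ʳ : ∀ x y n → rem (x + rem y n) n ≡ rem (x + y) n
rem-+ʳ x y n = trans (cong (λ z → rem z n) (+-comm x (rem y n)))
  (trans (rem-+ y x n) (cong (λ z → rem z n) (+-comm y x)))

rem-+-cong : ∀ {x x′ y y′} n → rem x n ≡ rem x′ n → rem y n ≡ rem y′ n → rem (x + y) n ≡ rem (x′ + y′) n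
rem-+-cong {x} {x′} {y} {y′} n ex ey = begin
  rem (x + y) n           ≡⟨ sym (rem-+ x y n) ⟩
  rem (rem x n + y) n     ≡⟨ cong (λ z → rem (z + y) n) ex ⟩
  rem (rem x′ n + y) n    ≡⟨ rem-+ x′ y n ⟩
  rem (x′ + y) n          ≡⟨ sym (rem-+ʳ x′ y n) ⟩
  rem (x′ + rem y n) n    ≡⟨ cong (λ z → rem (x′ + z) n) ey ⟩
  rem (x′ + rem y′ n) n   ≡⟨ rem-+ʳ x′ y′ n ⟩
  rem (x′ + y′) n         ∎
  where open ≡-Reasoning

rem-*-cong : ∀ {x x′} c n → rem x n ≡ rem x′ n → rem (c * x) n ≡ rem (c * x′) n
rem-*-cong zero    n eq = refl
rem-*-cong (suc c) n eq = rem-+-cong n eq (rem-*-cong c n eq)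

rotate : ∀ {n} → ℕ → Fin n → Fin n
rotate {suc n} c a = (toℕ a + c) mod suc n

toℕ-rotate : ∀ {n} c (a : Fin n) → toℕ (rotate c a) ≡ rem (toℕ a + c) n
toℕ-rotate {suc n} c a = Fin.toℕ-fromℕ< (m%n<n (toℕ a + c) (suc n))

rotate-≡ : ∀ {n} c d (a b : Fin n) → rem (toℕ a + c) n ≡ rem (toℕ b + d) n → rotate c a ≡ rotate d b
rotate-≡ c d a b eq = Fin.toℕ-injective (trans (toℕ-rotate c a) (trans eq (sym (toℕ-rotate d b))))

rotate-rotate : ∀ {n} c d (a : Fin n) → rotate d (rotate c a) ≡ rotate (c + d) a
rotate-rotate {n} c d a = rotate-≡ d (c + d) (rotate c a) a
  (trans (cong (λ z → rem (z + d) n) (toℕ-rotate c a))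
         (trans (rem-+ (toℕ a + c) d n) (cong (λ z → rem z n) (+-assoc (toℕ a) c d))))

rotate-multiple : ∀ {n} c (a : Fin n) → rem c n ≡ 0 → rotate c a ≡ a
rotate-multiple {n} c a eq = Fin.toℕ-injective (trans (toℕ-rotate c a)
  (trans (sym (rem-+ʳ (toℕ a) c n)) (trans (cong (λ z → rem (toℕ a + z) n) eq)
    (trans (cong (λ z → rem z n) (+-identityʳ (toℕ a))) (rem-small (Fin.toℕ<n a))))))

∑-rotate : ∀ {n} c (f : Fin n → ℕ) → ∑ (allFin n) (f ∘ rotate c) ≡ ∑ (allFin n) f
∑-rotate {zero}      c f = refl
∑-rotate {n@(suc _)} c f = ∑-bijection (rotate c) (rotate c⁻)
  (λ a → trans (rotate-rotate c c⁻ a) (rotate-multiple (c + c⁻) a full))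
  (λ a → trans (rotate-rotate c⁻ c a) (rotate-multiple (c⁻ + c) a (trans (cong (λ z → rem z n) (+-comm c⁻ c)) full))) f
  where
  c⁻ = n ∸ c % n
  full : rem (c + c⁻) n ≡ 0
  full = trans (sym (rem-+ c c⁻ n)) (trans (cong (λ z → rem z n) (m+[n∸m]≡n (<⇒≤ (m%n<n c n)))) (n%n≡0 n))

-- The place where divisibility of `m` by `n` enters: a rotation modulo `m` permutes the possible
-- entries, and modulo `n` it still reads as adding `c`.
rem-rotate : ∀ {m n} .{{_ : NonZero n}} → n ∣ m → ∀ c (a : Fin m) →
  rem (suc (toℕ (rotate c a))) n ≡ rem (suc (toℕ a) + c) n
rem-rotate {m@(suc _)} {n@(suc _)} n∣m c a = rem-+-cong {1} {1} {toℕ (rotate c a)} {toℕ a + c} n refl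
  (trans (cong (_% n) (toℕ-rotate c a)) (m∣n⇒o%n%m≡o%m n m (toℕ a + c) n∣m))

vec-ext : ∀ {A : Set} {n} {v w : Vec A n} → (∀ p → lookup v p ≡ lookup w p) → v ≡ w
vec-ext {v = v} {w} eq = trans (sym (Vec.tabulate∘lookup v)) (trans (Vec.tabulate-cong eq) (Vec.tabulate∘lookup w))

-- Pairwise independent oracles from subset sums.

-- The bit of weight 2 ^ r of the seed s multiplies z (i ∸ 1 ∸ r).
combine : (ℕ → ℕ) → ℕ → ℕ → ℕ
combine z zero    s = 0
combine z (suc i) s = s % 2 * z i + combine z i (s / 2)

combine-cong : ∀ n {z z′} i s → (∀ {g} → g < i → rem (z g) n ≡ rem (z′ g) n) →
  rem (combine z i s) n ≡ rem (combine z′ i s) n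
combine-cong n zero    s eq = refl
combine-cong n (suc i) s eq =
  rem-+-cong n (rem-*-cong (s % 2) n (eq ≤-refl)) (combine-cong n i (s / 2) (eq ∘ m≤n⇒m≤1+n))

combine-+ : ∀ z a c i s → combine (λ g → z g + a g * c) i s ≡ combine z i s + combine a i s * c
combine-+ z a c zero    s = refl
combine-+ z a c (suc i) s = trans (cong (s % 2 * (z i + a i * c) +_) (combine-+ z a c i (s / 2)))
  (lemma (s % 2) (z i) (a i) c (combine z i (s / 2)) (combine a i (s / 2)))
  where
  lemma : ∀ b z a c x y → b * (z + a * c) + (x + y * c) ≡ b * z + x + (b * a + y) * c
  lemma = solve-∀

unit : ℕ → ℕ → ℕ
unit g i = 𝟙 (g ≟ i)

-- Coefficient with which the g-th summand enters `combine _ i s`.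
coefficient : ℕ → ℕ → ℕ → ℕ
coefficient i g s = combine (unit g) i s

coefficient-high : ∀ i g s → i ≤ g → coefficient i g s ≡ 0
coefficient-high zero    g s i≤g = refl
coefficient-high (suc i) g s i<g = cong₂ _+_
  (trans (cong (s % 2 *_) (𝟙-no (g ≟ i) (λ e → <⇒≢ i<g (sym e)))) (*-zeroʳ (s % 2)))
  (coefficient-high i g (s / 2) (<⇒≤ i<g))

coefficient-top : ∀ i s → coefficient (suc i) i s ≡ s % 2
coefficient-top i s = trans (cong₂ _+_ (trans (cong (s % 2 *_) (𝟙-yes (i ≟ i) refl)) (*-identityʳ (s % 2)))
  (coefficient-high i i (s / 2) ≤-refl)) (+-identityʳ (s % 2))

coefficient-low : ∀ i g s → g < i → coefficient (suc i) g s ≡ coefficient i g (s / 2)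
coefficient-low i g s g<i = cong (_+ coefficient i g (s / 2))
  (trans (cong (s % 2 *_) (𝟙-no (g ≟ i) (<⇒≢ g<i))) (*-zeroʳ (s % 2)))

coefficient-bit : ∀ i g s → g < i → coefficient i g s ≡ 0 ⊎ coefficient i g s ≡ 1
coefficient-bit (suc i) g s g<1+i with m≤n⇒m<n∨m≡n (s≤s⁻¹ g<1+i)
... | inj₁ g<i rewrite coefficient-low i g s g<i = coefficient-bit i g (s / 2) g<i
... | inj₂ refl rewrite coefficient-top g s = bit-cases (s % 2) (m%n<n s 2)
  where
  bit-cases : ∀ b → b < 2 → b ≡ 0 ⊎ b ≡ 1
  bit-cases 0 _ = inj₁ refl
  bit-cases 1 _ = inj₂ refl
  bit-cases (suc (suc _)) (s≤s (s≤s ()))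

-- The coefficients are the bits of the seed, so two seeds disagree in one of them. The column in
-- which they disagree is the source of pairwise independence.
separate : ∀ i s s′ → s < 2 ^ i → s′ < 2 ^ i → s ≢ s′ →
  Σ[ g ∈ ℕ ] g < i × coefficient i g s ≢ coefficient i g s′
separate zero    s s′ s< s′< s≢s′ = contradiction (trans (n<1⇒n≡0 s<) (sym (n<1⇒n≡0 s′<))) s≢s′
separate (suc i) s s′ s< s′< s≢s′ with s % 2 ≟ s′ % 2
... | no ≢₂ = i , ≤-refl , λ e → ≢₂ (trans (sym (coefficient-top i s)) (trans e (coefficient-top i s′)))
... | yes ≡₂ with separate i (s / 2) (s′ / 2) (halve s<) (halve s′<)
                   (λ e → s≢s′ (trans (m≡m%n+[m/n]*n s 2) (trans (cong₂ (λ a b → a + b * 2) ≡₂ e) (sym (m≡m%n+[m/n]*n s′ 2)))))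
  where
  halve : ∀ {x} → x < 2 * 2 ^ i → x / 2 < 2 ^ i
  halve x< = m<n*o⇒m/o<n (<-≤-trans x< (≤-reflexive (*-comm 2 (2 ^ i))))
...   | g , g<i , ≢′ = g , m≤n⇒m≤1+n g<i , λ e → ≢′ (trans (sym (coefficient-low i g s g<i)) (trans e (coefficient-low i g s′ g<i)))

-- List 1, rotated by c, is used up to position H for the walk itself; behind it
-- lie U rows of G entries, and the seed-dependent subset sums of the rows are
-- the oracle values.

module Oracles {m n : ℕ} .{{_ : NonZero n}} (n∣m : n ∣ m) (H G U c : ℕ)
               (fits : H + U * G ≤ n) (c≤n : c ≤ n) where

  position : ℕ → ℕ
  position y = rem (y + c) n

  oracleAt : (ℕ → ℕ) → ℕ → ℕ → ℕ
  oracleAt v s u = rem (combine (λ i → v (position (H + u * G + i))) G s) n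

  oracle : Vec (Fin m) n → ℕ → Vec (Fin n) U
  oracle w s = Vec.tabulate (λ u → combine (λ i → value w (position (H + toℕ u * G + i))) G s mod n)

  toℕ-mod : ∀ x → toℕ (x mod n) ≡ rem x n
  toℕ-mod x = trans (Fin.toℕ-fromℕ< (m%n<n x n)) (sym (rem≡% x n))

  lookup-oracle : ∀ w s u → toℕ (lookup (oracle w s) u) ≡ oracleAt (value w) s (toℕ u)
  lookup-oracle w s u = trans (cong toℕ (Vec.lookup∘tabulate _ u)) (toℕ-mod _)

  preposition : ℕ → ℕ
  preposition p = rem (p + (n ∸ c)) n

  preposition-position : ∀ {y} → y < n → preposition (position y) ≡ y
  preposition-position {y} y<n = begin
    rem (rem (y + c) n + (n ∸ c)) n   ≡⟨ rem-+ (y + c) (n ∸ c) n ⟩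
    rem (y + c + (n ∸ c)) n           ≡⟨ cong (λ z → rem z n) (trans (+-assoc y c _) (cong (y +_) (m+[n∸m]≡n c≤n))) ⟩
    rem (y + n) n                     ≡⟨ rem≡% (y + n) n ⟩
    (y + n) % n                       ≡⟨ [m+n]%n≡m%n y n ⟩
    y % n                             ≡⟨ m<n⇒m%n≡m y<n ⟩
    y                                 ∎
    where open ≡-Reasoning

  position-< : ∀ y → position y < n
  position-< y = rem-< (y + c) n

  module Shift (g : ℕ) (g<G : g < G) where
    private instance
      G≢0 : NonZero G
      G≢0 = >-nonZero (≤-trans (s≤s z≤n) g<G)

    -- The row of y to be added at rotated position y₀, if that lies in column g.
    amount : Vec (Fin n) U → ℕ → ℕ
    amount y y₀ with y₀ <? H
    ... | yes _ = 0
    ... | no _  = unit g ((y₀ ∸ H) % G) * nth 0 (List.map toℕ (Vec.toList y)) ((y₀ ∸ H) / G)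

    amount-low : ∀ y {y₀} → y₀ < H → amount y y₀ ≡ 0
    amount-low y {y₀} y₀<H with y₀ <? H
    ... | yes _ = refl
    ... | no y₀≮H = contradiction y₀<H y₀≮H

    amount-row : ∀ y (u : Fin U) {i} → i < G → amount y (H + toℕ u * G + i) ≡ unit g i * toℕ (lookup y u)
    amount-row y u {i} i<G with H + toℕ u * G + i <? H
    ... | yes lt = contradiction (≤-trans (m≤m+n H (toℕ u * G)) (m≤m+n _ i)) (<⇒≱ lt)
    ... | no _   = cong₂ (λ a b → unit g a * b)
        (trans (cong (_% G) drop) (trans ([m+kn]%n≡m%n i (toℕ u) G) (m<n⇒m%n≡m i<G)))
        (trans (cong (nth 0 (List.map toℕ (Vec.toList y))) quotient) (nth-map 0 toℕ y u))
      where
      drop : H + toℕ u * G + i ∸ H ≡ i + toℕ u * G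
      drop = trans (cong (_∸ H) (trans (+-assoc H _ i) (cong (H +_) (+-comm (toℕ u * G) i)))) (m+n∸m≡n H _)
      quotient : (H + toℕ u * G + i ∸ H) / G ≡ toℕ u
      quotient = trans (cong (_/ G) drop) (trans (+-distrib-/-∣ʳ i {toℕ u * G} {G} (divides (toℕ u) refl))
        (cong₂ _+_ (m<n⇒m/n≡0 i<G) (m*n/n≡m (toℕ u) G)))

    shift : Vec (Fin n) U → Vec (Fin m) n → Vec (Fin m) n
    shift y w = Vec.tabulate (λ p → rotate (amount y (preposition (toℕ p))) (lookup w p))

    ∑-shift : ∀ y F → ∑ (words (allFin m) n) (F ∘ shift y) ≡ ∑ (words (allFin m) n) F
    ∑-shift y F = ∑-words-reindex (allFin m) (λ p → rotate (amount y (preposition (toℕ p))))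
      (λ p f → ∑-rotate (amount y (preposition (toℕ p))) f) F

    value-shift : ∀ y w {p} (p<n : p < n) →
      value (shift y w) p ≡ suc (toℕ (rotate (amount y (preposition p)) (lookup w (fromℕ< p<n))))
    value-shift y w {p} p<n = trans (nth-map-< 0 _ (shift y w) p<n) (cong (suc ∘ toℕ)
      (trans (Vec.lookup∘tabulate _ (fromℕ< p<n))
        (cong (λ z → rotate (amount y (preposition z)) (lookup w (fromℕ< p<n))) (Fin.toℕ-fromℕ< p<n))))

    value-shift-low : ∀ y w {x} → x < H → value (shift y w) (position x) ≡ value w (position x)
    value-shift-low y w {x} x<H = begin
      value (shift y w) (position x)
        ≡⟨ value-shift y w (position-< x) ⟩
      suc (toℕ (rotate (amount y (preposition (position x))) (lookup w (fromℕ< (position-< x)))))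
        ≡⟨ cong (suc ∘ toℕ) (trans (cong (λ z → rotate z _) (trans (cong (amount y)
             (preposition-position (<-≤-trans x<H (≤-trans (m≤m+n H _) fits)))) (amount-low y x<H)))
             (rotate-multiple 0 _ (rem-0 m))) ⟩
      suc (toℕ (lookup w (fromℕ< (position-< x))))
        ≡⟨ sym (nth-map-< 0 _ w (position-< x)) ⟩
      value w (position x) ∎
      where open ≡-Reasoning


    row-< : ∀ (u : Fin U) {i} → i < G → H + toℕ u * G + i < n
    row-< u {i} i<G = begin-strict
      H + toℕ u * G + i     ≡⟨ trans (+-assoc H _ i) (cong (H +_) (+-comm (toℕ u * G) i)) ⟩
      H + (i + toℕ u * G)   <⟨ +-monoʳ-< H (+-monoˡ-< (toℕ u * G) i<G) ⟩
      H + suc (toℕ u) * G   ≤⟨ +-monoʳ-≤ H (*-monoˡ-≤ G (Fin.toℕ<n u)) ⟩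
      H + U * G             ≤⟨ fits ⟩
      n                     ∎
      where open ≤-Reasoning

    value-shift-row : ∀ y w (u : Fin U) {i} → i < G →
      rem (value (shift y w) (position (H + toℕ u * G + i))) n ≡
      rem (value w (position (H + toℕ u * G + i)) + unit g i * toℕ (lookup y u)) n
    value-shift-row y w u {i} i<G = begin
      rem (value (shift y w) p) n
        ≡⟨ cong (λ z → rem z n) (value-shift y w p<n) ⟩
      rem (suc (toℕ (rotate (amount y (preposition p)) (lookup w (fromℕ< p<n))))) n
        ≡⟨ rem-rotate n∣m (amount y (preposition p)) (lookup w (fromℕ< p<n)) ⟩
      rem (suc (toℕ (lookup w (fromℕ< p<n))) + amount y (preposition p)) n
        ≡⟨ cong₂ (λ a b → rem (a + b) n) (sym (nth-map-< 0 _ w p<n))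
             (trans (cong (amount y) (preposition-position (row-< u i<G))) (amount-row y u i<G)) ⟩
      rem (value w p + unit g i * toℕ (lookup y u)) n ∎
      where
      open ≡-Reasoning
      p = position (H + toℕ u * G + i)
      p<n = position-< (H + toℕ u * G + i)

    -- Subset sums are linear: a shift of column `g` reaches the oracle values exactly with the bit
    -- of the seed belonging to that column.
    oracle-shift : ∀ y w s u → toℕ (lookup (oracle (shift y w) s) u) ≡
      rem (toℕ (lookup (oracle w s) u) + coefficient G g s * toℕ (lookup y u)) n
    oracle-shift y w s u = begin
      toℕ (lookup (oracle (shift y w) s) u)
        ≡⟨ lookup-oracle (shift y w) s u ⟩
      oracleAt (value (shift y w)) s (toℕ u)
        ≡⟨ combine-cong n G s (value-shift-row y w u) ⟩
      rem (combine (λ i → value w (position (H + toℕ u * G + i)) + unit g i * toℕ (lookup y u)) G s) n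
        ≡⟨ cong (λ z → rem z n) (combine-+ _ (unit g) (toℕ (lookup y u)) G s) ⟩
      rem (combine (λ i → value w (position (H + toℕ u * G + i))) G s + coefficient G g s * toℕ (lookup y u)) n
        ≡⟨ sym (rem-+ _ _ n) ⟩
      rem (oracleAt (value w) s (toℕ u) + coefficient G g s * toℕ (lookup y u)) n
        ≡⟨ cong (λ z → rem (z + coefficient G g s * toℕ (lookup y u)) n) (sym (lookup-oracle w s u)) ⟩
      rem (toℕ (lookup (oracle w s) u) + coefficient G g s * toℕ (lookup y u)) n ∎
      where open ≡-Reasoning

    oracle-unshifted : ∀ y w s → coefficient G g s ≡ 0 → oracle (shift y w) s ≡ oracle w s
    oracle-unshifted y w s eq = vec-ext (λ u → Fin.toℕ-injective (trans (oracle-shift y w s u)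
      (trans (cong (λ z → rem (toℕ (lookup (oracle w s) u) + z * toℕ (lookup y u)) n) eq)
        (trans (cong (λ z → rem z n) (+-identityʳ _)) (rem-small (Fin.toℕ<n (lookup (oracle w s) u)))))))

    oracle-shifted : ∀ y w s → coefficient G g s ≡ 1 →
      oracle (shift y w) s ≡ Vec.tabulate (λ u → rotate (toℕ (lookup (oracle w s) u)) (lookup y u))
    oracle-shifted y w s eq = vec-ext (λ u → Fin.toℕ-injective (trans (oracle-shift y w s u)
      (trans (cong (λ z → rem (toℕ (lookup (oracle w s) u) + z * toℕ (lookup y u)) n) eq)
        (trans (cong (λ z → rem z n) (trans (cong (toℕ (lookup (oracle w s) u) +_) (+-identityʳ _)) (+-comm _ (toℕ (lookup y u)))))
          (sym (trans (cong toℕ (Vec.lookup∘tabulate _ u)) (toℕ-rotate _ (lookup y u))))))))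

    -- Averaging over all shifts of column g turns oracle values with an odd
    -- g-th coefficient into uniformly random ones.
    average : ∀ s → coefficient G g s ≡ 1 →
      ∀ (R : Vec (Fin m) n → ℕ) → (∀ y w → R (shift y w) ≡ R w) →
      ∀ (J : Vec (Fin m) n → Vec (Fin n) U → ℕ) → (∀ y w h → J (shift y w) h ≡ J w h) →
      n ^ U * ∑ (words (allFin m) n) (λ w → R w * J w (oracle w s)) ≡
      ∑ (words (allFin m) n) (λ w → R w * ∑ (words (allFin n) U) (J w))
    average s eq R R-shift J J-shift = begin
      n ^ U * ∑ Ω (λ w → R w * J w (oracle w s))
        ≡⟨ cong (_* ∑ Ω (λ w → R w * J w (oracle w s)))
             (trans (cong (_^ U) (sym (length-allFin n))) (sym (length-words (allFin n) U))) ⟩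
      length ys * ∑ Ω (λ w → R w * J w (oracle w s))
        ≡⟨ sym (∑-const ys _) ⟩
      ∑ ys (λ _ → ∑ Ω (λ w → R w * J w (oracle w s)))
        ≡⟨ ∑-cong ys (λ y → sym (∑-shift y (λ w → R w * J w (oracle w s)))) ⟩
      ∑ ys (λ y → ∑ Ω (λ w → R (shift y w) * J (shift y w) (oracle (shift y w) s)))
        ≡⟨ ∑-cong ys (λ y → ∑-cong Ω (λ w → cong₂ _*_ (R-shift y w)
             (trans (J-shift y w _) (cong (J w) (oracle-shifted y w s eq))))) ⟩
      ∑ ys (λ y → ∑ Ω (λ w → R w * J w (rotated w y)))
        ≡⟨ ∑-swap ys Ω (λ y w → R w * J w (rotated w y)) ⟩
      ∑ Ω (λ w → ∑ ys (λ y → R w * J w (rotated w y)))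
        ≡⟨ ∑-cong Ω (λ w → trans (∑-*ˡ ys (R w) _) (cong (R w *_)
             (∑-words-reindex (allFin n) (λ u → rotate (toℕ (lookup (oracle w s) u)))
               (λ u f → ∑-rotate _ f) (J w)))) ⟩
      ∑ Ω (λ w → R w * ∑ ys (J w)) ∎
      where
      open ≡-Reasoning
      Ω = words (allFin m) n
      ys = words (allFin n) U
      rotated : Vec (Fin m) n → Vec (Fin n) U → Vec (Fin n) U
      rotated w y = Vec.tabulate (λ u → rotate (toℕ (lookup (oracle w s) u)) (lookup y u))

  -- Q and J may look at list 1 only in the part that no oracle value reads.
  module Moments (Q : Vec (Fin m) n → ℕ) (J : Vec (Fin m) n → Vec (Fin n) U → ℕ)
    (Q-cong : ∀ w w′ → (∀ {x} → x < H → value w (position x) ≡ value w′ (position x)) → Q w ≡ Q w′)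
    (J-cong : ∀ w w′ h → (∀ {x} → x < H → value w (position x) ≡ value w′ (position x)) → J w h ≡ J w′ h)
    (J-idem : ∀ w h → J w h * J w h ≡ J w h) where

    Ω : List (Vec (Fin m) n)
    Ω = words (allFin m) n

    P : Vec (Fin m) n → ℕ
    P w = ∑ (words (allFin n) U) (J w)

    -- Seed 0 is left out: it selects the empty subset, so its oracle is constantly 0.
    seed : Fin (2 ^ G ∸ 1) → ℕ
    seed S = suc (toℕ S)

    I : Fin (2 ^ G ∸ 1) → Vec (Fin m) n → ℕ
    I S w = J w (oracle w (seed S))

    private
      seed< : ∀ S → seed S < 2 ^ G
      seed< S = ≤-trans (s≤s (Fin.toℕ<n S)) (≤-reflexive (m+[n∸m]≡n (>-nonZero⁻¹ (2 ^ G) {{m^n≢0 2 G}})))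

      module _ {g} (g<G : g < G) where
        open Shift g g<G

        average-Q : ∀ s → coefficient G g s ≡ 1 →
          ∀ (R : Vec (Fin m) n → ℕ) → (∀ y w → R (shift y w) ≡ R w) →
          n ^ U * ∑ Ω (λ w → Q w * (R w * J w (oracle w s))) ≡ ∑ Ω (λ w → Q w * (R w * P w))
        average-Q s eq R R-shift = begin
          n ^ U * ∑ Ω (λ w → Q w * (R w * J w (oracle w s)))
            ≡⟨ cong (n ^ U *_) (∑-cong Ω (λ w → sym (*-assoc (Q w) (R w) _))) ⟩
          n ^ U * ∑ Ω (λ w → Q w * R w * J w (oracle w s))
            ≡⟨ average s eq (λ w → Q w * R w) (λ y w → cong₂ _*_ (Q-shift y w) (R-shift y w)) J J-shift ⟩
          ∑ Ω (λ w → Q w * R w * P w)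
            ≡⟨ ∑-cong Ω (λ w → *-assoc (Q w) (R w) _) ⟩
          ∑ Ω (λ w → Q w * (R w * P w)) ∎
          where
          open ≡-Reasoning
          Q-shift : ∀ y w → Q (shift y w) ≡ Q w
          Q-shift y w = Q-cong (shift y w) w (value-shift-low y w)
          J-shift : ∀ y w h → J (shift y w) h ≡ J w h
          J-shift y w h = J-cong (shift y w) w h (value-shift-low y w)

        P-shift : ∀ y w → P (shift y w) ≡ P w
        P-shift y w = ∑-cong (words (allFin n) U) (λ h → J-cong (shift y w) w h (value-shift-low y w))

        I-shift : ∀ S → coefficient G g (seed S) ≡ 0 → ∀ y w → I S (shift y w) ≡ I S w
        I-shift S eq y w = trans (cong (J (shift y w)) (oracle-unshifted y w (seed S) eq))
                                 (J-cong (shift y w) w _ (value-shift-low y w))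

      coefficient-0 : ∀ i g → coefficient i g 0 ≡ 0
      coefficient-0 zero    g = refl
      coefficient-0 (suc i) g = coefficient-0 i g

      odd : ∀ S → Σ[ g ∈ ℕ ] g < G × coefficient G g (seed S) ≡ 1
      odd S with separate G (seed S) 0 (seed< S) (>-nonZero⁻¹ (2 ^ G) {{m^n≢0 2 G}}) (λ ())
      ... | g , g<G , ≢₀ with coefficient-bit G g (seed S) g<G
      ...   | inj₁ ≡0 = contradiction (trans ≡0 (sym (coefficient-0 G g))) ≢₀
      ...   | inj₂ ≡1 = g , g<G , ≡1

    I-idem : ∀ S w → I S w * I S w ≡ I S w
    I-idem S w = J-idem w _

    meanP : ∀ S → n ^ U * ∑ Ω (λ w → Q w * (P w * I S w)) ≡ ∑ Ω (λ w → Q w * (P w * P w))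
    meanP S = let g , g<G , eq = odd S in average-Q g<G (seed S) eq P (P-shift g<G)

    mean : ∀ S → n ^ U * ∑ Ω (λ w → Q w * I S w) ≡ ∑ Ω (λ w → Q w * P w)
    mean S = let g , g<G , eq = odd S in begin
      n ^ U * ∑ Ω (λ w → Q w * I S w)
        ≡⟨ cong (n ^ U *_) (∑-cong Ω (λ w → cong (Q w *_) (sym (*-identityˡ (I S w))))) ⟩
      n ^ U * ∑ Ω (λ w → Q w * (1 * I S w))
        ≡⟨ average-Q g<G (seed S) eq (λ _ → 1) (λ _ _ → refl) ⟩
      ∑ Ω (λ w → Q w * (1 * P w))
        ≡⟨ ∑-cong Ω (λ w → cong (Q w *_) (*-identityˡ (P w))) ⟩
      ∑ Ω (λ w → Q w * P w) ∎
      where open ≡-Reasoning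

    private
      -- Column `g` enters only the oracle of the second seed. Averaging over its shifts turns the
      -- second indicator into its mean `P` and leaves the first untouched, which `meanP` then
      -- averages by means of a column of its own.
      pair : ∀ S S′ {g} → g < G → coefficient G g (seed S) ≡ 0 → coefficient G g (seed S′) ≡ 1 →
        n ^ U * (n ^ U * ∑ Ω (λ w → Q w * (I S w * I S′ w))) ≡ ∑ Ω (λ w → Q w * (P w * P w))
      pair S S′ g<G ≡0 ≡1 = begin
        n ^ U * (n ^ U * ∑ Ω (λ w → Q w * (I S w * I S′ w)))
          ≡⟨ cong (n ^ U *_) (average-Q g<G (seed S′) ≡1 (I S) (I-shift g<G S ≡0)) ⟩
        n ^ U * ∑ Ω (λ w → Q w * (I S w * P w))
          ≡⟨ cong (n ^ U *_) (∑-cong Ω (λ w → cong (Q w *_) (*-comm (I S w) (P w)))) ⟩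
        n ^ U * ∑ Ω (λ w → Q w * (P w * I S w))
          ≡⟨ meanP S ⟩
        ∑ Ω (λ w → Q w * (P w * P w)) ∎
        where open ≡-Reasoning

    pairs : ∀ S S′ → S ≢ S′ → n ^ U * (n ^ U * ∑ Ω (λ w → Q w * (I S w * I S′ w))) ≡ ∑ Ω (λ w → Q w * (P w * P w))
    pairs S S′ S≢S′ with separate G (seed S) (seed S′) (seed< S) (seed< S′) (S≢S′ ∘ Fin.toℕ-injective ∘ suc-injective)
    ... | g , g<G , ≢₁ with coefficient-bit G g (seed S) g<G | coefficient-bit G g (seed S′) g<G
    ...   | inj₁ ≡0 | inj₁ ≡0′ = contradiction (trans ≡0 (sym ≡0′)) ≢₁
    ...   | inj₂ ≡1 | inj₂ ≡1′ = contradiction (trans ≡1 (sym ≡1′)) ≢₁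
    ...   | inj₁ ≡0 | inj₂ ≡1′ = pair S S′ g<G ≡0 ≡1′
    ...   | inj₂ ≡1 | inj₁ ≡0′ = trans (cong (λ z → n ^ U * (n ^ U * z))
              (∑-cong Ω (λ w → cong (Q w *_) (*-comm (I S w) (I S′ w))))) (pair S′ S g<G ≡0′ ≡1)

    open Chebyshev Ω (2 ^ G ∸ 1) (n ^ U) I Q P I-idem mean meanP pairs public

-- Bucket loads of a random list.

^-distribʳ-* : ∀ n a b → (a * b) ^ n ≡ a ^ n * b ^ n
^-distribʳ-* zero    a b = refl
^-distribʳ-* (suc n) a b = trans (cong (a * b *_) (^-distribʳ-* n a b)) (lemma a b (a ^ n) (b ^ n))
  where
  lemma : ∀ a b x y → a * b * (x * y) ≡ a * x * (b * y)
  lemma = solve-∀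

-- Each of the `m / K + 1` possible quotients admits at most one entry, and `K ≤ m` absorbs the
-- additional one.
residue-count : ∀ m K .{{_ : NonZero K}} r → K ≤ m →
  K * ∑ (allFin m) (λ a → 𝟙 (rem (suc (toℕ a)) K ≟ r)) ≤ 2 * m
residue-count m K r K≤m = begin
  K * ∑ (allFin m) (λ a → 𝟙 (rem (suc (toℕ a)) K ≟ r))
    ≤⟨ *-monoʳ-≤ K (∑-mono (allFin m) by-quotient) ⟩
  K * ∑ (allFin m) (λ a → ∑ (allFin (suc (m / K))) (λ q → 𝟙 (suc (toℕ a) ≟ r + toℕ q * K)))
    ≡⟨ cong (K *_) (∑-swap (allFin m) (allFin (suc (m / K))) (λ a q → 𝟙 (suc (toℕ a) ≟ r + toℕ q * K))) ⟩
  K * ∑ (allFin (suc (m / K))) (λ q → ∑ (allFin m) (λ a → 𝟙 (suc (toℕ a) ≟ r + toℕ q * K)))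
    ≤⟨ *-monoʳ-≤ K (∑-≤ (allFin (suc (m / K))) 1 (λ q → ∑-unique m _ (λ a → 𝟙≤1 _)
         (λ a b p p′ → Fin.toℕ-injective (suc-injective (trans (𝟙-pos _ p) (sym (𝟙-pos _ p′))))))) ⟩
  K * (length (allFin (suc (m / K))) * 1)
    ≡⟨ trans (cong (K *_) (trans (*-identityʳ _) (length-allFin (suc (m / K))))) (trans (*-suc K (m / K)) (cong (K +_) (*-comm K (m / K)))) ⟩
  K + m / K * K
    ≤⟨ +-mono-≤ K≤m (m/n*n≤m m K) ⟩
  m + m
    ≡⟨ cong (m +_) (sym (+-identityʳ m)) ⟩
  2 * m ∎
  where
  open ≤-Reasoning
  by-quotient : ∀ a → 𝟙 (rem (suc (toℕ a)) K ≟ r) ≤ ∑ (allFin (suc (m / K))) (λ q → 𝟙 (suc (toℕ a) ≟ r + toℕ q * K))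
  by-quotient a with rem (suc (toℕ a)) K ≟ r
  ... | no _ = z≤n
  ... | yes eq = ≤-trans (≤-reflexive (sym (𝟙-yes (suc (toℕ a) ≟ r + toℕ q * K) (begin-equality
      suc (toℕ a)                                 ≡⟨ m≡m%n+[m/n]*n (suc (toℕ a)) K ⟩
      suc (toℕ a) % K + suc (toℕ a) / K * K       ≡⟨ cong₂ (λ x y → x + y * K) (trans (sym (rem≡% (suc (toℕ a)) K)) eq) (sym (Fin.toℕ-fromℕ< q<)) ⟩
      r + toℕ q * K                               ∎))))
      (term≤∑ q (λ q → 𝟙 (suc (toℕ a) ≟ r + toℕ q * K)))
    where
    q< : suc (toℕ a) / K < suc (m / K)
    q< = s≤s (/-monoˡ-≤ K (Fin.toℕ<n a))
    q = fromℕ< q<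

2^∑ : ∀ {A : Set} {n} (f : A → ℕ) (w : Vec A n) →
  2 ^ ∑ (allFin n) (λ p → f (lookup w p)) ≡ Vec.foldr′ _*_ 1 (Vec.map (λ a → 2 ^ f a) w)
2^∑ f []      = refl
2^∑ {n = suc n} f (a ∷ w) = trans (cong (2 ^_) (∑-allFin-suc n (λ p → f (lookup (a ∷ w) p))))
  (trans (^-distribˡ-+-* 2 (f a) _) (cong (2 ^ f a *_) (2^∑ f w)))

-- By `half-power`, `(K + 2) ^ r ≤ 2 * K ^ r`, and `e` blocks of `r` factors cover the `n` factors;
-- those missing to `r * e` are padded on both sides.
growth : ∀ K r e n → 4 * r ≤ K + 2 → n ≤ r * e → (K + 2) ^ n ≤ 2 ^ e * K ^ n
growth zero zero e n _ n≤ rewrite n≤0⇒n≡0 n≤ = *-mono-≤ (>-nonZero⁻¹ (2 ^ e) {{m^n≢0 2 e}}) ≤-refl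
growth zero (suc r) e n 4r≤ n≤ with s≤s (s≤s ()) ← ≤-trans (≤-reflexive (sym (*-suc 4 r))) 4r≤
growth K@(suc _) r e n 4r≤ n≤ = *-cancelʳ-≤ _ _ (K ^ (r * e ∸ n)) {{m^n≢0 K (r * e ∸ n)}} (begin
  (K + 2) ^ n * K ^ (r * e ∸ n)
    ≤⟨ *-monoʳ-≤ ((K + 2) ^ n) (^-monoˡ-≤ (r * e ∸ n) (m≤m+n K 2)) ⟩
  (K + 2) ^ n * (K + 2) ^ (r * e ∸ n)
    ≡⟨ trans (sym (^-distribˡ-+-* (K + 2) n (r * e ∸ n))) (cong ((K + 2) ^_) (m+[n∸m]≡n n≤)) ⟩
  (K + 2) ^ (r * e)
    ≡⟨ sym (^-*-assoc (K + 2) r e) ⟩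
  ((K + 2) ^ r) ^ e
    ≤⟨ ^-monoˡ-≤ e (≤-trans (half-power (K + 2) 2 r (≤-trans (≤-reflexive (lemma r)) 4r≤))
         (≤-reflexive (cong (λ z → 2 * z ^ r) (m+n∸n≡m K 2)))) ⟩
  (2 * K ^ r) ^ e
    ≡⟨ trans (^-distribʳ-* e 2 (K ^ r)) (cong (2 ^ e *_) (trans (^-*-assoc K r e)
         (trans (cong (K ^_) (sym (m+[n∸m]≡n n≤))) (^-distribˡ-+-* K n (r * e ∸ n))))) ⟩
  2 ^ e * (K ^ n * K ^ (r * e ∸ n))
    ≡⟨ sym (*-assoc (2 ^ e) _ _) ⟩
  2 ^ e * K ^ n * K ^ (r * e ∸ n) ∎)
  where
  open ≤-Reasoning
  lemma : ∀ r → 2 * (r * 2) ≡ 4 * r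
  lemma = solve-∀

module Loads (m n K : ℕ) .{{_ : NonZero K}} (K≤m : K ≤ m) where

  loadAt : ℕ → Vec (Fin m) n → ℕ
  loadAt r w = ∑ (allFin n) (λ p → 𝟙 (rem (suc (toℕ (lookup w p))) K ≟ r))

  heavy : ℕ → Vec (Fin m) n → ℕ
  heavy μ w = ∑ (allFin K) (λ r → 𝟙 (μ <? loadAt (toℕ r) w))

  -- Chernoff's method with base 2: independence of the entries makes the mean of `2 ^ load` an
  -- `n`-th power of one plus the probability of a residue, which is at most `2 / K`.
  exponential-moment : ∀ r q e → 4 * q ≤ K + 2 → n ≤ q * e →
    ∑ (words (allFin m) n) (λ w → 2 ^ loadAt r w) ≤ 2 ^ e * m ^ n
  exponential-moment r q e 4q≤ n≤ = *-cancelˡ-≤ (K ^ n) {{m^n≢0 K n}} (begin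
    K ^ n * ∑ (words (allFin m) n) (λ w → 2 ^ loadAt r w)
      ≡⟨ cong (K ^ n *_) (trans (∑-cong (words (allFin m) n) (2^∑ (λ a → 𝟙 (hit? a)))) (∑-words-∏ (allFin m) n _)) ⟩
    K ^ n * ∑ (allFin m) (λ a → 2 ^ 𝟙 (hit? a)) ^ n
      ≡⟨ trans (sym (^-distribʳ-* n K _)) (cong (_^ n) (trans (cong (K *_) expand) (*-distribˡ-+ K m _))) ⟩
    (K * m + K * ∑ (allFin m) (λ a → 𝟙 (hit? a))) ^ n
      ≤⟨ ^-monoˡ-≤ n (+-monoʳ-≤ (K * m) (residue-count m K r K≤m)) ⟩
    (K * m + 2 * m) ^ n
      ≡⟨ trans (cong (_^ n) (sym (*-distribʳ-+ m K 2))) (^-distribʳ-* n (K + 2) m) ⟩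
    (K + 2) ^ n * m ^ n
      ≤⟨ *-monoˡ-≤ (m ^ n) (growth K q e n 4q≤ n≤) ⟩
    2 ^ e * K ^ n * m ^ n
      ≡⟨ lemma (2 ^ e) (K ^ n) (m ^ n) ⟩
    K ^ n * (2 ^ e * m ^ n) ∎)
    where
    open ≤-Reasoning
    lemma : ∀ a b c → a * b * c ≡ b * (a * c)
    lemma = solve-∀
    hit? : ∀ (a : Fin m) → Dec (rem (suc (toℕ a)) K ≡ r)
    hit? a = rem (suc (toℕ a)) K ≟ r
    2^𝟙 : ∀ {X : Set} (d : Dec X) → 2 ^ 𝟙 d ≡ 1 + 𝟙 d
    2^𝟙 (yes _) = refl
    2^𝟙 (no _)  = refl
    expand : ∑ (allFin m) (λ a → 2 ^ 𝟙 (hit? a)) ≡ m + ∑ (allFin m) (λ a → 𝟙 (hit? a))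
    expand = trans (∑-cong (allFin m) (λ a → 2^𝟙 (hit? a))) (trans (∑-+ (allFin m) (λ _ → 1) _)
      (cong (_+ ∑ (allFin m) (λ a → 𝟙 (hit? a))) (trans (∑-allFin-const m 1) (*-identityʳ m))))

  -- Markov's inequality for `2 ^ load`, summed over the `K` residues.
  heavy-rare : ∀ μ q e → 4 * q ≤ K + 2 → n ≤ q * e →
    ∑ (words (allFin m) n) (heavy μ) * 2 ^ μ ≤ K * (2 ^ e * m ^ n)
  heavy-rare μ q e 4q≤ n≤ = begin
    ∑ Ω (heavy μ) * 2 ^ μ
      ≡⟨ cong (_* 2 ^ μ) (∑-swap Ω (allFin K) (λ w r → 𝟙 (μ <? loadAt (toℕ r) w))) ⟩
    ∑ (allFin K) (λ r → ∑ Ω (λ w → 𝟙 (μ <? loadAt (toℕ r) w))) * 2 ^ μ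
      ≡⟨ trans (sym (∑-*ʳ (allFin K) (2 ^ μ) _)) (∑-cong (allFin K) (λ r → sym (∑-*ʳ Ω (2 ^ μ) _))) ⟩
    ∑ (allFin K) (λ r → ∑ Ω (λ w → 𝟙 (μ <? loadAt (toℕ r) w) * 2 ^ μ))
      ≤⟨ ∑-mono (allFin K) (λ r → ≤-trans (∑-mono Ω (λ w → markov (loadAt (toℕ r) w) (μ <? loadAt (toℕ r) w)))
           (exponential-moment (toℕ r) q e 4q≤ n≤)) ⟩
    ∑ (allFin K) (λ r → 2 ^ e * m ^ n)
      ≡⟨ ∑-allFin-const K _ ⟩
    K * (2 ^ e * m ^ n) ∎
    where
    open ≤-Reasoning
    Ω = words (allFin m) n
    markov : ∀ x (d : Dec (μ < x)) → 𝟙 d * 2 ^ μ ≤ 2 ^ x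
    markov x (yes μ<x) = ≤-trans (≤-reflexive (+-identityʳ (2 ^ μ))) (^-monoʳ-≤ 2 (<⇒≤ μ<x))
    markov x (no _)    = z≤n

  light : ∀ μ w → heavy μ w ≡ 0 → ∀ {r} → r < K → loadAt r w ≤ μ
  light μ w eq {r} r<K with μ <? loadAt r w
  ... | no ≮ = ≮⇒≥ ≮
  ... | yes lt = contradiction eq (>⇒≢ (<-≤-trans (subst (0 <_) (sym (𝟙-yes (μ <? loadAt (toℕ r′) w) lt′)) z<s)
                   (term≤∑ r′ (λ r → 𝟙 (μ <? loadAt (toℕ r) w)))))
    where
    r′ = fromℕ< r<K
    lt′ : μ < loadAt (toℕ r′) w
    lt′ = subst (λ z → μ < loadAt z w) (sym (Fin.toℕ-fromℕ< r<K)) lt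

-- The two-list instance behind a solution.

choose : ℕ → ℕ → ℕ → ℕ
choose zero    a b = b
choose (suc _) a b = a

choose-< : ∀ {x H} a b → x < H → choose (H ∸ x) a b ≡ a
choose-< {zero}  {suc H} a b x<H = refl
choose-< {suc x} {suc H} a b x<H = choose-< a b (s≤s⁻¹ x<H)

choose-≥ : ∀ {x H} a b → H ≤ x → choose (H ∸ x) a b ≡ b
choose-≥ {x} {H} a b H≤x = cong (λ z → choose z a b) (m≤n⇒m∸n≡0 H≤x)

-- Vertices below `H` stand for entries of list 1. The others stand for entries of list 2, hashed by
-- the complement `off ∸ v₂`, the value a partner in list 1 must have modulo `K`. The test `H ∸ x`
-- is nonzero exactly when `x < H`, as in the machine's conditional.
bucketOf : (n H K c₁ c₂ off : ℕ) (v₁ v₂ : ℕ → ℕ) → ℕ → ℕ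
bucketOf n H K c₁ c₂ off v₁ v₂ x =
  rem (choose (H ∸ x) (v₁ (rem (x + c₁) n)) (off ∸ v₂ (rem (x + c₂) n))) K

value-rotate : ∀ {m n} (w : Vec (Fin m) n) c x → value w (rem (toℕ x + c) n) ≡ suc (toℕ (lookup w (rotate c x)))
value-rotate w c x = trans (cong (value w) (sym (toℕ-rotate c x))) (nth-map 0 _ w (rotate c x))

value≤m : ∀ {m n} (w : Vec (Fin m) n) p → value w p ≤ m
value≤m []      p       = z≤n
value≤m (a ∷ w) zero    = Fin.toℕ<n a
value≤m (a ∷ w) (suc p) = value≤m w p

-- A solution of k-SUM whose first two entries sit at the vertices i and j.

module Pair {m n : ℕ} .{{_ : NonZero n}} (H G K : ℕ) .{{_ : NonZero K}} (n∣m : n ∣ m)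
            (fits : H + suc K * G ≤ n) (c₁ c₂ ℓ μ : ℕ) (c₁≤n : c₁ ≤ n) (i j : Fin n) where

  oracle : Vec (Fin m) n → ℕ → Vec (Fin n) (suc K)
  oracle = Oracles.oracle n∣m H G (suc K) c₁ fits c₁≤n

  -- A bucket besides the `K` residues, into which no vertex hashes: its oracle value is the random
  -- starting point of the walk.
  ⋆ : Fin (suc K)
  ⋆ = Fin.fromℕ K

  -- The multiple `m * K` of `K` leaves residues alone and prevents truncation when an entry of list
  -- 2 is subtracted. The program obtains the same number without knowing the pair, by subtracting
  -- the guessed entries from the target plus `m * K`.
  offset : Vec (Fin m) n → Vec (Fin m) n → ℕ
  offset w₁ w₂ = value w₁ (rem (toℕ i + c₁) n) + value w₂ (rem (toℕ j + c₂) n) + m * K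

  -- A table rather than a function, so that inputs agreeing on the relevant entries have equal
  -- buckets without function extensionality.
  buckets : Vec (Fin m) n → Vec (Fin m) n → Vec (Fin (suc K)) n
  buckets w₁ w₂ = Vec.tabulate (λ x → Fin.inject₁
    (choose (H ∸ toℕ x) (value w₁ (rem (toℕ x + c₁) n)) (offset w₁ w₂ ∸ value w₂ (rem (toℕ x + c₂) n)) mod K))

  β : Vec (Fin m) n → Vec (Fin m) n → Fin n → Fin (suc K)
  β w₁ w₂ = lookup (buckets w₁ w₂)

  toℕ-β : ∀ w₁ w₂ x → toℕ (β w₁ w₂ x) ≡ bucketOf n H K c₁ c₂ (offset w₁ w₂) (value w₁) (value w₂) (toℕ x)
  toℕ-β w₁ w₂ x = trans (cong toℕ (Vec.lookup∘tabulate _ x))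
    (trans (Fin.toℕ-inject₁ _) (trans (Fin.toℕ-fromℕ< (m%n<n _ K)) (sym (rem≡% _ K))))

  β-<K : ∀ w₁ w₂ x → toℕ (β w₁ w₂ x) < K
  β-<K w₁ w₂ x = subst (_< K) (sym (toℕ-β w₁ w₂ x)) (rem-< _ K)

  ⋆≢β : ∀ w₁ w₂ x → ⋆ ≢ β w₁ w₂ x
  ⋆≢β w₁ w₂ x eq = <⇒≢ (β-<K w₁ w₂ x) (trans (cong toℕ (sym eq)) (Fin.toℕ-fromℕ K))

  found : Vec (Fin m) n → Vec (Fin m) n → Vec (Fin n) (suc K) → ℕ
  found w₁ w₂ h = 𝟙 (Rho.finds? (β w₁ w₂) ⋆ i j ℓ h)

  seeds : ℕ
  seeds = 2 ^ G ∸ 1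

  successes : Vec (Fin m) n → Vec (Fin m) n → ℕ
  successes w₁ w₂ = ∑ (allFin seeds) (λ S → found w₁ w₂ (oracle w₁ (suc (toℕ S))))

  spread? : ∀ w₁ w₂ → Dec (∀ u → ∑ (allFin n) (λ x → 𝟙 (u Fin.≟ β w₁ w₂ x)) ≤ μ + μ)
  spread? w₁ w₂ = Fin.all? (λ u → ∑ (allFin n) (λ x → 𝟙 (u Fin.≟ β w₁ w₂ x)) ≤? μ + μ)

  unlucky? : ∀ w₁ w₂ → Dec (2 * (n ^ suc K * successes w₁ w₂) ≤ seeds * ∑ (words (allFin n) (suc K)) (found w₁ w₂))
  unlucky? w₁ w₂ = 2 * (n ^ suc K * successes w₁ w₂) ≤? seeds * ∑ (words (allFin n) (suc K)) (found w₁ w₂)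

  -- Unlucky inputs are charged here only if their loads are balanced; the unbalanced ones are
  -- accounted for by `heavy`.
  bad : Vec (Fin m) n → Vec (Fin m) n → ℕ
  bad w₁ w₂ = 𝟙 (spread? w₁ w₂) * 𝟙 (unlucky? w₁ w₂)

  module _ (i<H : toℕ i < H) (H≤j : H ≤ toℕ j) where

    i≢j : i ≢ j
    i≢j refl = <⇒≱ i<H H≤j

    βi≡βj : ∀ w₁ w₂ → β w₁ w₂ i ≡ β w₁ w₂ j
    βi≡βj w₁ w₂ = Fin.toℕ-injective (begin
      toℕ (β w₁ w₂ i)
        ≡⟨ toℕ-β w₁ w₂ i ⟩
      rem (choose (H ∸ toℕ i) a _) K
        ≡⟨ cong (λ z → rem z K) (choose-< a _ i<H) ⟩
      rem a K
        ≡⟨ trans (rem≡% a K) (trans (sym ([m+kn]%n≡m%n a m K)) (sym (rem≡% (a + m * K) K))) ⟩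
      rem (a + m * K) K
        ≡⟨ cong (λ z → rem z K) (sym (trans (cong (_∸ b) (trans (+-assoc a b (m * K))
             (trans (cong (a +_) (+-comm b (m * K))) (sym (+-assoc a (m * K) b))))) (m+n∸n≡m (a + m * K) b))) ⟩
      rem (offset w₁ w₂ ∸ b) K
        ≡⟨ cong (λ z → rem z K) (sym (choose-≥ _ (offset w₁ w₂ ∸ b) H≤j)) ⟩
      rem (choose (H ∸ toℕ j) _ (offset w₁ w₂ ∸ b)) K
        ≡⟨ sym (toℕ-β w₁ w₂ j) ⟩
      toℕ (β w₁ w₂ j) ∎)
      where
      open ≡-Reasoning
      a = value w₁ (rem (toℕ i + c₁) n)
      b = value w₂ (rem (toℕ j + c₂) n)

    found-many : 2 * ((ℓ + ℓ) * ((ℓ + ℓ) * (μ + μ))) ≤ n → ∀ w₁ w₂ →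
      (∀ u → ∑ (allFin n) (λ x → 𝟙 (u Fin.≟ β w₁ w₂ x)) ≤ μ + μ) →
      ℓ * ℓ * n ^ suc K ≤ 2 * (n * n) * ∑ (words (allFin n) (suc K)) (found w₁ w₂)
    found-many small w₁ w₂ load =
      Rho.finds-many (β w₁ w₂) ⋆ i j (βi≡βj w₁ w₂) i≢j (⋆≢β w₁ w₂) (μ + μ) load ℓ small

    private
      pos-cong : ∀ w₂ w₁ w₁′ → (∀ {x} → x < H → value w₁ (rem (x + c₁) n) ≡ value w₁′ (rem (x + c₁) n)) →
        buckets w₁ w₂ ≡ buckets w₁′ w₂
      pos-cong w₂ w₁ w₁′ eq = Vec.tabulate-cong (λ x → cong (λ z → Fin.inject₁ (z mod K)) (go (toℕ x)))
        where
        off≡ : offset w₁ w₂ ≡ offset w₁′ w₂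
        off≡ = cong (λ z → z + value w₂ (rem (toℕ j + c₂) n) + m * K) (eq i<H)
        go : ∀ x → choose (H ∸ x) (value w₁ (rem (x + c₁) n)) (offset w₁ w₂ ∸ value w₂ (rem (x + c₂) n)) ≡
                   choose (H ∸ x) (value w₁′ (rem (x + c₁) n)) (offset w₁′ w₂ ∸ value w₂ (rem (x + c₂) n))
        go x with x <? H
        ... | yes x<H = trans (choose-< _ _ x<H) (trans (eq x<H) (sym (choose-< _ _ x<H)))
        ... | no x≮H  = trans (choose-≥ _ _ (≮⇒≥ x≮H)) (trans (cong (_∸ value w₂ (rem (x + c₂) n)) off≡) (sym (choose-≥ _ _ (≮⇒≥ x≮H))))

      Q : Vec (Fin m) n → Vec (Fin m) n → ℕ
      Q w₂ w₁ = 𝟙 (spread? w₁ w₂)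

    bad-rare : 0 < G → 2 * ((ℓ + ℓ) * ((ℓ + ℓ) * (μ + μ))) ≤ n → ∀ w₂ →
      seeds * (ℓ * ℓ * (ℓ * ℓ)) * ∑ (words (allFin m) n) (λ w₁ → bad w₁ w₂) ≤
      4 * (2 * (n * n) * (2 * (n * n))) * length (words (allFin m) n)
    bad-rare 0<G small w₂ = Oracles.Moments.rare-bound n∣m H G (suc K) c₁ fits c₁≤n
        (Q w₂) (λ w₁ h → found w₁ w₂ h)
        (λ w w′ eq → cong (λ bs → 𝟙 (Fin.all? (λ u → ∑ (allFin n) (λ x → 𝟙 (u Fin.≟ lookup bs x)) ≤? μ + μ))) (pos-cong w₂ w w′ eq))
        (λ w w′ h eq → cong (λ bs → 𝟙 (Rho.finds? (lookup bs) ⋆ i j ℓ h)) (pos-cong w₂ w w′ eq))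
        (λ w h → 𝟙-idem (Rho.finds? (β w w₂) ⋆ i j ℓ h))
        -- The success probability for a uniformly random oracle, by `found-many`.
        (ℓ * ℓ) (2 * (n * n))
        (m<n⇒0<n∸m (^-monoʳ-< 2 (s≤s (s≤s z≤n)) 0<G)) (>-nonZero⁻¹ (n ^ suc K) {{m^n≢0 n (suc K)}})
        (λ w₁ → 𝟙≤1 (spread? w₁ w₂))
        (λ w₁ → ≤-trans (∑-≤ (words (allFin n) (suc K)) 1 (λ h → 𝟙≤1 (Rho.finds? (β w₁ w₂) ⋆ i j ℓ h)))
          (≤-reflexive (trans (*-identityʳ _) (trans (length-words (allFin n) (suc K)) (cong (_^ suc K) (length-allFin n))))))
        many
      where
      many : ∀ w₁ → 0 < 𝟙 (spread? w₁ w₂) → ℓ * ℓ * n ^ suc K ≤ 2 * (n * n) * ∑ (words (allFin n) (suc K)) (found w₁ w₂)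
      many w₁ pos = found-many small w₁ w₂ (𝟙-pos (spread? w₁ w₂) pos)

    not-bad : 2 * ((ℓ + ℓ) * ((ℓ + ℓ) * (μ + μ))) ≤ n → ∀ w₁ w₂ → bad w₁ w₂ ≡ 0 →
      (∀ u → ∑ (allFin n) (λ x → 𝟙 (u Fin.≟ β w₁ w₂ x)) ≤ μ + μ) →
      seeds * (ℓ * ℓ) ≤ 4 * (n * n) * successes w₁ w₂
    not-bad small w₁ w₂ eq load = *-cancelʳ-≤ _ _ (n ^ suc K) {{m^n≢0 n (suc K)}} (begin
      seeds * (ℓ * ℓ) * n ^ suc K
        ≡⟨ *-assoc seeds (ℓ * ℓ) _ ⟩
      seeds * (ℓ * ℓ * n ^ suc K)
        ≤⟨ *-monoʳ-≤ seeds (found-many small w₁ w₂ load) ⟩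
      seeds * (2 * (n * n) * p)
        ≡⟨ lemma₁ seeds (n * n) p ⟩
      2 * (n * n) * (seeds * p)
        ≤⟨ *-monoʳ-≤ (2 * (n * n)) (<⇒≤ (≰⇒> (𝟙-×-zero (spread? w₁ w₂) (unlucky? w₁ w₂) eq load))) ⟩
      2 * (n * n) * (2 * (n ^ suc K * successes w₁ w₂))
        ≡⟨ lemma₂ (n * n) (n ^ suc K) (successes w₁ w₂) ⟩
      4 * (n * n) * successes w₁ w₂ * n ^ suc K ∎)
      where
      open ≤-Reasoning
      p = ∑ (words (allFin n) (suc K)) (found w₁ w₂)
      lemma₁ : ∀ s q p → s * (2 * q * p) ≡ 2 * q * (s * p)
      lemma₁ = solve-∀
      lemma₂ : ∀ q a x → 2 * q * (2 * (a * x)) ≡ 4 * q * x * a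
      lemma₂ = solve-∀

  module _ (K≤m : K ≤ m) where
    open Loads m n K K≤m

    -- The vertices of bucket `u` below `H` are entries of list 1 with residue `u`, the others are
    -- entries of list 2 with the single reflected residue `r`; rotating the indices preserves both
    -- counts.
    light⇒spread : ∀ w₁ w₂ → heavy μ w₁ ≡ 0 → heavy μ w₂ ≡ 0 →
      ∀ u → ∑ (allFin n) (λ x → 𝟙 (u Fin.≟ β w₁ w₂ x)) ≤ μ + μ
    light⇒spread w₁ w₂ light₁ light₂ u with toℕ u <? K
    ... | no u≮K = ≤-trans (≤-reflexive (∑-zero (allFin n) (λ x → 𝟙-no (u Fin.≟ β w₁ w₂ x) (λ { refl → u≮K (β-<K w₁ w₂ x) })))) z≤n
    ... | yes u<K = begin
      ∑ (allFin n) (λ x → 𝟙 (u Fin.≟ β w₁ w₂ x))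
        ≤⟨ ∑-mono (allFin n) (λ x → cover x (u Fin.≟ β w₁ w₂ x)) ⟩
      ∑ (allFin n) (λ x → 𝟙 (in₁? (rotate c₁ x)) + 𝟙 (in₂? (rotate c₂ x)))
        ≡⟨ ∑-+ (allFin n) _ _ ⟩
      ∑ (allFin n) (λ x → 𝟙 (in₁? (rotate c₁ x))) + ∑ (allFin n) (λ x → 𝟙 (in₂? (rotate c₂ x)))
        ≡⟨ cong₂ _+_ (∑-rotate c₁ (λ p → 𝟙 (in₁? p))) (∑-rotate c₂ (λ p → 𝟙 (in₂? p))) ⟩
      loadAt (toℕ u) w₁ + loadAt r w₂
        ≤⟨ +-mono-≤ (light μ w₁ light₁ u<K) (light μ w₂ light₂ (rem-< _ K)) ⟩
      μ + μ ∎
      where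
      open ≤-Reasoning
      o = offset w₁ w₂
      r = rem (o + (K ∸ toℕ u)) K
      in₁? : ∀ p → Dec (rem (suc (toℕ (lookup w₁ p))) K ≡ toℕ u)
      in₁? p = rem (suc (toℕ (lookup w₁ p))) K ≟ toℕ u
      in₂? : ∀ p → Dec (rem (suc (toℕ (lookup w₂ p))) K ≡ r)
      in₂? p = rem (suc (toℕ (lookup w₂ p))) K ≟ r
      reflect : ∀ v → v ≤ o → rem (o ∸ v) K ≡ toℕ u → rem v K ≡ r
      reflect v v≤o eq = sym (begin-equality
        rem (o + (K ∸ toℕ u)) K
          ≡⟨ cong (λ z → rem (z + (K ∸ toℕ u)) K) (trans (sym (m∸n+n≡m v≤o)) (+-comm (o ∸ v) v)) ⟩
        rem (v + (o ∸ v) + (K ∸ toℕ u)) K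
          ≡⟨ cong (λ z → rem z K) (+-assoc v (o ∸ v) _) ⟩
        rem (v + ((o ∸ v) + (K ∸ toℕ u))) K
          ≡⟨ rem-+-cong {v} {v} K refl (begin-equality
               rem ((o ∸ v) + (K ∸ toℕ u)) K      ≡⟨ sym (rem-+ (o ∸ v) _ K) ⟩
               rem (rem (o ∸ v) K + (K ∸ toℕ u)) K ≡⟨ cong (λ z → rem (z + (K ∸ toℕ u)) K) eq ⟩
               rem (toℕ u + (K ∸ toℕ u)) K        ≡⟨ cong (λ z → rem z K) (m+[n∸m]≡n (<⇒≤ u<K)) ⟩
               rem K K                            ≡⟨ trans (rem≡% K K) (n%n≡0 K) ⟩
               0                                  ≡⟨ sym (rem-0 K) ⟩
               rem 0 K                            ∎) ⟩
        rem (v + 0) K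
          ≡⟨ cong (λ z → rem z K) (+-identityʳ v) ⟩
        rem v K ∎)
      cover : ∀ x (d : Dec (u ≡ β w₁ w₂ x)) → 𝟙 d ≤ 𝟙 (in₁? (rotate c₁ x)) + 𝟙 (in₂? (rotate c₂ x))
      cover x (no _) = z≤n
      cover x (yes u≡) with toℕ x <? H
      ... | yes x<H = ≤-trans (≤-reflexive (sym (𝟙-yes (in₁? (rotate c₁ x))
              (trans (cong (λ z → rem z K) (trans (sym (value-rotate w₁ c₁ x)) (sym (choose-< _ _ x<H))))
                (sym (trans (cong toℕ u≡) (toℕ-β w₁ w₂ x))))))) (m≤m+n _ _)
      ... | no x≮H = ≤-trans (≤-reflexive (sym (𝟙-yes (in₂? (rotate c₂ x))
              (trans (cong (λ z → rem z K) (sym (value-rotate w₂ c₂ x)))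
                (reflect (value w₂ (rem (toℕ x + c₂) n))
                  (≤-trans (value≤m w₂ _) (≤-trans (m≤m*n m K) (m≤n+m (m * K) _)))
                  (sym (trans (cong toℕ u≡) (trans (toℕ-β w₁ w₂ x) (cong (λ z → rem z K) (choose-≥ _ _ (≮⇒≥ x≮H)))))))))))
              (m≤n+m _ _)

-- Union bound over rotations and pairs of vertices.

bools : List Bool
bools = true ∷ false ∷ []

-- In list 1 the vertices cover `H` positions, less than half if `n` is odd, so the offsets 0, `H`
-- and `2H` are required to reach every position. In list 2 they cover the other `n - H` positions,
-- at least half, and two offsets suffice.
shift₁ shift₂ : ℕ → Vec Bool 3 → ℕ
shift₁ H (a ∷ b ∷ _) = (bit a + bit b) * H
shift₂ H (_ ∷ _ ∷ c ∷ []) = bit c * H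

∑∑-split : ∀ {A : Set} (Ω : List A) (h : A → ℕ) (r : A → A → ℕ) →
  ∑ Ω (λ x → ∑ Ω (λ y → h x + h y + r x y)) ≡ length Ω * ∑ Ω h + length Ω * ∑ Ω h + ∑ Ω (λ x → ∑ Ω (r x))
∑∑-split Ω h r = begin
  ∑ Ω (λ x → ∑ Ω (λ y → h x + h y + r x y))
    ≡⟨ ∑-cong Ω (λ x → trans (∑-+ Ω (λ y → h x + h y) (r x))
         (cong (_+ ∑ Ω (r x)) (trans (∑-+ Ω (λ _ → h x) h) (cong (_+ ∑ Ω h) (∑-const Ω (h x)))))) ⟩
  ∑ Ω (λ x → length Ω * h x + ∑ Ω h + ∑ Ω (r x))
    ≡⟨ trans (∑-+ Ω (λ x → length Ω * h x + ∑ Ω h) (λ x → ∑ Ω (r x))) (cong (_+ ∑ Ω (λ x → ∑ Ω (r x)))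
         (trans (∑-+ Ω (λ x → length Ω * h x) (λ _ → ∑ Ω h)) (cong₂ _+_ (∑-*ˡ Ω (length Ω) h) (∑-const Ω (∑ Ω h))))) ⟩
  length Ω * ∑ Ω h + length Ω * ∑ Ω h + ∑ Ω (λ x → ∑ Ω (r x)) ∎
  where open ≡-Reasoning

module Typical {m n : ℕ} .{{_ : NonZero n}} (H G K ℓ μ : ℕ) .{{_ : NonZero K}} (n∣m : n ∣ m)
               (fits : H + suc K * G ≤ n) (2H≤n : H + H ≤ n) (n≤2H+1 : n ≤ suc (H + H)) (0<H : 0 < H)
               (K≤m : K ≤ m) (0<G : 0 < G)
               (small : 2 * ((ℓ + ℓ) * ((ℓ + ℓ) * (μ + μ))) ≤ n)
               (q e : ℕ) (4q≤ : 4 * q ≤ K + 2) (n≤qe : n ≤ q * e) (tail : 8 * (K * 2 ^ e) ≤ 2 ^ μ)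
               (many : 512 * (n * n * (n * n * (n * n))) ≤ (2 ^ G ∸ 1) * (ℓ * ℓ * (ℓ * ℓ)))
               where

  shift₁≤n : ∀ v → shift₁ H v ≤ n
  shift₁≤n (a ∷ b ∷ _) = ≤-trans (*-monoˡ-≤ H (+-mono-≤ (bit≤1 a) (bit≤1 b)))
    (≤-trans (≤-reflexive (cong (H +_) (+-identityʳ H))) 2H≤n)
    where
    bit≤1 : ∀ b → bit b ≤ 1
    bit≤1 true  = ≤-refl
    bit≤1 false = z≤n

  bad successes : Vec Bool 3 → Fin n → Fin n → Vec (Fin m) n → Vec (Fin m) n → ℕ
  bad v i j = Pair.bad H G K n∣m fits (shift₁ H v) (shift₂ H v) ℓ μ (shift₁≤n v) i j
  successes v i j = Pair.successes H G K n∣m fits (shift₁ H v) (shift₂ H v) ℓ μ (shift₁≤n v) i j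

  heavy : ℕ → Vec (Fin m) n → ℕ
  heavy = Loads.heavy m n K K≤m

  private
    Ω : List (Vec (Fin m) n)
    Ω = words (allFin m) n

    |Ω| : ℕ
    |Ω| = length Ω

  vs : List (Vec Bool 3)
  vs = words bools 3

  relevant : Vec Bool 3 → Fin n → Fin n → Vec (Fin m) n → Vec (Fin m) n → ℕ
  relevant v i j w₁ w₂ = 𝟙 (toℕ i <? H) * 𝟙 (H ≤? toℕ j) * bad v i j w₁ w₂

  -- A union bound in the form of a count, which vanishes on typical pairs of lists. It ranges over
  -- all offsets and all pairs of vertices, because the adversary decides only afterwards which pair
  -- is wanted.
  badness : Vec (Fin m) n → Vec (Fin m) n → ℕ
  badness w₁ w₂ = heavy μ w₁ + heavy μ w₂ +
    ∑ vs (λ v → ∑ (allFin n) (λ i → ∑ (allFin n) (λ j → relevant v i j w₁ w₂)))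

  private
    sλ : ℕ
    sλ = (2 ^ G ∸ 1) * (ℓ * ℓ * (ℓ * ℓ))

    n² : ℕ
    n² = n * n

    instance
      sλ≢0 : NonZero sλ
      sλ≢0 = >-nonZero (≤-trans (≤-trans (>-nonZero⁻¹ _ {{m*n≢0 512 _ {{_}} {{m*n≢0 n² _ {{m*n≢0 n n}} {{m*n≢0 n² n² {{m*n≢0 n n}} {{m*n≢0 n n}}}}}}}}) ≤-refl) many)

    relevant-rare : ∀ v i j w₂ → sλ * ∑ Ω (λ w₁ → relevant v i j w₁ w₂) ≤ 4 * (2 * n² * (2 * n²)) * |Ω|
    relevant-rare v i j w₂ = ∑-restrict Ω (toℕ i <? H) (H ≤? toℕ j) sλ _ (λ w₁ → bad v i j w₁ w₂)
      (λ i<H H≤j → Pair.bad-rare H G K n∣m fits (shift₁ H v) (shift₂ H v) ℓ μ (shift₁≤n v) i j i<H H≤j 0<G small w₂)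

    all-relevant : ∀ vs → sλ * ∑ Ω (λ w₁ → ∑ Ω (λ w₂ → ∑ vs (λ v → ∑ (allFin n) (λ i → ∑ (allFin n) (λ j → relevant v i j w₁ w₂))))) ≤
                   length vs * (n * (n * (|Ω| * (4 * (2 * n² * (2 * n²)) * |Ω|))))
    all-relevant vs = begin
      sλ * ∑ Ω (λ w₁ → ∑ Ω (λ w₂ → ∑ vs (λ v → ∑ (allFin n) (λ i → ∑ (allFin n) (λ j → relevant v i j w₁ w₂)))))
        ≡⟨ cong (sλ *_) (begin-equality
             ∑ Ω (λ w₁ → ∑ Ω (λ w₂ → ∑ vs (λ v → ∑ (allFin n) (λ i → ∑ (allFin n) (λ j → relevant v i j w₁ w₂)))))
               ≡⟨ ∑-cong Ω (λ w₁ → ∑-swap Ω vs (λ w₂ v → ∑ (allFin n) (λ i → ∑ (allFin n) (λ j → relevant v i j w₁ w₂)))) ⟩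
             ∑ Ω (λ w₁ → ∑ vs (λ v → ∑ Ω (λ w₂ → ∑ (allFin n) (λ i → ∑ (allFin n) (λ j → relevant v i j w₁ w₂)))))
               ≡⟨ ∑-swap Ω vs (λ w₁ v → ∑ Ω (λ w₂ → ∑ (allFin n) (λ i → ∑ (allFin n) (λ j → relevant v i j w₁ w₂)))) ⟩
             ∑ vs (λ v → ∑ Ω (λ w₁ → ∑ Ω (λ w₂ → ∑ (allFin n) (λ i → ∑ (allFin n) (λ j → relevant v i j w₁ w₂)))))
               ≡⟨ ∑-cong vs (λ v → trans
                    (∑-cong Ω (λ w₁ → ∑-swap Ω (allFin n) (λ w₂ i → ∑ (allFin n) (λ j → relevant v i j w₁ w₂))))
                    (∑-swap Ω (allFin n) (λ w₁ i → ∑ Ω (λ w₂ → ∑ (allFin n) (λ j → relevant v i j w₁ w₂))))) ⟩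
             ∑ vs (λ v → ∑ (allFin n) (λ i → ∑ Ω (λ w₁ → ∑ Ω (λ w₂ → ∑ (allFin n) (λ j → relevant v i j w₁ w₂)))))
               ≡⟨ ∑-cong vs (λ v → ∑-cong (allFin n) (λ i → trans
                    (∑-cong Ω (λ w₁ → ∑-swap Ω (allFin n) (λ w₂ j → relevant v i j w₁ w₂)))
                    (trans (∑-swap Ω (allFin n) (λ w₁ j → ∑ Ω (λ w₂ → relevant v i j w₁ w₂)))
                      (∑-cong (allFin n) (λ j → ∑-swap Ω Ω (λ w₁ w₂ → relevant v i j w₁ w₂)))))) ⟩
             ∑ vs (λ v → ∑ (allFin n) (λ i → ∑ (allFin n) (λ j → ∑ Ω (λ w₂ → ∑ Ω (λ w₁ → relevant v i j w₁ w₂))))) ∎) ⟩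
      sλ * ∑ vs (λ v → ∑ (allFin n) (λ i → ∑ (allFin n) (λ j → ∑ Ω (λ w₂ → ∑ Ω (λ w₁ → relevant v i j w₁ w₂)))))
        ≡⟨ trans (sym (∑-*ˡ vs sλ _)) (∑-cong vs (λ v → trans (sym (∑-*ˡ (allFin n) sλ _)) (∑-cong (allFin n) (λ i →
             trans (sym (∑-*ˡ (allFin n) sλ _)) (∑-cong (allFin n) (λ j → sym (∑-*ˡ Ω sλ _))))))) ⟩
      ∑ vs (λ v → ∑ (allFin n) (λ i → ∑ (allFin n) (λ j → ∑ Ω (λ w₂ → sλ * ∑ Ω (λ w₁ → relevant v i j w₁ w₂)))))
        ≤⟨ ∑-mono vs (λ v → ∑-mono (allFin n) (λ i → ∑-mono (allFin n) (λ j → ∑-mono Ω (relevant-rare v i j)))) ⟩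
      ∑ vs (λ v → ∑ (allFin n) (λ i → ∑ (allFin n) (λ j → ∑ Ω (λ w₂ → B))))
        ≡⟨ trans (∑-const vs _) (cong (length vs *_) (trans (∑-allFin-const n _) (cong (n *_)
             (trans (∑-allFin-const n _) (cong (n *_) (∑-const Ω B)))))) ⟩
      length vs * (n * (n * (|Ω| * B))) ∎
      where
      open ≤-Reasoning
      B = 4 * (2 * n² * (2 * n²)) * |Ω|

    quarter : 4 * ∑ Ω (λ w₁ → ∑ Ω (λ w₂ → ∑ vs (λ v → ∑ (allFin n) (λ i → ∑ (allFin n) (λ j → relevant v i j w₁ w₂))))) ≤ |Ω| * |Ω|
    quarter = *-cancelˡ-≤ sλ (begin
      sλ * (4 * x)
        ≡⟨ lemma₁ sλ x ⟩
      4 * (sλ * x)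
        ≤⟨ *-monoʳ-≤ 4 (all-relevant vs) ⟩
      -- There are 8 choices of the offset bits and `4 * 2 * 2 = 16` comes from `bad-rare`, whence
      -- `512 = 4 * 8 * 16`.
      4 * (8 * (n * (n * (|Ω| * (4 * (2 * n² * (2 * n²)) * |Ω|)))))
        ≡⟨ lemma₂ n |Ω| ⟩
      512 * (n² * (n² * n²)) * (|Ω| * |Ω|)
        ≤⟨ *-monoˡ-≤ (|Ω| * |Ω|) many ⟩
      sλ * (|Ω| * |Ω|) ∎)
      where
      open ≤-Reasoning
      x = ∑ Ω (λ w₁ → ∑ Ω (λ w₂ → ∑ vs (λ v → ∑ (allFin n) (λ i → ∑ (allFin n) (λ j → relevant v i j w₁ w₂)))))
      lemma₁ : ∀ s x → s * (4 * x) ≡ 4 * (s * x)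
      lemma₁ = solve-∀
      lemma₂ : ∀ n o → 4 * (8 * (n * (n * (o * (4 * (2 * (n * n) * (2 * (n * n))) * o))))) ≡
                       512 * (n * n * (n * n * (n * n))) * (o * o)
      lemma₂ = solve-∀

    eighth : 8 * ∑ Ω (heavy μ) ≤ |Ω|
    eighth = *-cancelʳ-≤ _ _ (2 ^ μ) {{m^n≢0 2 μ}} (begin
      8 * ∑ Ω (heavy μ) * 2 ^ μ
        ≡⟨ *-assoc 8 (∑ Ω (heavy μ)) (2 ^ μ) ⟩
      8 * (∑ Ω (heavy μ) * 2 ^ μ)
        ≤⟨ *-monoʳ-≤ 8 (Loads.heavy-rare m n K K≤m μ q e 4q≤ n≤qe) ⟩
      8 * (K * (2 ^ e * m ^ n))
        ≡⟨ lemma K (2 ^ e) (m ^ n) ⟩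
      m ^ n * (8 * (K * 2 ^ e))
        ≤⟨ *-monoʳ-≤ (m ^ n) tail ⟩
      m ^ n * 2 ^ μ
        ≡⟨ cong (_* 2 ^ μ) (sym (trans (length-words (allFin m) n) (cong (_^ n) (length-allFin m)))) ⟩
      |Ω| * 2 ^ μ ∎)
      where
      open ≤-Reasoning
      lemma : ∀ k e p → 8 * (k * (e * p)) ≡ p * (8 * (k * e))
      lemma = solve-∀

  -- The mean of the count is at most 1/8 for each of the two lists being heavy plus 1/4 for the
  -- relevant pairs, that is 1/2.
  badness-rare : 2 * ∑ Ω (λ w₁ → ∑ Ω (λ w₂ → badness w₁ w₂)) ≤ |Ω| * |Ω|
  badness-rare = *-cancelˡ-≤ 4 (begin
    4 * (2 * ∑ Ω (λ w₁ → ∑ Ω (λ w₂ → badness w₁ w₂)))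
      ≡⟨ cong (λ z → 4 * (2 * z)) (∑∑-split Ω (heavy μ) rel) ⟩
    4 * (2 * (|Ω| * hs + |Ω| * hs + x))
      ≡⟨ lemma₁ |Ω| hs x ⟩
    2 * (|Ω| * (8 * hs)) + 2 * (4 * x)
      ≤⟨ +-mono-≤ (*-monoʳ-≤ 2 (*-monoʳ-≤ |Ω| eighth)) (*-monoʳ-≤ 2 quarter) ⟩
    2 * (|Ω| * |Ω|) + 2 * (|Ω| * |Ω|)
      ≡⟨ lemma₂ (|Ω| * |Ω|) ⟩
    4 * (|Ω| * |Ω|) ∎)
    where
    open ≤-Reasoning
    rel : Vec (Fin m) n → Vec (Fin m) n → ℕ
    rel w₁ w₂ = ∑ vs (λ v → ∑ (allFin n) (λ i → ∑ (allFin n) (λ j → relevant v i j w₁ w₂)))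
    hs x : ℕ
    hs = ∑ Ω (heavy μ)
    x = ∑ Ω (λ w₁ → ∑ Ω (rel w₁))
    lemma₁ : ∀ o h x → 4 * (2 * (o * h + o * h + x)) ≡ 2 * (o * (8 * h)) + 2 * (4 * x)
    lemma₁ = solve-∀
    lemma₂ : ∀ o → 2 * o + 2 * o ≡ 4 * o
    lemma₂ = solve-∀

  ∑-bools-zero : ∀ l (f : Vec Bool l → ℕ) → ∑ (words bools l) f ≡ 0 → ∀ v → f v ≡ 0
  ∑-bools-zero zero    f eq [] = m+n≡0⇒m≡0 (f []) eq
  ∑-bools-zero (suc l) f eq (b ∷ v) = ∑-bools-zero l (λ v → f (b ∷ v)) (pick b (trans (sym (∑-words-suc bools l f)) eq)) v
    where
    pick : ∀ b → ∑ bools (λ b → ∑ (words bools l) (λ v → f (b ∷ v))) ≡ 0 → ∑ (words bools l) (λ v → f (b ∷ v)) ≡ 0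
    pick true  eq = m+n≡0⇒m≡0 _ eq
    pick false eq = m+n≡0⇒m≡0 _ (m+n≡0⇒n≡0 (∑ (words bools l) (λ v → f (true ∷ v))) eq)

  ∑-allFin-zero : ∀ {k} (f : Fin k → ℕ) → ∑ (allFin k) f ≡ 0 → ∀ i → f i ≡ 0
  ∑-allFin-zero f eq i = n≤0⇒n≡0 (≤-trans (term≤∑ i f) (≤-reflexive eq))

  typical : ∀ w₁ w₂ → badness w₁ w₂ ≡ 0 → ∀ v i j → toℕ i < H → H ≤ toℕ j →
    (2 ^ G ∸ 1) * (ℓ * ℓ) ≤ 4 * (n * n) * successes v i j w₁ w₂
  typical w₁ w₂ eq v i j i<H H≤j = Pair.not-bad H G K n∣m fits (shift₁ H v) (shift₂ H v) ℓ μ (shift₁≤n v) i j i<H H≤j small w₁ w₂ bad≡0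
    (Pair.light⇒spread H G K n∣m fits (shift₁ H v) (shift₂ H v) ℓ μ (shift₁≤n v) i j K≤m w₁ w₂ (m+n≡0⇒m≡0 (heavy μ w₁) heavies) (m+n≡0⇒n≡0 (heavy μ w₁) heavies))
    where
    heavies : heavy μ w₁ + heavy μ w₂ ≡ 0
    heavies = m+n≡0⇒m≡0 (heavy μ w₁ + heavy μ w₂) eq
    bad≡0 : bad v i j w₁ w₂ ≡ 0
    bad≡0 = trans (sym (trans (cong₂ (λ a b → a * b * bad v i j w₁ w₂) (𝟙-yes (toℕ i <? H) i<H) (𝟙-yes (H ≤? toℕ j) H≤j))
                              (*-identityˡ _)))
      (∑-allFin-zero (λ j → relevant v i j w₁ w₂)
        (∑-allFin-zero (λ i → ∑ (allFin n) (λ j → relevant v i j w₁ w₂))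
          (∑-bools-zero 3 (λ v → ∑ (allFin n) (λ i → ∑ (allFin n) (λ j → relevant v i j w₁ w₂)))
            (m+n≡0⇒n≡0 (heavy μ w₁ + heavy μ w₂) eq) v) i) j)

  private
    wrap : ∀ x → x < n → rem (n + x) n ≡ x
    wrap x x<n = trans (cong (λ z → rem z n) (+-comm n x)) (trans (rem≡% (x + n) n) (trans ([m+n]%n≡m%n x n) (m<n⇒m%n≡m x<n)))

    cover₁ : ∀ p → p < n → Σ[ a ∈ Bool ] Σ[ b ∈ Bool ] Σ[ x ∈ ℕ ] x < H × rem (x + (bit a + bit b) * H) n ≡ p
    cover₁ p p<n with p <? H
    ... | yes p<H = false , false , p , p<H , trans (cong (λ z → rem z n) (+-identityʳ p)) (rem-small p<n)
    ... | no p≮H with p ∸ H <? H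
    ...   | yes lt = true , false , p ∸ H , lt ,
              trans (cong (λ z → rem z n) (trans (cong (p ∸ H +_) (+-identityʳ H)) (m∸n+n≡m (≮⇒≥ p≮H)))) (rem-small p<n)
    -- The last position of an odd `n`, reached from index 0 with offset `2H`.
    ...   | no ≮ = true , true , 0 , 0<H , trans (cong (λ z → rem z n) (trans (cong (H +_) (+-identityʳ H)) (sym p≡))) (rem-small p<n)
      where
      p≡ : p ≡ H + H
      p≡ = ≤-antisym (s≤s⁻¹ (≤-trans p<n n≤2H+1))
                     (≤-trans (+-monoˡ-≤ H (≮⇒≥ ≮)) (≤-reflexive (m∸n+n≡m (≮⇒≥ p≮H))))

    cover₂ : ∀ p → p < n → Σ[ c ∈ Bool ] Σ[ x ∈ ℕ ] x < n × H ≤ x × rem (x + bit c * H) n ≡ p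
    cover₂ p p<n with p <? H
    ... | no p≮H = false , p , p<n , ≮⇒≥ p≮H , trans (cong (λ z → rem z n) (+-identityʳ p)) (rem-small p<n)
    ... | yes p<H = true , n ∸ H + p ,
        <-≤-trans (+-monoʳ-< (n ∸ H) p<H) (≤-reflexive (m∸n+n≡m H≤n)) ,
        ≤-trans (≤-trans (≤-reflexive (sym (m+n∸n≡m H H))) (∸-monoˡ-≤ H 2H≤n)) (m≤m+n (n ∸ H) p) ,
        trans (cong (λ z → rem z n) (begin
          n ∸ H + p + (H + 0)   ≡⟨ lemma (n ∸ H) p H ⟩
          n ∸ H + H + p         ≡⟨ cong (_+ p) (m∸n+n≡m H≤n) ⟩
          n + p                 ∎)) (wrap p p<n)
      where
      open ≡-Reasoning
      H≤n = ≤-trans (m≤m+n H H) 2H≤n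
      lemma : ∀ a p h → a + p + (h + 0) ≡ a + h + p
      lemma = solve-∀

  covered : ∀ p₁ p₂ → p₁ < n → p₂ < n → Σ[ v ∈ Vec Bool 3 ] Σ[ i ∈ Fin n ] Σ[ j ∈ Fin n ]
    toℕ i < H × H ≤ toℕ j × rem (toℕ i + shift₁ H v) n ≡ p₁ × rem (toℕ j + shift₂ H v) n ≡ p₂
  covered p₁ p₂ p₁<n p₂<n =
    let a , b , x , x<H , eq₁ = cover₁ p₁ p₁<n
        c , y , y<n , H≤y , eq₂ = cover₂ p₂ p₂<n
        x<n = <-≤-trans x<H (≤-trans (m≤m+n H H) 2H≤n)
    in a ∷ b ∷ c ∷ [] , fromℕ< x<n , fromℕ< y<n ,
       subst (_< H) (sym (Fin.toℕ-fromℕ< x<n)) x<H , subst (H ≤_) (sym (Fin.toℕ-fromℕ< y<n)) H≤y ,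
       trans (cong (λ z → rem (z + (bit a + bit b) * H) n) (Fin.toℕ-fromℕ< x<n)) eq₁ ,
       trans (cong (λ z → rem (z + bit c * H) n) (Fin.toℕ-fromℕ< y<n)) eq₂

-- A program logic with exact running times.

block : ∀ {R} → List (Fin R × Expr R) → Cmd R
block []             = skip
block ((x , e) ∷ is) = (x ≔ e) ⨟ block is

blockCost : ∀ {R} → List (Fin R × Expr R) → ℕ
blockCost []       = 1
blockCost (_ ∷ is) = suc (suc (blockCost is))

coinFree : ∀ {R} → Expr R → Bool
coinFree coin = false
coinFree _    = true

allCoinFree : ∀ {R} → List (Fin R × Expr R) → Bool
allCoinFree []             = true
allCoinFree ((_ , e) ∷ is) = coinFree e ∧ allCoinFree is

loopCost : ℕ → ℕ → ℕ
loopCost τ zero    = 1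
loopCost τ (suc i) = suc (τ + loopCost τ i)

∑-tail : ∀ τ (F : Vec Bool τ → ℕ) → ∑ (words bools (suc τ)) (λ bs → F (Vec.tail bs)) ≡ 2 * ∑ (words bools τ) F
∑-tail τ F = trans (∑-words-suc bools τ (λ bs → F (Vec.tail bs))) (∑-const bools (∑ (words bools τ) F))

take-++ : ∀ {A : Set} {σ τ} (us : Vec A σ) (vs : Vec A τ) → Vec.take σ (us Vec.++ vs) ≡ us
take-++ {σ = σ} us vs = proj₁ (Vec.++-injective (Vec.take σ (us Vec.++ vs)) us (Vec.take++drop≡id σ (us Vec.++ vs)))

drop-++ : ∀ {A : Set} {σ τ} (us : Vec A σ) (vs : Vec A τ) → Vec.drop σ (us Vec.++ vs) ≡ vs
drop-++ {σ = σ} us vs = proj₂ (Vec.++-injective (Vec.take σ (us Vec.++ vs)) us (Vec.take++drop≡id σ (us Vec.++ vs)))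

-- Every step consumes a coin, also the one that unfolds a sequence or a loop. This leading coin is
-- the factor 2, and the others are divided between the two parts.
∑-halves : ∀ σ τ (F : Vec Bool σ → Vec Bool τ → ℕ) →
  ∑ (words bools (suc (σ + τ))) (λ bs → F (Vec.take σ (Vec.tail bs)) (Vec.drop σ (Vec.tail bs))) ≡
  2 * ∑ (words bools σ) (λ us → ∑ (words bools τ) (F us))
∑-halves σ τ F = trans (∑-tail (σ + τ) (λ bs → F (Vec.take σ bs) (Vec.drop σ bs)))
  (cong (2 *_) (trans (∑-words-++ bools σ τ (λ bs → F (Vec.take σ bs) (Vec.drop σ bs)))
    (∑-cong (words bools σ) (λ us → ∑-cong (words bools τ) (λ vs → cong₂ F (take-++ us vs) (drop-++ us vs))))))

module Execution {R : ℕ} (I : Instance) where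

  run′ : ∀ {τ} → Config R → Vec Bool τ → Config R
  run′ κ []       = κ
  run′ κ (b ∷ bs) = run′ (step I κ b) bs

  steps≡run′ : ∀ {τ} κ (bs : Vec Bool τ) → steps I κ (Vec.toList bs) ≡ run′ κ bs
  steps≡run′ κ []       = refl
  steps≡run′ κ (b ∷ bs) = steps≡run′ (step I κ b) bs

  run′-++ : ∀ {σ τ} κ (us : Vec Bool σ) (vs : Vec Bool τ) → run′ κ (us Vec.++ vs) ≡ run′ (run′ κ us) vs
  run′-++ κ []       vs = refl
  run′-++ κ (u ∷ us) vs = run′-++ (step I κ u) us vs

  -- Quantifying over the continuation and the earlier output makes executions compose; an exact
  -- time lets the coins be split at a fixed place.
  Exec : Cmd R → (τ : ℕ) → Store R → (Vec Bool τ → Store R) → Set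
  Exec c τ ρ f = ∀ bs K o → run′ ⟨ c ∷ K , ρ , o ⟩ bs ≡ ⟨ K , f bs , o ⟩

  private
    halves : ∀ σ {τ} (bs : Vec Bool (σ + τ)) → bs ≡ Vec.take σ bs Vec.++ Vec.drop σ bs
    halves σ bs = sym (Vec.take++drop≡id σ bs)

  exec-seq : ∀ {c d σ τ ρ f} {g : Vec Bool σ → Vec Bool τ → Store R} →
    Exec c σ ρ f → (∀ us → Exec d τ (f us) (g us)) →
    Exec (c ⨟ d) (suc (σ + τ)) ρ (λ bs → g (Vec.take σ (Vec.tail bs)) (Vec.drop σ (Vec.tail bs)))
  exec-seq {c} {d} {σ} {ρ = ρ} {f} {g} ex ex′ (b ∷ bs) K o = begin
    run′ ⟨ c ∷ d ∷ K , ρ , o ⟩ bs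
      ≡⟨ cong (run′ ⟨ c ∷ d ∷ K , ρ , o ⟩) (halves σ bs) ⟩
    run′ ⟨ c ∷ d ∷ K , ρ , o ⟩ (Vec.take σ bs Vec.++ Vec.drop σ bs)
      ≡⟨ run′-++ ⟨ c ∷ d ∷ K , ρ , o ⟩ (Vec.take σ bs) (Vec.drop σ bs) ⟩
    run′ (run′ ⟨ c ∷ d ∷ K , ρ , o ⟩ (Vec.take σ bs)) (Vec.drop σ bs)
      ≡⟨ cong (λ κ → run′ κ (Vec.drop σ bs)) (ex (Vec.take σ bs) (d ∷ K) o) ⟩
    run′ ⟨ d ∷ K , f (Vec.take σ bs) , o ⟩ (Vec.drop σ bs)
      ≡⟨ ex′ (Vec.take σ bs) (Vec.drop σ bs) K o ⟩
    ⟨ K , g (Vec.take σ bs) (Vec.drop σ bs) , o ⟩ ∎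
    where open ≡-Reasoning

  -- From ρ, the command c takes exactly τ steps, and ends in a store that
  -- satisfies Q and does not depend on the coins.
  Runs : Store R → Cmd R → ℕ → (Store R → Set) → Set
  Runs ρ c τ Q = Σ[ ρ′ ∈ Store R ] Exec c τ ρ (λ _ → ρ′) × Q ρ′

  runs-seq : ∀ {ρ c d σ τ} {Q S : Store R → Set} →
    Runs ρ c σ Q → (∀ ρ′ → Q ρ′ → Runs ρ′ d τ S) → Runs ρ (c ⨟ d) (suc (σ + τ)) S
  runs-seq {ρ} {c} {d} {σ} {τ} (ρ₁ , ex₁ , q) next =
    let ρ₂ , ex₂ , s = next ρ₁ q
    in ρ₂ , exec-seq {c} {d} {σ} {τ} {ρ} {λ _ → ρ₁} {λ _ _ → ρ₂} ex₁ (λ _ → ex₂) , s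

  assign : List (Fin R × Expr R) → Store R → Store R
  assign []             ρ = ρ
  assign ((x , e) ∷ is) ρ = assign is (ρ [ x ]≔ eval I false ρ e)

  private
    eval-coinFree : ∀ (e : Expr R) → T (coinFree e) → ∀ b ρ → eval I b ρ e ≡ eval I false ρ e
    eval-coinFree (const _)       _ b ρ = refl
    eval-coinFree (_ ⊕ _)         _ b ρ = refl
    eval-coinFree (_ ⊖ _)         _ b ρ = refl
    eval-coinFree (_ ⊗ _)         _ b ρ = refl
    eval-coinFree (_ ⊘ _)         _ b ρ = refl
    eval-coinFree (_ ⊛ _)         _ b ρ = refl
    eval-coinFree paramK          _ b ρ = refl
    eval-coinFree paramN          _ b ρ = refl
    eval-coinFree paramM          _ b ρ = refl
    eval-coinFree (entry _ _)     _ b ρ = refl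
    eval-coinFree targetSign      _ b ρ = refl
    eval-coinFree (targetDigit _) _ b ρ = refl

    T-∧ : ∀ a {b} → T (a ∧ b) → T a × T b
    T-∧ true t = tt , t

  exec-block : ∀ is → T (allCoinFree is) → ∀ ρ → Exec (block is) (blockCost is) ρ (λ _ → assign is ρ)
  exec-block []             cf ρ (_ ∷ []) K o = refl
  exec-block ((x , e) ∷ is) cf ρ (_ ∷ b ∷ bs) K o =
    trans (cong (λ v → run′ ⟨ block is ∷ K , ρ [ x ]≔ v , o ⟩ bs) (eval-coinFree e (proj₁ (T-∧ (coinFree e) cf)) b ρ))
          (exec-block is (proj₂ (T-∧ (coinFree e) cf)) _ bs K o)

  runs-block : ∀ is → {cf : T (allCoinFree is)} → ∀ {ρ} {Q : Store R → Set} →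
    Q (assign is ρ) → Runs ρ (block is) (blockCost is) Q
  runs-block is {cf} {ρ} q = assign is ρ , exec-block is cf ρ , q

  exec-if : ∀ {x c d τ ρ f} → (lookup ρ x ≢ 0 → Exec c τ ρ f) → (lookup ρ x ≡ 0 → Exec d τ ρ f) →
    Exec (ifNonZero x then c else d) (suc τ) ρ (f ∘ Vec.tail)
  exec-if {x} {ρ = ρ} then-ex else-ex (b ∷ bs) K o with lookup ρ x
  ... | zero  = else-ex refl bs K o
  ... | suc _ = then-ex (λ ()) bs K o

  runs-if : ∀ {ρ x c d τ} {Q : Store R → Set} →
    (lookup ρ x ≢ 0 → Runs ρ c τ Q) → (lookup ρ x ≡ 0 → Runs ρ d τ Q) →
    Runs ρ (ifNonZero x then c else d) (suc τ) Q
  runs-if {ρ} {x} {c} {d} {τ} {Q} rc rd = go (lookup ρ x) refl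
    where
    go : ∀ v → lookup ρ x ≡ v → Runs ρ (ifNonZero x then c else d) (suc τ) Q
    go zero eq =
      let ρ′ , ex , q = rd eq
      in ρ′ , exec-if {x} {c} {d} {τ} {ρ} {λ _ → ρ′} (λ ne → contradiction eq ne) (λ _ → ex) , q
    go (suc v) eq =
      let ne = λ e → contradiction (trans (sym eq) e) (λ ())
          ρ′ , ex , q = rc ne
      in ρ′ , exec-if {x} {c} {d} {τ} {ρ} {λ _ → ρ′} (λ _ → ex) (λ e → contradiction e ne) , q

  exec-while-zero : ∀ {x c ρ} → lookup ρ x ≡ 0 → Exec (whileNonZero x loop c) 1 ρ (λ _ → ρ)
  exec-while-zero {x} {ρ = ρ} eq (b ∷ []) K o with lookup ρ x
  exec-while-zero refl (b ∷ []) K o | zero = refl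

  exec-while-suc : ∀ {x c σ τ ρ f} {g : Vec Bool σ → Vec Bool τ → Store R} → lookup ρ x ≢ 0 →
    Exec c σ ρ f → (∀ us → Exec (whileNonZero x loop c) τ (f us) (g us)) →
    Exec (whileNonZero x loop c) (suc (σ + τ)) ρ (λ bs → g (Vec.take σ (Vec.tail bs)) (Vec.drop σ (Vec.tail bs)))
  exec-while-suc {x} {c} {σ} {τ} {ρ} {f} {g} ne ex ex′ (b ∷ bs) K o with lookup ρ x
  ... | zero  = contradiction refl ne
  ... | suc _ = exec-seq {c} {whileNonZero x loop c} {σ} {τ} {ρ} {f} {g} ex ex′ (b ∷ bs) K o

  -- The invariant is indexed by the number of iterations left, so that the loop has an exact time
  -- as well.
  runs-while : ∀ {x c τ} (P : ℕ → Store R → Set) →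
    (∀ ρ → P 0 ρ → lookup ρ x ≡ 0) → (∀ i ρ → P (suc i) ρ → lookup ρ x ≢ 0) →
    (∀ i ρ → P (suc i) ρ → Runs ρ c τ (P i)) →
    ∀ i ρ → P i ρ → Runs ρ (whileNonZero x loop c) (loopCost τ i) (P 0)
  runs-while {x} {c} P stop go body zero ρ p = ρ , exec-while-zero {x} {c} (stop ρ p) , p
  runs-while {x} {c} {τ} P stop go body (suc i) ρ p =
    let ρ₁ , ex₁ , p₁ = body i ρ p
        ρ₂ , ex₂ , p₂ = runs-while P stop go body i ρ₁ p₁
    in ρ₂ , exec-while-suc {x} {c} {τ} {loopCost τ i} {ρ} {λ _ → ρ₁} {λ _ _ → ρ₂} (go i ρ p) ex₁ (λ _ → ex₂) , p₂

  -- Randomized triples.  χ marks the failing states, and the triple bounds the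
  -- failure probability after c by x / y times the one before.

  module Contraction (χ : Store R → ℕ) where

    record RandAt (ρ : Store R) (c : Cmd R) (τ x y : ℕ) (Q : Store R → Set) : Set where
      constructor outcome
      field
        final   : Vec Bool τ → Store R
        runs    : Exec c τ ρ final
        post    : ∀ bs → Q (final bs)
        shrinks : y * ∑ (words bools τ) (λ bs → χ (final bs)) ≤ x * χ ρ * 2 ^ τ

    record Rand (P : Store R → Set) (c : Cmd R) (τ x y : ℕ) (Q : Store R → Set) : Set where
      constructor rand
      field from : ∀ ρ → P ρ → RandAt ρ c τ x y Q

    open Rand public

    weaken : ∀ {ρ c τ x y} {Q Q′ : Store R → Set} → (∀ ρ → Q ρ → Q′ ρ) → RandAt ρ c τ x y Q → RandAt ρ c τ x y Q′
    weaken imp (outcome f ex q le) = outcome f ex (λ bs → imp _ (q bs)) le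

    runs⇒rand : ∀ {P Q c τ} → (∀ ρ → P ρ → Runs ρ c τ (λ ρ′ → Q ρ′ × χ ρ′ ≤ χ ρ)) → Rand P c τ 1 1 Q
    runs⇒rand {c = c} {τ} t = rand λ ρ p →
      let ρ′ , ex , q , le = t ρ p
          open ≤-Reasoning in
      outcome (λ _ → ρ′) ex (λ _ → q) (begin
        1 * ∑ (words bools τ) (λ _ → χ ρ′)   ≡⟨ trans (*-identityˡ _) (trans (∑-const (words bools τ) (χ ρ′)) (cong (_* χ ρ′) (length-words bools τ))) ⟩
        2 ^ τ * χ ρ′                         ≤⟨ *-monoʳ-≤ (2 ^ τ) le ⟩
        2 ^ τ * χ ρ                          ≡⟨ trans (*-comm (2 ^ τ) (χ ρ)) (cong (_* 2 ^ τ) (sym (*-identityˡ (χ ρ)))) ⟩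
        1 * χ ρ * 2 ^ τ                      ∎)

    private
      compose : ∀ σ τ x y x′ y′ χ₀ (f : Vec Bool σ → ℕ) (g : Vec Bool σ → Vec Bool τ → ℕ) →
        y * ∑ (words bools σ) f ≤ x * χ₀ * 2 ^ σ →
        (∀ us → y′ * ∑ (words bools τ) (g us) ≤ x′ * f us * 2 ^ τ) →
        y * y′ * (2 * ∑ (words bools σ) (λ us → ∑ (words bools τ) (g us))) ≤ x * x′ * χ₀ * 2 ^ suc (σ + τ)
      compose σ τ x y x′ y′ χ₀ f g le le′ = begin
        y * y′ * (2 * ∑ (words bools σ) (λ us → ∑ (words bools τ) (g us)))
          ≡⟨ lemma₁ y y′ _ ⟩
        2 * (y * (y′ * ∑ (words bools σ) (λ us → ∑ (words bools τ) (g us))))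
          ≡⟨ cong (λ z → 2 * (y * z)) (sym (∑-*ˡ (words bools σ) y′ _)) ⟩
        2 * (y * ∑ (words bools σ) (λ us → y′ * ∑ (words bools τ) (g us)))
          ≤⟨ *-monoʳ-≤ 2 (*-monoʳ-≤ y (∑-mono (words bools σ) le′)) ⟩
        2 * (y * ∑ (words bools σ) (λ us → x′ * f us * 2 ^ τ))
          ≡⟨ cong (λ z → 2 * (y * z)) (trans (∑-*ʳ (words bools σ) (2 ^ τ) _) (cong (_* 2 ^ τ) (∑-*ˡ (words bools σ) x′ f))) ⟩
        2 * (y * (x′ * ∑ (words bools σ) f * 2 ^ τ))
          ≡⟨ lemma₂ y x′ (∑ (words bools σ) f) (2 ^ τ) ⟩
        2 * (x′ * 2 ^ τ * (y * ∑ (words bools σ) f))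
          ≤⟨ *-monoʳ-≤ 2 (*-monoʳ-≤ (x′ * 2 ^ τ) le) ⟩
        2 * (x′ * 2 ^ τ * (x * χ₀ * 2 ^ σ))
          ≡⟨ lemma₃ x x′ χ₀ (2 ^ τ) (2 ^ σ) ⟩
        x * x′ * χ₀ * (2 * (2 ^ σ * 2 ^ τ))
          ≡⟨ cong (λ z → x * x′ * χ₀ * (2 * z)) (sym (^-distribˡ-+-* 2 σ τ)) ⟩
        x * x′ * χ₀ * 2 ^ suc (σ + τ) ∎
        where
        open ≤-Reasoning
        lemma₁ : ∀ y z s → y * z * (2 * s) ≡ 2 * (y * (z * s))
        lemma₁ = solve-∀
        lemma₂ : ∀ y x s t → 2 * (y * (x * s * t)) ≡ 2 * (x * t * (y * s))
        lemma₂ = solve-∀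
        lemma₃ : ∀ x z c t s → 2 * (z * t * (x * c * s)) ≡ x * z * c * (2 * (s * t))
        lemma₃ = solve-∀

    rand-seq : ∀ {P Q S c d σ τ x y x′ y′} → Rand P c σ x y Q → Rand Q d τ x′ y′ S →
      Rand P (c ⨟ d) (suc (σ + τ)) (x * x′) (y * y′) S
    rand-seq {S = S} {c} {d} {σ} {τ} {x} {y} {x′} {y′} tc td = rand λ ρ p →
      let outcome f ex q le = from tc ρ p
          g = λ us → RandAt.final (from td (f us) (q us))
      in outcome (λ bs → g (Vec.take σ (Vec.tail bs)) (Vec.drop σ (Vec.tail bs)))
         (exec-seq {c} {d} {σ} {τ} {ρ} {f} {g} ex (λ us → RandAt.runs (from td (f us) (q us))))
         (λ bs → RandAt.post (from td _ (q (Vec.take σ (Vec.tail bs)))) (Vec.drop σ (Vec.tail bs)))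
         (≤-trans (≤-reflexive (cong (y * y′ *_) (∑-halves σ τ (λ us vs → χ (g us vs)))))
           (compose σ τ x y x′ y′ (χ ρ) (χ ∘ f) (λ us vs → χ (g us vs)) le
             (λ us → RandAt.shrinks (from td (f us) (q us)))))

    det-seq : ∀ {P Q S c d σ τ x y} → (∀ ρ → P ρ → Runs ρ c σ (λ ρ′ → Q ρ′ × χ ρ′ ≤ χ ρ)) → Rand Q d τ x y S →
      Rand P (c ⨟ d) (suc (σ + τ)) x y S
    det-seq {P} {S = S} {c} {d} {σ} {τ} {x} {y} before after =
      subst₂ (λ x y → Rand P (c ⨟ d) (suc (σ + τ)) x y S) (*-identityˡ x) (*-identityˡ y)
        (rand-seq {c = c} {d} {σ} {τ} {1} {1} {x} {y} (runs⇒rand {c = c} {σ} before) after)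

    -- The factors are functions of the iterations left, because iterations may contract
    -- differently: in the loop over the guesses only the right guess is credited.
    rand-while : ∀ {x c τ} (P : ℕ → Store R → Set) (a b : ℕ → ℕ) →
      (∀ ρ → P 0 ρ → lookup ρ x ≡ 0) → (∀ i ρ → P (suc i) ρ → lookup ρ x ≢ 0) →
      a 0 ≡ 1 → b 0 ≡ 1 → ∀ N →
      (∀ i → i < N → Σ[ a′ ∈ ℕ ] Σ[ b′ ∈ ℕ ] a (suc i) ≡ a′ * a i × b (suc i) ≡ b′ * b i × Rand (P (suc i)) c τ a′ b′ (P i)) →
      ∀ i → i ≤ N → Rand (P i) (whileNonZero x loop c) (loopCost τ i) (a i) (b i) (P 0)
    rand-while {x} {c} P a b stop go a0 b0 N body zero i≤N = rand λ ρ p →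
      outcome (λ _ → ρ) (exec-while-zero {x} {c} (stop ρ p)) (λ _ → p) (≤-reflexive (trans
        (cong₂ (λ u v → u * v) b0 (trans (∑-const (words bools 1) (χ ρ)) (*-comm 2 (χ ρ))))
        (trans (*-identityˡ _) (cong (_* 2) (sym (trans (cong (_* χ ρ) a0) (*-identityˡ (χ ρ))))))))
    rand-while {x} {c} {τ} P a b stop go a0 b0 N body (suc i) i<N = rand λ ρ p →
      let a′ , b′ , a≡ , b≡ , t = body i i<N
          outcome f ex q le = from t ρ p
          ih = from (rand-while P a b stop go a0 b0 N body i (<⇒≤ i<N))
          g = λ us → RandAt.final (ih (f us) (q us))
      in outcome (λ bs → g (Vec.take τ (Vec.tail bs)) (Vec.drop τ (Vec.tail bs)))
         (exec-while-suc {x} {c} {τ} {loopCost τ i} {ρ} {f} {g} (go i ρ p) ex (λ us → RandAt.runs (ih (f us) (q us))))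
         (λ bs → RandAt.post (ih _ (q (Vec.take τ (Vec.tail bs)))) (Vec.drop τ (Vec.tail bs)))
         (subst₂ (λ u v → v * ∑ (words bools (suc (τ + loopCost τ i))) (λ bs → χ (g (Vec.take τ (Vec.tail bs)) (Vec.drop τ (Vec.tail bs)))) ≤
                       u * χ ρ * 2 ^ suc (τ + loopCost τ i)) (sym a≡) (sym b≡)
           (≤-trans (≤-reflexive (cong (b′ * b i *_) (∑-halves τ (loopCost τ i) (λ us vs → χ (g us vs)))))
             (compose τ (loopCost τ i) a′ b′ (a i) (b i) (χ ρ) (χ ∘ f) (λ us vs → χ (g us vs)) le
               (λ us → RandAt.shrinks (ih (f us) (q us))))))

-- The program.

register : ∀ {n} i → {T (i <ᵇ n)} → Fin n
register {suc n} zero        = Fin.zero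
register {suc n} (suc i) {p} = Fin.suc (register i {p})

Register : Set
Register = Fin 58

zeroᵣ oneᵣ twoᵣ fourᵣ eightᵣ nᵣ mᵣ kᵣ k₁ᵣ k₂ᵣ kcᵣ pwᵣ kmᵣ a₃ᵣ a₄ᵣ : Register
a₅ᵣ capᵣ lgᵣ sqᵣ lg₂ᵣ Hᵣ Gᵣ Kᵣ Lᵣ repᵣ pw₂ᵣ posᵣ Tᵣ TKᵣ Jᵣ : Register
restᵣ offᵣ rcᵣ FPᵣ FQᵣ FJᵣ c₁ᵣ c₂ᵣ Sᵣ lcᵣ pᵣ qᵣ Mᵣ x₀ᵣ argᵣ : Register
accᵣ uᵣ sᵣ ctrᵣ baseᵣ pos₁ᵣ pos₂ᵣ vᵣ bitᵣ y₁ᵣ y₂ᵣ y₃ᵣ y₄ᵣ : Register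
zeroᵣ = register 0
oneᵣ = register 1
twoᵣ = register 2
fourᵣ = register 3
eightᵣ = register 4
nᵣ = register 5
mᵣ = register 6
kᵣ = register 7
k₁ᵣ = register 8
k₂ᵣ = register 9
kcᵣ = register 10
pwᵣ = register 11
kmᵣ = register 12
a₃ᵣ = register 13
a₄ᵣ = register 14
a₅ᵣ = register 15
capᵣ = register 16
lgᵣ = register 17
sqᵣ = register 18
lg₂ᵣ = register 19
Hᵣ = register 20
Gᵣ = register 21
Kᵣ = register 22
Lᵣ = register 23
repᵣ = register 24
pw₂ᵣ = register 25
posᵣ = register 26
Tᵣ = register 27
TKᵣ = register 28
Jᵣ = register 29
restᵣ = register 30
offᵣ = register 31
rcᵣ = register 32
FPᵣ = register 33
FQᵣ = register 34
FJᵣ = register 35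
c₁ᵣ = register 36
c₂ᵣ = register 37
Sᵣ = register 38
lcᵣ = register 39
pᵣ = register 40
qᵣ = register 41
Mᵣ = register 42
x₀ᵣ = register 43
argᵣ = register 44
accᵣ = register 45
uᵣ = register 46
sᵣ = register 47
ctrᵣ = register 48
baseᵣ = register 49
pos₁ᵣ = register 50
pos₂ᵣ = register 51
vᵣ = register 52
bitᵣ = register 53
y₁ᵣ = register 54
y₂ᵣ = register 55
y₃ᵣ = register 56
y₄ᵣ = register 57

-- Every while loop counts a register down to zero, and both branches of every
-- conditional take the same time, so the running time depends on k, n, m only.

hashStart hashBody : List (Register × Expr 58)
hashStart =
  (sᵣ , Sᵣ ⊖ zeroᵣ) ∷ (accᵣ , const 0) ∷ (y₁ᵣ , uᵣ ⊗ Gᵣ) ∷ (y₂ᵣ , y₁ᵣ ⊕ Hᵣ) ∷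
  (baseᵣ , y₂ᵣ ⊕ c₁ᵣ) ∷ (ctrᵣ , Gᵣ ⊖ zeroᵣ) ∷ []
hashBody =
  (ctrᵣ , ctrᵣ ⊖ oneᵣ) ∷ (bitᵣ , sᵣ ⊛ twoᵣ) ∷ (sᵣ , sᵣ ⊘ twoᵣ) ∷ (y₃ᵣ , baseᵣ ⊕ ctrᵣ) ∷
  (pos₁ᵣ , y₃ᵣ ⊛ nᵣ) ∷ (vᵣ , entry zeroᵣ pos₁ᵣ) ∷ (y₁ᵣ , bitᵣ ⊗ vᵣ) ∷ (y₂ᵣ , accᵣ ⊕ y₁ᵣ) ∷
  (accᵣ , y₂ᵣ ⊛ nᵣ) ∷ []

hashCmd : Cmd 58
hashCmd = block hashStart ⨟ (whileNonZero ctrᵣ loop block hashBody)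

list₁Branch list₂Branch : List (Register × Expr 58)
list₁Branch = (y₂ᵣ , argᵣ ⊕ c₁ᵣ) ∷ (pos₁ᵣ , y₂ᵣ ⊛ nᵣ) ∷ (vᵣ , entry zeroᵣ pos₁ᵣ) ∷ (y₃ᵣ , vᵣ ⊖ zeroᵣ) ∷ []
list₂Branch = (y₂ᵣ , argᵣ ⊕ c₂ᵣ) ∷ (pos₁ᵣ , y₂ᵣ ⊛ nᵣ) ∷ (vᵣ , entry oneᵣ pos₁ᵣ) ∷ (y₃ᵣ , offᵣ ⊖ vᵣ) ∷ []

nextCmd : Cmd 58
nextCmd = block ((y₁ᵣ , Hᵣ ⊖ argᵣ) ∷ []) ⨟
  ((ifNonZero y₁ᵣ then block list₁Branch else block list₂Branch) ⨟
  (block ((uᵣ , y₃ᵣ ⊛ Kᵣ) ∷ []) ⨟ hashCmd))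

moveCmd : Register → Cmd 58
moveCmd x = block ((argᵣ , x ⊖ zeroᵣ) ∷ []) ⨟ (nextCmd ⨟ block ((x , accᵣ ⊖ zeroᵣ) ∷ []))

floydCmd : Cmd 58
floydCmd = block ((lcᵣ , lcᵣ ⊖ oneᵣ) ∷ []) ⨟ (moveCmd pᵣ ⨟ (moveCmd qᵣ ⨟ (moveCmd qᵣ ⨟
  -- The sum of the two truncated differences is the distance of `p` and `q`, hence zero exactly at
  -- a meeting.
  (block ((y₁ᵣ , pᵣ ⊖ qᵣ) ∷ (y₂ᵣ , qᵣ ⊖ pᵣ) ∷ (y₃ᵣ , y₁ᵣ ⊕ y₂ᵣ) ∷ []) ⨟
  (ifNonZero y₃ᵣ then block ((y₁ᵣ , const 0) ∷ []) else block ((Mᵣ , pᵣ ⊖ zeroᵣ) ∷ []))))))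

testBlock recordBlock idleBlock : List (Register × Expr 58)
testBlock =
  (lcᵣ , lcᵣ ⊖ oneᵣ) ∷ (y₁ᵣ , pᵣ ⊕ c₁ᵣ) ∷ (pos₁ᵣ , y₁ᵣ ⊛ nᵣ) ∷ (vᵣ , entry zeroᵣ pos₁ᵣ) ∷
  (y₁ᵣ , qᵣ ⊕ c₂ᵣ) ∷ (pos₂ᵣ , y₁ᵣ ⊛ nᵣ) ∷ (bitᵣ , entry oneᵣ pos₂ᵣ) ∷ (y₁ᵣ , vᵣ ⊕ bitᵣ) ∷
  (y₂ᵣ , y₁ᵣ ⊕ restᵣ) ∷ (y₃ᵣ , y₂ᵣ ⊖ Tᵣ) ∷ (y₁ᵣ , Tᵣ ⊖ y₂ᵣ) ∷ (y₄ᵣ , y₃ᵣ ⊕ y₁ᵣ) ∷ []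
recordBlock = (FPᵣ , pos₁ᵣ ⊖ zeroᵣ) ∷ (FQᵣ , pos₂ᵣ ⊖ zeroᵣ) ∷ (FJᵣ , Jᵣ ⊖ zeroᵣ) ∷ []
idleBlock = (y₁ᵣ , const 0) ∷ (y₁ᵣ , const 0) ∷ (y₁ᵣ , const 0) ∷ []

collectCmd : Cmd 58
collectCmd = block testBlock ⨟
  ((ifNonZero y₄ᵣ then block idleBlock else block recordBlock) ⨟
  (moveCmd pᵣ ⨟ moveCmd qᵣ))

-- The reduction of the seed modulo `capᵣ` never changes it, since `cap` exceeds all seeds. Like the
-- other reductions modulo `capᵣ` it serves the space analysis, which looks only at the form of the
-- assignments.
rotationCmd tossCmd seedCmd : Cmd 58
rotationCmd = (bitᵣ ≔ coin) ⨟ ((vᵣ ≔ coin) ⨟ ((uᵣ ≔ (bitᵣ ⊕ vᵣ)) ⨟ ((c₁ᵣ ≔ (uᵣ ⊗ Hᵣ)) ⨟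
  ((bitᵣ ≔ coin) ⨟ ((c₂ᵣ ≔ (bitᵣ ⊗ Hᵣ)) ⨟ block ((Sᵣ , const 0) ∷ (ctrᵣ , Gᵣ ⊖ zeroᵣ) ∷ []))))))
tossCmd = (ctrᵣ ≔ (ctrᵣ ⊖ oneᵣ)) ⨟ ((bitᵣ ≔ coin) ⨟ ((y₁ᵣ ≔ (Sᵣ ⊕ Sᵣ)) ⨟ ((y₂ᵣ ≔ (y₁ᵣ ⊕ bitᵣ)) ⨟ (Sᵣ ≔ (y₂ᵣ ⊛ capᵣ)))))
seedCmd = whileNonZero ctrᵣ loop tossCmd

searchCmd iterationCmd repeatCmd : Cmd 58
searchCmd = block ((uᵣ , Kᵣ ⊖ zeroᵣ) ∷ []) ⨟ (hashCmd ⨟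
  (block ((x₀ᵣ , accᵣ ⊖ zeroᵣ) ∷ (pᵣ , accᵣ ⊖ zeroᵣ) ∷ (qᵣ , accᵣ ⊖ zeroᵣ) ∷ (Mᵣ , accᵣ ⊖ zeroᵣ) ∷ (lcᵣ , Lᵣ ⊖ zeroᵣ) ∷ []) ⨟
  ((whileNonZero lcᵣ loop floydCmd) ⨟
  (block ((pᵣ , x₀ᵣ ⊖ zeroᵣ) ∷ (qᵣ , Mᵣ ⊖ zeroᵣ) ∷ (lcᵣ , Lᵣ ⊖ zeroᵣ) ∷ []) ⨟
  (whileNonZero lcᵣ loop collectCmd)))))
iterationCmd = block ((rcᵣ , rcᵣ ⊖ oneᵣ) ∷ []) ⨟ (rotationCmd ⨟ (seedCmd ⨟ searchCmd))
repeatCmd = whileNonZero rcᵣ loop iterationCmd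

-- A guess is a single number below `n ^ (k - 2)`, whose base-`n` digits are the positions in the
-- remaining lists; no tuple is ever stored.
restBody : List (Register × Expr 58)
restBody =
  (lcᵣ , lcᵣ ⊖ oneᵣ) ∷ (pos₁ᵣ , k₁ᵣ ⊖ lcᵣ) ∷ (pos₂ᵣ , sᵣ ⊛ nᵣ) ∷ (sᵣ , sᵣ ⊘ nᵣ) ∷
  (vᵣ , entry pos₁ᵣ pos₂ᵣ) ∷ (y₁ᵣ , restᵣ ⊕ vᵣ) ∷ (restᵣ , y₁ᵣ ⊛ capᵣ) ∷ []

tupleCmd tuplesCmd : Cmd 58
tupleCmd = block ((Jᵣ , Jᵣ ⊖ oneᵣ) ∷ (restᵣ , const 0) ∷ (sᵣ , Jᵣ ⊖ zeroᵣ) ∷ (lcᵣ , k₂ᵣ ⊖ zeroᵣ) ∷ []) ⨟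
  ((whileNonZero lcᵣ loop block restBody) ⨟
  (block ((offᵣ , TKᵣ ⊖ restᵣ) ∷ (rcᵣ , repᵣ ⊖ zeroᵣ) ∷ []) ⨟ repeatCmd))
tuplesCmd = whileNonZero Jᵣ loop tupleCmd

emitBody : Cmd 58
emitBody = block ((lcᵣ , lcᵣ ⊖ oneᵣ) ∷ (pos₁ᵣ , k₁ᵣ ⊖ lcᵣ) ∷ (pos₂ᵣ , sᵣ ⊛ nᵣ) ∷ (sᵣ , sᵣ ⊘ nᵣ) ∷
  (vᵣ , entry pos₁ᵣ pos₂ᵣ) ∷ []) ⨟ emit vᵣ

emitCmd : Cmd 58
emitCmd = block ((vᵣ , entry zeroᵣ FPᵣ) ∷ []) ⨟ (emit vᵣ ⨟
  (block ((vᵣ , entry oneᵣ FQᵣ) ∷ []) ⨟ (emit vᵣ ⨟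
  (block ((sᵣ , FJᵣ ⊖ zeroᵣ) ∷ (lcᵣ , k₂ᵣ ⊖ zeroᵣ) ∷ []) ⨟ (whileNonZero lcᵣ loop emitBody)))))

initialBlock powerBody setupBlock lgBody sqBody sizesBlock digitBody : List (Register × Expr 58)
initialBlock =
  (oneᵣ , const 1) ∷ (twoᵣ , const 2) ∷ (fourᵣ , const 4) ∷ (eightᵣ , const 8) ∷
  (nᵣ , paramN) ∷ (kcᵣ , paramK) ∷ (pwᵣ , const 1) ∷ []
powerBody = (kcᵣ , kcᵣ ⊖ oneᵣ) ∷ (pwᵣ , pwᵣ ⊗ nᵣ) ∷ []
setupBlock =
  (mᵣ , paramM) ∷ (kᵣ , paramK) ∷ (k₁ᵣ , kᵣ ⊖ oneᵣ) ∷ (k₂ᵣ , k₁ᵣ ⊖ oneᵣ) ∷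
  (uᵣ , nᵣ ⊗ nᵣ) ∷ (Jᵣ , pwᵣ ⊘ uᵣ) ∷ (kmᵣ , kᵣ ⊗ mᵣ) ∷
  (uᵣ , nᵣ ⊕ oneᵣ) ∷ (argᵣ , uᵣ ⊕ uᵣ) ∷ (a₃ᵣ , argᵣ ⊗ argᵣ) ∷ (a₄ᵣ , a₃ᵣ ⊗ a₃ᵣ) ∷ (a₅ᵣ , a₄ᵣ ⊗ a₄ᵣ) ∷
  (c₁ᵣ , kmᵣ ⊕ oneᵣ) ∷ (a₃ᵣ , c₁ᵣ ⊕ c₁ᵣ) ∷ (capᵣ , a₅ᵣ ⊗ a₃ᵣ) ∷ (ctrᵣ , nᵣ ⊖ zeroᵣ) ∷ []
lgBody = (ctrᵣ , ctrᵣ ⊘ twoᵣ) ∷ (y₁ᵣ , lgᵣ ⊕ oneᵣ) ∷ (lgᵣ , y₁ᵣ ⊛ capᵣ) ∷ []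
sqBody = (ctrᵣ , ctrᵣ ⊘ fourᵣ) ∷ (y₁ᵣ , sqᵣ ⊕ sqᵣ) ∷ (sqᵣ , y₁ᵣ ⊛ capᵣ) ∷ []
sizesBlock =
  (Hᵣ , nᵣ ⊘ twoᵣ) ∷ (Gᵣ , eightᵣ ⊗ lgᵣ) ∷ (vᵣ , Hᵣ ⊘ Gᵣ) ∷ (Kᵣ , vᵣ ⊖ oneᵣ) ∷
  (lg₂ᵣ , lgᵣ ⊗ lgᵣ) ∷ (sᵣ , sqᵣ ⊘ lg₂ᵣ) ∷ (Lᵣ , sᵣ ⊕ sᵣ) ∷ (ctrᵣ , lg₂ᵣ ⊗ lg₂ᵣ) ∷
  (y₁ᵣ , ctrᵣ ⊗ lg₂ᵣ) ∷ (repᵣ , nᵣ ⊗ y₁ᵣ) ∷ (pw₂ᵣ , const 1) ∷ (ctrᵣ , kmᵣ ⊖ zeroᵣ) ∷ []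
digitBody =
  (ctrᵣ , ctrᵣ ⊘ twoᵣ) ∷ (vᵣ , targetDigit posᵣ) ∷ (bitᵣ , vᵣ ⊛ twoᵣ) ∷ (y₁ᵣ , bitᵣ ⊗ pw₂ᵣ) ∷
  (y₂ᵣ , Tᵣ ⊕ y₁ᵣ) ∷ (Tᵣ , y₂ᵣ ⊛ capᵣ) ∷ (y₁ᵣ , pw₂ᵣ ⊕ pw₂ᵣ) ∷ (pw₂ᵣ , y₁ᵣ ⊛ capᵣ) ∷
  (y₁ᵣ , posᵣ ⊕ oneᵣ) ∷ (posᵣ , y₁ᵣ ⊛ capᵣ) ∷ []

powerCmd sizesCmd setupCmd programCmd : Cmd 58
powerCmd = whileNonZero kcᵣ loop block powerBody
sizesCmd = block setupBlock ⨟ ((whileNonZero ctrᵣ loop block lgBody) ⨟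
  (block ((ctrᵣ , nᵣ ⊖ zeroᵣ) ∷ (sqᵣ , const 1) ∷ []) ⨟ ((whileNonZero ctrᵣ loop block sqBody) ⨟
  (block sizesBlock ⨟ ((whileNonZero ctrᵣ loop block digitBody) ⨟
  block ((uᵣ , mᵣ ⊗ Kᵣ) ∷ (TKᵣ , Tᵣ ⊕ uᵣ) ∷ []))))))
setupCmd = block initialBlock ⨟ (powerCmd ⨟ sizesCmd)
programCmd = (setupCmd ⨟ tuplesCmd) ⨟ emitCmd

kSum : Algorithm
kSum = algorithm 58 programCmd

-- Symbolic execution of one search.

-- The registers, grouped by the loop that changes them.
record Fixed : Set where
  constructor fixed
  field nᵛ mᵛ kᵛ k₁ᵛ k₂ᵛ kcᵛ pwᵛ kmᵛ a₃ᵛ a₄ᵛ a₅ᵛ capᵛ lgᵛ sqᵛ lg₂ᵛ Hᵛ Gᵛ Kᵛ Lᵛ repᵛ pw₂ᵛ posᵛ Tᵛ TKᵛ : ℕ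

record Tuple : Set where
  constructor tuple
  field Jᵛ restᵛ offᵛ rcᵛ : ℕ

record Best : Set where
  constructor best
  field FPᵛ FQᵛ FJᵛ : ℕ

record Iteration : Set where
  constructor iteration
  field c₁ᵛ c₂ᵛ Sᵛ : ℕ

record Walker : Set where
  constructor walker
  field lcᵛ pᵛ qᵛ Mᵛ x₀ᵛ : ℕ

record Scratch : Set where
  constructor scratch
  field argᵛ accᵛ uᵛ sᵛ ctrᵛ baseᵛ pos₁ᵛ pos₂ᵛ vᵛ bitᵛ y₁ᵛ y₂ᵛ y₃ᵛ y₄ᵛ : ℕ

open Fixed public
open Tuple public
open Best public
open Iteration public
open Walker public
open Scratch public

-- An explicit vector, on which updates and lookups at concrete registers compute; the effect of a
-- straight-line block is then established by `refl`. The first five registers are constants of the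
-- program.
layout : Fixed → Tuple → Best → Iteration → Walker → Scratch → Store 58
layout f t b i w z =
  0 ∷ 1 ∷ 2 ∷ 4 ∷ 8 ∷ nᵛ f ∷ mᵛ f ∷ kᵛ f ∷ k₁ᵛ f ∷ k₂ᵛ f ∷ kcᵛ f ∷ pwᵛ f ∷ kmᵛ f ∷ a₃ᵛ f ∷ a₄ᵛ f ∷ a₅ᵛ f ∷ capᵛ f ∷ lgᵛ f ∷ sqᵛ f ∷ lg₂ᵛ f ∷ Hᵛ f ∷ Gᵛ f ∷ Kᵛ f ∷ Lᵛ f ∷ repᵛ f ∷ pw₂ᵛ f ∷ posᵛ f ∷ Tᵛ f ∷ TKᵛ f ∷
  Jᵛ t ∷ restᵛ t ∷ offᵛ t ∷ rcᵛ t ∷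
  FPᵛ b ∷ FQᵛ b ∷ FJᵛ b ∷
  c₁ᵛ i ∷ c₂ᵛ i ∷ Sᵛ i ∷
  lcᵛ w ∷ pᵛ w ∷ qᵛ w ∷ Mᵛ w ∷ x₀ᵛ w ∷
  argᵛ z ∷ accᵛ z ∷ uᵛ z ∷ sᵛ z ∷ ctrᵛ z ∷ baseᵛ z ∷ pos₁ᵛ z ∷ pos₂ᵛ z ∷ vᵛ z ∷ bitᵛ z ∷ y₁ᵛ z ∷ y₂ᵛ z ∷ y₃ᵛ z ∷ y₄ᵛ z ∷ []

choose-≢0 : ∀ {v} a b → v ≢ 0 → choose v a b ≡ a
choose-≢0 {zero}  a b ne = contradiction refl ne
choose-≢0 {suc v} a b ne = refl

hashCost nextCost moveCost floydCost collectCost : ℕ → ℕ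
hashCost G = suc (blockCost hashStart + loopCost (blockCost hashBody) G)
nextCost G = suc (3 + suc (suc (blockCost list₁Branch) + suc (3 + hashCost G)))
moveCost G = suc (3 + suc (nextCost G + 3))
floydCost G = suc (3 + suc (moveCost G + suc (moveCost G + suc (moveCost G + suc (7 + 4)))))
collectCost G = suc (blockCost testBlock + suc (suc (blockCost recordBlock) + suc (moveCost G + moveCost G)))

searchCost : ℕ → ℕ → ℕ
searchCost G L = suc (3 + suc (hashCost G + suc (11 + suc (loopCost (floydCost G) L + suc (7 + loopCost (collectCost G) L)))))

module Semantics (I : Instance) where

  open Execution {58} I

  read : ℕ → ℕ → ℕ
  read a p = nth 0 (nth [] (Instance.lists I) a) p

  entriesOf : Fixed → ℕ → ℕ → List ℕ
  entriesOf f zero    s = []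
  entriesOf f (suc c) s = read (k₁ᵛ f ∸ c) (rem s (nᵛ f)) ∷ entriesOf f c (quot s (nᵛ f))

  hashLoop : ℕ → ℕ → ℕ → ℕ → ℕ → ℕ
  hashLoop n base zero    s acc = acc
  hashLoop n base (suc i) s acc = hashLoop n base i (quot s 2) (rem (acc + rem s 2 * read 0 (rem (base + i) n)) n)

  hashValue : Fixed → Iteration → ℕ → ℕ
  hashValue f i u = hashLoop (nᵛ f) (u * Gᵛ f + Hᵛ f + c₁ᵛ i) (Gᵛ f) (Sᵛ i) 0

  nextValue : Fixed → Tuple → Iteration → ℕ → ℕ
  nextValue f t i x = hashValue f i (bucketOf (nᵛ f) (Hᵛ f) (Kᵛ f) (c₁ᵛ i) (c₂ᵛ i) (offᵛ t) (read 0) (read 1) x)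

  module _ (f : Fixed) (t : Tuple) (i : Iteration) where

    Scratched : Best → Walker → (Scratch → Set) → Store 58 → Set
    Scratched b w φ ρ = Σ[ z ∈ Scratch ] ρ ≡ layout f t b i w z × φ z

    runs-hash : ∀ b w z → Runs (layout f t b i w z) hashCmd (hashCost (Gᵛ f))
      (Scratched b w (λ z′ → accᵛ z′ ≡ hashValue f i (uᵛ z)))
    runs-hash b w z = runs-seq
      {Q = λ ρ → P (Gᵛ f) ρ}
      (runs-block hashStart (_ , refl , refl , refl , refl))
      (λ ρ p → let ρ′ , ex , z′ , eq , _ , _ , acc≡ = runs-while P
                     (λ { _ (_ , refl , refl , _) → refl })
                     (λ { _ _ (_ , refl , refl , _) () })
                     (λ { _ _ (_ , refl , refl , refl , acc≡) →
                          runs-block hashBody (_ , refl , refl , refl , acc≡) })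
                     (Gᵛ f) ρ p
               in ρ′ , ex , z′ , eq , acc≡)
      where
      base = uᵛ z * Gᵛ f + Hᵛ f + c₁ᵛ i
      -- The invariant says that finishing from the current seed and accumulator yields the final
      -- value, so every iteration preserves it by computation.
      P : ℕ → Store 58 → Set
      P c = Scratched b w (λ z′ → ctrᵛ z′ ≡ c × baseᵛ z′ ≡ base ×
              hashLoop (nᵛ f) base c (sᵛ z′) (accᵛ z′) ≡ hashValue f i (uᵛ z))

    runs-next : ∀ b w z → Runs (layout f t b i w z) nextCmd (nextCost (Gᵛ f))
      (Scratched b w (λ z′ → accᵛ z′ ≡ nextValue f t i (argᵛ z)))
    runs-next b w z = runs-seq
      {Q = Scratched b w (λ z′ → argᵛ z′ ≡ argᵛ z × y₁ᵛ z′ ≡ Hᵛ f ∸ argᵛ z)}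
      (runs-block _ (_ , refl , refl , refl))
      (λ { _ (_ , refl , refl , refl) → runs-seq
        {Q = Scratched b w (λ z′ → y₃ᵛ z′ ≡ selected)}
        (runs-if (λ ne → runs-block list₁Branch (_ , refl , sym (choose-≢0 in₁ in₂ ne)))
                 (λ eq → runs-block list₂Branch (_ , refl , sym (cong (λ v → choose v in₁ in₂) eq))))
        (λ { _ (_ , refl , refl) → runs-seq
          {Q = Scratched b w (λ z′ → uᵛ z′ ≡ rem selected (Kᵛ f))}
          (runs-block _ (_ , refl , refl))
          (λ { _ (_ , refl , refl) → runs-hash b w _ }) }) })
      where
      in₁ = read 0 (rem (argᵛ z + c₁ᵛ i) (nᵛ f))
      in₂ = offᵛ t ∸ read 1 (rem (argᵛ z + c₂ᵛ i) (nᵛ f))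
      selected = choose (Hᵛ f ∸ argᵛ z) in₁ in₂

    runs-move-p : ∀ b w z → Runs (layout f t b i w z) (moveCmd pᵣ) (moveCost (Gᵛ f))
      (Scratched b (record w { pᵛ = nextValue f t i (pᵛ w) }) (λ _ → ⊤))
    runs-move-p b w z = runs-seq
      {Q = Scratched b w (λ z′ → argᵛ z′ ≡ pᵛ w)}
      (runs-block _ (_ , refl , refl))
      (λ { _ (_ , refl , refl) → runs-seq
        (runs-next b w _)
        (λ { _ (_ , refl , refl) → runs-block _ (_ , refl , tt) }) })

    runs-move-q : ∀ b w z → Runs (layout f t b i w z) (moveCmd qᵣ) (moveCost (Gᵛ f))
      (Scratched b (record w { qᵛ = nextValue f t i (qᵛ w) }) (λ _ → ⊤))
    runs-move-q b w z = runs-seq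
      {Q = Scratched b w (λ z′ → argᵛ z′ ≡ qᵛ w)}
      (runs-block _ (_ , refl , refl))
      (λ { _ (_ , refl , refl) → runs-seq
        (runs-next b w _)
        (λ { _ (_ , refl , refl) → runs-block _ (_ , refl , tt) }) })

    walk : ℕ → ℕ → ℕ
    walk x zero    = x
    walk x (suc c) = nextValue f t i (walk x c)

    walk-+ : ∀ x c d → walk (walk x c) d ≡ walk x (c + d)
    walk-+ x c zero    = cong (walk x) (sym (+-identityʳ c))
    walk-+ x c (suc d) = trans (cong (nextValue f t i) (walk-+ x c d)) (cong (walk x) (sym (+-suc c d)))

    Meets : ℕ → ℕ → Set
    Meets x c = 0 < c × walk x c ≡ walk x (c + c)

    -- Nothing is known about `Mᵛ` before the first meeting; afterwards it holds some meeting point,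
    -- which is all that the second phase requires.
    record Floyding (x : ℕ) (left : ℕ) (w : Walker) : Set where
      constructor floyding
      field
        count   : ℕ
        left≡   : lcᵛ w ≡ left
        done    : count + left ≡ Lᵛ f
        start   : x₀ᵛ w ≡ x
        slow    : pᵛ w ≡ walk x count
        fast    : qᵛ w ≡ walk x (count + count)
        meeting : ∀ {c} → c ≤ count → Meets x c → Σ[ c′ ∈ ℕ ] Meets x c′ × Mᵛ w ≡ walk x c′

    private
      ∸-≡ : ∀ {a b} → (a ∸ b) + (b ∸ a) ≡ 0 → a ≡ b
      ∸-≡ {a} {b} eq = ≤-antisym (m∸n≡0⇒m≤n (m+n≡0⇒m≡0 (a ∸ b) eq)) (m∸n≡0⇒m≤n (m+n≡0⇒n≡0 (a ∸ b) eq))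

      ≡-∸ : ∀ {a b} → a ≡ b → (a ∸ b) + (b ∸ a) ≡ 0
      ≡-∸ {a} refl = cong₂ _+_ (n∸n≡0 a) (n∸n≡0 a)

      Stepped : Best → ℕ → (Walker → Set) → Store 58 → Set
      Stepped b x φ ρ = Σ[ w ∈ Walker ] Σ[ z ∈ Scratch ] ρ ≡ layout f t b i w z × φ w

    runs-floyd : ∀ b x c ρ → Stepped b x (Floyding x (suc c)) ρ → Runs ρ floydCmd (floydCost (Gᵛ f)) (Stepped b x (Floyding x c))
    runs-floyd b x c _ (walker lc p q M x₀ , _ , refl , floyding d refl done refl refl refl meeting) = runs-seq
      {Q = Scratched b (walker c (walk x d) (walk x (d + d)) M x) (λ _ → ⊤)}
      (runs-block _ (_ , refl , tt))
      (λ { _ (z₁ , refl , tt) → runs-seq (runs-move-p b _ z₁)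
      (λ { _ (z₂ , refl , tt) → runs-seq (runs-move-q b _ z₂)
      (λ { _ (z₃ , refl , tt) → runs-seq (runs-move-q b _ z₃)
      (λ { _ (_ , refl , tt) → runs-seq
        {Q = Scratched b (walker c p′ q′ M x) (λ z → y₃ᵛ z ≡ (p′ ∸ q′) + (q′ ∸ p′))}
        (runs-block _ (_ , refl , refl))
        (λ { _ (_ , refl , refl) → runs-if
          (λ ne → runs-block _ (_ , _ , refl , floyding (suc d) refl (trans (sym (+-suc d c)) done) refl refl q≡
            (λ c≤ m → meeting (<d c≤ m (λ e → ne (≡-∸ e))) m)))
          (λ eq → runs-block _ (_ , _ , refl , floyding (suc d) refl (trans (sym (+-suc d c)) done) refl refl q≡
            (λ _ _ → suc d , (z<s , trans (∸-≡ eq) q≡) , refl))) }) }) }) }) })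
      where
      p′ = walk x (suc d)
      q′ = nextValue f t i (nextValue f t i (walk x (d + d)))
      q≡ : q′ ≡ walk x (suc d + suc d)
      q≡ = cong (walk x) (cong suc (sym (+-suc d d)))
      <d : ∀ {c} → c ≤ suc d → Meets x c → p′ ≢ q′ → c ≤ d
      <d c≤ (_ , m) ne with m≤n⇒m<n∨m≡n c≤
      ... | inj₁ (s≤s c≤d) = c≤d
      ... | inj₂ refl      = contradiction (trans m (sym q≡)) ne

    module _ (V : Best → Set) where

      Hits : ℕ → ℕ → Set
      Hits x y = read 0 (rem (x + c₁ᵛ i) (nᵛ f)) + read 1 (rem (y + c₂ᵛ i) (nᵛ f)) + restᵛ t ≡ Tᵛ f

      record Collecting (x y : ℕ) (b : Best) (left : ℕ) (b′ : Best) (w : Walker) : Set where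
        constructor collecting
        field
          count  : ℕ
          left≡  : lcᵛ w ≡ left
          done   : count + left ≡ Lᵛ f
          first  : pᵛ w ≡ walk x count
          second : qᵛ w ≡ walk y count
          kept   : b′ ≡ b ⊎ V b′
          hit    : ∀ {a} → a < count → Hits (walk x a) (walk y a) → V b′

      Collected : ℕ → ℕ → Best → ℕ → Store 58 → Set
      Collected x y b left ρ =
        Σ[ b′ ∈ Best ] Σ[ w ∈ Walker ] Σ[ z ∈ Scratch ] ρ ≡ layout f t b′ i w z × Collecting x y b left b′ w

      -- The conclusion of `finds⇒` in terms of the numbers computed by the machine; it forces the
      -- search to record a hit.
      Wins : Set
      Wins = Σ[ a ∈ ℕ ] Σ[ c ∈ ℕ ] a < Lᵛ f × c ≤ Lᵛ f × Meets x c ×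
          (∀ c → Meets x c → Hits (walk x a) (walk x (c + a)))
        where x = hashValue f i (Kᵛ f)

      -- The first component makes progress permanent: a record is only ever replaced by a valid
      -- one.
      Searched : Best → Best → Set
      Searched b b′ = (b′ ≡ b ⊎ V b′) × (Wins → V b′)

      module _ (valid : ∀ x y → Hits x y → V (best (rem (x + c₁ᵛ i) (nᵛ f)) (rem (y + c₂ᵛ i) (nᵛ f)) (Jᵛ t))) where

        runs-collect : ∀ x y b c ρ → Collected x y b (suc c) ρ →
          Runs ρ collectCmd (collectCost (Gᵛ f)) (Collected x y b c)
        runs-collect x y b c _ (b′ , walker lc p q M x₀ , _ , refl ,
                                collecting d refl done refl refl kept hit) = runs-seq
          {Q = λ ρ → Scratched b′ w₁ (λ z → pos₁ᵛ z ≡ r₁ × pos₂ᵛ z ≡ r₂ × y₄ᵛ z ≡ (s ∸ Tᵛ f) + (Tᵛ f ∸ s)) ρ}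
          (runs-block testBlock (_ , refl , refl , refl , refl))
          (λ { _ (_ , refl , refl , refl , refl) → runs-seq
            {Q = λ ρ → Σ[ b″ ∈ Best ] Scratched b″ w₁ (λ _ → (b″ ≡ b ⊎ V b″) × (∀ {a} → a < suc d → Hits (walk x a) (walk y a) → V b″)) ρ}
            (runs-if
              (λ ne → runs-block idleBlock (_ , _ , refl , kept , λ {_} a< h → hit (<d a< h (λ e → ne (≡-∸ e))) h))
              (λ eq → runs-block recordBlock (_ , _ , refl , inj₂ (valid (walk x d) (walk y d) (∸-≡ eq)) , λ {_} _ _ → valid (walk x d) (walk y d) (∸-≡ eq))))
            (λ { _ (b″ , z₁ , refl , kept′ , hit′) → runs-seq (runs-move-p b″ _ z₁)
            (λ { _ (z₂ , refl , tt) → let ρ′ , ex , z₃ , eq , tt = runs-move-q b″ _ z₂ in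
              ρ′ , ex , b″ , _ , z₃ , eq , collecting (suc d) refl (trans (sym (+-suc d c)) done) refl refl kept′ hit′ }) }) })
          where
          w₁ = walker c (walk x d) (walk y d) M x₀
          r₁ = rem (walk x d + c₁ᵛ i) (nᵛ f)
          r₂ = rem (walk y d + c₂ᵛ i) (nᵛ f)
          s = read 0 r₁ + read 1 r₂ + restᵛ t
          <d : ∀ {a} → a < suc d → Hits (walk x a) (walk y a) → s ≢ Tᵛ f → a < d
          <d (s≤s a≤d) h ne with m≤n⇒m<n∨m≡n a≤d
          ... | inj₁ a<d  = a<d
          ... | inj₂ refl = contradiction h ne

        abstract
          runs-search : ∀ b w z → Runs (layout f t b i w z) searchCmd (searchCost (Gᵛ f) (Lᵛ f))
            (λ ρ → Σ[ b′ ∈ Best ] Σ[ w′ ∈ Walker ] Σ[ z′ ∈ Scratch ] ρ ≡ layout f t b′ i w′ z′ × Searched b b′)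
          runs-search b w z = runs-seq
            {Q = Scratched b w (λ z′ → uᵛ z′ ≡ Kᵛ f)}
            (runs-block _ (_ , refl , refl))
            (λ { _ (z₁ , refl , refl) → runs-seq (runs-hash b w z₁)
            (λ { _ (_ , refl , refl) → runs-seq
              {Q = Stepped b x (Floyding x (Lᵛ f))}
              (runs-block _ (_ , _ , refl , floyding 0 refl refl refl refl refl
                (λ { z≤n (() , _) })))
            (λ ρ p → runs-seq
              (runs-while (λ c → Stepped b x (Floyding x c))
                (λ { _ (_ , _ , refl , fl) → Floyding.left≡ fl })
                (λ { _ _ (_ , _ , refl , fl) e → contradiction (trans (sym (Floyding.left≡ fl)) e) (λ ()) })
                (runs-floyd b x) (Lᵛ f) ρ p)
            (λ { _ (walker lc p q M x₀ , _ , refl , floyding d refl done refl refl refl meeting) → runs-seq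
              {Q = Collected x M b (Lᵛ f)}
              (runs-block _ (_ , _ , _ , refl , collecting 0 refl refl refl refl (inj₁ refl) (λ ())))
            (λ ρ p → let ρ′ , ex , b′ , w′ , z′ , eq , collecting d′ _ done′ _ _ kept hit =
                           runs-while (Collected x M b)
                             (λ { _ (_ , _ , _ , refl , co) → Collecting.left≡ co })
                             (λ { _ _ (_ , _ , _ , refl , co) e → contradiction (trans (sym (Collecting.left≡ co)) e) (λ ()) })
                             (runs-collect x M b) (Lᵛ f) ρ p
                     in ρ′ , ex , b′ , w′ , z′ , eq , kept , λ (a , c , a<L , c≤L , m , hits) →
                          let c′ , m′ , M≡ = meeting (≤-trans c≤L (≤-reflexive (trans (sym done) (+-identityʳ d)))) m
                          in hit (<-≤-trans a<L (≤-reflexive (trans (sym done′) (+-identityʳ d′))))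
                               (subst (λ y → Hits (walk x a) y)
                                 (sym (trans (cong (λ y → walk y a) M≡) (walk-+ x c′ a))) (hits c′ m′))) }) ) }) })
            where
            x : ℕ
            x = hashValue f i (Kᵛ f)

-- The distribution of the coins.

∑< : ℕ → (ℕ → ℕ) → ℕ
∑< zero    F = 0
∑< (suc N) F = F 0 + ∑< N (F ∘ suc)

∑<-cong : ∀ N {F F′ : ℕ → ℕ} → (∀ x → F x ≡ F′ x) → ∑< N F ≡ ∑< N F′
∑<-cong zero    eq = refl
∑<-cong (suc N) eq = cong₂ _+_ (eq 0) (∑<-cong N (eq ∘ suc))

∑<-+ : ∀ N N′ F → ∑< (N + N′) F ≡ ∑< N F + ∑< N′ (λ x → F (N + x))
∑<-+ zero    N′ F = refl
∑<-+ (suc N) N′ F = trans (cong (F 0 +_) (∑<-+ N N′ (F ∘ suc))) (sym (+-assoc (F 0) _ _))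

∑-allFin≡∑< : ∀ N F → ∑ (allFin N) (F ∘ toℕ) ≡ ∑< N F
∑-allFin≡∑< zero    F = refl
∑-allFin≡∑< (suc N) F = trans (∑-allFin-suc N (F ∘ toℕ)) (cong (F 0 +_) (∑-allFin≡∑< N (F ∘ suc)))

-- The law of `pick` as an expectation functional: the mean of `F` over uniform coins is
-- `sumOver F / size`.
record Distributed {τ} {A : Set} (pick : Vec Bool τ → A) (size : ℕ) (sumOver : (A → ℕ) → ℕ) : Set where
  constructor distributed
  field law : ∀ F → size * ∑ (words bools τ) (F ∘ pick) ≡ 2 ^ τ * sumOver F

open Distributed public

distributed-seq : ∀ {σ τ} {A B : Set} {p : Vec Bool σ → A} {r : Vec Bool σ → Vec Bool τ → B} {M N sA} {sB : A → (B → ℕ) → ℕ} →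
  Distributed p M sA → (∀ us → Distributed (r us) N (sB (p us))) →
  (∀ c (F : A → ℕ) → sA (λ a → c * F a) ≡ c * sA F) → (∀ {F F′ : A → ℕ} → (∀ a → F a ≡ F′ a) → sA F ≡ sA F′) →
  Distributed (λ bs → r (Vec.take σ (Vec.tail bs)) (Vec.drop σ (Vec.tail bs))) (M * N) (λ F → sA (λ a → sB a F))
distributed-seq {σ} {τ} {p = p} {r} {M} {N} {sA} {sB} (distributed lawA) lawB linear ext = distributed λ F → begin
  M * N * ∑ (words bools (suc (σ + τ))) (λ bs → F (r (Vec.take σ (Vec.tail bs)) (Vec.drop σ (Vec.tail bs))))
    ≡⟨ cong (M * N *_) (∑-halves σ τ (λ us vs → F (r us vs))) ⟩
  M * N * (2 * ∑ (words bools σ) (λ us → ∑ (words bools τ) (λ vs → F (r us vs))))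
    ≡⟨ lemma₁ M N _ ⟩
  2 * (M * (N * ∑ (words bools σ) (λ us → ∑ (words bools τ) (λ vs → F (r us vs)))))
    ≡⟨ cong (λ z → 2 * (M * z)) (trans (sym (∑-*ˡ (words bools σ) N _)) (∑-cong (words bools σ) (λ us → law (lawB us) F))) ⟩
  2 * (M * ∑ (words bools σ) (λ us → 2 ^ τ * sB (p us) F))
    ≡⟨ cong (2 *_) (lawA (λ a → 2 ^ τ * sB a F)) ⟩
  2 * (2 ^ σ * sA (λ a → 2 ^ τ * sB a F))
    ≡⟨ cong (λ z → 2 * (2 ^ σ * z)) (linear (2 ^ τ) (λ a → sB a F)) ⟩
  2 * (2 ^ σ * (2 ^ τ * sA (λ a → sB a F)))
    ≡⟨ trans (cong (2 *_) (sym (*-assoc (2 ^ σ) (2 ^ τ) _))) (trans (cong (λ z → 2 * (z * _)) (sym (^-distribˡ-+-* 2 σ τ))) (sym (*-assoc 2 (2 ^ (σ + τ)) _))) ⟩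
  2 ^ suc (σ + τ) * sA (λ a → sB a F) ∎
  where
  open ≡-Reasoning
  lemma₁ : ∀ m n s → m * n * (2 * s) ≡ 2 * (m * (n * s))
  lemma₁ = solve-∀

-- Steps that do not assign `coin` lose theirs; a mask marks the positions whose coin is stored.
kept : ∀ {τ} → Vec Bool τ → ℕ
kept []           = 0
kept (true  ∷ ms) = suc (kept ms)
kept (false ∷ ms) = kept ms

select : ∀ {τ} (ms : Vec Bool τ) → Vec Bool τ → Vec Bool (kept ms)
select []           []       = []
select (true  ∷ ms) (b ∷ bs) = b ∷ select ms bs
select (false ∷ ms) (b ∷ bs) = select ms bs

select-distributed : ∀ {τ} (ms : Vec Bool τ) → Distributed (select ms) (2 ^ kept ms) (∑ (words bools (kept ms)))
select-distributed [] = distributed λ F → refl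
select-distributed {suc τ} (false ∷ ms) = distributed λ F → begin
  2 ^ kept ms * ∑ (words bools (suc τ)) (λ bs → F (select (false ∷ ms) bs))
    ≡⟨ cong (2 ^ kept ms *_) (trans (∑-words-suc bools τ _) (∑-const bools (∑ (words bools τ) (F ∘ select ms)))) ⟩
  2 ^ kept ms * (2 * ∑ (words bools τ) (F ∘ select ms))
    ≡⟨ lemma (2 ^ kept ms) (∑ (words bools τ) (F ∘ select ms)) ⟩
  2 * (2 ^ kept ms * ∑ (words bools τ) (F ∘ select ms))
    ≡⟨ cong (2 *_) (law (select-distributed ms) F) ⟩
  2 * (2 ^ τ * ∑ (words bools (kept ms)) F)
    ≡⟨ sym (*-assoc 2 (2 ^ τ) _) ⟩
  2 ^ suc τ * ∑ (words bools (kept ms)) F ∎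
  where
  open ≡-Reasoning
  lemma : ∀ a b → a * (2 * b) ≡ 2 * (a * b)
  lemma = solve-∀
select-distributed {suc τ} (true ∷ ms) = distributed λ F → begin
  2 * 2 ^ kept ms * ∑ (words bools (suc τ)) (λ bs → F (select (true ∷ ms) bs))
    ≡⟨ cong (2 * 2 ^ kept ms *_) (∑-words-suc bools τ _) ⟩
  2 * 2 ^ kept ms * ∑ bools (λ b → ∑ (words bools τ) (λ bs → F (b ∷ select ms bs)))
    ≡⟨ trans (*-assoc 2 (2 ^ kept ms) _) (cong (2 *_) (sym (∑-*ˡ bools (2 ^ kept ms) (λ b → ∑ (words bools τ) (λ bs → F (b ∷ select ms bs)))))) ⟩
  2 * ∑ bools (λ b → 2 ^ kept ms * ∑ (words bools τ) (λ bs → F (b ∷ select ms bs)))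
    ≡⟨ cong (2 *_) (∑-cong bools (λ b → law (select-distributed ms) (λ v → F (b ∷ v)))) ⟩
  2 * ∑ bools (λ b → 2 ^ τ * ∑ (words bools (kept ms)) (λ v → F (b ∷ v)))
    ≡⟨ trans (cong (2 *_) (∑-*ˡ bools (2 ^ τ) (λ b → ∑ (words bools (kept ms)) (λ v → F (b ∷ v))))) (sym (*-assoc 2 (2 ^ τ) _)) ⟩
  2 ^ suc τ * ∑ bools (λ b → ∑ (words bools (kept ms)) (λ v → F (b ∷ v)))
    ≡⟨ cong (2 ^ suc τ *_) (sym (∑-words-suc bools (kept ms) F)) ⟩
  2 ^ suc τ * ∑ (words bools (suc (kept ms))) F ∎
  where open ≡-Reasoning

rotationMask : Vec Bool 17
rotationMask = false ∷ true ∷ false ∷ true ∷ false ∷ false ∷ false ∷ false ∷ false ∷ true ∷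
  false ∷ false ∷ false ∷ false ∷ false ∷ false ∷ false ∷ []

tossMask : Vec Bool 9
tossMask = false ∷ false ∷ false ∷ true ∷ false ∷ false ∷ false ∷ false ∷ false ∷ []

module Randomness (I : Instance) where

  open Execution {58} I

  module _ (f : Fixed) (t : Tuple) (b : Best) (w : Walker) where

    rotated : Vec Bool 3 → Iteration
    rotated v = iteration (shift₁ (Hᵛ f) v) (shift₂ (Hᵛ f) v) 0

    abstract
      exec-rotation : ∀ i z → Σ[ z′ ∈ (Vec Bool 17 → Scratch) ] (∀ bs → ctrᵛ (z′ bs) ≡ Gᵛ f) ×
        Exec rotationCmd 17 (layout f t b i w z) (λ bs → layout f t b (rotated (select rotationMask bs)) w (z′ bs))
      exec-rotation i z = (λ { (_ ∷ a ∷ _ ∷ b ∷ _ ∷ _ ∷ _ ∷ _ ∷ _ ∷ c ∷ _ ∷ _ ∷ _ ∷ _ ∷ _ ∷ _ ∷ _ ∷ []) →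
          record z { bitᵛ = bit c ; vᵛ = bit b ; uᵛ = bit a + bit b ; ctrᵛ = Gᵛ f } }) ,
        (λ { (_ ∷ a ∷ _ ∷ b ∷ _ ∷ _ ∷ _ ∷ _ ∷ _ ∷ c ∷ _ ∷ _ ∷ _ ∷ _ ∷ _ ∷ _ ∷ _ ∷ []) → refl }) ,
        (λ { (_ ∷ a ∷ _ ∷ b ∷ _ ∷ _ ∷ _ ∷ _ ∷ _ ∷ c ∷ _ ∷ _ ∷ _ ∷ _ ∷ _ ∷ _ ∷ _ ∷ []) K o → refl })

    record Seeded (i : Iteration) (left : ℕ) (z : Scratch) : Set where
      field
        pick : Vec Bool (loopCost 9 left) → ℕ
        rest : Vec Bool (loopCost 9 left) → Scratch
        exec : Exec seedCmd (loopCost 9 left) (layout f t b i w z)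
                 (λ bs → layout f t b (record i { Sᵛ = pick bs }) w (rest bs))
        -- Bits tossed below the prefix `Sᵛ i` give a uniform element of the block of numbers with
        -- this prefix.
        law′ : Distributed pick (2 ^ left) (λ F → ∑< (2 ^ left) (λ r → F (Sᵛ i * 2 ^ left + r)))

    abstract
      -- The bound on `suc (Sᵛ i) * 2 ^ left` is inherited when a bit is appended, and it keeps the
      -- reduction modulo `cap` from changing the seed.
      seeded : ∀ left i z → ctrᵛ z ≡ left → suc (Sᵛ i) * 2 ^ left ≤ capᵛ f → Seeded i left z
      seeded zero i z@(scratch _ _ _ _ _ _ _ _ _ _ _ _ _ _) refl _ = record
        { pick = λ _ → Sᵛ i ; rest = λ _ → z
        ; exec = exec-while-zero {ctrᵣ} {tossCmd} refl
        ; law′ = distributed λ F → trans (+-identityʳ _) (trans (∑-const (words bools 1) (F (Sᵛ i)))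
            (cong (2 *_) (trans (cong F (sym (trans (+-identityʳ _) (*-identityʳ (Sᵛ i))))) (sym (+-identityʳ _))))) }
      seeded (suc left) i@(iteration c₁ c₂ s) z@(scratch _ _ _ _ _ _ _ _ _ _ _ _ _ _) refl fits = record
        { pick = λ bs → Seeded.pick (next (Vec.take 9 (Vec.tail bs))) (Vec.drop 9 (Vec.tail bs))
        ; rest = λ bs → Seeded.rest (next (Vec.take 9 (Vec.tail bs))) (Vec.drop 9 (Vec.tail bs))
        ; exec = exec-while-suc {ctrᵣ} {tossCmd} {9} {loopCost 9 left}
                   {layout f t b i w z} {λ us → layout f t b (iteration c₁ c₂ (double us)) w (z′ us)}
                   {λ us vs → layout f t b (iteration c₁ c₂ (Seeded.pick (next us) vs)) w (Seeded.rest (next us) vs)}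
                   (λ ()) toss (λ us → Seeded.exec (next us))
        ; law′ = distributed λ F → trans (law (distributed-seq {p = select tossMask} {sA = ∑ (words bools 1)}
                     {sB = λ v F → ∑< (2 ^ left) (λ r → F (doubled v * 2 ^ left + r))} (select-distributed tossMask)
                     (λ us → Seeded.law′ (next us)) (∑-*ˡ (words bools 1)) (∑-cong (words bools 1))) F)
                     (cong (2 ^ loopCost 9 (suc left) *_) (merge F)) }
        where
        doubled : Vec Bool 1 → ℕ
        doubled (a ∷ []) = s + s + bit a
        double : Vec Bool 9 → ℕ
        double us = doubled (select tossMask us)
        z′ : Vec Bool 9 → Scratch
        z′ us = record z { ctrᵛ = left ; bitᵛ = bit (lookup us (register 3)) ; y₁ᵛ = s + s ; y₂ᵛ = double us }
        doubled-fits : ∀ v → suc (doubled v) * 2 ^ left ≤ capᵛ f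
        doubled-fits (a ∷ []) = ≤-trans (*-monoˡ-≤ (2 ^ left) (s≤s (+-monoʳ-≤ (s + s) (bit≤1 a))))
          (≤-trans (≤-reflexive (lemma s (2 ^ left))) fits)
          where
          bit≤1 : ∀ a → bit a ≤ 1
          bit≤1 true  = ≤-refl
          bit≤1 false = z≤n
          lemma : ∀ s p → suc (s + s + 1) * p ≡ suc s * (2 * p)
          lemma = solve-∀
        doubled-< : ∀ v → doubled v < capᵛ f
        doubled-< v = ≤-trans (m≤m*n (suc (doubled v)) (2 ^ left) {{m^n≢0 2 left}}) (doubled-fits v)
        toss : Exec tossCmd 9 (layout f t b i w z) (λ us → layout f t b (iteration c₁ c₂ (double us)) w (z′ us))
        toss us@(_ ∷ _ ∷ _ ∷ a ∷ _ ∷ _ ∷ _ ∷ _ ∷ _ ∷ []) K o =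
          cong (λ S → ⟨ K , layout f t b (iteration c₁ c₂ S) w (z′ us) , o ⟩) (rem-small (doubled-< (a ∷ [])))
        next : ∀ us → Seeded (iteration c₁ c₂ (double us)) left (z′ us)
        next us = seeded left (iteration c₁ c₂ (double us)) (z′ us) refl (doubled-fits (select tossMask us))
        merge : ∀ (F : ℕ → ℕ) → ∑ (words bools 1) (λ v → ∑< (2 ^ left) (λ r → F (doubled v * 2 ^ left + r))) ≡
                      ∑< (2 ^ suc left) (λ r → F (s * 2 ^ suc left + r))
        merge F = begin
          ∑< N (λ r → F ((s + s + 1) * N + r)) + (∑< N (λ r → F ((s + s + 0) * N + r)) + 0)
            ≡⟨ trans (cong (∑< N (λ r → F ((s + s + 1) * N + r)) +_) (+-identityʳ _)) (+-comm (∑< N (λ r → F ((s + s + 1) * N + r))) _) ⟩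
          ∑< N (λ r → F ((s + s + 0) * N + r)) + ∑< N (λ r → F ((s + s + 1) * N + r))
            ≡⟨ cong₂ _+_ (∑<-cong N (λ r → cong F (lemma₀ s N r))) (∑<-cong N (λ r → cong F (lemma₁ s N r))) ⟩
          ∑< N (λ r → F (s * (2 * N) + r)) + ∑< N (λ r → F (s * (2 * N) + (N + r)))
            ≡⟨ sym (∑<-+ N N (λ r → F (s * (2 * N) + r))) ⟩
          ∑< (N + N) (λ r → F (s * (2 * N) + r))
            ≡⟨ cong (λ M → ∑< M (λ r → F (s * (2 * N) + r))) (cong (N +_) (sym (+-identityʳ N))) ⟩
          ∑< (2 * N) (λ r → F (s * (2 * N) + r)) ∎
          where
          open ≡-Reasoning
          N : ℕ
          N = 2 ^ left
          lemma₀ : ∀ s N r → (s + s + 0) * N + r ≡ s * (2 * N) + r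
          lemma₀ = solve-∀
          lemma₁ : ∀ s N r → (s + s + 1) * N + r ≡ s * (2 * N) + (N + r)
          lemma₁ = solve-∀

const-distributed : ∀ τ {A : Set} (x : A) → Distributed {τ} (λ _ → x) 1 (λ F → F x)
const-distributed τ x = distributed λ F → trans (*-identityˡ _)
  (trans (∑-const (words bools τ) (F x)) (cong (_* F x) (length-words bools τ)))

-- The failure after the coins is bounded through the picked value alone, so the law of `pick`
-- replaces the sum over coins by `sumOver weight`.
distributed-bound : ∀ {τ} {A : Set} {pick : Vec Bool τ → A} {N sumOver} → Distributed pick N sumOver → NonZero N →
  ∀ (χ : Vec Bool τ → ℕ) weight c → (∀ bs → χ bs ≤ c * weight (pick bs)) →
  ∀ x y → y * sumOver weight ≤ x * N → y * ∑ (words bools τ) χ ≤ x * c * 2 ^ τ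
distributed-bound {τ} {pick = pick} {N} {sumOver} picks N≢0 χ weight c decay x y le = *-cancelˡ-≤ N {{N≢0}} (begin
  N * (y * ∑ (words bools τ) χ)
    ≤⟨ *-monoʳ-≤ N (*-monoʳ-≤ y (∑-mono (words bools τ) decay)) ⟩
  N * (y * ∑ (words bools τ) (λ bs → c * weight (pick bs)))
    ≡⟨ cong (λ s → N * (y * s)) (∑-*ˡ (words bools τ) c (weight ∘ pick)) ⟩
  N * (y * (c * ∑ (words bools τ) (weight ∘ pick)))
    ≡⟨ lemma₁ N y c _ ⟩
  y * (c * (N * ∑ (words bools τ) (weight ∘ pick)))
    ≡⟨ cong (λ s → y * (c * s)) (law picks weight) ⟩
  y * (c * (2 ^ τ * sumOver weight))
    ≡⟨ lemma₂ y c (2 ^ τ) _ ⟩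
  c * 2 ^ τ * (y * sumOver weight)
    ≤⟨ *-monoʳ-≤ (c * 2 ^ τ) le ⟩
  c * 2 ^ τ * (x * N)
    ≡⟨ lemma₃ c (2 ^ τ) x N ⟩
  N * (x * c * 2 ^ τ) ∎)
  where
  open ≤-Reasoning
  lemma₁ : ∀ n y f s → n * (y * (f * s)) ≡ y * (f * (n * s))
  lemma₁ = solve-∀
  lemma₂ : ∀ y f t s → y * (f * (t * s)) ≡ f * t * (y * s)
  lemma₂ = solve-∀
  lemma₃ : ∀ f t x n → f * t * (x * n) ≡ n * (x * f * t)
  lemma₃ = solve-∀

-- Iterations and guesses.

iterationCost : ℕ → ℕ → ℕ
iterationCost G L = suc (3 + suc (17 + suc (loopCost 9 G + searchCost G L)))

∑<-*ˡ : ∀ N c F → ∑< N (λ x → c * F x) ≡ c * ∑< N F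
∑<-*ˡ zero    c F = sym (*-zeroʳ c)
∑<-*ˡ (suc N) c F = trans (cong (c * F 0 +_) (∑<-*ˡ N c (F ∘ suc))) (sym (*-distribˡ-+ c (F 0) _))

-- `V` holds for every recorded hit and `W` for the record at all times. Choosing them and `fail`
-- differently lets one analysis yield termination, the success probability, and the fact that the
-- output always consists of list entries.
module Iterate (I : Instance) (f : Fixed) (V W : Best → Set) (V⇒W : ∀ {b} → V b → W b)
               (fail : Best → ℕ) (V⇒0 : ∀ {b} → V b → fail b ≡ 0)
               (2^G≤cap : 2 ^ Gᵛ f ≤ capᵛ f) where

  open Execution {58} I
  open Semantics I
  open Randomness I

  private
    G L : ℕ
    G = Gᵛ f
    L = Lᵛ f

  χ : Store 58 → ℕ
  χ ρ = fail (best (lookup ρ FPᵣ) (lookup ρ FQᵣ) (lookup ρ FJᵣ))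

  open Contraction χ

  choice : Vec Bool 3 → ℕ → Iteration
  choice v S = iteration (shift₁ (Hᵛ f) v) (shift₂ (Hᵛ f) v) S

  Valid : Tuple → Set
  Valid t = ∀ i x y → Hits f t i V x y → V (best (rem (x + c₁ᵛ i) (nᵛ f)) (rem (y + c₂ᵛ i) (nᵛ f)) (Jᵛ t))

  State : Tuple → Store 58 → Set
  State t ρ = Σ[ b ∈ Best ] Σ[ i ∈ Iteration ] Σ[ w ∈ Walker ] Σ[ z ∈ Scratch ] ρ ≡ layout f t b i w z × W b

  record Iterated (t : Tuple) (b : Best) (ρ : Store 58) : Set where
    field
      pick    : Vec Bool (iterationCost G L) → Vec Bool 3 × ℕ
      final   : Vec Bool (iterationCost G L) → Store 58
      exec    : Exec iterationCmd (iterationCost G L) ρ final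
      reached : ∀ bs → Σ[ b′ ∈ Best ] Σ[ i ∈ Iteration ] Σ[ w ∈ Walker ] Σ[ z ∈ Scratch ]
                  final bs ≡ layout f t b′ i w z ×
                  Searched f t (choice (proj₁ (pick bs)) (proj₂ (pick bs))) V b b′
      picks   : Distributed pick (1 * (8 * (2 ^ G * 1))) (λ F → ∑ (words bools 3) (λ v → ∑< (2 ^ G) (λ S → F (v , S))))

  iterated : ∀ r t → Valid t → rcᵛ t ≡ r → ∀ b i w z →
    Iterated t b (layout f (record t { rcᵛ = suc r }) b i w z)
  iterated r t valid refl b i w z = record
    { pick = λ bs → rotate-pick (Vec.drop 3 (Vec.tail bs))
    ; final = λ bs → rotate-final (Vec.drop 3 (Vec.tail bs))
    ; exec = exec-seq {block ((rcᵣ , rcᵣ ⊖ oneᵣ) ∷ [])} {rotationCmd ⨟ (seedCmd ⨟ searchCmd)} {3} {suc (17 + suc (loopCost 9 G + searchCost G L))}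
               {f = λ _ → layout f t b i w z} {λ _ → rotate-final}
               (exec-block ((rcᵣ , rcᵣ ⊖ oneᵣ) ∷ []) tt (layout f (record t { rcᵛ = suc r }) b i w z)) (λ _ → rotate-exec)
    ; reached = λ bs → searched-outcome (Vec.take 17 (Vec.tail (Vec.drop 3 (Vec.tail bs)))) (Vec.drop 17 (Vec.tail (Vec.drop 3 (Vec.tail bs))))
    ; picks = distributed-seq {3} {suc (17 + suc (loopCost 9 G + searchCost G L))} {p = λ _ → tt} {r = λ _ → rotate-pick} {sA = λ F → F tt}
                {λ _ F → ∑ (words bools 3) (λ v → ∑< (2 ^ G) (λ S → F (v , S)))}
                (const-distributed 3 tt) (λ _ → rotate-law) (λ _ _ → refl) (λ eq → eq tt) }
    where
    σ = suc (loopCost 9 G + searchCost G L)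

    z₁ : Vec Bool 17 → Scratch
    z₁ = proj₁ (exec-rotation f t b w i z)

    seeded₁ : ∀ us → Seeded f t b w (choice (select rotationMask us) 0) G (z₁ us)
    seeded₁ us = seeded f t b w G (choice (select rotationMask us) 0) (z₁ us)
      (proj₁ (proj₂ (exec-rotation f t b w i z)) us) (≤-trans (≤-reflexive (*-identityˡ (2 ^ G))) 2^G≤cap)

    S₁ : Vec Bool 17 → Vec Bool (loopCost 9 G) → ℕ
    S₁ us = Seeded.pick (seeded₁ us)

    searched : ∀ us vs → Runs (layout f t b (choice (select rotationMask us) (S₁ us vs)) w (Seeded.rest (seeded₁ us) vs))
      searchCmd (searchCost G L)
      (λ ρ → Σ[ b′ ∈ Best ] Σ[ w′ ∈ Walker ] Σ[ z′ ∈ Scratch ] ρ ≡ layout f t b′ (choice (select rotationMask us) (S₁ us vs)) w′ z′ ×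
         Searched f t (choice (select rotationMask us) (S₁ us vs)) V b b′)
    searched us vs = runs-search f t (choice (select rotationMask us) (S₁ us vs)) V (valid (choice (select rotationMask us) (S₁ us vs))) b w (Seeded.rest (seeded₁ us) vs)

    seed-final : Vec Bool 17 → Vec Bool σ → Store 58
    seed-final us bs = proj₁ (searched us (Vec.take (loopCost 9 G) (Vec.tail bs)))

    seed-exec : ∀ us → Exec (seedCmd ⨟ searchCmd) σ (layout f t b (choice (select rotationMask us) 0) w (z₁ us)) (seed-final us)
    seed-exec us = exec-seq {seedCmd} {searchCmd} {loopCost 9 G} {searchCost G L}
      {f = λ vs → layout f t b (choice (select rotationMask us) (S₁ us vs)) w (Seeded.rest (seeded₁ us) vs)}
      {λ vs _ → proj₁ (searched us vs)} (Seeded.exec (seeded₁ us)) (λ vs → proj₁ (proj₂ (searched us vs)))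

    seed-pick : Vec Bool 17 → Vec Bool σ → Vec Bool 3 × ℕ
    seed-pick us bs = select rotationMask us , S₁ us (Vec.take (loopCost 9 G) (Vec.tail bs))

    seed-law : ∀ us → Distributed (seed-pick us) (2 ^ G * 1) (λ F → ∑< (2 ^ G) (λ S → F (select rotationMask us , S)))
    seed-law us = distributed-seq {loopCost 9 G} {searchCost G L} {p = S₁ us} {r = λ vs _ → select rotationMask us , S₁ us vs}
      {sA = ∑< (2 ^ G)} {λ S F → F (select rotationMask us , S)} (Seeded.law′ (seeded₁ us))
      (λ vs → const-distributed (searchCost G L) _) (∑<-*ˡ (2 ^ G)) (∑<-cong (2 ^ G))

    rotate-final : Vec Bool (suc (17 + σ)) → Store 58
    rotate-final bs = seed-final (Vec.take 17 (Vec.tail bs)) (Vec.drop 17 (Vec.tail bs))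

    rotate-exec : Exec (rotationCmd ⨟ (seedCmd ⨟ searchCmd)) (suc (17 + σ)) (layout f t b i w z) rotate-final
    rotate-exec = exec-seq {rotationCmd} {seedCmd ⨟ searchCmd} {17} {σ}
      {f = λ us → layout f t b (choice (select rotationMask us) 0) w (z₁ us)} {seed-final}
      (proj₂ (proj₂ (exec-rotation f t b w i z))) seed-exec

    rotate-pick : Vec Bool (suc (17 + σ)) → Vec Bool 3 × ℕ
    rotate-pick bs = seed-pick (Vec.take 17 (Vec.tail bs)) (Vec.drop 17 (Vec.tail bs))

    rotate-law : Distributed rotate-pick (8 * (2 ^ G * 1)) (λ F → ∑ (words bools 3) (λ v → ∑< (2 ^ G) (λ S → F (v , S))))
    rotate-law = distributed-seq {17} {σ} {p = select rotationMask} {r = seed-pick} {sA = ∑ (words bools 3)}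
      {λ v F → ∑< (2 ^ G) (λ S → F (v , S))} (select-distributed rotationMask) seed-law
      (∑-*ˡ (words bools 3)) (∑-cong (words bools 3))

    searched-outcome : ∀ us bs → Σ[ b′ ∈ Best ] Σ[ i ∈ Iteration ] Σ[ w ∈ Walker ] Σ[ z ∈ Scratch ]
      seed-final us bs ≡ layout f t b′ i w z ×
      Searched f t (choice (proj₁ (seed-pick us bs)) (proj₂ (seed-pick us bs))) V b b′
    searched-outcome us bs =
      let b′ , w′ , z′ , eq , se = proj₂ (proj₂ (searched us (Vec.take (loopCost 9 G) (Vec.tail bs))))
      in b′ , _ , w′ , z′ , eq , se

  private
    iteration-at : ∀ r t → Valid t → rcᵛ t ≡ r →
      (win : Vec Bool 3 → ℕ → ℕ) → (∀ v S → 0 < win v S → Wins f t (choice v S) V) →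
      ∀ x y → y * ∑ (words bools 3) (λ v → ∑< (2 ^ G) (λ S → 1 ∸ win v S)) ≤ x * (8 * 2 ^ G) →
      ∀ b i w z → W b → RandAt (layout f (record t { rcᵛ = suc r }) b i w z) iterationCmd (iterationCost G L) x y (State t)
    iteration-at r t valid rc≡ win wins x y le b i w z wb =
      outcome (it .final) (it .exec) (λ bs → let b′ , i′ , w′ , z′ , eq , kept , _ = it .reached bs in b′ , i′ , w′ , z′ , eq , keep kept)
        (distributed-bound (it .picks) N≢0 (λ bs → χ (it .final bs)) (λ (v , S) → 1 ∸ win v S) (fail b) decay x y
          (≤-trans le (≤-reflexive (lemma x (2 ^ G)))))
      where
      open Iterated
      N = 1 * (8 * (2 ^ G * 1))
      N≢0 : NonZero N
      N≢0 = m*n≢0 1 (8 * (2 ^ G * 1)) {{_}} {{m*n≢0 8 (2 ^ G * 1) {{_}} {{m*n≢0 (2 ^ G) 1 {{m^n≢0 2 G}}}}}}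
      it = iterated r t valid rc≡ b i w z
      keep : ∀ {b′} → b′ ≡ b ⊎ V b′ → W b′
      keep (inj₁ refl) = wb
      keep (inj₂ v)    = V⇒W v
      shrink : ∀ b′ v S → Searched f t (choice v S) V b b′ → fail b′ ≤ fail b * (1 ∸ win v S)
      shrink b′ v S (kept , won) with win v S | wins v S
      shrink b′ v S (inj₁ refl , won) | zero  | _ = ≤-reflexive (sym (*-identityʳ (fail b)))
      shrink b′ v S (inj₂ vb , won)   | zero  | _ = ≤-trans (≤-reflexive (V⇒0 vb)) z≤n
      shrink b′ v S (_ , won)         | suc _ | w = ≤-trans (≤-reflexive (V⇒0 (won (w z<s)))) z≤n
      decay : ∀ bs → χ (it .final bs) ≤ fail b * (1 ∸ win (proj₁ (it .pick bs)) (proj₂ (it .pick bs)))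
      decay bs = let b′ , i′ , w′ , z′ , eq , se = it .reached bs
                 in ≤-trans (≤-reflexive (cong χ eq)) (shrink b′ (proj₁ (it .pick bs)) (proj₂ (it .pick bs)) se)
      lemma : ∀ x g → x * (8 * g) ≡ x * (1 * (8 * (g * 1)))
      lemma = solve-∀

  iteration-rand : ∀ r t → Valid t → rcᵛ t ≡ r →
    (win : Vec Bool 3 → ℕ → ℕ) → (∀ v S → 0 < win v S → Wins f t (choice v S) V) →
    ∀ x y → y * ∑ (words bools 3) (λ v → ∑< (2 ^ G) (λ S → 1 ∸ win v S)) ≤ x * (8 * 2 ^ G) →
    Rand (State (record t { rcᵛ = suc r })) iterationCmd (iterationCost G L) x y (State t)
  iteration-rand r t valid rc≡ win wins x y le = rand λ { _ (b , i , w , z , refl , wb) →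
    iteration-at r t valid rc≡ win wins x y le b i w z wb }

tupleCost : ℕ → ℕ → ℕ → ℕ → ℕ
tupleCost G L rep k₂ = suc (9 + suc (loopCost 15 k₂ + suc (5 + loopCost (iterationCost G L) rep)))

∑<-const : ∀ N c → ∑< N (λ _ → c) ≡ N * c
∑<-const zero    c = refl
∑<-const (suc N) c = cong (c +_) (∑<-const N c)

-- The trivial contraction by `1 / 1`, for guesses about which nothing is claimed.
no-wins : ∀ N → 1 * ∑ (words bools 3) (λ v → ∑< N (λ S → 1)) ≤ 1 * (8 * N)
no-wins N = *-monoʳ-≤ 1 (≤-reflexive (trans (∑-const (words bools 3) (∑< N (λ S → 1)))
  (cong (8 *_) (trans (∑<-const N 1) (*-identityʳ N)))))

module Tuples (I : Instance) (f : Fixed) (V W : Best → Set) (V⇒W : ∀ {b} → V b → W b)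
              (fail : Best → ℕ) (V⇒0 : ∀ {b} → V b → fail b ≡ 0)
              (2^G≤cap : 2 ^ Gᵛ f ≤ capᵛ f)
              (M : ℕ) (read≤M : ∀ a p → Semantics.read I a p ≤ M) (rest<cap : k₂ᵛ f * M < capᵛ f) where

  open Execution {58} I
  open Semantics I
  open Iterate I f V W V⇒W fail V⇒0 2^G≤cap
  open Contraction χ

  picks≤ : ∀ c s → sum (entriesOf f c s) ≤ c * M
  picks≤ zero    s = z≤n
  picks≤ (suc c) s = +-mono-≤ (read≤M _ _) (picks≤ c _)

  total : ℕ → ℕ
  total j = sum (entriesOf f (k₂ᵛ f) j)

  Ready : ℕ → Tuple → Set
  Ready j t = Jᵛ t ≡ j × restᵛ t ≡ total j × offᵛ t ≡ TKᵛ f ∸ total j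

  private
    ready-tuple : ℕ → ℕ → Tuple
    ready-tuple j r = tuple j (total j) (TKᵛ f ∸ total j) r

    Rested : ℕ → ℕ → ℕ → Best → Iteration → ℕ → Store 58 → Set
    Rested j off rc b i c ρ = Σ[ r ∈ ℕ ] Σ[ w ∈ Walker ] Σ[ z ∈ Scratch ]
      ρ ≡ layout f (tuple j r off rc) b i w z × lcᵛ w ≡ c × r + sum (entriesOf f c (sᵛ z)) ≡ total j

    runs-rest : ∀ j off rc b i c ρ → Rested j off rc b i (suc c) ρ → Runs ρ (block restBody) 15 (Rested j off rc b i c)
    runs-rest j off rc b i c _ (r , _ , scratch _ _ _ s _ _ _ _ _ _ _ _ _ _ , refl , refl , eq) =
      runs-block restBody (_ , _ , _ , refl , refl , trans (cong (_+ sum (entriesOf f c (quot s (nᵛ f)))) (rem-small small)) eq′)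
      where
      v = read (k₁ᵛ f ∸ c) (rem s (nᵛ f))
      eq′ : r + v + sum (entriesOf f c (quot s (nᵛ f))) ≡ total j
      eq′ = trans (+-assoc r v _) eq
      small : r + v < capᵛ f
      small = ≤-<-trans (≤-trans (m≤m+n (r + v) _) (≤-reflexive eq′)) (≤-<-trans (picks≤ (k₂ᵛ f) j) rest<cap)

  module _ (j : ℕ) (valid : ∀ t → Ready j t → Valid t)
           (win : Vec Bool 3 → ℕ → ℕ) (wins : ∀ t → Ready j t → ∀ v S → 0 < win v S → Wins f t (choice v S) V)
           (x y : ℕ) (enough : y * ∑ (words bools 3) (λ v → ∑< (2 ^ Gᵛ f) (λ S → 1 ∸ win v S)) ≤ x * (8 * 2 ^ Gᵛ f)) where

    private
      ready : ∀ r → Ready j (ready-tuple j r)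
      ready r = refl , refl , refl

      repeat-rand : ∀ r → r ≤ repᵛ f → Rand (State (ready-tuple j r)) repeatCmd (loopCost (iterationCost (Gᵛ f) (Lᵛ f)) r) (x ^ r) (y ^ r) (State (ready-tuple j 0))
      repeat-rand = rand-while (λ r → State (ready-tuple j r)) (x ^_) (y ^_)
        (λ { _ (_ , _ , _ , _ , refl , _) → refl }) (λ { _ _ (_ , _ , _ , _ , refl , _) () }) refl refl (repᵛ f)
        (λ r _ → x , y , refl , refl , iteration-rand r (ready-tuple j r) (valid (ready-tuple j r) (ready r)) refl win (wins (ready-tuple j r) (ready r)) x y enough)

    TupleState : ℕ → Store 58 → Set
    TupleState j ρ = Σ[ t ∈ Tuple ] Jᵛ t ≡ j × State t ρ

    tuple-rand : Rand (TupleState (suc j)) tupleCmd (tupleCost (Gᵛ f) (Lᵛ f) (repᵛ f) (k₂ᵛ f)) (x ^ repᵛ f) (y ^ repᵛ f) (TupleState j)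
    tuple-rand = det-seq
      {Q = λ ρ → Σ[ off ∈ ℕ ] Σ[ rc ∈ ℕ ] Σ[ b ∈ Best ] Σ[ i ∈ Iteration ] Rested j off rc b i (k₂ᵛ f) ρ × W b}
      (λ { _ (_ , refl , b , i , w , z , refl , wb) →
           runs-block _ ((_ , _ , b , i , (0 , _ , _ , refl , refl , refl) , wb) , ≤-refl) })
      (det-seq
        {Q = λ ρ → Σ[ off ∈ ℕ ] Σ[ rc ∈ ℕ ] State (tuple j (total j) off rc) ρ}
        (λ { _ (off , rc , b , i , re@(_ , _ , _ , refl , _) , wb) →
             let ρ′ , ex , r , w , z , eq , _ , r≡ = runs-while (Rested j off rc b i)
                   (λ { _ (_ , _ , _ , refl , lc≡ , _) → lc≡ })
                   (λ { _ _ (_ , _ , _ , refl , lc≡ , _) e → contradiction (trans (sym lc≡) e) (λ ()) })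
                   (runs-rest j off rc b i) (k₂ᵛ f) _ re
             in ρ′ , ex , (off , rc , b , i , w , z ,
                  trans eq (cong (λ r → layout f (tuple j r off rc) b i w z) (trans (sym (+-identityʳ r)) r≡)) , wb) ,
                ≤-reflexive (cong χ eq) })
        (det-seq
          {Q = State (ready-tuple j (repᵛ f))}
          (λ { _ (off , rc , b , i , w , z , refl , wb) → runs-block _ ((b , i , w , _ , refl , wb) , ≤-refl) })
          (rand λ ρ st → weaken (λ _ st → _ , refl , st) (from (repeat-rand (repᵛ f) ≤-refl) ρ st))))

  -- The counter of guesses runs downwards, so the accumulated factor switches from 1 to `x` when
  -- the counter drops from `suc j` to `j`.
  factor : ℕ → ℕ → ℕ → ℕ
  factor j x i = if j <ᵇ i then x else 1

  factor-≤ : ∀ j x {i} → i ≤ j → factor j x i ≡ 1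
  factor-≤ j x {i} i≤j with j <ᵇ i in eq
  ... | false = refl
  ... | true  = contradiction (<ᵇ⇒< j i (subst T (sym eq) tt)) (≤⇒≯ i≤j)

  factor-> : ∀ j x {i} → j < i → factor j x i ≡ x
  factor-> j x {i} j<i with j <ᵇ i in eq
  ... | true  = refl
  ... | false = contradiction (<⇒<ᵇ j<i) (λ t → subst T eq t)

  -- Only the j-th tuple is known to contribute to the success probability.
  abstract
    tuples-rand : (∀ j t → Ready j t → Valid t) → ∀ j
      (win : Vec Bool 3 → ℕ → ℕ) → (∀ t → Ready j t → ∀ v S → 0 < win v S → Wins f t (choice v S) V) →
      ∀ x y → y * ∑ (words bools 3) (λ v → ∑< (2 ^ Gᵛ f) (λ S → 1 ∸ win v S)) ≤ x * (8 * 2 ^ Gᵛ f) →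
      ∀ N → Rand (λ ρ → Σ[ t ∈ Tuple ] Jᵛ t ≡ N × State t ρ) tuplesCmd (loopCost (tupleCost (Gᵛ f) (Lᵛ f) (repᵛ f) (k₂ᵛ f)) N)
        (factor j (x ^ repᵛ f) N) (factor j (y ^ repᵛ f) N) (λ ρ → Σ[ t ∈ Tuple ] Jᵛ t ≡ 0 × State t ρ)
    tuples-rand valid j win wins x y enough N = rand-while
      (λ c ρ → Σ[ t ∈ Tuple ] Jᵛ t ≡ c × State t ρ) (factor j (x ^ repᵛ f)) (factor j (y ^ repᵛ f))
      (λ { _ (_ , refl , _ , _ , _ , _ , refl , _) → refl })
      (λ { _ _ (_ , refl , _ , _ , _ , _ , refl , _) () })
      refl refl N body N ≤-refl
      where
      1^≡1 : ∀ r → 1 ^ r ≡ 1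
      1^≡1 r = ^-zeroˡ r
      body : ∀ i → i < N → Σ[ a ∈ ℕ ] Σ[ b ∈ ℕ ] factor j (x ^ repᵛ f) (suc i) ≡ a * factor j (x ^ repᵛ f) i ×
        factor j (y ^ repᵛ f) (suc i) ≡ b * factor j (y ^ repᵛ f) i ×
        Rand (λ ρ → Σ[ t ∈ Tuple ] Jᵛ t ≡ suc i × State t ρ) tupleCmd (tupleCost (Gᵛ f) (Lᵛ f) (repᵛ f) (k₂ᵛ f)) a b (λ ρ → Σ[ t ∈ Tuple ] Jᵛ t ≡ i × State t ρ)
      body i _ = go (i ≟ j)
        where
        Step : ℕ → ℕ → Set
        Step a b = Rand (λ ρ → Σ[ t ∈ Tuple ] Jᵛ t ≡ suc i × State t ρ) tupleCmd (tupleCost (Gᵛ f) (Lᵛ f) (repᵛ f) (k₂ᵛ f)) a b (λ ρ → Σ[ t ∈ Tuple ] Jᵛ t ≡ i × State t ρ)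
        trivially : 1 * ∑ (words bools 3) (λ v → ∑< (2 ^ Gᵛ f) (λ S → 1)) ≤ 1 * (8 * 2 ^ Gᵛ f)
        trivially = no-wins (2 ^ Gᵛ f)
        at : ∀ v → i ≡ j → factor j v (suc i) ≡ v * factor j v i
        at v refl = trans (factor-> i v ≤-refl) (sym (trans (cong (v *_) (factor-≤ i v ≤-refl)) (*-identityʳ v)))
        away : ∀ v → i ≢ j → factor j v (suc i) ≡ 1 * factor j v i
        away v i≢j with <-cmp i j
        ... | tri< i<j _ _ = trans (factor-≤ j v i<j) (sym (trans (*-identityˡ _) (factor-≤ j v (<⇒≤ i<j))))
        ... | tri≈ _ i≡j _ = contradiction i≡j i≢j
        ... | tri> _ _ j<i = trans (factor-> j v (m≤n⇒m≤1+n j<i)) (sym (trans (*-identityˡ _) (factor-> j v j<i)))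
        hit : i ≡ j → Step (x ^ repᵛ f) (y ^ repᵛ f)
        hit refl = tuple-rand i (valid i) win wins x y enough
        miss : Step 1 1
        miss = subst₂ Step (1^≡1 (repᵛ f)) (1^≡1 (repᵛ f)) (tuple-rand i (valid i) (λ _ _ → 0) (λ _ _ _ _ ()) 1 1 trivially)
        go : Dec (i ≡ j) → Σ[ a ∈ ℕ ] Σ[ b ∈ ℕ ] factor j (x ^ repᵛ f) (suc i) ≡ a * factor j (x ^ repᵛ f) i ×
          factor j (y ^ repᵛ f) (suc i) ≡ b * factor j (y ^ repᵛ f) i × Step a b
        go (yes i≡j) = x ^ repᵛ f , y ^ repᵛ f , at (x ^ repᵛ f) i≡j , at (y ^ repᵛ f) i≡j , hit i≡j
        go (no i≢j)  = 1 , 1 , away (x ^ repᵛ f) i≢j , away (y ^ repᵛ f) i≢j , miss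

-- Sizes and the set-up phase.

-- Digits b x i: x has exactly i digits in base b.
data Digits (b : ℕ) : ℕ → ℕ → Set where
  none : Digits b 0 0
  more : ∀ {x i} → x ≢ 0 → Digits b (quot x b) i → Digits b x (suc i)

digits : ∀ b x → Σ[ i ∈ ℕ ] Digits (2+ b) x i
digits b = <-rec (λ x → Σ[ i ∈ ℕ ] Digits (2+ b) x i) λ where
  zero    rec → 0 , none
  (suc x) rec → let i , d = rec (m/n<m (suc x) (2+ b) (s≤s (s≤s z≤n))) in suc i , more (λ ()) d

digits-upper : ∀ {b x i} → Digits (suc b) x i → x < suc b ^ i
digits-upper none = s≤s z≤n
digits-upper {b} {x} {suc i} (more _ d) = begin-strict
  x                                    ≡⟨ m≡m%n+[m/n]*n x (suc b) ⟩
  x % suc b + x / suc b * suc b        <⟨ +-monoˡ-< _ (m%n<n x (suc b)) ⟩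
  suc b + x / suc b * suc b            ≤⟨ *-monoˡ-≤ (suc b) (digits-upper d) ⟩
  suc b ^ i * suc b                    ≡⟨ *-comm (suc b ^ i) (suc b) ⟩
  suc b ^ suc i                        ∎
  where open ≤-Reasoning

digits-lower : ∀ {b x i} → Digits (suc b) x (suc i) → suc b ^ i ≤ x
digits-lower {i = zero}  (more x≢0 _) = n≢0⇒n>0 x≢0
digits-lower {b} {x} {suc i} (more _ d) = begin
  suc b * suc b ^ i          ≡⟨ *-comm (suc b) _ ⟩
  suc b ^ i * suc b          ≤⟨ *-monoˡ-≤ (suc b) (digits-lower d) ⟩
  x / suc b * suc b          ≤⟨ m/n*n≤m x (suc b) ⟩
  x                          ∎
  where open ≤-Reasoning

n<2^n : ∀ n → n < 2 ^ n
n<2^n zero    = s≤s z≤n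
n<2^n (suc n) = begin-strict
  suc n              ≤⟨ n<2^n n ⟩
  2 ^ n              <⟨ m<m+n (2 ^ n) (>-nonZero⁻¹ (2 ^ n) {{m^n≢0 2 n}}) ⟩
  2 ^ n + 2 ^ n      ≡⟨ cong (2 ^ n +_) (sym (+-identityʳ (2 ^ n))) ⟩
  2 ^ suc n          ∎
  where open ≤-Reasoning

digits-≤ : ∀ {x i} → Digits 2 x i → i ≤ x
digits-≤ none = z≤n
digits-≤ {i = suc i} d@(more _ _) = ≤-trans (n<2^n i) (digits-lower d)

2^digits : ∀ {x i} → Digits 2 x i → 2 ^ i ≤ suc (2 * x)
2^digits none = ≤-refl
2^digits d@(more _ _) = m≤n⇒m≤1+n (*-monoʳ-≤ 2 (digits-lower d))

^-distrib-4 : ∀ i → 4 ^ i ≡ 2 ^ i * 2 ^ i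
^-distrib-4 i = ^-distribʳ-* i 2 2

2^digits₄ : ∀ {x i} → Digits 4 x i → 2 ^ i ≤ suc (2 * x)
2^digits₄ none = ≤-refl
2^digits₄ {x} {suc i} d@(more _ _) = m≤n⇒m≤1+n (*-monoʳ-≤ 2 (≤-trans
  (≤-trans (m≤m*n (2 ^ i) (2 ^ i) {{m^n≢0 2 i}}) (≤-reflexive (sym (^-distrib-4 i)))) (digits-lower d)))

quot≡/ : ∀ x n .{{_ : NonZero n}} → quot x n ≡ x / n
quot≡/ x (suc n) = refl

-- Splitting the quotient `A / d` into its parity and its half: with `d` a power of two this appends
-- one binary digit to the part of the target already read.
rem-double : ∀ A d → 0 < d → rem A d + rem (quot A d) 2 * d ≡ rem A (d + d)
rem-double A d@(suc _) _ = sym (begin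
  A % (d + d)
    ≡⟨ cong (_% (d + d)) A≡ ⟩
  (r + q % 2 * d + q / 2 * (d + d)) % (d + d)
    ≡⟨ [m+kn]%n≡m%n (r + q % 2 * d) (q / 2) (d + d) ⟩
  (r + q % 2 * d) % (d + d)
    ≡⟨ m<n⇒m%n≡m (+-mono-<-≤ (m%n<n A d) (≤-trans (*-monoˡ-≤ d (s≤s⁻¹ (m%n<n q 2))) (≤-reflexive (*-identityˡ d)))) ⟩
  r + q % 2 * d ∎)
  where
  open ≡-Reasoning
  r = A % d
  q = A / d
  lemma : ∀ r a b d → r + (a + b * 2) * d ≡ r + a * d + b * (d + d)
  lemma = solve-∀
  A≡ : A ≡ r + q % 2 * d + q / 2 * (d + d)
  A≡ = trans (m≡m%n+[m/n]*n A d) (trans (cong (λ z → r + z * d) (m≡m%n+[m/n]*n q 2)) (lemma r (q % 2) (q / 2) d))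

-- The end marker 2 is even and hence reads as 0, which is the true digit beyond the leading one.
rem-digit : ∀ p t → rem (digit p t) 2 ≡ rem (quot ℤ.∣ t ∣ (2 ^ p)) 2
rem-digit p t with 2 ^ p ≤ᵇ ℤ.∣ t ∣ in eq
... | true  = m%n%n≡m%n (quot ℤ.∣ t ∣ (2 ^ p)) 2
... | false = cong (λ z → rem z 2) {0} (sym (trans (quot≡/ ℤ.∣ t ∣ (2 ^ p) {{m^n≢0 2 p}})
    (m<n⇒m/n≡0 {{m^n≢0 2 p}} (≰⇒> (λ le → subst T eq (≤⇒≤ᵇ le))))))

eighth-power : ℕ → ℕ
eighth-power x = x * x * (x * x) * (x * x * (x * x))

module Sizes (k n m : ℕ) where

  -- Digit counts in base 2 and 4 replace logarithm and square root: `2 ^ sqBits` lies above `√n`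
  -- and, for positive `n`, is at most `2 √n`.
  lgBits sqBits tBits : ℕ
  lgBits = proj₁ (digits 0 n)
  sqBits = proj₁ (digits 2 n)
  tBits  = proj₁ (digits 0 (k * m))

  -- In `cap`, the eighth power dominates the `2 ^ width` seeds and the other factor the sums of
  -- entries and the truncated target. `buckets` is one less than the number of rows of `width`
  -- entries that fit into half a list; the remaining row determines the start of the walk.
  cap half width buckets reach rounds count : ℕ
  cap     = eighth-power (n + 1 + (n + 1)) * (k * m + 1 + (k * m + 1))
  half    = quot n 2
  width   = 8 * lgBits
  buckets = quot half width ∸ 1
  reach   = quot (2 ^ sqBits) (lgBits * lgBits)
  rounds  = n * (lgBits * lgBits * (lgBits * lgBits) * (lgBits * lgBits))
  count   = quot (n ^ k) (n * n)

  private
    x y : ℕ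
    x = n + 1 + (n + 1)
    y = k * m + 1 + (k * m + 1)

    ≤² : ∀ z → z ≤ z * z
    ≤² zero      = z≤n
    ≤² z@(suc _) = m≤m*n z z

    x≡ : suc (suc (2 * n)) ≡ x
    x≡ = lemma n
      where
      lemma : ∀ n → suc (suc (2 * n)) ≡ n + 1 + (n + 1)
      lemma = solve-∀

    y≡ : suc (suc (2 * (k * m))) ≡ y
    y≡ = lemma (k * m)
      where
      lemma : ∀ n → suc (suc (2 * n)) ≡ n + 1 + (n + 1)
      lemma = solve-∀

    x≤x⁸ : x ≤ eighth-power x
    x≤x⁸ = ≤-trans (≤² x) (≤-trans (≤² (x * x)) (≤² (x * x * (x * x))))

    instance
      y≢0 : NonZero y
      y≢0 = >-nonZero (≤-trans (s≤s z≤n) (≤-reflexive y≡))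
      x⁸≢0 : NonZero (eighth-power x)
      x⁸≢0 = >-nonZero (≤-trans (≤-trans (s≤s z≤n) (≤-reflexive x≡)) x≤x⁸)

    x⁸≤cap : eighth-power x ≤ cap
    x⁸≤cap = m≤m*n (eighth-power x) y

    y≤cap : y ≤ cap
    y≤cap = m≤n*m y (eighth-power x)

  2n+1<cap : suc (2 * n) < cap
  2n+1<cap = ≤-trans (≤-reflexive x≡) (≤-trans x≤x⁸ x⁸≤cap)

  2km+1<cap : suc (2 * (k * m)) < cap
  2km+1<cap = ≤-trans (≤-reflexive y≡) y≤cap

  2^width≤cap : 2 ^ width ≤ cap
  2^width≤cap = begin
    2 ^ (8 * lgBits)         ≡⟨ trans (cong (2 ^_) (*-comm 8 lgBits)) (sym (^-*-assoc 2 lgBits 8)) ⟩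
    (2 ^ lgBits) ^ 8         ≡⟨ lemma (2 ^ lgBits) ⟩
    eighth-power (2 ^ lgBits) ≤⟨ eighth-mono (≤-trans (2^digits (proj₂ (digits 0 n))) (≤-trans (n≤1+n _) (≤-reflexive x≡))) ⟩
    eighth-power x           ≤⟨ x⁸≤cap ⟩
    cap                      ∎
    where
    open ≤-Reasoning
    lemma : ∀ z → z * (z * (z * (z * (z * (z * (z * (z * 1))))))) ≡ z * z * (z * z) * (z * z * (z * z))
    lemma = solve-∀
    eighth-mono : ∀ {a b} → a ≤ b → eighth-power a ≤ eighth-power b
    eighth-mono le = *-mono-≤ (*-mono-≤ (*-mono-≤ le le) (*-mono-≤ le le)) (*-mono-≤ (*-mono-≤ le le) (*-mono-≤ le le))

  k₂m<cap : (k ∸ 1 ∸ 1) * m < cap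
  k₂m<cap = ≤-<-trans (*-monoˡ-≤ m (≤-trans (m∸n≤m (k ∸ 1) 1) (m∸n≤m k 1)))
    (≤-<-trans (m≤n⇒m≤1+n (m≤m+n (k * m) _)) 2km+1<cap)

  setupCost totalCost : ℕ
  setupCost = suc (15 + suc (loopCost 5 k + suc (33 + suc (loopCost 7 lgBits + suc (5 + suc (loopCost 7 sqBits +
    suc (25 + suc (loopCost 21 tBits + 5))))))))
  totalCost = suc (setupCost + loopCost (tupleCost width (reach + reach) rounds (k ∸ 1 ∸ 1)) count)

module Setup (I : Instance) where

  open Instance I
  open Sizes k n m
  open Execution {58} I

  -- The target may be negative or too long to be stored, so only `tBits` digits of its absolute
  -- value are kept. If the instance is solvable, the target is a natural number of at most `k * m`
  -- and nothing is lost; otherwise any output is allowed.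
  targetPart mask : ℕ
  mask       = 2 ^ tBits
  targetPart = rem ℤ.∣ target ∣ mask

  fixed₀ : ℕ → ℕ → Fixed
  fixed₀ kc pw = fixed n 0 0 0 0 kc pw 0 0 0 0 0 0 0 0 0 0 0 0 0 0 0 0 0

  fixed₁ : (lg sq : ℕ) → Fixed
  fixed₁ lg sq = fixed n m k (k ∸ 1) (k ∸ 1 ∸ 1) 0 (n ^ k) (k * m) (k * m + 1 + (k * m + 1))
    (x * x * (x * x)) (eighth-power x) cap lg sq 0 0 0 0 0 0 0 0 0 0
    where
    x : ℕ
    x = n + 1 + (n + 1)

  fixed₂ : (pw₂ pos T TK : ℕ) → Fixed
  fixed₂ pw₂ pos T TK = record (fixed₁ lgBits (2 ^ sqBits))
    { lg₂ᵛ = lgBits * lgBits ; Hᵛ = half ; Gᵛ = width ; Kᵛ = buckets ; Lᵛ = reach + reach ; repᵛ = rounds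
    ; pw₂ᵛ = pw₂ ; posᵛ = pos ; Tᵛ = T ; TKᵛ = TK }

  settled : Fixed
  settled = fixed₂ mask tBits targetPart (targetPart + m * buckets)

  setting : Fixed → ℕ → ℕ → Scratch → Store 58
  setting f J c z = layout f (tuple J 0 0 0) (best 0 0 0) (iteration c 0 0) (walker 0 0 0 0 0) z

  Stage : Fixed → ℕ → (Scratch → Set) → Store 58 → Set
  Stage f J φ ρ = Σ[ c ∈ ℕ ] Σ[ z ∈ Scratch ]
    ρ ≡ setting f J c z × φ z

  private
    blank : Scratch
    blank = scratch 0 0 0 0 0 0 0 0 0 0 0 0 0 0

    runs-power : Runs (layout (fixed₀ k 1) (tuple 0 0 0 0) (best 0 0 0) (iteration 0 0 0) (walker 0 0 0 0 0) blank)
      powerCmd (loopCost 5 k) (λ ρ → ρ ≡ layout (fixed₀ 0 (n ^ k)) (tuple 0 0 0 0) (best 0 0 0) (iteration 0 0 0) (walker 0 0 0 0 0) blank)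
    runs-power =
      let ρ′ , ex , p , j , eq , j≡ , p≡ = runs-while P
            (λ { _ (_ , _ , refl , _) → refl }) (λ { _ _ (_ , _ , refl , _) () })
            (λ { c _ (p , j , refl , j≡ , p≡) → runs-block powerBody
                 (_ , suc j , refl , trans (sym (+-suc j c)) j≡ , trans (cong (_* n) p≡) (*-comm (n ^ j) n)) })
            k _ (1 , 0 , refl , refl , refl)
      in ρ′ , ex , trans eq (cong (λ p → start 0 p) (trans p≡ (cong (n ^_) (trans (sym (+-identityʳ j)) j≡))))
      where
      start : ℕ → ℕ → Store 58
      start kc pw = layout (fixed₀ kc pw) (tuple 0 0 0 0) (best 0 0 0) (iteration 0 0 0) (walker 0 0 0 0 0) blank
      P : ℕ → Store 58 → Set
      P c ρ = Σ[ p ∈ ℕ ] Σ[ j ∈ ℕ ] ρ ≡ start c p × j + c ≡ k × p ≡ n ^ j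

    Lg : ℕ → Store 58 → Set
    Lg c ρ = Σ[ l ∈ ℕ ] Stage (fixed₁ l 0) count (λ z → Digits 2 (ctrᵛ z) c × l + c ≡ lgBits) ρ

    digits-stop : ∀ {b x} → Digits b x 0 → x ≡ 0
    digits-stop none = refl

    digits-go : ∀ {b x c} → Digits b x (suc c) → x ≢ 0
    digits-go (more x≢0 _) = x≢0

    digits-next : ∀ {b x c} → Digits b x (suc c) → Digits b (quot x b) c
    digits-next (more _ d) = d

    lg<cap : ∀ {l c} → l + suc c ≡ lgBits → l + 1 < cap
    lg<cap {l} {c} eq = ≤-<-trans (≤-trans (≤-trans (+-monoʳ-≤ l (s≤s z≤n)) (≤-reflexive eq))
      (≤-trans (digits-≤ (proj₂ (digits 0 n))) (m≤n⇒m≤1+n (m≤m+n n _)))) 2n+1<cap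

    runs-lg : ∀ ρ → Lg lgBits ρ → Runs ρ (whileNonZero ctrᵣ loop block lgBody) (loopCost 7 lgBits) (Stage (fixed₁ lgBits 0) count (λ _ → ⊤))
    runs-lg ρ p =
      let ρ′ , ex , l , c , z , eq , _ , l≡ = runs-while Lg
            (λ { _ (_ , _ , _ , refl , d , _) → digits-stop d }) (λ { _ _ (_ , _ , _ , refl , d , _) → digits-go d })
            (λ { c _ (l , _ , _ , refl , d , l≡) → runs-block lgBody
              (_ , _ , _ , refl , digits-next d ,
               trans (cong (_+ c) (trans (rem-small (lg<cap l≡)) (+-comm l 1))) (trans (sym (+-suc l c)) l≡)) })
            lgBits ρ p
      in ρ′ , ex , c , z , trans eq (cong (λ l → setting (fixed₁ l 0) count c z) (trans (sym (+-identityʳ l)) l≡)) , tt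

    Sq : ℕ → Store 58 → Set
    Sq c ρ = Σ[ s ∈ ℕ ] Stage (fixed₁ lgBits s) count (λ z → Digits 4 (ctrᵛ z) c × s * 2 ^ c ≡ 2 ^ sqBits) ρ

    double-power : ∀ s c → (s + s) * 2 ^ c ≡ s * 2 ^ suc c
    double-power s c = lemma s (2 ^ c)
      where
      lemma : ∀ s p → (s + s) * p ≡ s * (2 * p)
      lemma = solve-∀

    double<cap : ∀ {s c} → s * 2 ^ suc c ≡ 2 ^ sqBits → s + s < cap
    double<cap {s} {c} eq = ≤-<-trans (≤-trans (m≤m*n (s + s) (2 ^ c) {{m^n≢0 2 c}})
      (≤-trans (≤-reflexive (trans (double-power s c) eq)) (2^digits₄ (proj₂ (digits 2 n))))) 2n+1<cap

    runs-sq : ∀ ρ → Sq sqBits ρ → Runs ρ (whileNonZero ctrᵣ loop block sqBody) (loopCost 7 sqBits) (Stage (fixed₁ lgBits (2 ^ sqBits)) count (λ _ → ⊤))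
    runs-sq ρ p =
      let ρ′ , ex , s , c , z , eq , _ , s≡ = runs-while Sq
            (λ { _ (_ , _ , _ , refl , d , _) → digits-stop d }) (λ { _ _ (_ , _ , _ , refl , d , _) → digits-go d })
            (λ { c _ (s , _ , _ , refl , d , s≡) → runs-block sqBody
              (_ , _ , _ , refl , digits-next d ,
               trans (cong (_* 2 ^ c) (rem-small (double<cap {s} {c} s≡))) (trans (double-power s c) s≡)) })
            sqBits ρ p
      in ρ′ , ex , c , z , trans eq (cong (λ s → setting (fixed₁ lgBits s) count c z) (trans (sym (*-identityʳ s)) s≡)) , tt

    Di : ℕ → Store 58 → Set
    Di c ρ = Σ[ p ∈ ℕ ] Stage (fixed₂ (2 ^ p) p (rem ℤ.∣ target ∣ (2 ^ p)) 0) count (λ z → Digits 2 (ctrᵛ z) c × p + c ≡ tBits) ρ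

    module DigitStep {p c} (p≡ : p + suc c ≡ tBits) where
      d : ℕ
      d = 2 ^ p

      2d<cap : d + d < cap
      2d<cap = ≤-<-trans (begin
        2 ^ p + 2 ^ p         ≡⟨ cong (2 ^ p +_) (sym (+-identityʳ (2 ^ p))) ⟩
        2 ^ suc p             ≤⟨ ^-monoʳ-≤ 2 (≤-trans (m≤m+n (suc p) c) (≤-reflexive (trans (sym (+-suc p c)) p≡))) ⟩
        2 ^ tBits             ≤⟨ 2^digits (proj₂ (digits 0 (k * m))) ⟩
        suc (2 * (k * m))     ∎) 2km+1<cap
        where open ≤-Reasoning

      pw₂≡ : rem (d + d) cap ≡ 2 ^ suc p
      pw₂≡ = trans (rem-small 2d<cap) (cong (2 ^ p +_) (sym (+-identityʳ (2 ^ p))))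

      pos≡ : rem (p + 1) cap ≡ suc p
      pos≡ = trans (rem-small (≤-<-trans (≤-trans (≤-reflexive (+-comm p 1)) (≤-trans (n<2^n p) (m≤m+n d d))) 2d<cap)) (+-comm p 1)

      T≡ : rem (rem ℤ.∣ target ∣ d + rem (digit p target) 2 * d) cap ≡ rem ℤ.∣ target ∣ (2 ^ suc p)
      T≡ = trans (cong (λ z → rem z cap) sum≡) (trans (rem-small (<-trans (rem-< ℤ.∣ target ∣ (d + d) {{d+d≢0}}) 2d<cap))
        (cong (rem ℤ.∣ target ∣) (cong (2 ^ p +_) (sym (+-identityʳ (2 ^ p))))))
        where
        0<d : 0 < d
        0<d = >-nonZero⁻¹ d {{m^n≢0 2 p}}
        d+d≢0 : NonZero (d + d)
        d+d≢0 = >-nonZero (≤-trans 0<d (m≤m+n d d))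
        sum≡ : rem ℤ.∣ target ∣ d + rem (digit p target) 2 * d ≡ rem ℤ.∣ target ∣ (d + d)
        sum≡ = trans (cong (λ z → rem ℤ.∣ target ∣ d + z * d) (rem-digit p target)) (rem-double ℤ.∣ target ∣ d 0<d)

    runs-digit : ∀ c q c₁ z → Digits 2 (ctrᵛ z) (suc c) → q + suc c ≡ tBits →
      Runs (setting (fixed₂ (2 ^ q) q (rem ℤ.∣ target ∣ (2 ^ q)) 0) count c₁ z) (block digitBody) 21 (Di c)
    runs-digit c q c₁ (scratch arg acc u s ctr base pos₁ pos₂ _ _ _ _ y₃ y₄) d q≡ = runs-block digitBody
      (suc q , c₁ , z′ , adjusted pw₂≡ pos≡ T≡ , digits-next d , trans (sym (+-suc q c)) q≡)
      where
      open DigitStep {q} {c} q≡ using (pw₂≡; pos≡; T≡)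
      z′ : Scratch
      z′ = scratch arg acc u s (quot ctr 2) base pos₁ pos₂ (digit q target) (rem (digit q target) 2) (q + 1)
             (rem ℤ.∣ target ∣ (2 ^ q) + rem (digit q target) 2 * 2 ^ q) y₃ y₄
      adjusted : ∀ {a a′ b b′ e e′} → a ≡ a′ → b ≡ b′ → e ≡ e′ →
        setting (fixed₂ a b e 0) count c₁ z′ ≡ setting (fixed₂ a′ b′ e′ 0) count c₁ z′
      adjusted refl refl refl = refl

    runs-digits : ∀ ρ → Di tBits ρ → Runs ρ (whileNonZero ctrᵣ loop block digitBody) (loopCost 21 tBits) (Stage (fixed₂ mask tBits targetPart 0) count (λ _ → ⊤))
    runs-digits ρ p =
      let ρ′ , ex , q , c , z , eq , _ , q≡ = runs-while Di
            (λ { _ (_ , _ , _ , refl , d , _) → digits-stop d }) (λ { _ _ (_ , _ , _ , refl , d , _) → digits-go d })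
            (λ { c _ (q , c₁ , z , refl , d , q≡) → runs-digit c q c₁ z d q≡ })
            tBits ρ p
      in ρ′ , ex , c , z , trans eq (cong (λ q → setting (fixed₂ (2 ^ q) q (rem ℤ.∣ target ∣ (2 ^ q)) 0) count c z) (trans (sym (+-identityʳ q)) q≡)) , tt

  abstract
    runs-setup : Runs (Vec.replicate 58 0) setupCmd setupCost (Stage settled count (λ _ → ⊤))
    runs-setup = runs-seq
      {Q = λ ρ → ρ ≡ layout (fixed₀ k 1) (tuple 0 0 0 0) (best 0 0 0) (iteration 0 0 0) (walker 0 0 0 0 0) blank}
      (runs-block initialBlock refl)
      (λ { _ refl → runs-seq runs-power
      (λ { _ refl → runs-seq {Q = Lg lgBits}
        (runs-block setupBlock (0 , _ , _ , refl , proj₂ (digits 0 n) , refl))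
      (λ ρ p → runs-seq (runs-lg ρ p)
      (λ { _ (c , _ , refl , _) → runs-seq {Q = Sq sqBits}
        (runs-block _ (1 , _ , _ , refl , proj₂ (digits 2 n) , *-identityˡ (2 ^ sqBits)))
      (λ ρ p → runs-seq (runs-sq ρ p)
      (λ { _ (c , z , refl , _) → runs-seq {Q = Di tBits} (runs-sizes c z)
      (λ ρ p → runs-seq (runs-digits ρ p)
      (λ { _ (c , _ , refl , _) → runs-block _ (_ , _ , refl , tt) }) ) }) ) }) ) }) })
      where
      rem-one : ∀ A → rem A 1 ≡ 0
      rem-one A = n%1≡0 A
      runs-sizes : ∀ c z → Runs (setting (fixed₁ lgBits (2 ^ sqBits)) count c z) (block sizesBlock) 25 (Di tBits)
      runs-sizes c (scratch arg acc u s ctr base pos₁ pos₂ v bit y₁ y₂ y₃ y₄) = runs-block sizesBlock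
        (0 , c , z′ , cong (λ T → setting (fixed₂ 1 0 T 0) count c z′) (sym (rem-one ℤ.∣ target ∣)) , proj₂ (digits 0 (k * m)) , refl)
        where
        z′ : Scratch
        z′ = scratch arg acc u reach (k * m) base pos₁ pos₂ (quot half width) bit
               (lgBits * lgBits * (lgBits * lgBits) * (lgBits * lgBits)) y₂ y₃ y₄

-- Output.

emitCost : ℕ → ℕ
emitCost k₂ = suc (3 + suc (1 + suc (3 + suc (1 + suc (5 + loopCost 13 k₂)))))

module Emission (I : Instance) (f : Fixed) where

  open Execution {58} I
  open Semantics I

  answer : Best → List ℕ
  answer (best P Q J) = read 0 P ∷ read 1 Q ∷ entriesOf f (k₂ᵛ f) J

  -- Running c from ρ appends out to the output.
  Emits : Store 58 → Cmd 58 → ℕ → List ℕ → (Store 58 → Set) → Set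
  Emits ρ c τ out Q = Σ[ ρ′ ∈ Store 58 ] (∀ (bs : Vec Bool τ) K o → run′ ⟨ c ∷ K , ρ , o ⟩ bs ≡ ⟨ K , ρ′ , o ++ out ⟩) × Q ρ′

  emits-silent : ∀ {ρ c τ} {Q : Store 58 → Set} → Runs ρ c τ Q → Emits ρ c τ [] Q
  emits-silent (ρ′ , ex , q) = ρ′ , (λ bs K o → trans (ex bs K o) (cong (λ o → ⟨ K , ρ′ , o ⟩) (sym (List.++-identityʳ o)))) , q

  emits-emit : ∀ {ρ x} {Q : Store 58 → Set} → Q ρ → Emits ρ (emit x) 1 (lookup ρ x ∷ []) Q
  emits-emit {ρ} q = ρ , (λ { (_ ∷ []) K o → refl }) , q

  private
    glue : ∀ {κ κ₁ κ₂ : Config 58} {σ τ} (bs : Vec Bool (σ + τ)) → run′ κ (Vec.take σ bs) ≡ κ₁ → run′ κ₁ (Vec.drop σ bs) ≡ κ₂ → run′ κ bs ≡ κ₂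
    glue {κ} {σ = σ} bs eq₁ eq₂ = trans (cong (run′ κ) (sym (Vec.take++drop≡id σ bs)))
      (trans (run′-++ κ (Vec.take σ bs) (Vec.drop σ bs)) (trans (cong (λ κ → run′ κ (Vec.drop σ bs)) eq₁) eq₂))

  emits-seq : ∀ {ρ c d σ τ out out′} {Q S : Store 58 → Set} → Emits ρ c σ out Q →
    (∀ ρ′ → Q ρ′ → Emits ρ′ d τ out′ S) → Emits ρ (c ⨟ d) (suc (σ + τ)) (out ++ out′) S
  emits-seq {ρ} {c} {d} {σ} {τ} {out} {out′} (ρ₁ , ex₁ , q) next = let ρ₂ , ex₂ , s = next ρ₁ q in
    ρ₂ , (λ { (b ∷ bs) K o → glue {⟨ c ∷ d ∷ K , ρ , o ⟩} {σ = σ} bs (ex₁ (Vec.take σ bs) (d ∷ K) o)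
      (trans (ex₂ (Vec.drop σ bs) K (o ++ out)) (cong (λ o → ⟨ K , ρ₂ , o ⟩) (List.++-assoc o out out′))) }) , s

  private
    Left : Tuple → Best → Iteration → ℕ → ℕ → Store 58 → Set
    Left t b i c s ρ = Σ[ w ∈ Walker ] Σ[ z ∈ Scratch ] ρ ≡ layout f t b i w z × lcᵛ w ≡ c × sᵛ z ≡ s

    emits-picked : ∀ t b i c s ρ → Left t b i c s ρ → Emits ρ (whileNonZero lcᵣ loop emitBody) (loopCost 13 c) (entriesOf f c s) (λ _ → ⊤)
    emits-picked t b i zero s _ (w , z , refl , lc≡ , _) = emits-silent (_ , exec-while-zero {x = lcᵣ} {c = emitBody} lc≡ , tt)
    emits-picked t b i (suc c) s _ (_ , _ , refl , refl , refl) =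
      let ρ₁ , ex₁ , left , _ = emits-seq {c = block bodyBlock} {d = emit vᵣ} {σ = 11} {τ = 1} {out = []} {out′ = v ∷ []}
            {Q = LeftBody} {S = LeftBody}
            (emits-silent (runs-block bodyBlock ((_ , _ , refl , refl , refl) , refl)))
            (λ { ρ (left , eq) → subst (λ v → Emits ρ (emit vᵣ) 1 (v ∷ []) LeftBody) eq (emits-emit {ρ} {vᵣ} (left , eq)) })
          ρ₂ , ex₂ , _ = emits-picked t b i c (quot s (nᵛ f)) ρ₁ left
      in ρ₂ , (λ { (_ ∷ bs) K o → glue {σ = 13} bs (ex₁ (Vec.take 13 bs) ((whileNonZero lcᵣ loop emitBody) ∷ K) o)
            (trans (ex₂ (Vec.drop 13 bs) K (o ++ (v ∷ []))) (cong (λ o → ⟨ K , ρ₂ , o ⟩) (List.++-assoc o (v ∷ []) (entriesOf f c (quot s (nᵛ f)))))) }) , tt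
      where
      v = read (k₁ᵛ f ∸ c) (rem s (nᵛ f))
      LeftBody : Store 58 → Set
      LeftBody ρ = Left t b i c (quot s (nᵛ f)) ρ × lookup ρ vᵣ ≡ v
      bodyBlock : List (Register × Expr 58)
      bodyBlock = (lcᵣ , lcᵣ ⊖ oneᵣ) ∷ (pos₁ᵣ , k₁ᵣ ⊖ lcᵣ) ∷ (pos₂ᵣ , sᵣ ⊛ nᵣ) ∷ (sᵣ , sᵣ ⊘ nᵣ) ∷ (vᵣ , entry pos₁ᵣ pos₂ᵣ) ∷ []

  abstract
    emits-answer : ∀ t b i w z → Emits (layout f t b i w z) emitCmd (emitCost (k₂ᵛ f)) (answer b) (λ _ → ⊤)
    emits-answer t b i w z = emits-seq
      {Q = λ ρ → Σ[ z ∈ Scratch ] ρ ≡ layout f t b i w z × vᵛ z ≡ read 0 (FPᵛ b)}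
      (emits-silent (runs-block _ (_ , refl , refl)))
      (λ { _ (z₁ , refl , refl) → emits-seq (emits-emit {layout f t b i w z₁} {vᵣ} {_≡ layout f t b i w z₁} refl)
      (λ { _ refl → emits-seq
        {Q = λ ρ → Σ[ z ∈ Scratch ] ρ ≡ layout f t b i w z × vᵛ z ≡ read 1 (FQᵛ b)}
        (emits-silent (runs-block _ (_ , refl , refl)))
      (λ { _ (z₂ , refl , refl) → emits-seq (emits-emit {layout f t b i w z₂} {vᵣ} {_≡ layout f t b i w z₂} refl)
      (λ { _ refl → emits-seq {Q = Left t b i (k₂ᵛ f) (FJᵛ b)}
        (emits-silent (runs-block _ (_ , _ , refl , refl , refl)))
        (λ ρ left → emits-picked t b i (k₂ᵛ f) (FJᵛ b) ρ left) }) }) }) })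

-- Answers and solutions of an instance.

nth-∈ : ∀ {m n} (v : Vec (Fin m) n) {p} → p < n → value v p ∈ List.map (λ i → suc (toℕ i)) (Vec.toList v)
nth-∈ (a ∷ v) {zero}  _   = here refl
nth-∈ (a ∷ v) {suc p} p<n = there (nth-∈ v (s≤s⁻¹ p<n))

∈-nth : ∀ {m n} (v : Vec (Fin m) n) {x} → x ∈ List.map (λ i → suc (toℕ i)) (Vec.toList v) → Σ[ p ∈ ℕ ] p < n × value v p ≡ x
∈-nth (a ∷ v) (here refl) = 0 , z<s , refl
∈-nth (a ∷ v) (there x∈)  = let p , p<n , eq = ∈-nth v x∈ in suc p , s≤s p<n , eq

nth-++ : ∀ {A : Set} (d : A) (pre : List A) x post → nth d (pre ++ x ∷ post) (length pre) ≡ x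
nth-++ d []        x post = refl
nth-++ d (_ ∷ pre) x post = nth-++ d pre x post

sum-bound : ∀ {m n k} (vs : Vec (Vec (Fin m) n) k) {s} → Pointwise _∈_ s (entries vs) → sum s ≤ k * m
sum-bound []       []          = z≤n
sum-bound (v ∷ vs) (x∈ ∷ rest) = let p , _ , eq = ∈-nth v x∈ in
  +-mono-≤ (≤-trans (≤-reflexive (sym eq)) (value≤m v p)) (sum-bound vs rest)

read≤m : ∀ {m n k} (vs : Vec (Vec (Fin m) n) k) a p → nth 0 (nth [] (entries vs) a) p ≤ m
read≤m []       a       p = z≤n
read≤m (v ∷ vs) zero    p = value≤m v p
read≤m (v ∷ vs) (suc a) p = read≤m vs a p

module Answers {m n k′ : ℕ} .{{_ : NonZero n}} (w₁ w₂ : Vec (Fin m) n) (ws : Vec (Vec (Fin m) n) k′) (t : ℤ) where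

  w : Vectors (2+ k′) n m
  w = w₁ ∷ w₂ ∷ ws

  I : Instance
  I = instanceOf w t

  open Setup I
  open Semantics I
  open Emission I settled
  open Sizes (2+ k′) n m

  private
    -- The machine addresses a list by the number `c` of lists that follow it; the length of the
    -- prefix converts this into an index from the front.
    at-prefix : ∀ {c} pre (vs : Vec (Vec (Fin m) n) (suc c)) → entries w ≡ pre ++ entries vs → length pre + suc c ≡ 2+ k′ →
      ∀ p → read (suc k′ ∸ c) p ≡ value (Vec.head vs) p
    at-prefix {c} pre (v ∷ vs) eq len p = cong (λ l → nth 0 l p) (trans (cong (nth [] (entries w)) index)
      (trans (cong (λ ls → nth [] ls (length pre)) eq) (nth-++ [] pre _ (entries vs))))
      where
      index : suc k′ ∸ c ≡ length pre
      index = trans (cong (_∸ c) (suc-injective (trans (sym len) (+-suc (length pre) c)))) (m+n∸n≡m (length pre) c)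

    next-prefix : ∀ {c} pre (v : Vec (Fin m) n) (vs : Vec (Vec (Fin m) n) c) → entries w ≡ pre ++ entries (v ∷ vs) →
      length pre + suc c ≡ 2+ k′ → Σ[ pre′ ∈ List (List ℕ) ] entries w ≡ pre′ ++ entries vs × length pre′ + c ≡ 2+ k′
    next-prefix {c} pre v vs eq len = pre ++ x ∷ [] , trans eq (sym (List.++-assoc pre (x ∷ []) (entries vs))) ,
      trans (cong (_+ c) (trans (List.length-++ pre) (+-comm (length pre) 1))) (trans (sym (+-suc (length pre) c)) len)
      where
      x = List.map (λ i → suc (toℕ i)) (Vec.toList v)

    entries-member : ∀ {c} pre (vs : Vec (Vec (Fin m) n) c) → entries w ≡ pre ++ entries vs → length pre + c ≡ 2+ k′ →
      ∀ s → Pointwise _∈_ (entriesOf settled c s) (entries vs)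
    entries-member pre []       eq len s = []
    entries-member pre (v ∷ vs) eq len s =
      let pre′ , eq′ , len′ = next-prefix pre v vs eq len in
      subst (_∈ _) (sym (at-prefix pre (v ∷ vs) eq len (rem s n))) (nth-∈ v (rem-< s n)) ∷ entries-member pre′ vs eq′ len′ (quot s n)

    entries-index : ∀ {c} pre (vs : Vec (Vec (Fin m) n) c) → entries w ≡ pre ++ entries vs → length pre + c ≡ 2+ k′ →
      ∀ {s} → Pointwise _∈_ s (entries vs) → Σ[ j ∈ ℕ ] j < n ^ c × entriesOf settled c j ≡ s
    entries-index pre []       eq len [] = 0 , z<s , refl
    entries-index {suc c} pre (v ∷ vs) eq len (x∈ ∷ rest) =
      let pre′ , eq′ , len′ = next-prefix pre v vs eq len
          j , j< , tail≡ = entries-index pre′ vs eq′ len′ rest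
          p , p<n , head≡ = ∈-nth v x∈
          rem≡ : rem (p + j * n) n ≡ p
          rem≡ = trans (rem≡% (p + j * n) n) (trans ([m+kn]%n≡m%n p j n) (m<n⇒m%n≡m p<n))
          quot≡ : quot (p + j * n) n ≡ j
          quot≡ = trans (quot≡/ (p + j * n) n) (trans (+-distrib-/-∣ʳ p {j * n} {n} (divides j refl))
            (cong₂ _+_ (m<n⇒m/n≡0 p<n) (m*n/n≡m j n)))
      -- The position in the head list is the lowest base-`n` digit of the guess.
      in p + j * n ,
         ≤-trans (+-monoˡ-≤ (j * n) p<n) (≤-trans (*-monoˡ-≤ n j<) (≤-reflexive (*-comm (n ^ c) n))) ,
         cong₂ _∷_ (trans (at-prefix pre (v ∷ vs) eq len (rem (p + j * n) n)) (trans (cong (value v) rem≡) head≡))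
                   (trans (cong (entriesOf settled c) quot≡) tail≡)

  answer-member : ∀ b → FPᵛ b < n → FQᵛ b < n → Pointwise _∈_ (answer b) (entries w)
  answer-member b P<n Q<n = nth-∈ w₁ P<n ∷ nth-∈ w₂ Q<n ∷ entries-member (_ ∷ _ ∷ []) ws refl refl (FJᵛ b)

  InRange Correct : Best → Set
  InRange b = FPᵛ b < n × FQᵛ b < n
  Correct b = InRange b × sum (answer b) ≡ targetPart

  correct? : ∀ b → Dec (Correct b)
  correct? b = (FPᵛ b <? n ×-dec FQᵛ b <? n) ×-dec (sum (answer b) ≟ targetPart)

  record Solved : Set where
    field
      p₁ p₂ j : ℕ
      p₁<n    : p₁ < n
      p₂<n    : p₂ < n
      j<count : j < count
      sum≡    : value w₁ p₁ + value w₂ p₂ + sum (entriesOf settled k′ j) ≡ targetPart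
      target≡ : t ≡ ℤ.+ targetPart

  private
    count≡ : count ≡ n ^ k′
    count≡ = trans (quot≡/ (n * (n * n ^ k′)) (n * n) {{m*n≢0 n n}}) (trans
      (cong (λ z → _/_ z (n * n) {{m*n≢0 n n}}) (trans (sym (*-assoc n n (n ^ k′))) (*-comm (n * n) (n ^ k′))))
      (m*n/n≡m (n ^ k′) (n * n) {{m*n≢0 n n}}))

    targetPart≡ : ∀ {s} → Pointwise _∈_ s (entries w) → ℤ.+ sum s ≡ t → targetPart ≡ sum s
    targetPart≡ {s} s∈ refl = rem-small (≤-<-trans (sum-bound w s∈) (digits-upper (proj₂ (digits 0 ((2+ k′) * m)))))

  solved : Solvable I → Solved
  solved (x ∷ y ∷ s , s∈@(x∈ ∷ y∈ ∷ rest) , refl) =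
    let p₁ , p₁<n , eq₁ = ∈-nth w₁ x∈
        p₂ , p₂<n , eq₂ = ∈-nth w₂ y∈
        j , j< , eq = entries-index (_ ∷ _ ∷ []) ws refl refl rest
        T≡ = targetPart≡ s∈ refl
    in record { p₁ = p₁ ; p₂ = p₂ ; j = j ; p₁<n = p₁<n ; p₂<n = p₂<n ; j<count = subst (j <_) (sym count≡) j<
              ; sum≡ = trans (cong₂ _+_ (cong₂ _+_ eq₁ eq₂) (cong sum eq)) (trans (+-assoc x y (sum s)) (sym T≡))
              ; target≡ = cong ℤ.+_ (sym T≡) }

  correct⇒solution : Solvable I → ∀ b → Correct b → Solution I (answer b)
  correct⇒solution (s , s∈ , refl) b ((P<n , Q<n) , eq) = answer-member b P<n Q<n , cong ℤ.+_ (trans eq (targetPart≡ s∈ refl))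

  valid : ∀ u i → restᵛ u ≡ sum (entriesOf settled k′ (Jᵛ u)) → ∀ x y → Hits settled u i Correct x y →
    Correct (best (rem (x + c₁ᵛ i) n) (rem (y + c₂ᵛ i) n) (Jᵛ u))
  valid u i rest≡ x y hit = (rem-< (x + c₁ᵛ i) n , rem-< (y + c₂ᵛ i) n) ,
    trans (sym (+-assoc (read 0 (rem (x + c₁ᵛ i) n)) _ _)) (trans (cong (read 0 (rem (x + c₁ᵛ i) n) + read 1 (rem (y + c₂ᵛ i) n) +_) (sym rest≡)) hit)

-- With `r = suc p` this is `(1 - 1/r) ^ r ≤ 1/2`: of `r` rounds that succeed with probability
-- `1/r`, all fail with probability at most 1/2. The first two terms of the binomial expansion
-- suffice.
power-gap : ∀ p → 2 * p ^ suc p ≤ suc p ^ suc p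
power-gap p = begin
  2 * (p * p ^ p)                       ≡⟨ lemma p (p ^ p) ⟩
  p ^ p * p + p * p ^ p                 ≤⟨ +-monoʳ-≤ (p ^ p * p) (*-monoˡ-≤ (p ^ p) (n≤1+n p)) ⟩
  p ^ p * p + suc p * p ^ p             ≤⟨ binomial p ⟩
  suc p ^ suc p                         ∎
  where
  open ≤-Reasoning
  lemma : ∀ p q → 2 * (p * q) ≡ q * p + p * q
  lemma = solve-∀
  lemma′ : ∀ p q r → p * q * p + (p * q + r * (p * q)) + r * q ≡ suc p * (q * p + r * q)
  lemma′ = solve-∀
  binomial : ∀ r → p ^ r * p + suc r * p ^ r ≤ suc p ^ suc r
  binomial zero = ≤-reflexive (lemma″ p)
    where
    lemma″ : ∀ p → 1 * p + 1 ≡ suc p * 1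
    lemma″ = solve-∀
  binomial (suc r) = ≤-trans (≤-trans (m≤m+n _ (suc r * p ^ r)) (≤-reflexive (lemma′ p (p ^ r) (suc r)))) (*-monoʳ-≤ (suc p) (binomial r))

-- The machine's walk as a walk along the oracle.

module Link {m n k′ : ℕ} .{{_ : NonZero n}} (n∣m : n ∣ m)
            (w₁ w₂ : Vec (Fin m) n) (ws : Vec (Vec (Fin m) n) k′) (t : ℤ) where

  open Answers w₁ w₂ ws t
  open Setup I
  open Semantics I
  open Sizes (2+ k′) n m

  module _ .{{_ : NonZero buckets}} (fits : half + suc buckets * width ≤ n) (v : Vec Bool 3) (shift≤n : shift₁ half v ≤ n)
           (μ : ℕ) (i j : Fin n) (S : ℕ) where

    private
      c₁ c₂ : ℕ
      c₁ = shift₁ half v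
      c₂ = shift₂ half v

      it : Iteration
      it = iteration c₁ c₂ S

      β : Fin n → Fin (suc buckets)
      β = Pair.β half width buckets n∣m fits c₁ c₂ reach μ shift≤n i j w₁ w₂

      ⋆ : Fin (suc buckets)
      ⋆ = Fin.fromℕ buckets

      h : Vec (Fin n) (suc buckets)
      h = Pair.oracle half width buckets n∣m fits c₁ c₂ reach μ shift≤n i j w₁ S

    -- Reducing the accumulator in every round, as the machine does to stay within its space, agrees
    -- with a single reduction at the end.
    hash-loop : ∀ base l s a → hashLoop n base l s (rem a n) ≡ rem (a + combine (λ g → read 0 (rem (base + g) n)) l s) n
    hash-loop base zero    s a = cong (λ z → rem z n) (sym (+-identityʳ a))
    hash-loop base (suc l) s a = trans (cong (hashLoop n base l (quot s 2)) (rem-+ a (rem s 2 * read 0 (rem (base + l) n)) n))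
      (trans (hash-loop base l (quot s 2) (a + rem s 2 * read 0 (rem (base + l) n))) (cong (λ z → rem z n) (+-assoc a _ _)))

    hash≡oracle : ∀ u → hashValue settled it (toℕ u) ≡ toℕ (lookup h u)
    hash≡oracle u = begin
      hashLoop n (toℕ u * width + half + c₁) width S 0
        ≡⟨ cong (hashLoop n (toℕ u * width + half + c₁) width S) (sym (rem-0 n)) ⟩
      hashLoop n (toℕ u * width + half + c₁) width S (rem 0 n)
        ≡⟨ hash-loop (toℕ u * width + half + c₁) width S 0 ⟩
      rem (combine (λ g → value w₁ (rem (toℕ u * width + half + c₁ + g) n)) width S) n
        ≡⟨ combine-cong n width S (λ {g} _ → cong (λ p → rem (value w₁ (rem p n)) n) (lemma (toℕ u * width) half c₁ g)) ⟩
      rem (combine (λ g → value w₁ (rem (half + toℕ u * width + g + c₁) n)) width S) n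
        ≡⟨ sym (Oracles.lookup-oracle n∣m half width (suc buckets) c₁ fits shift≤n w₁ S u) ⟩
      toℕ (lookup h u) ∎
      where
      open ≡-Reasoning
      lemma : ∀ a b c g → a + b + c + g ≡ b + a + g + c
      lemma = solve-∀

    module _ (u : Tuple) (off≡ : offᵛ u ≡ Pair.offset half width buckets n∣m fits c₁ c₂ reach μ shift≤n i j w₁ w₂) where

      walk≡vertex : ∀ c → walk settled u it (hashValue settled it buckets) c ≡ toℕ (Walk.vertex β ⋆ h c)
      walk≡vertex zero    = trans (cong (hashValue settled it) (sym (Fin.toℕ-fromℕ buckets))) (hash≡oracle ⋆)
      walk≡vertex (suc c) = begin
        nextValue settled u it (walk settled u it (hashValue settled it buckets) c)
          ≡⟨ cong (nextValue settled u it) (walk≡vertex c) ⟩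
        hashValue settled it (bucketOf n half buckets c₁ c₂ (offᵛ u) (read 0) (read 1) (toℕ (Walk.vertex β ⋆ h c)))
          ≡⟨ cong (hashValue settled it) (trans (cong (λ o → bucketOf n half buckets c₁ c₂ o (value w₁) (value w₂) (toℕ (Walk.vertex β ⋆ h c))) off≡)
               (sym (Pair.toℕ-β half width buckets n∣m fits c₁ c₂ reach μ shift≤n i j w₁ w₂ (Walk.vertex β ⋆ h c)))) ⟩
        hashValue settled it (toℕ (β (Walk.vertex β ⋆ h c)))
          ≡⟨ hash≡oracle (β (Walk.vertex β ⋆ h c)) ⟩
        toℕ (Walk.vertex β ⋆ h (suc c)) ∎
        where open ≡-Reasoning

      found⇒wins : ∀ (V : Best → Set) → toℕ i < half → half ≤ toℕ j →
        read 0 (rem (toℕ i + c₁) n) + read 1 (rem (toℕ j + c₂) n) + restᵛ u ≡ targetPart →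
        0 < Pair.found half width buckets n∣m fits c₁ c₂ reach μ shift≤n i j w₁ w₂ h → Wins settled u it V
      found⇒wins V i<H H≤j hit pos =
        let a , a< , at-i , (c , 0<c , c≤ , meet) , collide = Rho.finds⇒ β ⋆ i j
              (Pair.βi≡βj half width buckets n∣m fits c₁ c₂ reach μ shift≤n i j i<H H≤j w₁ w₂)
              (Pair.i≢j half width buckets n∣m fits c₁ c₂ reach μ shift≤n i j i<H H≤j)
              reach h (𝟙-pos (Rho.finds? β ⋆ i j reach h) pos)
        in a , c , a< , c≤ , (0<c , trans (walk≡vertex c) (trans (cong toℕ meet) (sym (walk≡vertex (c + c))))) ,
           λ c (0<c , meet) → subst₂ (λ x y → read 0 (rem (x + c₁) n) + read 1 (rem (y + c₂) n) + restᵛ u ≡ targetPart)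
             (sym (trans (walk≡vertex a) (cong toℕ at-i)))
             (sym (trans (walk≡vertex (c + a)) (cong toℕ (collide c 0<c
               (Fin.toℕ-injective (trans (sym (walk≡vertex c)) (trans meet (walk≡vertex (c + c)))))))))
             hit

-- Runs of the whole program.

half-success : ∀ σ ρ (F : Vec Bool (suc (σ + ρ)) → ℕ) (χ : Vec Bool σ → ℕ) →
  (∀ bs → 1 ≤ F bs + χ (Vec.take σ (Vec.tail bs))) → 2 * ∑ (words bools σ) χ ≤ 2 ^ σ →
  2 ^ suc (σ + ρ) ≤ 2 * ∑ (words bools (suc (σ + ρ))) F
half-success σ ρ F χ cover few = +-cancelʳ-≤ (2 ^ suc (σ + ρ)) _ _ (begin
  2 ^ τ + 2 ^ τ
    ≡⟨ cong (2 ^ τ +_) (sym (+-identityʳ (2 ^ τ))) ⟩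
  2 * 2 ^ τ
    ≡⟨ cong (2 *_) (trans (sym (length-words bools τ)) (length-∑ (words bools τ))) ⟩
  2 * ∑ (words bools τ) (λ _ → 1)
    ≤⟨ *-monoʳ-≤ 2 (≤-trans (∑-mono (words bools τ) cover) (≤-reflexive (∑-+ (words bools τ) F _))) ⟩
  2 * (∑ (words bools τ) F + ∑ (words bools τ) (λ bs → χ (Vec.take σ (Vec.tail bs))))
    ≡⟨ cong (λ z → 2 * (∑ (words bools τ) F + z)) (trans (∑-halves σ ρ (λ us _ → χ us))
         -- Only the `σ` coins of the search decide about failure; the leading coin and the last `ρ`
         -- coins are averaged out.
         (cong (2 *_) (trans (∑-cong (words bools σ) (λ us → trans (∑-const (words bools ρ) (χ us)) (cong (_* χ us) (length-words bools ρ))))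
           (∑-*ˡ (words bools σ) (2 ^ ρ) χ)))) ⟩
  2 * (∑ (words bools τ) F + 2 * (2 ^ ρ * ∑ (words bools σ) χ))
    ≡⟨ lemma (∑ (words bools τ) F) (2 ^ ρ) (∑ (words bools σ) χ) ⟩
  2 * ∑ (words bools τ) F + 2 * (2 ^ ρ * (2 * ∑ (words bools σ) χ))
    ≤⟨ +-monoʳ-≤ (2 * ∑ (words bools τ) F) (*-monoʳ-≤ 2 (*-monoʳ-≤ (2 ^ ρ) few)) ⟩
  2 * ∑ (words bools τ) F + 2 * (2 ^ ρ * 2 ^ σ)
    ≡⟨ cong (λ z → 2 * ∑ (words bools τ) F + 2 * z) (trans (*-comm (2 ^ ρ) (2 ^ σ)) (sym (^-distribˡ-+-* 2 σ ρ))) ⟩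
  2 * ∑ (words bools τ) F + 2 ^ τ ∎)
  where
  open ≤-Reasoning
  τ : ℕ
  τ = suc (σ + ρ)
  lemma : ∀ f r x → 2 * (f + 2 * (r * x)) ≡ 2 * f + 2 * (r * (2 * x))
  lemma = solve-∀

module Program (I : Instance) (read≤m : ∀ a p → Semantics.read I a p ≤ Instance.m I)
               (V W : Best → Set) (V⇒W : ∀ {b} → V b → W b)
               (fail : Best → ℕ) (V⇒0 : ∀ {b} → V b → fail b ≡ 0) (W₀ : W (best 0 0 0)) where

  open Instance I
  open Sizes k n m
  open Setup I
  open Execution {58} I
  open Semantics I
  open Iterate I settled V W V⇒W fail V⇒0 2^width≤cap
  open Tuples I settled V W V⇒W fail V⇒0 2^width≤cap m read≤m k₂m<cap
  open Contraction χ public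

  initialStore : Store 58
  initialStore = Vec.replicate 58 0

  Final : Store 58 → Set
  Final ρ = Σ[ u ∈ Tuple ] State u ρ

  search-rand : (∀ j u → Ready j u → Valid u) → ∀ j
    (win : Vec Bool 3 → ℕ → ℕ) → (∀ u → Ready j u → ∀ v S → 0 < win v S → Wins settled u (choice v S) V) →
    ∀ x y → y * ∑ (words bools 3) (λ v → ∑< (2 ^ width) (λ S → 1 ∸ win v S)) ≤ x * (8 * 2 ^ width) →
    RandAt initialStore (setupCmd ⨟ tuplesCmd) totalCost (factor j (x ^ rounds) count) (factor j (y ^ rounds) count) Final
  search-rand valid j win wins x y enough =
    weaken (λ _ (u , _ , st) → u , st) (from (det-seq
      {P = _≡ initialStore}
      {Q = λ ρ → Σ[ u ∈ Tuple ] Jᵛ u ≡ count × State u ρ}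
      {d = tuplesCmd} {setupCost}
      {loopCost (tupleCost width (reach + reach) rounds (k ∸ 1 ∸ 1)) count}
      (λ { _ refl → let ρ′ , ex , c , z , eq , _ = runs-setup
                    in ρ′ , ex , (tuple count 0 0 0 , refl , best 0 0 0 , iteration c 0 0 , walker 0 0 0 0 0 , z , eq , W₀) , ≤-reflexive (cong χ eq) })
      (tuples-rand valid j win wins x y enough count)) initialStore refl)

  private
    stopped : ∀ {τ} ρ o (bs : Vec Bool τ) → run′ ⟨ [] , ρ , o ⟩ bs ≡ ⟨ [] , ρ , o ⟩
    stopped ρ o []       = refl
    stopped ρ o (_ ∷ bs) = stopped ρ o bs

    split-run : ∀ {κ κ₁ κ₂ : Config 58} σ {τ} (bs : Vec Bool (σ + τ)) → run′ κ (Vec.take σ bs) ≡ κ₁ → run′ κ₁ (Vec.drop σ bs) ≡ κ₂ → run′ κ bs ≡ κ₂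
    split-run {κ} σ bs eq₁ eq₂ = trans (cong (run′ κ) (sym (Vec.take++drop≡id σ bs)))
      (trans (run′-++ κ (Vec.take σ bs) (Vec.drop σ bs)) (trans (cong (λ κ → run′ κ (Vec.drop σ bs)) eq₁) eq₂))

  bestOf : Store 58 → Best
  bestOf ρ = best (lookup ρ FPᵣ) (lookup ρ FQᵣ) (lookup ρ FJᵣ)

  -- The time bound exceeds the exact running time, and the `e` surplus coins are spent by the
  -- halted machine, whose configuration no longer changes.
  run-program : ∀ {fin : Vec Bool totalCost → Store 58} → Exec (setupCmd ⨟ tuplesCmd) totalCost initialStore fin → (∀ bs → Final (fin bs)) →
    ∀ e (bs : Vec Bool (suc (totalCost + (emitCost (k ∸ 1 ∸ 1) + e)))) →
    Σ[ ρ ∈ Store 58 ] run kSum I (Vec.toList bs) ≡ ⟨ [] , ρ , Emission.answer I settled (bestOf (fin (Vec.take totalCost (Vec.tail bs)))) ⟩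
  run-program {fin} ex post e (b₀ ∷ bs) = go (post (Vec.take totalCost bs))
    where
    us = Vec.take totalCost bs
    vs = Vec.drop totalCost bs
    go : Final (fin us) → _
    go (u , b , i , w , z , eq , _) =
      let ρ , emits , _ = Emission.emits-answer I settled u b i w z
          out = Emission.answer I settled
      in ρ , trans (steps≡run′ (initial kSum) (b₀ ∷ bs))
        (split-run {⟨ (setupCmd ⨟ tuplesCmd) ∷ emitCmd ∷ [] , initialStore , [] ⟩} totalCost bs
          (trans (ex us (emitCmd ∷ []) []) (cong (λ ρ → ⟨ emitCmd ∷ [] , ρ , [] ⟩) eq))
          (split-run (emitCost (k ∸ 1 ∸ 1)) vs (emits (Vec.take (emitCost (k ∸ 1 ∸ 1)) vs) [] [])
            (trans (stopped ρ (out b) (Vec.drop (emitCost (k ∸ 1 ∸ 1)) vs))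
              (cong (λ ρ′ → ⟨ [] , ρ , out (bestOf ρ′) ⟩) (sym eq)))))

runTime : ℕ → ℕ → ℕ → ℕ
runTime k n m = suc (Sizes.totalCost k n m + emitCost (k ∸ 1 ∸ 1))

halts : ∀ {k n m} (w : Vectors k n m) t T → runTime k n m ≤ T → RunsInTime kSum (instanceOf w t) T
halts {k} {n} {m} w t T τ≤T coins = go (sym T≡) coins
  where
  -- With trivial predicates and no winning choice, what remains of the analysis is the exact
  -- running time.
  open Program (instanceOf w t) (read≤m w) (λ _ → ⊤) (λ _ → ⊤) (λ _ → tt) (λ _ → 0) (λ _ → refl) tt
  e : ℕ
  e = T ∸ runTime k n m
  T≡ : suc (Sizes.totalCost k n m + (emitCost (k ∸ 1 ∸ 1) + e)) ≡ T
  T≡ = trans (cong suc (sym (+-assoc (Sizes.totalCost k n m) _ e))) (m+[n∸m]≡n τ≤T)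
  go : ∀ {T} → T ≡ suc (Sizes.totalCost k n m + (emitCost (k ∸ 1 ∸ 1) + e)) → (coins : Vec Bool T) →
    Config.control (run kSum (instanceOf w t) (Vec.toList coins)) ≡ []
  go refl coins =
    let outcome fin ex post _ = search-rand (λ _ _ _ _ _ _ _ → tt) 0 (λ _ _ → 0) (λ _ _ _ _ ()) 1 1 (no-wins (2 ^ Sizes.width k n m))
    in cong Config.control (proj₂ (run-program ex post e coins))

-- Success on typical lists.

∑<-complement : ∀ N (F : ℕ → ℕ) → (∀ x → F x ≤ 1) → ∑< N (λ x → 1 ∸ F x) + ∑< N F ≡ N
∑<-complement zero    F le = refl
∑<-complement (suc N) F le = trans (interchange (1 ∸ F 0) _ (F 0) _)
  (cong₂ _+_ (m∸n+n≡m (le 0)) (∑<-complement N (F ∘ suc) (le ∘ suc)))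

complement-share : ∀ W′ W N r → W′ + W ≡ N → N ≤ suc r * W → suc r * W′ ≤ r * N
complement-share W′ W N r refl le = +-cancelʳ-≤ (W′ + W) _ _ (begin
  suc r * W′ + (W′ + W)       ≤⟨ +-monoʳ-≤ (suc r * W′) le ⟩
  suc r * W′ + suc r * W      ≡⟨ sym (*-distribˡ-+ (suc r) W′ W) ⟩
  W′ + W + r * (W′ + W)       ≡⟨ +-comm (W′ + W) _ ⟩
  r * (W′ + W) + (W′ + W)     ∎)
  where open ≤-Reasoning

term≤∑-bools : ∀ l (f : Vec Bool l → ℕ) v → f v ≤ ∑ (words bools l) f
term≤∑-bools zero    f [] = m≤m+n (f []) 0
term≤∑-bools (suc l) f (b ∷ v) = ≤-trans (term≤∑-bools l (λ v → f (b ∷ v)) v)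
  (≤-trans (pick b) (≤-reflexive (sym (∑-words-suc bools l f))))
  where
  pick : ∀ b → ∑ (words bools l) (λ v → f (b ∷ v)) ≤ ∑ bools (λ b → ∑ (words bools l) (λ v → f (b ∷ v)))
  pick true  = m≤m+n _ _
  pick false = ≤-trans (m≤m+n _ 0) (m≤n+m _ (∑ (words bools l) (λ v → f (true ∷ v))))

-- What the analysis needs to know about the sizes chosen by the program; it
-- holds for all large n.
record Regime (k n m : ℕ) : Set where
  open Sizes k n m
  field
    μ q e     : ℕ
    0<buckets : 0 < buckets
    0<half    : 0 < half
    0<width   : 0 < width
    0<rounds  : 0 < rounds
    fits      : half + suc buckets * width ≤ n
    2half≤n   : half + half ≤ n
    n≤2half+1 : n ≤ suc (half + half)
    buckets≤m : buckets ≤ m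
    small     : 2 * ((reach + reach) * ((reach + reach) * (μ + μ))) ≤ n
    4q≤       : 4 * q ≤ buckets + 2
    n≤qe      : n ≤ q * e
    tail      : 8 * (buckets * 2 ^ e) ≤ 2 ^ μ
    many      : 512 * (n * n * (n * n * (n * n))) ≤ (2 ^ width ∸ 1) * (reach * reach * (reach * reach))
    repeats   : ∀ X → (2 ^ width ∸ 1) * (reach * reach) ≤ 4 * (n * n) * X → 8 * 2 ^ width ≤ rounds * X

all-succeed : ∀ A I T → ¬ Solvable I → ∑ (words bools T) (λ coins → 𝟙 (succeeds? A I (Vec.toList coins))) ≡ 2 ^ T
all-succeed A I T ¬s = trans (∑-cong (words bools T) (λ coins → 𝟙-yes (succeeds? A I (Vec.toList coins)) (λ s → contradiction s ¬s)))
  (trans (sym (length-∑ (words bools T))) (length-words bools T))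

module Large {k′ n m : ℕ} .{{n≢0 : NonZero n}} (n∣m : n ∣ m) (R : Regime (2+ k′) n m) where

  open Regime R
  open Sizes (2+ k′) n m

  private instance
    buckets≢0 : NonZero buckets
    buckets≢0 = >-nonZero 0<buckets

  badness : Vec (Fin m) n → Vec (Fin m) n → ℕ
  badness = Typical.badness half width buckets reach μ n∣m fits 2half≤n n≤2half+1 0<half buckets≤m 0<width small q e 4q≤ n≤qe tail many

  badness-rare : 2 * ∑ (words (allFin m) n) (λ w₁ → ∑ (words (allFin m) n) (badness w₁)) ≤ length (words (allFin m) n) * length (words (allFin m) n)
  badness-rare = Typical.badness-rare half width buckets reach μ n∣m fits 2half≤n n≤2half+1 0<half buckets≤m 0<width small q e 4q≤ n≤qe tail many

  private
    shift≤n : ∀ v → shift₁ half v ≤ n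
    shift≤n = Typical.shift₁≤n half width buckets reach μ n∣m fits 2half≤n n≤2half+1 0<half buckets≤m 0<width small q e 4q≤ n≤qe tail many

  module _ (w₁ w₂ : Vec (Fin m) n) (ws : Vec (Vec (Fin m) n) k′) (t : ℤ) (good : badness w₁ w₂ ≡ 0) where

    open Answers w₁ w₂ ws t
    open Setup I using (settled; targetPart)
    open Semantics I
    open Emission I settled using (answer)
    open Program I (read≤m w) Correct InRange proj₁ (λ b → 𝟙 (¬? (correct? b))) (λ {b} c → 𝟙-no (¬? (correct? b)) (λ ¬c → ¬c c))
                 (>-nonZero⁻¹ n , >-nonZero⁻¹ n)
    open Iterate I settled Correct InRange proj₁ (λ b → 𝟙 (¬? (correct? b))) (λ {b} c → 𝟙-no (¬? (correct? b)) (λ ¬c → ¬c c)) 2^width≤cap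
      using (χ; Valid; choice)
    open Tuples I settled Correct InRange proj₁ (λ b → 𝟙 (¬? (correct? b))) (λ {b} c → 𝟙-no (¬? (correct? b)) (λ ¬c → ¬c c)) 2^width≤cap
      m (read≤m w) k₂m<cap using (Ready; total; factor; factor->)

    private
      valid-ready : ∀ j u → Ready j u → Valid u
      valid-ready j u (refl , rest≡ , _) i = valid u i rest≡

      module _ (s : Solved) where
        open Solved s

        cover : Σ[ v ∈ Vec Bool 3 ] Σ[ x ∈ Fin n ] Σ[ y ∈ Fin n ]
          toℕ x < half × half ≤ toℕ y × rem (toℕ x + shift₁ half v) n ≡ p₁ × rem (toℕ y + shift₂ half v) n ≡ p₂
        cover = Typical.covered half width buckets reach μ n∣m fits 2half≤n n≤2half+1 0<half buckets≤m 0<width small q e 4q≤ n≤qe tail many p₁ p₂ p₁<n p₂<n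

        v₀ : Vec Bool 3
        v₀ = proj₁ cover

        x y : Fin n
        x = proj₁ (proj₂ cover)
        y = proj₁ (proj₂ (proj₂ cover))

        x<half : toℕ x < half
        x<half = proj₁ (proj₂ (proj₂ (proj₂ cover)))

        half≤y : half ≤ toℕ y
        half≤y = proj₁ (proj₂ (proj₂ (proj₂ (proj₂ cover))))

        aligned? : ∀ v → Dec (rem (toℕ x + shift₁ half v) n ≡ p₁ × rem (toℕ y + shift₂ half v) n ≡ p₂)
        aligned? v = (rem (toℕ x + shift₁ half v) n ≟ p₁) ×-dec (rem (toℕ y + shift₂ half v) n ≟ p₂)

        hit : Vec Bool 3 → ℕ → ℕ
        hit v S = Pair.found half width buckets n∣m fits (shift₁ half v) (shift₂ half v) reach μ (shift≤n v) x y w₁ w₂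
                    (Pair.oracle half width buckets n∣m fits (shift₁ half v) (shift₂ half v) reach μ (shift≤n v) x y w₁ S)

        hit≤1 : ∀ v S → hit v S ≤ 1
        hit≤1 v S = 𝟙≤1 (Rho.finds? (Pair.β half width buckets n∣m fits (shift₁ half v) (shift₂ half v) reach μ (shift≤n v) x y w₁ w₂)
                      (Fin.fromℕ buckets) x y reach (Pair.oracle half width buckets n∣m fits (shift₁ half v) (shift₂ half v) reach μ (shift≤n v) x y w₁ S))

        -- A hit counts only for offsets that carry the vertices `x` and `y` to the positions of the
        -- solution; `v₀` is one such choice of the bits.
        win : Vec Bool 3 → ℕ → ℕ
        win v S = 𝟙 (aligned? v) * hit v S

        win≤1 : ∀ v S → win v S ≤ 1
        win≤1 v S = *-mono-≤ (𝟙≤1 (aligned? v)) (hit≤1 v S)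

        factors-pos : ∀ a b → 0 < a * b → 0 < a × 0 < b
        factors-pos zero    b       ()
        factors-pos (suc a) zero    p = contradiction p (λ p → <⇒≢ p (sym (*-zeroʳ (suc a))))
        factors-pos (suc a) (suc b) p = z<s , z<s

        wins : ∀ u → Ready j u → ∀ v S → 0 < win v S → Wins settled u (choice v S) Correct
        wins u (_ , rest≡ , off≡) v S pos =
          let al⁺ , hit⁺ = factors-pos (𝟙 (aligned? v)) (hit v S) pos
              at₁ , at₂ = 𝟙-pos (aligned? v) al⁺
          in Link.found⇒wins n∣m w₁ w₂ ws t fits v (shift≤n v) μ x y S u
               (trans off≡ (trans (offset-eq (value w₁ p₁) (value w₂ p₂) (total j) (m * buckets) targetPart sum≡)
                 (cong₂ (λ a b → value w₁ a + value w₂ b + m * buckets) (sym at₁) (sym at₂))))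
               Correct x<half half≤y
               (trans (cong₂ _+_ (cong₂ (λ a b → value w₁ a + value w₂ b) at₁ at₂) rest≡) sum≡)
               hit⁺
          where
          offset-eq : ∀ a b r M T → a + b + r ≡ T → T + M ∸ r ≡ a + b + M
          offset-eq a b r M T refl = trans (cong (_∸ r) (lemma a b r M)) (m+n∸n≡m (a + b + M) r)
            where
            lemma : ∀ a b r M → a + b + r + M ≡ a + b + M + r
            lemma = solve-∀

        hits : ℕ
        hits = ∑ (allFin (2 ^ width ∸ 1)) (λ S → hit v₀ (suc (toℕ S)))

        many-hits : 8 * 2 ^ width ≤ rounds * hits
        many-hits = repeats hits (Typical.typical half width buckets reach μ n∣m fits 2half≤n n≤2half+1 0<half buckets≤m 0<width small q e 4q≤ n≤qe tail many
          w₁ w₂ good v₀ x y x<half half≤y)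

        all-wins no-win : ℕ
        all-wins = ∑ (words bools 3) (λ v → ∑< (2 ^ width) (win v))
        no-win   = ∑ (words bools 3) (λ v → ∑< (2 ^ width) (λ S → 1 ∸ win v S))

        hits≤wins : hits ≤ all-wins
        hits≤wins = begin
          hits
            ≡⟨ ∑-allFin≡∑< (2 ^ width ∸ 1) (hit v₀ ∘ suc) ⟩
          ∑< (2 ^ width ∸ 1) (hit v₀ ∘ suc)
            -- The machine may also toss the seed 0, which is missing from `hits`.
            ≤⟨ m≤n+m _ (hit v₀ 0) ⟩
          ∑< (suc (2 ^ width ∸ 1)) (hit v₀)
            ≡⟨ cong (λ N → ∑< N (hit v₀)) (m+[n∸m]≡n (>-nonZero⁻¹ (2 ^ width) {{m^n≢0 2 width}})) ⟩
          ∑< (2 ^ width) (hit v₀)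
            ≡⟨ ∑<-cong (2 ^ width) (λ S → sym (trans (cong (_* hit v₀ S) (𝟙-yes (aligned? v₀) (proj₂ (proj₂ (proj₂ (proj₂ (proj₂ cover)))))))
                 (*-identityˡ (hit v₀ S)))) ⟩
          ∑< (2 ^ width) (win v₀)
            ≤⟨ term≤∑-bools 3 (λ v → ∑< (2 ^ width) (win v)) v₀ ⟩
          all-wins ∎
          where open ≤-Reasoning

        complement : no-win + all-wins ≡ 8 * 2 ^ width
        complement = trans (sym (∑-+ (words bools 3) (λ v → ∑< (2 ^ width) (λ S → 1 ∸ win v S)) (λ v → ∑< (2 ^ width) (win v))))
          (trans (∑-cong (words bools 3) (λ v → ∑<-complement (2 ^ width) (win v) (win≤1 v))) (∑-const (words bools 3) (2 ^ width)))

        record FewFailures (σ : ℕ) : Set where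
          constructor fewFailures
          field
            final : Vec Bool σ → Store 58
            runs  : Execution.Exec I (setupCmd ⨟ tuplesCmd) σ initialStore final
            post  : ∀ bs → Final (final bs)
            few   : 2 * ∑ (words bools σ) (χ ∘ final) ≤ 2 ^ σ

        -- The right guess contracts the failure by `(r / rounds) ^ rounds`, at most 1/2 by
        -- `power-gap`, and the failure indicator of the initial store is at most 1.
        halve : ∀ {σ} r → rounds ≡ suc r →
          RandAt initialStore (setupCmd ⨟ tuplesCmd) σ (factor j (r ^ rounds) count) (factor j (rounds ^ rounds) count) Final → FewFailures σ
        halve {σ} r rounds≡ (outcome fin ex post le) = fewFailures fin ex post (*-cancelˡ-≤ (rounds ^ rounds) {{nz}} (begin
          rounds ^ rounds * (2 * X)          ≡⟨ lemma₁ (rounds ^ rounds) X ⟩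
          2 * (rounds ^ rounds * X)          ≡⟨ cong (λ z → 2 * (z * X)) (sym (factor-> j (rounds ^ rounds) j<count)) ⟩
          2 * (factor j (rounds ^ rounds) count * X)
                                             ≤⟨ *-monoʳ-≤ 2 le ⟩
          2 * (factor j (r ^ rounds) count * χ initialStore * 2 ^ σ)
                                             ≤⟨ *-monoʳ-≤ 2 (*-monoˡ-≤ (2 ^ σ) (*-monoʳ-≤ (factor j (r ^ rounds) count) (𝟙≤1 (¬? (correct? (bestOf initialStore)))))) ⟩
          2 * (factor j (r ^ rounds) count * 1 * 2 ^ σ)
                                             ≡⟨ trans (cong (λ z → 2 * (z * 1 * 2 ^ σ)) (factor-> j (r ^ rounds) j<count)) (lemma₂ (r ^ rounds) (2 ^ σ)) ⟩
          2 * r ^ rounds * 2 ^ σ             ≤⟨ *-monoˡ-≤ (2 ^ σ) (subst (λ z → 2 * r ^ z ≤ z ^ z) (sym rounds≡) (power-gap r)) ⟩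
          rounds ^ rounds * 2 ^ σ            ∎))
          where
          open ≤-Reasoning
          X : ℕ
          X = ∑ (words bools σ) (χ ∘ fin)
          nz : NonZero (rounds ^ rounds)
          nz = m^n≢0 rounds rounds {{>-nonZero 0<rounds}}
          lemma₁ : ∀ a x → a * (2 * x) ≡ 2 * (a * x)
          lemma₁ = solve-∀
          lemma₂ : ∀ a x → 2 * (a * 1 * x) ≡ 2 * a * x
          lemma₂ = solve-∀

        rounds≡ : rounds ≡ suc (rounds ∸ 1)
        rounds≡ = sym (m+[n∸m]≡n 0<rounds)

        enough : rounds * no-win ≤ (rounds ∸ 1) * (8 * 2 ^ width)
        enough = subst (λ z → z * no-win ≤ (rounds ∸ 1) * (8 * 2 ^ width)) (sym rounds≡)
          (complement-share no-win all-wins (8 * 2 ^ width) (rounds ∸ 1) complement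
            (subst (λ z → 8 * 2 ^ width ≤ z * all-wins) rounds≡ (≤-trans many-hits (*-monoʳ-≤ rounds hits≤wins))))

        searched : RandAt initialStore (setupCmd ⨟ tuplesCmd) totalCost (factor j ((rounds ∸ 1) ^ rounds) count) (factor j (rounds ^ rounds) count) Final
        searched = search-rand valid-ready j win wins (rounds ∸ 1) rounds enough

        few-failures : FewFailures totalCost
        few-failures = halve {totalCost} (rounds ∸ 1) rounds≡ searched

        covers : ∀ {σ e′} (fin : Vec Bool σ → Store 58) (bs : Vec Bool (suc (σ + e′))) → Solvable I →
          Σ[ ρ ∈ Store 58 ] run kSum I (Vec.toList bs) ≡ ⟨ [] , ρ , answer (bestOf (fin (Vec.take σ (Vec.tail bs)))) ⟩ →
          Dec (Correct (bestOf (fin (Vec.take σ (Vec.tail bs))))) →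
          1 ≤ 𝟙 (succeeds? kSum I (Vec.toList bs)) + χ (fin (Vec.take σ (Vec.tail bs)))
        covers fin bs solvable (_ , ran) (yes c) = ≤-trans (≤-reflexive (sym (𝟙-yes (succeeds? kSum I (Vec.toList bs))
          (λ _ → subst (Solution I) (sym (cong Config.output ran)) (correct⇒solution solvable _ c))))) (m≤m+n _ _)
        covers {σ} fin bs solvable _ (no ¬c) = ≤-trans (≤-reflexive (sym (𝟙-yes (¬? (correct? (bestOf (fin (Vec.take σ (Vec.tail bs)))))) ¬c))) (m≤n+m _ _)

        halved : ∀ {σ e′ T} → suc (σ + e′) ≡ T → (fs : FewFailures σ) → Solvable I →
          (∀ (bs : Vec Bool (suc (σ + e′))) → Σ[ ρ ∈ Store 58 ]
            run kSum I (Vec.toList bs) ≡ ⟨ [] , ρ , answer (bestOf (FewFailures.final fs (Vec.take σ (Vec.tail bs)))) ⟩) →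
          2 ^ T ≤ 2 * ∑ (words bools T) (λ coins → 𝟙 (succeeds? kSum I (Vec.toList coins)))
        halved {σ} {e′} refl (fewFailures fin _ _ few) solvable ran = half-success σ e′ _ (χ ∘ fin)
          (λ bs → covers fin bs solvable (ran bs) (correct? (bestOf (fin (Vec.take σ (Vec.tail bs)))))) few

    half-succeed : ∀ T → runTime (2+ k′) n m ≤ T →
      2 ^ T ≤ 2 * ∑ (words bools T) (λ coins → 𝟙 (succeeds? kSum I (Vec.toList coins)))
    half-succeed T τ≤T = go (solvable? I)
      where
      e′ : ℕ
      e′ = T ∸ runTime (2+ k′) n m
      go : Dec (Solvable I) → 2 ^ T ≤ 2 * ∑ (words bools T) (λ coins → 𝟙 (succeeds? kSum I (Vec.toList coins)))
      go (no ¬s) = ≤-trans (≤-reflexive (sym (all-succeed kSum I T ¬s))) (m≤n*m _ 2)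
      go (yes s) = halved (solved s) {totalCost} {emitCost k′ + e′} {T}
        (trans (cong suc (sym (+-assoc totalCost (emitCost k′) e′))) (m+[n∸m]≡n τ≤T))
        (few-failures (solved s)) s
        (run-program (FewFailures.runs (few-failures (solved s))) (FewFailures.post (few-failures (solved s))) e′)

-- Space.

-- A register of rank r holds at most B ^ 2 ^ r.  Sums and products raise the
-- rank, so every accumulator has to be reduced modulo a register of its own rank.
ranks : Vec ℕ 58
ranks =
  0 ∷ 0 ∷ 0 ∷ 0 ∷ 0 ∷ 0 ∷ 0 ∷ 0 ∷ 0 ∷ 0 ∷ 0 ∷ 0 ∷ 1 ∷ 3 ∷ 4 ∷ 5 ∷ 6 ∷ 6 ∷ 6 ∷ 7 ∷ 0 ∷ 7 ∷ 0 ∷ 7 ∷ 10 ∷ 6 ∷ 6 ∷ 6 ∷ 7 ∷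
  0 ∷ 6 ∷ 7 ∷ 11 ∷ 1 ∷ 1 ∷ 1 ∷ 2 ∷ 2 ∷ 6 ∷ 8 ∷ 1 ∷ 1 ∷ 1 ∷ 1 ∷
  2 ∷ 0 ∷ 1 ∷ 6 ∷ 8 ∷ 11 ∷ 0 ∷ 0 ∷ 0 ∷ 0 ∷ 9 ∷ 10 ∷ 12 ∷ 13 ∷ []

rank : Register → ℕ
rank = lookup ranks

-- The bound of one rank is the square of the preceding one, which has room for a sum or product of
-- two operands. Differences and quotients are bounded by the left operand, remainders by either; 8
-- is the largest literal.
admissible : Expr 58 → ℕ → Bool
admissible (const c) r = c ≤ᵇ 8
admissible (x ⊕ y)   r = suc (rank x ⊔ rank y) ≤ᵇ r
admissible (x ⊗ y)   r = suc (rank x ⊔ rank y) ≤ᵇ r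
admissible (x ⊖ y)   r = rank x ≤ᵇ r
admissible (x ⊘ y)   r = rank x ≤ᵇ r
admissible (x ⊛ y)   r = (rank x ≤ᵇ r) ∨ (rank y ≤ᵇ r)
admissible _         r = true

ranked : Cmd 58 → Bool
ranked (x ≔ e)                  = admissible e (rank x)
ranked (emit x)                 = true
ranked skip                     = true
ranked (c ⨟ d)                  = ranked c ∧ ranked d
ranked (ifNonZero x then c else d) = ranked c ∧ ranked d
ranked (whileNonZero x loop c)  = ranked c

allRanked : List (Cmd 58) → Set
allRanked []      = ⊤
allRanked (c ∷ K) = T (ranked c) × allRanked K

T-∧₁ : ∀ a {b} → T (a ∧ b) → T a
T-∧₁ true _ = tt

T-∧₂ : ∀ a {b} → T (a ∧ b) → T b
T-∧₂ true t = t

quot≤ : ∀ x y → quot x y ≤ x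
quot≤ x zero    = z≤n
quot≤ x (suc y) = m/n≤m x (suc y)

rem≤ˡ : ∀ x y → rem x y ≤ x
rem≤ˡ x zero    = z≤n
rem≤ˡ x (suc y) = m%n≤m x (suc y)

rem≤ʳ : ∀ x y → rem x y ≤ y
rem≤ʳ x zero    = z≤n
rem≤ʳ x (suc y) = <⇒≤ (m%n<n x (suc y))

levels : ℕ → ℕ → ℕ
levels B zero    = B
levels B (suc r) = levels B r * levels B r

module Space (I : Instance) (B : ℕ) (8≤B : 8 ≤ B) (k≤B : Instance.k I ≤ B) (n≤B : Instance.n I ≤ B) (m≤B : Instance.m I ≤ B)
             (read≤B : ∀ a p → Semantics.read I a p ≤ B) (power≤B : Instance.n I ^ Instance.k I ≤ B) where

  open Instance I

  bound : ℕ → ℕ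
  bound = levels B

  B≤bound : ∀ r → B ≤ bound r
  B≤bound zero    = ≤-refl
  B≤bound (suc r) = ≤-trans (B≤bound r) (m≤m*n (bound r) (bound r) {{>-nonZero (≤-trans (≤-trans (s≤s z≤n) 8≤B) (B≤bound r))}})

  bound-mono : ∀ {r s} → r ≤ s → bound r ≤ bound s
  bound-mono {s = s} z≤n       = B≤bound s
  bound-mono (s≤s le) = *-mono-≤ (bound-mono le) (bound-mono le)

  bound-+ : ∀ {a b r} → a ≤ bound r → b ≤ bound r → a + b ≤ bound (suc r)
  bound-+ {r = r} a≤ b≤ = ≤-trans (+-mono-≤ a≤ b≤) (≤-trans (≤-reflexive (cong (bound r +_) (sym (+-identityʳ (bound r)))))
    (*-monoˡ-≤ (bound r) (≤-trans (≤-trans (s≤s (s≤s z≤n)) 8≤B) (B≤bound r))))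

  Bounded : Store 58 → Set
  Bounded ρ = ∀ x → lookup ρ x ≤ bound (rank x)

  bounded-update : ∀ ρ x v → Bounded ρ → v ≤ bound (rank x) → Bounded (ρ [ x ]≔ v)
  bounded-update ρ x v bd v≤ y with x Fin.≟ y
  ... | yes refl = ≤-trans (≤-reflexive (Vec.lookup∘update x ρ v)) v≤
  ... | no x≢y   = ≤-trans (≤-reflexive (Vec.lookup∘update′ (x≢y ∘ sym) ρ v)) (bd y)

  private
    small : ∀ {v r} → v ≤ B → v ≤ bound r
    small {r = r} v≤B = ≤-trans v≤B (B≤bound r)

    2≤B : 2 ≤ B
    2≤B = ≤-trans (s≤s (s≤s z≤n)) 8≤B

    digit≤2 : ∀ p t → digit p t ≤ 2
    digit≤2 p t with 2 ^ p ≤ᵇ ℤ.∣ t ∣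
    ... | true  = rem≤ʳ (quot ℤ.∣ t ∣ (2 ^ p)) 2
    ... | false = ≤-refl

    sign≤1 : ∀ t → sign t ≤ 1
    sign≤1 (ℤ.+ _)    = z≤n
    sign≤1 ℤ.-[1+ _ ] = ≤-refl

    bit≤1 : ∀ b → bit b ≤ 1
    bit≤1 true  = ≤-refl
    bit≤1 false = z≤n

    T-∨ : ∀ a {b} → T (a ∨ b) → T a ⊎ T b
    T-∨ true  t = inj₁ t
    T-∨ false t = inj₂ t

  eval≤ : ∀ b ρ → Bounded ρ → ∀ e r → T (admissible e r) → eval I b ρ e ≤ bound r
  eval≤ b ρ bd (const c)       r ok = small {r = r} (≤-trans (≤ᵇ⇒≤ c 8 ok) 8≤B)
  eval≤ b ρ bd (x ⊕ y)         r ok = ≤-trans (bound-+ {r = rank x ⊔ rank y} (≤-trans (bd x) (bound-mono (m≤m⊔n (rank x) (rank y))))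
    (≤-trans (bd y) (bound-mono (m≤n⊔m (rank x) (rank y))))) (bound-mono (≤ᵇ⇒≤ (suc (rank x ⊔ rank y)) r ok))
  eval≤ b ρ bd (x ⊖ y)         r ok = ≤-trans (m∸n≤m (lookup ρ x) (lookup ρ y)) (≤-trans (bd x) (bound-mono (≤ᵇ⇒≤ (rank x) r ok)))
  eval≤ b ρ bd (x ⊗ y)         r ok = ≤-trans (*-mono-≤ (≤-trans (bd x) (bound-mono (m≤m⊔n (rank x) (rank y))))
    (≤-trans (bd y) (bound-mono (m≤n⊔m (rank x) (rank y))))) (bound-mono (≤ᵇ⇒≤ (suc (rank x ⊔ rank y)) r ok))
  eval≤ b ρ bd (x ⊘ y)     r ok = ≤-trans (quot≤ (lookup ρ x) (lookup ρ y)) (≤-trans (bd x) (bound-mono (≤ᵇ⇒≤ (rank x) r ok)))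
  eval≤ b ρ bd (x ⊛ y)     r ok with T-∨ (rank x ≤ᵇ r) ok
  ... | inj₁ t = ≤-trans (rem≤ˡ (lookup ρ x) (lookup ρ y)) (≤-trans (bd x) (bound-mono (≤ᵇ⇒≤ (rank x) r t)))
  ... | inj₂ t = ≤-trans (rem≤ʳ (lookup ρ x) (lookup ρ y)) (≤-trans (bd y) (bound-mono (≤ᵇ⇒≤ (rank y) r t)))
  eval≤ b ρ bd paramK          r ok = small {r = r} k≤B
  eval≤ b ρ bd paramN          r ok = small {r = r} n≤B
  eval≤ b ρ bd paramM          r ok = small {r = r} m≤B
  eval≤ b ρ bd (entry x y)     r ok = small {r = r} (read≤B _ _)
  eval≤ b ρ bd targetSign      r ok = small {r = r} (≤-trans (sign≤1 target) (≤-trans (s≤s z≤n) 2≤B))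
  eval≤ b ρ bd (targetDigit x) r ok = small {r = r} (≤-trans (digit≤2 (lookup ρ x) target) 2≤B)
  eval≤ b ρ bd coin            r ok = small {r = r} (≤-trans (bit≤1 b) (≤-trans (s≤s z≤n) 2≤B))

  private
    rest : List (Cmd 58)
    rest = sizesCmd ∷ tuplesCmd ∷ emitCmd ∷ []

    -- The ranks of the remaining program are checked by computation.
    rest-ranked : allRanked rest
    rest-ranked = tt , tt , tt , tt

    -- The argument `p` is kept apart from the register because the counter is lowered before the
    -- multiplication: in between, the invariant holds for the product that is about to be stored.
    LoopInv : Store 58 → ℕ → Set
    LoopInv ρ p = Bounded ρ × lookup ρ nᵣ ≡ n × lookup ρ oneᵣ ≡ 1 × p * n ^ lookup ρ kcᵣ ≤ n ^ k

  -- Reachable configurations.  Only the loop computing n ^ k is not ranked;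
  -- its invariant is pw * n ^ kc ≤ n ^ k.
  data Safe : Config 58 → Set where
    main  : ∀ {K ρ o} → allRanked K → Bounded ρ → Safe ⟨ K , ρ , o ⟩
    enter₀ : ∀ {ρ o} → ρ ≡ Vec.replicate 58 0 → Safe ⟨ programCmd ∷ [] , ρ , o ⟩
    enter₁ : ∀ {ρ o} → ρ ≡ Vec.replicate 58 0 → Safe ⟨ (setupCmd ⨟ tuplesCmd) ∷ emitCmd ∷ [] , ρ , o ⟩
    enter₂ : ∀ {ρ o} → ρ ≡ Vec.replicate 58 0 → Safe ⟨ setupCmd ∷ tuplesCmd ∷ emitCmd ∷ [] , ρ , o ⟩
    load  : ∀ {ρ o} is → T (ranked (block is)) → T (allCoinFree is) → Bounded ρ → LoopInv (Execution.assign I is ρ) (lookup (Execution.assign I is ρ) pwᵣ) →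
            Safe ⟨ block is ∷ (powerCmd ⨟ sizesCmd) ∷ tuplesCmd ∷ emitCmd ∷ [] , ρ , o ⟩
    load₁ : ∀ {ρ o x e} is → T (admissible e (rank x)) → T (coinFree e) → T (ranked (block is)) → T (allCoinFree is) → Bounded ρ →
            LoopInv (Execution.assign I ((x , e) ∷ is) ρ) (lookup (Execution.assign I ((x , e) ∷ is) ρ) pwᵣ) →
            Safe ⟨ (x ≔ e) ∷ block is ∷ (powerCmd ⨟ sizesCmd) ∷ tuplesCmd ∷ emitCmd ∷ [] , ρ , o ⟩
    join  : ∀ {ρ o} → LoopInv ρ (lookup ρ pwᵣ) → Safe ⟨ (powerCmd ⨟ sizesCmd) ∷ tuplesCmd ∷ emitCmd ∷ [] , ρ , o ⟩
    test  : ∀ {ρ o} → LoopInv ρ (lookup ρ pwᵣ) → Safe ⟨ powerCmd ∷ rest , ρ , o ⟩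
    body₀ : ∀ {ρ o c} → lookup ρ kcᵣ ≡ suc c → LoopInv ρ (lookup ρ pwᵣ) → Safe ⟨ block powerBody ∷ powerCmd ∷ rest , ρ , o ⟩
    body₁ : ∀ {ρ o c} → lookup ρ kcᵣ ≡ suc c → LoopInv ρ (lookup ρ pwᵣ) →
            Safe ⟨ (kcᵣ ≔ (kcᵣ ⊖ oneᵣ)) ∷ block ((pwᵣ , pwᵣ ⊗ nᵣ) ∷ []) ∷ powerCmd ∷ rest , ρ , o ⟩
    body₂ : ∀ {ρ o} → LoopInv ρ (lookup ρ pwᵣ * n) → Safe ⟨ block ((pwᵣ , pwᵣ ⊗ nᵣ) ∷ []) ∷ powerCmd ∷ rest , ρ , o ⟩
    body₃ : ∀ {ρ o} → LoopInv ρ (lookup ρ pwᵣ * n) → Safe ⟨ (pwᵣ ≔ (pwᵣ ⊗ nᵣ)) ∷ skip ∷ powerCmd ∷ rest , ρ , o ⟩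
    body₄ : ∀ {ρ o} → LoopInv ρ (lookup ρ pwᵣ) → Safe ⟨ skip ∷ powerCmd ∷ rest , ρ , o ⟩

  private
    zeros-bounded : ∀ {ρ} → ρ ≡ Vec.replicate 58 0 → Bounded ρ
    zeros-bounded refl x = ≤-trans (≤-reflexive (Vec.lookup-replicate x 0)) z≤n

    step-main : ∀ K ρ o b → allRanked K → Bounded ρ → Safe (step I ⟨ K , ρ , o ⟩ b)
    step-main []      ρ o b ok bd = main ok bd
    step-main ((x ≔ e) ∷ K) ρ o b (t , ok) bd = main ok (bounded-update ρ x _ bd (eval≤ b ρ bd e (rank x) t))
    step-main (emit x ∷ K) ρ o b (_ , ok) bd = main ok bd
    step-main (skip ∷ K)   ρ o b (_ , ok) bd = main ok bd
    step-main ((c ⨟ d) ∷ K) ρ o b (t , ok) bd = main (T-∧₁ (ranked c) t , T-∧₂ (ranked c) t , ok) bd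
    step-main ((ifNonZero x then c else d) ∷ K) ρ o b (t , ok) bd with lookup ρ x
    ... | zero  = main (T-∧₂ (ranked c) t , ok) bd
    ... | suc _ = main (T-∧₁ (ranked c) t , ok) bd
    step-main ((whileNonZero x loop c) ∷ K) ρ o b (t , ok) bd with lookup ρ x
    ... | zero  = main ok bd
    ... | suc _ = main (t , t , ok) bd

    eval-det : ∀ b ρ (e : Expr 58) → T (coinFree e) → eval I b ρ e ≡ eval I false ρ e
    eval-det b ρ (const _)       _ = refl
    eval-det b ρ (_ ⊕ _)         _ = refl
    eval-det b ρ (_ ⊖ _)         _ = refl
    eval-det b ρ (_ ⊗ _)         _ = refl
    eval-det b ρ (_ ⊘ _)         _ = refl
    eval-det b ρ (_ ⊛ _)         _ = refl
    eval-det b ρ paramK          _ = refl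
    eval-det b ρ paramN          _ = refl
    eval-det b ρ paramM          _ = refl
    eval-det b ρ (entry _ _)     _ = refl
    eval-det b ρ targetSign      _ = refl
    eval-det b ρ (targetDigit _) _ = refl

    step-while-zero : ∀ {ρ : Store 58} {x} {c : Cmd 58} K o b → lookup ρ x ≡ 0 → step I ⟨ (whileNonZero x loop c) ∷ K , ρ , o ⟩ b ≡ ⟨ K , ρ , o ⟩
    step-while-zero {ρ} {x} K o b eq with lookup ρ x | eq
    ... | zero | refl = refl

    step-while-suc : ∀ {ρ : Store 58} {x} {c : Cmd 58} {v} K o b → lookup ρ x ≡ suc v → step I ⟨ (whileNonZero x loop c) ∷ K , ρ , o ⟩ b ≡ ⟨ c ∷ (whileNonZero x loop c) ∷ K , ρ , o ⟩
    step-while-suc {ρ} {x} K o b eq with lookup ρ x | eq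
    ... | suc _ | refl = refl

    product≤ : ∀ a c N → a * N * N ^ c ≤ N ^ k → N ^ k ≤ B → a * N ≤ B
    product≤ a c zero      le N^k≤B = ≤-trans (≤-reflexive (*-zeroʳ a)) z≤n
    product≤ a c N@(suc _) le N^k≤B = ≤-trans (m≤m*n (a * N) (N ^ c) {{m^n≢0 N c}}) (≤-trans le N^k≤B)

  safe-step : ∀ {κ} b → Safe κ → Safe (step I κ b)
  safe-step b (main {K} {ρ} {o} ok bd) = step-main K ρ o b ok bd
  safe-step b (enter₀ eq) = enter₁ eq
  safe-step b (enter₁ eq) = enter₂ eq
  safe-step b (enter₂ eq) = load initialBlock tt tt (zeros-bounded eq) (loaded eq)
    where
    assign-bounded : ∀ is ρ → T (ranked (block is)) → Bounded ρ → Bounded (Execution.assign I is ρ)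
    assign-bounded []             ρ ok bd = bd
    assign-bounded ((x , e) ∷ is) ρ ok bd = assign-bounded is _ (T-∧₂ (admissible e (rank x)) ok)
      (bounded-update ρ x _ bd (eval≤ false ρ bd e (rank x) (T-∧₁ (admissible e (rank x)) ok)))
    loaded : ∀ {ρ} → ρ ≡ Vec.replicate 58 0 → LoopInv (Execution.assign I initialBlock ρ) (lookup (Execution.assign I initialBlock ρ) pwᵣ)
    loaded refl = assign-bounded initialBlock (Vec.replicate 58 0) tt (zeros-bounded refl) , refl , refl , ≤-reflexive (*-identityˡ (n ^ k))
  safe-step b (load [] ok cf bd inv) = join inv
  safe-step b (load ((x , e) ∷ is) ok cf bd inv) =
    load₁ is (T-∧₁ (admissible e (rank x)) ok) (T-∧₁ (coinFree e) cf) (T-∧₂ (admissible e (rank x)) ok) (T-∧₂ (coinFree e) cf) bd inv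
  safe-step b (load₁ {ρ} {x = x} {e} is ad cf ok cfs bd inv) = load is ok cfs
    (bounded-update ρ x _ bd (eval≤ b ρ bd e (rank x) ad))
    (subst (λ v → LoopInv (Execution.assign I is (ρ [ x ]≔ v)) (lookup (Execution.assign I is (ρ [ x ]≔ v)) pwᵣ)) (sym (eval-det b ρ e cf)) inv)
  safe-step b (join inv) = test inv
  safe-step b (test {ρ} {o} inv) = go (lookup ρ kcᵣ) refl
    where
    go : ∀ v → lookup ρ kcᵣ ≡ v → Safe (step I ⟨ powerCmd ∷ rest , ρ , o ⟩ b)
    go zero    eq = subst Safe (sym (step-while-zero {ρ} {kcᵣ} {block powerBody} rest o b eq)) (main rest-ranked (proj₁ inv))
    go (suc c) eq = subst Safe (sym (step-while-suc {ρ} {kcᵣ} {block powerBody} rest o b eq)) (body₀ eq inv)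
  safe-step b (body₀ eq inv) = body₁ eq inv
  safe-step b (body₁ {ρ} {c = c} eq (bd , n≡ , one≡ , le)) = body₂
    ( bounded-update ρ kcᵣ dec bd (≤-trans (m∸n≤m (lookup ρ kcᵣ) (lookup ρ oneᵣ)) (bd kcᵣ))
    , trans (Vec.lookup∘update′ {i = nᵣ} {kcᵣ} (λ ()) ρ dec) n≡
    , trans (Vec.lookup∘update′ {i = oneᵣ} {kcᵣ} (λ ()) ρ dec) one≡
    , subst₂ (λ p c → p * n * n ^ c ≤ n ^ k) (sym (Vec.lookup∘update′ {i = pwᵣ} {kcᵣ} (λ ()) ρ dec))
        (sym (trans (Vec.lookup∘update kcᵣ ρ dec) (trans (cong₂ _∸_ eq one≡) refl)))
        (≤-trans (≤-reflexive (*-assoc (lookup ρ pwᵣ) n (n ^ c))) (subst (λ z → lookup ρ pwᵣ * n ^ z ≤ n ^ k) eq le)))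
    where
    dec : ℕ
    dec = lookup ρ kcᵣ ∸ lookup ρ oneᵣ
  safe-step b (body₂ inv) = body₃ inv
  safe-step b (body₃ {ρ} (bd , n≡ , one≡ , le)) = body₄
    ( bounded-update ρ pwᵣ mul bd (subst (λ z → lookup ρ pwᵣ * z ≤ B) (sym n≡) (product≤ (lookup ρ pwᵣ) (lookup ρ kcᵣ) n le power≤B))
    , trans (Vec.lookup∘update′ {i = nᵣ} {pwᵣ} (λ ()) ρ mul) n≡
    , trans (Vec.lookup∘update′ {i = oneᵣ} {pwᵣ} (λ ()) ρ mul) one≡
    , subst₂ (λ p c → p * n ^ c ≤ n ^ k) (sym (trans (Vec.lookup∘update pwᵣ ρ mul) (cong (lookup ρ pwᵣ *_) n≡)))
        (sym (Vec.lookup∘update′ {i = kcᵣ} {pwᵣ} (λ ()) ρ mul)) le)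
    where
    mul : ℕ
    mul = lookup ρ pwᵣ * lookup ρ nᵣ
  safe-step b (body₄ inv) = test inv

  safe⇒bounded : ∀ {κ} → Safe κ → Bounded (Config.store κ)
  safe⇒bounded (main _ bd)          = bd
  safe⇒bounded (enter₀ eq)          = zeros-bounded eq
  safe⇒bounded (enter₁ eq)          = zeros-bounded eq
  safe⇒bounded (enter₂ eq)          = zeros-bounded eq
  safe⇒bounded (load _ _ _ bd _)    = bd
  safe⇒bounded (load₁ _ _ _ _ _ bd _) = bd
  safe⇒bounded (join inv)           = proj₁ inv
  safe⇒bounded (test inv)           = proj₁ inv
  safe⇒bounded (body₀ _ inv)        = proj₁ inv
  safe⇒bounded (body₁ _ inv)        = proj₁ inv
  safe⇒bounded (body₂ inv)          = proj₁ inv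
  safe⇒bounded (body₃ inv)          = proj₁ inv
  safe⇒bounded (body₄ inv)          = proj₁ inv

  safe-steps : ∀ {κ} bs → Safe κ → Safe (steps I κ bs)
  safe-steps []       s = s
  safe-steps (b ∷ bs) s = safe-steps bs (safe-step b s)

  private
    rank≤13 : ∀ x → rank x ≤ 13
    rank≤13 = from-yes (Fin.all? (λ x → rank x ≤? 13))

    sum≤ : ∀ {R} (ρ : Vec ℕ R) b → (∀ x → lookup ρ x ≤ b) → Vec.sum (Vec.map (λ v → suc ⌊log₂ v ⌋) ρ) ≤ R * suc ⌊log₂ b ⌋
    sum≤ []      b le = z≤n
    sum≤ (v ∷ ρ) b le = +-mono-≤ (s≤s (⌊log₂⌋-mono-≤ (le Fin.zero))) (sum≤ ρ b (le ∘ Fin.suc))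

  -- R and r stand for 58 and 13, which must not be unfolded.
  space≤ : ∀ coins {R r} → R ≡ 58 → r ≡ 13 → space kSum (run kSum I coins) ≤ R * suc ⌊log₂ bound r ⌋
  space≤ coins {r = r} refl r≡ = sum≤ (Config.store (run kSum I coins)) (bound r)
    (λ x → ≤-trans (safe⇒bounded (safe-steps coins (enter₀ refl)) x) (bound-mono (≤-trans (rank≤13 x) (≤-reflexive (sym r≡)))))

-- Size estimates for large inputs.

fourth-power-step : ∀ x → 8 ≤ x → suc x ^ 4 ≤ 2 * x ^ 4
fourth-power-step x 8≤x = half-power (suc x) 1 4 (m≤n⇒m≤1+n 8≤x)

-- With `d = l - 64` this is `l⁴ ≤ 2 ^ (l - 1)`, and the right-hand side is at most `n` for a number
-- `n` of `l` binary digits.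
fourth-power≤ : ∀ d → (d + 64) ^ 4 ≤ 2 ^ (d + 63)
fourth-power≤ zero    = ≤ᵇ⇒≤ (64 ^ 4) (2 ^ 63) tt
fourth-power≤ (suc d) = ≤-trans (fourth-power-step (d + 64) (≤-trans (≤ᵇ⇒≤ 8 64 tt) (m≤n+m 64 d)))
  (*-monoʳ-≤ 2 (fourth-power≤ d))

square-root≤ : ∀ {n i} → Digits 4 n i → 0 < n → 2 ^ i * 2 ^ i ≤ 4 * n
square-root≤ {n} {zero}  _ 0<n = ≤-trans 0<n (m≤n*m n 4)
square-root≤ {n} {suc i} d _   = ≤-trans (≤-reflexive (sym (^-distrib-4 (suc i)))) (*-monoʳ-≤ 4 (digits-lower d))

-- The threshold stems from `tail`. With loads up to `μ = l²` and `e = 128 l`, the exponent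
-- `3 + l + 128 l` on the left is at most `132 l`, which is below `l²` once `l` exceeds 132.
module Numerics (k′ n m : ℕ) (n≤m : n ≤ m) (large : 2 ^ 132 ≤ n) where

  open Sizes (2+ k′) n m

  l root s : ℕ
  l    = lgBits
  root = 2 ^ sqBits
  s    = 2 ^ width ∸ 1

  private
    n<2^l : n < 2 ^ l
    n<2^l = digits-upper (proj₂ (digits 0 n))

    132<l : 132 < l
    132<l = ≰⇒> (λ l≤ → <⇒≱ (≤-<-trans large n<2^l) (^-monoʳ-≤ 2 l≤))

    instance
      l≢0 : NonZero l
      l≢0 = >-nonZero (≤-trans (s≤s z≤n) 132<l)
      n≢0 : NonZero n
      n≢0 = >-nonZero (≤-trans (>-nonZero⁻¹ (2 ^ 132) {{m^n≢0 2 132}}) large)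

    lower : ∀ {x i} → Digits 2 x i → 0 < i → 2 ^ (i ∸ 1) ≤ x
    lower {i = suc i} d _ = digits-lower d

    l⁴≤n : l * l * (l * l) ≤ n
    l⁴≤n = begin
      l * l * (l * l)                ≡⟨ lemma l ⟩
      l ^ 4                          ≡⟨ cong (_^ 4) (sym (m∸n+n≡m 64≤l)) ⟩
      (l ∸ 64 + 64) ^ 4              ≤⟨ fourth-power≤ (l ∸ 64) ⟩
      2 ^ (l ∸ 64 + 63)              ≡⟨ cong (2 ^_) (trans (sym (+-∸-assoc (l ∸ 64) {64} {1} (s≤s z≤n))) (cong (_∸ 1) (m∸n+n≡m 64≤l))) ⟩
      2 ^ (l ∸ 1)                    ≤⟨ lower (proj₂ (digits 0 n)) (>-nonZero⁻¹ l) ⟩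
      n                              ∎
      where
      open ≤-Reasoning
      64≤l : 64 ≤ l
      64≤l = ≤-trans (≤ᵇ⇒≤ 64 133 tt) 132<l
      lemma : ∀ l → l * l * (l * l) ≡ l * (l * (l * (l * 1)))
      lemma = solve-∀

    132l≤n : 132 * l ≤ n
    132l≤n = ≤-trans (≤-trans (*-monoˡ-≤ l (<⇒≤ 132<l)) (m≤m*n (l * l) (l * l) {{m*n≢0 l l}})) l⁴≤n

    l²≥ : ∀ c → c ≤ 132 → c ≤ l * l
    l²≥ c c≤ = ≤-trans c≤ (≤-trans (<⇒≤ 132<l) (m≤m*n l l))

    root²≤4n : root * root ≤ 4 * n
    root²≤4n = square-root≤ (proj₂ (digits 2 n)) (>-nonZero⁻¹ n)

    n<root² : n < root * root
    n<root² = ≤-trans (digits-upper (proj₂ (digits 2 n))) (≤-reflexive (^-distrib-4 sqBits))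

    l²≤root : l * l ≤ root
    l²≤root = ≮⇒≥ λ root<l² → <⇒≱ n<root² (≤-trans (*-mono-≤ (<⇒≤ root<l²) (<⇒≤ root<l²)) l⁴≤n)

    instance
      l²≢0 : NonZero (l * l)
      l²≢0 = m*n≢0 l l

    reach≡ : reach ≡ root / (l * l)
    reach≡ = quot≡/ root (l * l)

    reach-upper : reach * (l * l) ≤ root
    reach-upper = ≤-trans (≤-reflexive (cong (_* (l * l)) reach≡)) (m/n*n≤m root (l * l))

    -- The quotient is at least 1 because `l² ≤ root`, so rounding it down costs at most a factor 2.
    root≤ : root ≤ 2 * reach * (l * l)
    root≤ = begin
      root                                       ≡⟨ m≡m%n+[m/n]*n root (l * l) ⟩
      root % (l * l) + root / (l * l) * (l * l)  ≤⟨ +-monoˡ-≤ _ (<⇒≤ (m%n<n root (l * l))) ⟩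
      l * l + root / (l * l) * (l * l)           ≤⟨ +-monoˡ-≤ _ (≤-trans (≤-reflexive (sym (*-identityˡ (l * l)))) (*-monoˡ-≤ (l * l) (m≥n⇒m/n>0 l²≤root))) ⟩
      root / (l * l) * (l * l) + root / (l * l) * (l * l) ≡⟨ cong (λ z → z * (l * l) + z * (l * l)) (sym reach≡) ⟩
      reach * (l * l) + reach * (l * l)          ≡⟨ lemma reach (l * l) ⟩
      2 * reach * (l * l)                        ∎
      where
      open ≤-Reasoning
      lemma : ∀ r x → r * x + r * x ≡ 2 * r * x
      lemma = solve-∀

    n≤ : n ≤ 4 * (l * l * (l * l)) * (reach * reach)
    n≤ = ≤-trans (<⇒≤ n<root²) (≤-trans (*-mono-≤ root≤ root≤) (≤-reflexive (lemma reach (l * l))))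
      where
      lemma : ∀ r x → 2 * r * x * (2 * r * x) ≡ 4 * (x * x) * (r * r)
      lemma = solve-∀

    n≤2half+1 : n ≤ suc (half + half)
    n≤2half+1 = begin
      n                  ≡⟨ m≡m%n+[m/n]*n n 2 ⟩
      n % 2 + n / 2 * 2  ≤⟨ +-monoˡ-≤ _ (s≤s⁻¹ (m%n<n n 2)) ⟩
      1 + n / 2 * 2      ≡⟨ cong suc (lemma (n / 2)) ⟩
      suc (half + half)  ∎
      where
      open ≤-Reasoning
      lemma : ∀ h → h * 2 ≡ h + h
      lemma = solve-∀

    2half≤n : half + half ≤ n
    2half≤n = ≤-trans (≤-reflexive (lemma (n / 2))) (m/n*n≤m n 2)
      where
      lemma : ∀ h → h + h ≡ h * 2
      lemma = solve-∀

    instance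
      width≢0 : NonZero width
      width≢0 = m*n≢0 8 l

    24l≤half : 3 * width ≤ half
    24l≤half = *-cancelˡ-≤ 2 (s≤s⁻¹ (begin
      suc (2 * (3 * (8 * l)))   ≤⟨ +-monoˡ-≤ (2 * (3 * (8 * l))) (>-nonZero⁻¹ l) ⟩
      l + 2 * (3 * (8 * l))     ≡⟨ lemma l ⟩
      49 * l                    ≤⟨ *-monoˡ-≤ l (≤ᵇ⇒≤ 49 132 tt) ⟩
      132 * l                   ≤⟨ 132l≤n ⟩
      n                         ≤⟨ n≤2half+1 ⟩
      suc (half + half)         ≡⟨ cong (λ z → suc (half + z)) (sym (+-identityʳ half)) ⟩
      suc (2 * half)            ∎))
      where
      open ≤-Reasoning
      lemma : ∀ l → l + 2 * (3 * (8 * l)) ≡ 49 * l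
      lemma = solve-∀

    rows : ℕ
    rows = half / width

    3≤rows : 3 ≤ rows
    3≤rows = ≤-trans (≤-reflexive (sym (m*n/n≡m 3 width))) (/-monoˡ-≤ width 24l≤half)

    rows≡ : rows ≡ suc buckets
    rows≡ = sym (trans (cong (λ z → suc (z ∸ 1)) (quot≡/ half width)) (m+[n∸m]≡n (≤-trans (s≤s z≤n) 3≤rows)))

    2≤buckets : 2 ≤ buckets
    2≤buckets = s≤s⁻¹ (≤-trans 3≤rows (≤-reflexive rows≡))

    rows*width≤half : suc buckets * width ≤ half
    rows*width≤half = ≤-trans (≤-reflexive (cong (_* width) (sym rows≡))) (m/n*n≤m half width)

    buckets≤n : buckets ≤ n
    buckets≤n = ≤-trans (≤-trans (n≤1+n buckets) (≤-trans (m≤m*n (suc buckets) width) rows*width≤half)) (≤-trans (m≤m+n half half) 2half≤n)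

    q : ℕ
    q = (buckets + 2) / 4

    1≤q : 1 ≤ q
    1≤q = m≥n⇒m/n>0 (+-monoˡ-≤ 2 2≤buckets)

    -- Up to rounding `q` is `n / (8 * width)`; the extra factor 2 in `16 * width` absorbs all
    -- roundings.
    n≤qe : n ≤ q * (16 * width)
    n≤qe = begin
      n                                               ≤⟨ n≤2half+1 ⟩
      suc (half + half)                               ≤⟨ s≤s (+-mono-≤ half≤ half≤) ⟩
      suc ((4 * q + 3) * width + (4 * q + 3) * width) ≤⟨ +-monoˡ-≤ _ (>-nonZero⁻¹ width) ⟩
      width + ((4 * q + 3) * width + (4 * q + 3) * width) ≡⟨ lemma₁ q width ⟩
      8 * q * width + 7 * width                       ≤⟨ +-monoʳ-≤ (8 * q * width) (*-monoˡ-≤ width (≤-trans (≤ᵇ⇒≤ 7 8 tt) (*-monoʳ-≤ 8 1≤q))) ⟩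
      8 * q * width + 8 * q * width                   ≡⟨ lemma₂ q width ⟩
      q * (16 * width)                                ∎
      where
      open ≤-Reasoning
      lemma₁ : ∀ q w → w + ((4 * q + 3) * w + (4 * q + 3) * w) ≡ 8 * q * w + 7 * w
      lemma₁ = solve-∀
      lemma₂ : ∀ q w → 8 * q * w + 8 * q * w ≡ q * (16 * w)
      lemma₂ = solve-∀
      buckets+2≤ : buckets + 2 ≤ 4 * q + 3
      buckets+2≤ = begin
        buckets + 2               ≡⟨ m≡m%n+[m/n]*n (buckets + 2) 4 ⟩
        (buckets + 2) % 4 + q * 4 ≤⟨ +-monoˡ-≤ (q * 4) (s≤s⁻¹ (m%n<n (buckets + 2) 4)) ⟩
        3 + q * 4                 ≡⟨ trans (+-comm 3 (q * 4)) (cong (_+ 3) (*-comm q 4)) ⟩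
        4 * q + 3                 ∎
      half≤ : half ≤ (4 * q + 3) * width
      half≤ = begin
        half                         ≡⟨ m≡m%n+[m/n]*n half width ⟩
        half % width + rows * width  ≤⟨ +-monoˡ-≤ (rows * width) (<⇒≤ (m%n<n half width)) ⟩
        suc rows * width             ≡⟨ cong (λ z → suc z * width) rows≡ ⟩
        2+ buckets * width           ≡⟨ cong (_* width) (+-comm 2 buckets) ⟩
        (buckets + 2) * width        ≤⟨ *-monoˡ-≤ width buckets+2≤ ⟩
        (4 * q + 3) * width          ∎

    tail : 8 * (buckets * 2 ^ (16 * width)) ≤ 2 ^ (l * l)
    tail = begin
      8 * (buckets * 2 ^ (16 * width))          ≤⟨ *-monoʳ-≤ 8 (*-monoˡ-≤ (2 ^ (16 * width)) (≤-trans buckets≤n (<⇒≤ n<2^l))) ⟩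
      2 ^ 3 * (2 ^ l * 2 ^ (16 * width))        ≡⟨ trans (cong (2 ^ 3 *_) (sym (^-distribˡ-+-* 2 l (16 * width)))) (sym (^-distribˡ-+-* 2 3 (l + 16 * width))) ⟩
      2 ^ (3 + (l + 16 * width))                ≤⟨ ^-monoʳ-≤ 2 exponent≤ ⟩
      2 ^ (l * l)                               ∎
      where
      open ≤-Reasoning
      exponent≤ : 3 + (l + 16 * width) ≤ l * l
      exponent≤ = begin
        3 + (l + 16 * (8 * l))   ≤⟨ +-monoˡ-≤ _ (*-monoʳ-≤ 3 (>-nonZero⁻¹ l)) ⟩
        3 * l + (l + 16 * (8 * l)) ≡⟨ lemma l ⟩
        132 * l                  ≤⟨ *-monoˡ-≤ l (<⇒≤ 132<l) ⟩
        l * l                    ∎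
        where
        lemma : ∀ l → 3 * l + (l + 16 * (8 * l)) ≡ 132 * l
        lemma = solve-∀

    -- This is what the division by `l²` in `reach` is for: `reach²` is at most `4 n / l⁴`, which
    -- against loads of `2 l²` leaves `64 n / l²`.
    small : 2 * ((reach + reach) * ((reach + reach) * (l * l + l * l))) ≤ n
    small = *-cancelʳ-≤ _ n (l * l) (begin
      2 * ((reach + reach) * ((reach + reach) * (l * l + l * l))) * (l * l) ≡⟨ lemma reach (l * l) ⟩
      16 * (reach * (l * l) * (reach * (l * l)))  ≤⟨ *-monoʳ-≤ 16 (*-mono-≤ reach-upper reach-upper) ⟩
      16 * (root * root)                          ≤⟨ *-monoʳ-≤ 16 root²≤4n ⟩
      16 * (4 * n)                                ≡⟨ trans (sym (*-assoc 16 4 n)) (*-comm 64 n) ⟩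
      n * 64                                      ≤⟨ *-monoʳ-≤ n (l²≥ 64 (≤ᵇ⇒≤ 64 132 tt)) ⟩
      n * (l * l)                                 ∎)
      where
      open ≤-Reasoning
      lemma : ∀ r x → 2 * ((r + r) * ((r + r) * (x + x))) * x ≡ 16 * (r * x * (r * x))
      lemma = solve-∀

    2^width≤2s : 2 ^ width ≤ 2 * s
    2^width≤2s = begin
      2 ^ width        ≡⟨ sym (m+[n∸m]≡n (>-nonZero⁻¹ (2 ^ width) {{m^n≢0 2 width}})) ⟩
      1 + s            ≤⟨ +-monoˡ-≤ s 1≤s ⟩
      s + s            ≡⟨ cong (s +_) (sym (+-identityʳ s)) ⟩
      2 * s            ∎
      where
      open ≤-Reasoning
      1≤s : 1 ≤ s
      1≤s = m<n⇒0<n∸m (^-monoʳ-< 2 (s≤s (s≤s z≤n)) (>-nonZero⁻¹ width))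

    n² : ℕ
    n² = n * n

    n⁸≤2s : n² * n² * (n² * n²) ≤ 2 * s
    n⁸≤2s = begin
      n² * n² * (n² * n²)                      ≡⟨ lemma n ⟩
      n ^ 8                                    ≤⟨ ^-monoˡ-≤ 8 (<⇒≤ n<2^l) ⟩
      (2 ^ l) ^ 8                              ≡⟨ trans (^-*-assoc 2 l 8) (cong (2 ^_) (*-comm l 8)) ⟩
      2 ^ width                                ≤⟨ 2^width≤2s ⟩
      2 * s                                    ∎
      where
      open ≤-Reasoning
      lemma : ∀ n → n * n * (n * n) * (n * n * (n * n)) ≡ n * (n * (n * (n * (n * (n * (n * (n * 1)))))))
      lemma = solve-∀

    l⁴ ℓ² : ℕ
    l⁴ = l * l * (l * l)
    ℓ² = reach * reach

    -- Up to constants and powers of `l`, the right-hand side is `n^8` from the seeds times `n²`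
    -- from the walks. Against `n^6` this leaves `n⁴` to absorb them.
    many : 512 * (n * n * (n * n * (n * n))) ≤ s * (ℓ² * ℓ²)
    many = *-cancelˡ-≤ (32 * (l⁴ * l⁴)) {{m*n≢0 32 (l⁴ * l⁴) {{_}} {{m*n≢0 l⁴ l⁴ {{l⁴≢0}} {{l⁴≢0}}}}}} (begin
      32 * (l⁴ * l⁴) * (512 * (n² * (n² * n²)))       ≡⟨ lemma₁ (l⁴ * l⁴) n² ⟩
      16384 * (l⁴ * l⁴) * (n² * n² * n²)              ≤⟨ *-monoˡ-≤ (n² * n² * n²) enough ⟩
      n² * n² * (n² * n² * n²)                        ≡⟨ lemma₂ n² ⟩
      n² * (n² * n² * (n² * n²))                      ≤⟨ *-mono-≤ (*-mono-≤ n≤ n≤) n⁸≤2s ⟩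
      4 * l⁴ * ℓ² * (4 * l⁴ * ℓ²) * (2 * s)           ≡⟨ lemma₃ l⁴ ℓ² s ⟩
      32 * (l⁴ * l⁴) * (s * (ℓ² * ℓ²))                ∎)
      where
      open ≤-Reasoning
      l⁴≢0 : NonZero l⁴
      l⁴≢0 = m*n≢0 (l * l) (l * l)
      lemma₁ : ∀ a n → 32 * a * (512 * (n * (n * n))) ≡ 16384 * a * (n * n * n)
      lemma₁ = solve-∀
      lemma₂ : ∀ n → n * n * (n * n * n) ≡ n * (n * n * (n * n))
      lemma₂ = solve-∀
      lemma₃ : ∀ a b s → 4 * a * b * (4 * a * b) * (2 * s) ≡ 32 * (a * a) * (s * (b * b))
      lemma₃ = solve-∀
      enough : 16384 * (l⁴ * l⁴) ≤ n² * n²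
      enough = ≤-trans (≤-reflexive (*-comm 16384 (l⁴ * l⁴))) (*-mono-≤ (*-mono-≤ l⁴≤n l⁴≤n)
        (≤-trans (≤-trans (≤ᵇ⇒≤ 16384 (132 * 132) tt) (*-mono-≤ (l²≥ 132 ≤-refl) (l²≥ 132 ≤-refl)))
          (≤-trans l⁴≤n (m≤m*n n n))))

    -- By `n≤` the ratio `reach² / n²` is at least `1 / (4 n l⁴)`. Of the six factors `l` in
    -- `rounds`, four compensate for this and the other two exceed the constant 256.
    repeats : ∀ X → s * ℓ² ≤ 4 * (n * n) * X → 8 * 2 ^ width ≤ rounds * X
    repeats X le = *-cancelˡ-≤ (32 * n²) {{m*n≢0 32 n² {{_}} {{m*n≢0 n n}}}} (begin
      32 * n² * (8 * 2 ^ width)                 ≡⟨ lemma₁ n² (2 ^ width) ⟩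
      256 * (n² * 2 ^ width)                    ≤⟨ *-mono-≤ 256≤l² (*-monoʳ-≤ n² 2^width≤2s) ⟩
      l * l * (n² * (2 * s))                    ≡⟨ lemma₂ (l * l) n s ⟩
      2 * (l * l) * n * s * n                   ≤⟨ *-monoʳ-≤ (2 * (l * l) * n * s) n≤ ⟩
      2 * (l * l) * n * s * (4 * l⁴ * ℓ²)       ≡⟨ lemma₃ (l * l) n s ℓ² ⟩
      8 * (n * (l * l * (l * l) * (l * l))) * (s * ℓ²)  ≤⟨ *-monoʳ-≤ (8 * (n * (l * l * (l * l) * (l * l)))) le ⟩
      8 * (n * (l * l * (l * l) * (l * l))) * (4 * n² * X) ≡⟨ lemma₄ (n * (l * l * (l * l) * (l * l))) n² X ⟩
      32 * n² * (n * (l * l * (l * l) * (l * l)) * X)      ≡⟨ cong (λ z → 32 * n² * (z * X)) rounds≡ ⟩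
      32 * n² * (rounds * X)                    ∎)
      where
      open ≤-Reasoning
      256≤l² : 256 ≤ l * l
      256≤l² = ≤-trans (≤ᵇ⇒≤ 256 (132 * 132) tt) (*-mono-≤ (<⇒≤ 132<l) (<⇒≤ 132<l))
      lemma₁ : ∀ n w → 32 * n * (8 * w) ≡ 256 * (n * w)
      lemma₁ = solve-∀
      lemma₂ : ∀ l n s → l * (n * n * (2 * s)) ≡ 2 * l * n * s * n
      lemma₂ = solve-∀
      lemma₃ : ∀ l n s r → 2 * l * n * s * (4 * (l * l) * r) ≡ 8 * (n * (l * l * l)) * (s * r)
      lemma₃ = solve-∀
      lemma₄ : ∀ a n x → 8 * a * (4 * n * x) ≡ 32 * n * (a * x)
      lemma₄ = solve-∀
      rounds≡ : n * (l * l * (l * l) * (l * l)) ≡ rounds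
      rounds≡ = refl

  regime : Regime (2+ k′) n m
  regime = record
    { μ = l * l ; q = q ; e = 16 * width
    ; 0<buckets = ≤-trans (s≤s z≤n) 2≤buckets
    ; 0<half = ≤-trans (≤-trans (>-nonZero⁻¹ width) (m≤m+n width _)) 24l≤half
    ; 0<width = >-nonZero⁻¹ width
    ; 0<rounds = >-nonZero⁻¹ rounds {{m*n≢0 n _ {{n≢0}} {{m*n≢0 (l * l * (l * l)) (l * l) {{m*n≢0 (l * l) (l * l)}}}}}}
    ; fits = ≤-trans (+-monoʳ-≤ half rows*width≤half) 2half≤n
    ; 2half≤n = 2half≤n ; n≤2half+1 = n≤2half+1
    ; buckets≤m = ≤-trans buckets≤n n≤m
    ; small = small
    ; 4q≤ = ≤-trans (≤-reflexive (*-comm 4 q)) (m/n*n≤m (buckets + 2) 4)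
    ; n≤qe = n≤qe ; tail = tail ; many = many ; repeats = repeats }

-- Running time.

loopCost≡ : ∀ τ i → loopCost τ i ≡ suc (i * suc τ)
loopCost≡ τ zero    = refl
loopCost≡ τ (suc i) = cong suc (trans (cong (τ +_) (loopCost≡ τ i)) (+-suc τ (i * suc τ)))

loopCost-mono : ∀ τ {i j} → i ≤ j → loopCost τ i ≤ loopCost τ j
loopCost-mono τ {i} {j} le = ≤-trans (≤-reflexive (loopCost≡ τ i)) (≤-trans (s≤s (*-monoˡ-≤ (suc τ) le)) (≤-reflexive (sym (loopCost≡ τ j))))

setupTime : (k lg sq t : ℕ) → ℕ
setupTime k lg sq t = suc (15 + suc (loopCost 5 k + suc (33 + suc (loopCost 7 lg + suc (5 + suc (loopCost 7 sq +
  suc (25 + suc (loopCost 21 t + 5))))))))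

setupTime-mono : ∀ k lg sq {t t′} → t ≤ t′ → setupTime k lg sq t ≤ setupTime k lg sq t′
setupTime-mono k lg sq le = +-monoʳ-≤ 17 (+-monoʳ-≤ (loopCost 5 k) (+-monoʳ-≤ 35 (+-monoʳ-≤ (loopCost 7 lg)
  (+-monoʳ-≤ 7 (+-monoʳ-≤ (loopCost 7 sq) (+-monoʳ-≤ 27 (+-monoˡ-≤ 5 (loopCost-mono 21 le))))))))

-- A running time for all m ≤ a n^d.
timeBound : (k a d n : ℕ) → ℕ
timeBound k a d n = suc (suc (setupTime k lgBits sqBits (suc (k * a + lgBits * d)) +
    loopCost (tupleCost width (reach + reach) rounds (k ∸ 1 ∸ 1)) count) + emitCost (k ∸ 1 ∸ 1))
  -- The sizes used here depend on `k` and `n` only, so 0 may stand for `m`.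
  where open Sizes k n 0

n<2^lg : ∀ k n m → n < 2 ^ Sizes.lgBits k n m
n<2^lg k n m = digits-upper (proj₂ (digits 0 n))

power≤2^ : ∀ k n m d → n ^ d ≤ 2 ^ (Sizes.lgBits k n m * d)
power≤2^ k n m d = ≤-trans (^-monoˡ-≤ d (<⇒≤ (n<2^lg k n m))) (≤-reflexive (^-*-assoc 2 (Sizes.lgBits k n m) d))

digits-bound : ∀ {x i y} → Digits 2 x i → x < 2 ^ y → i ≤ suc y
digits-bound none _ = z≤n
digits-bound {i = suc i} {y} d x< = s≤s (<⇒≤ (≰⇒> (λ y≤i → <⇒≱ x< (≤-trans (^-monoʳ-≤ 2 y≤i) (digits-lower d)))))

runTime≤ : ∀ k a d n m → m ≤ a * n ^ d → runTime k n m ≤ timeBound k a d n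
runTime≤ k a d n m m≤ = s≤s (+-monoˡ-≤ (emitCost (k ∸ 1 ∸ 1)) (s≤s (+-monoˡ-≤ _ (setupTime-mono k lg (Sizes.sqBits k n m)
  (digits-bound {y = k * a + Sizes.lgBits k n m * d} (proj₂ (digits 0 (k * m))) (begin-strict
    k * m                        ≤⟨ *-monoʳ-≤ k m≤ ⟩
    k * (a * n ^ d)              ≡⟨ sym (*-assoc k a (n ^ d)) ⟩
    k * a * n ^ d                ≤⟨ *-monoʳ-≤ (k * a) (power≤2^ k n m d) ⟩
    k * a * 2 ^ (lg * d)         <⟨ *-monoˡ-< (2 ^ (lg * d)) {{m^n≢0 2 (lg * d)}} (n<2^n (k * a)) ⟩
    2 ^ (k * a) * 2 ^ (lg * d)   ≡⟨ sym (^-distribˡ-+-* 2 (k * a) (lg * d)) ⟩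
    2 ^ (k * a + lg * d)         ∎))))))
  where
  open ≤-Reasoning
  lg : ℕ
  lg = Sizes.lgBits k n m

lg≤2log : ∀ k n m → 2 ≤ n → Sizes.lgBits k n m ≤ 2 * ⌊log₂ n ⌋
lg≤2log k n m 2≤n with Sizes.lgBits k n m | proj₂ (digits 0 n)
... | zero  | _ = z≤n
... | suc i | d = begin
  suc i                       ≤⟨ +-mono-≤ 1≤log i≤log ⟩
  ⌊log₂ n ⌋ + ⌊log₂ n ⌋       ≡⟨ cong (⌊log₂ n ⌋ +_) (sym (+-identityʳ ⌊log₂ n ⌋)) ⟩
  2 * ⌊log₂ n ⌋               ∎
  where
  open ≤-Reasoning
  i≤log : i ≤ ⌊log₂ n ⌋
  i≤log = ≤-trans (≤-reflexive (sym (⌊log₂[2^n]⌋≡n i))) (⌊log₂⌋-mono-≤ (digits-lower d))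
  1≤log : 1 ≤ ⌊log₂ n ⌋
  1≤log = ≤-trans (≤-reflexive (sym (⌊log₂[2^n]⌋≡n 1))) (⌊log₂⌋-mono-≤ 2≤n)

-- Opaque, because the conversion checker must not evaluate the literals.
abstract
  tupleFactor : (k′ : ℕ) → ℕ
  tupleFactor k′ = 20 + 16 * k′ + 2442

  fixedFactor : (k′ a d : ℕ) → ℕ
  fixedFactor k′ a d = 139 + 6 * (2+ k′) + 14 * k′ + 22 * ((2+ k′) * a) + (16 + 22 * d)

  tupleFactor≡ : ∀ k′ → tupleFactor k′ ≡ 20 + 16 * k′ + 2442
  tupleFactor≡ k′ = refl

  fixedFactor≡ : ∀ k′ a d → fixedFactor k′ a d ≡ 139 + 6 * (2+ k′) + 14 * k′ + 22 * ((2+ k′) * a) + (16 + 22 * d)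
  fixedFactor≡ k′ a d = refl

timeFactor : (k′ a d : ℕ) → ℕ
timeFactor k′ a d = fixedFactor k′ a d + tupleFactor k′

module Time (k′ a d n : ℕ) (2≤n : 2 ≤ n) where

  open Sizes (2+ k′) n 0

  private
    l root : ℕ
    l    = lgBits
    root = 2 ^ sqBits

    1≤l : 1 ≤ l
    1≤l = n≢0⇒n>0 λ l≡0 → <⇒≱ (subst (λ z → n < 2 ^ z) l≡0 (n<2^lg (2+ k′) n 0)) (≤-trans (s≤s z≤n) 2≤n)

    1≤root : 1 ≤ root
    1≤root = >-nonZero⁻¹ root {{m^n≢0 2 sqBits}}

    n≢0 : NonZero n
    n≢0 = >-nonZero (≤-trans (s≤s z≤n) 2≤n)

    instance
      l≢0 : NonZero l
      l≢0 = >-nonZero 1≤l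
      root≢0 : NonZero root
      root≢0 = >-nonZero 1≤root
      rounds≢0 : NonZero rounds
      rounds≢0 = m*n≢0 n _ {{n≢0}} {{m*n≢0 (l * l * (l * l)) (l * l) {{m*n≢0 (l * l) (l * l) {{m*n≢0 l l}} {{m*n≢0 l l}}}} {{m*n≢0 l l}}}}
      count≢0 : NonZero (n ^ k′)
      count≢0 = m^n≢0 n k′ {{n≢0}}

    pad : ∀ c x → .{{_ : NonZero x}} → c ≤ c * x
    pad c x = m≤m*n c x

    -- The numbers here and below add up instruction counts; since `1 ≤ l`, additive constants are
    -- absorbed into the multiples of `l`.
    hash≤ : hashCost width ≤ 175 * l
    hash≤ = begin
      14 + loopCost 19 width   ≡⟨ trans (cong (14 +_) (loopCost≡ 19 width)) (lemma l) ⟩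
      15 + 160 * l             ≤⟨ +-monoˡ-≤ (160 * l) (pad 15 l) ⟩
      15 * l + 160 * l         ≡⟨ sym (*-distribʳ-+ l 15 160) ⟩
      175 * l                  ∎
      where
      open ≤-Reasoning
      lemma : ∀ l → 14 + suc (8 * l * 20) ≡ 15 + 160 * l
      lemma = solve-∀

    add : ∀ {x} b c → x ≤ b * l → c + x ≤ (c + b) * l
    add {x} b c le = ≤-trans (+-mono-≤ (pad c l) le) (≤-reflexive (sym (*-distribʳ-+ l c b)))

    move≤ : moveCost width ≤ 202 * l
    move≤ = ≤-trans (≤-reflexive (lemma (hashCost width))) (add 175 27 hash≤)
      where
      lemma : ∀ h → suc (3 + suc (suc (3 + suc (suc 9 + suc (3 + h))) + 3)) ≡ 27 + h
      lemma = solve-∀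

    floyd≤ : suc (floydCost width) ≤ 626 * l
    floyd≤ = ≤-trans (≤-reflexive (lemma (moveCost width))) (add 606 20 (≤-trans (*-monoʳ-≤ 3 move≤) (≤-reflexive (sym (*-assoc 3 202 l)))))
      where
      lemma : ∀ h → suc (suc (3 + suc (h + suc (h + suc (h + suc (7 + 4)))))) ≡ 20 + 3 * h
      lemma = solve-∀

    collect≤ : suc (collectCost width) ≤ 441 * l
    collect≤ = ≤-trans (≤-reflexive (lemma (moveCost width))) (add 404 37 (≤-trans (*-monoʳ-≤ 2 move≤) (≤-reflexive (sym (*-assoc 2 202 l)))))
      where
      lemma : ∀ h → suc (suc (25 + suc (suc 7 + suc (h + h)))) ≡ 37 + 2 * h
      lemma = solve-∀

    -- The two loops over a walk dominate: they have at most `2 * root` rounds each, and a round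
    -- evaluates a bounded number of hashes at a cost linear in `l`.
    iteration≤ : suc (iterationCost width (reach + reach)) ≤ 2442 * (root * l)
    iteration≤ = begin
      suc (iterationCost width L)
        ≡⟨ trans (cong₂ (λ x y → suc (suc (3 + suc (17 + suc (x + suc (3 + suc (hashCost width + suc (11 + suc (y + suc (7 + loopCost (collectCost width) L))))))))))
             (loopCost≡ 9 width) (loopCost≡ (floydCost width) L))
             (trans (cong (λ y → suc (suc (3 + suc (17 + suc (suc (width * 10) + suc (3 + suc (hashCost width + suc (11 + suc (suc (L * suc (floydCost width)) + suc (7 + y)))))))))) (loopCost≡ (collectCost width) L))
               (lemma₁ (hashCost width) l L (suc (floydCost width)) (suc (collectCost width)))) ⟩
      53 + (hashCost width + 80 * l) + L * (suc (floydCost width) + suc (collectCost width))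
        ≤⟨ +-mono-≤ (≤-trans (add 255 53 (≤-trans (+-monoˡ-≤ (80 * l) hash≤) (≤-reflexive (sym (*-distribʳ-+ l 175 80)))))
             (≤-trans (*-monoʳ-≤ 308 (m≤n*m l root)) ≤-refl))
             (*-mono-≤ (+-mono-≤ reach≤root reach≤root) (+-mono-≤ floyd≤ collect≤)) ⟩
      308 * (root * l) + (root + root) * (626 * l + 441 * l)
        ≡⟨ lemma₂ root l ⟩
      2442 * (root * l) ∎
      where
      open ≤-Reasoning
      L : ℕ
      L = reach + reach
      reach≤root : reach ≤ root
      reach≤root = quot≤ root (l * l)
      lemma₁ : ∀ h l L f c → suc (suc (3 + suc (17 + suc (suc (8 * l * 10) + suc (3 + suc (h + suc (11 + suc (suc (L * f) + suc (7 + suc (L * c)))))))))) ≡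
                             53 + (h + 80 * l) + L * (f + c)
      lemma₁ = solve-∀
      lemma₂ : ∀ r l → 308 * (r * l) + (r + r) * (626 * l + 441 * l) ≡ 2442 * (r * l)
      lemma₂ = solve-∀

  abstract
    work : ℕ
    work = rounds * (root * l)

    work≡ : work ≡ rounds * (root * l)
    work≡ = refl

  private
    instance
      work≢0 : NonZero work
      work≢0 = subst NonZero (sym work≡) (m*n≢0 rounds (root * l) {{rounds≢0}} {{m*n≢0 root l}})

    tuple≤ : suc (tupleCost width (reach + reach) rounds k′) ≤ tupleFactor k′ * work
    tuple≤ = begin
      suc (tupleCost width (reach + reach) rounds k′)
        ≡⟨ trans (cong₂ (λ x y → suc (suc (9 + suc (x + suc (5 + y))))) (loopCost≡ 15 k′) (loopCost≡ (iterationCost width (reach + reach)) rounds))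
             (lemma₁ k′ (rounds * suc (iterationCost width (reach + reach)))) ⟩
      20 + 16 * k′ + rounds * suc (iterationCost width (reach + reach))
        ≤⟨ +-mono-≤ (pad (20 + 16 * k′) work) (*-monoʳ-≤ rounds iteration≤) ⟩
      (20 + 16 * k′) * work + rounds * (2442 * (root * l))
        ≡⟨ trans (cong ((20 + 16 * k′) * work +_) (trans (swap rounds 2442 (root * l)) (cong (2442 *_) (sym work≡))))
             (trans (sym (*-distribʳ-+ work (20 + 16 * k′) 2442)) (cong (_* work) (sym (tupleFactor≡ k′)))) ⟩
      tupleFactor k′ * work ∎
      where
      open ≤-Reasoning
      lemma₁ : ∀ k r → suc (suc (9 + suc (suc (k * 16) + suc (5 + suc r)))) ≡ 20 + 16 * k + r
      lemma₁ = solve-∀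
      swap : ∀ r c w → r * (c * w) ≡ c * (r * w)
      swap = solve-∀

    count≡ : count ≡ n ^ k′
    count≡ = trans (quot≡/ (n * (n * n ^ k′)) (n * n) {{m*n≢0 n n {{n≢0}} {{n≢0}}}}) (trans
      (cong (λ z → _/_ z (n * n) {{m*n≢0 n n {{n≢0}} {{n≢0}}}}) (trans (sym (*-assoc n n (n ^ k′))) (*-comm (n * n) (n ^ k′))))
      (m*n/n≡m (n ^ k′) (n * n) {{m*n≢0 n n {{n≢0}} {{n≢0}}}}))

    rest≤ : 3 + setupTime (2+ k′) l sqBits (suc ((2+ k′) * a + l * d)) + emitCost k′ ≤ fixedFactor k′ a d * work
    rest≤ = begin
      3 + setupTime (2+ k′) l sqBits (suc (ka + l * d)) + emitCost k′
        ≡⟨ cong₂ (λ x y → 3 + x + y)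
             (cong₂ (λ x y → suc (15 + suc (x + suc (33 + suc (y + suc (5 + suc (loopCost 7 sqBits + suc (25 + suc (loopCost 21 (suc (ka + l * d)) + 5)))))))))
               (loopCost≡ 5 (2+ k′)) (loopCost≡ 7 l))
             (cong (λ x → suc (3 + suc (1 + suc (3 + suc (1 + suc (5 + x)))))) (loopCost≡ 13 k′)) ⟩
      3 + suc (15 + suc (suc ((2+ k′) * 6) + suc (33 + suc (suc (l * 8) + suc (5 + suc (loopCost 7 sqBits + suc (25 + suc (loopCost 21 (suc (ka + l * d)) + 5)))))))) +
      suc (3 + suc (1 + suc (3 + suc (1 + suc (5 + suc (k′ * 14))))))
        ≡⟨ cong₂ (λ x y → 3 + suc (15 + suc (suc ((2+ k′) * 6) + suc (33 + suc (suc (l * 8) + suc (5 + suc (x + suc (25 + suc (y + 5)))))))) +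
             suc (3 + suc (1 + suc (3 + suc (1 + suc (5 + suc (k′ * 14)))))))
             (loopCost≡ 7 sqBits) (loopCost≡ 21 (suc (ka + l * d))) ⟩
      3 + suc (15 + suc (suc ((2+ k′) * 6) + suc (33 + suc (suc (l * 8) + suc (5 + suc (suc (sqBits * 8) + suc (25 + suc (suc (suc (ka + l * d) * 22) + 5)))))))) +
      suc (3 + suc (1 + suc (3 + suc (1 + suc (5 + suc (k′ * 14))))))
        ≡⟨ lemma₁ (2+ k′) k′ l sqBits ka d ⟩
      139 + 6 * (2+ k′) + 14 * k′ + 22 * ka + (8 * l + 8 * sqBits + 22 * d * l)
        ≤⟨ +-mono-≤ (pad (139 + 6 * (2+ k′) + 14 * k′ + 22 * ka) work)
             (+-mono-≤ (+-mono-≤ (*-monoʳ-≤ 8 l≤work) (*-monoʳ-≤ 8 sq≤work)) (*-monoʳ-≤ (22 * d) l≤work)) ⟩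
      (139 + 6 * (2+ k′) + 14 * k′ + 22 * ka) * work + (8 * work + 8 * work + 22 * d * work)
        ≡⟨ trans (cong ((139 + 6 * (2+ k′) + 14 * k′ + 22 * ka) * work +_) (lemma₂ d work))
             (trans (sym (*-distribʳ-+ work (139 + 6 * (2+ k′) + 14 * k′ + 22 * ka) (16 + 22 * d))) (cong (_* work) (sym (fixedFactor≡ k′ a d)))) ⟩
      fixedFactor k′ a d * work ∎
      where
      open ≤-Reasoning
      ka : ℕ
      ka = (2+ k′) * a
      l≤work : l ≤ work
      l≤work = ≤-trans (≤-trans (m≤n*m l root) (m≤n*m (root * l) rounds)) (≤-reflexive (sym work≡))
      sq≤work : sqBits ≤ work
      sq≤work = ≤-trans (<⇒≤ (n<2^n sqBits)) (≤-trans (≤-trans (m≤m*n root l) (m≤n*m (root * l) rounds)) (≤-reflexive (sym work≡)))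
      lemma₁ : ∀ K k l s A d → 3 + suc (15 + suc (suc (K * 6) + suc (33 + suc (suc (l * 8) + suc (5 + suc (suc (s * 8) + suc (25 + suc (suc (suc (A + l * d) * 22) + 5)))))))) +
        suc (3 + suc (1 + suc (3 + suc (1 + suc (5 + suc (k * 14)))))) ≡ 139 + 6 * K + 14 * k + 22 * A + (8 * l + 8 * s + 22 * d * l)
      lemma₁ = solve-∀
      lemma₂ : ∀ d w → 8 * w + 8 * w + 22 * d * w ≡ (16 + 22 * d) * w
      lemma₂ = solve-∀

  timeBound≤ : timeBound (2+ k′) a d n ≤ timeFactor k′ a d * (n ^ k′ * work)
  timeBound≤ = begin
    timeBound (2+ k′) a d n
      ≡⟨ cong (λ x → suc (suc (st + x) + emitCost k′)) (trans (loopCost≡ tc count) (cong (λ c → suc (c * suc tc)) count≡)) ⟩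
    suc (suc (st + suc (n ^ k′ * suc tc)) + emitCost k′)
      ≡⟨ lemma₁ st (n ^ k′ * suc tc) (emitCost k′) ⟩
    3 + st + emitCost k′ + n ^ k′ * suc tc
      ≤⟨ +-mono-≤ (≤-trans rest≤ (*-monoʳ-≤ (fixedFactor k′ a d) (m≤n*m work (n ^ k′)))) (*-monoʳ-≤ (n ^ k′) tuple≤) ⟩
    fixedFactor k′ a d * (n ^ k′ * work) + n ^ k′ * (tupleFactor k′ * work)
      ≡⟨ lemma₂ (fixedFactor k′ a d) (n ^ k′) (tupleFactor k′) work ⟩
    timeFactor k′ a d * (n ^ k′ * work) ∎
    where
    open ≤-Reasoning
    st tc : ℕ
    st = setupTime (2+ k′) l sqBits (suc ((2+ k′) * a + l * d))
    tc = tupleCost width (reach + reach) rounds k′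
    lemma₁ : ∀ s x e → suc (suc (s + suc x) + e) ≡ 3 + s + e + x
    lemma₁ = solve-∀
    lemma₂ : ∀ f p c w → f * (p * w) + p * (c * w) ≡ (f + c) * (p * w)
    lemma₂ = solve-∀

  log : ℕ
  log = ⌊log₂ n ^ (2 * (2+ k′) ∸ 1) ⌋

  -- The exponent 14 is twice 7: six factors `l` come from `rounds` and one from a hash evaluation.
  -- The square of `root` is at most `4 n`, which makes the power of `n` odd; `2 ^ 14` is the price
  -- of `l ≤ 2 * log`.
  timeBound² : timeBound (2+ k′) a d n ^ 2 ≤ timeFactor k′ a d * timeFactor k′ a d * (4 * 2 ^ 14) * (n ^ (2 * (2+ k′) ∸ 1) * log ^ 14)
  timeBound² = begin
    timeBound (2+ k′) a d n ^ 2
      ≤⟨ ^-monoˡ-≤ 2 timeBound≤ ⟩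
    (timeFactor k′ a d * (n ^ k′ * work)) ^ 2
      ≡⟨ cong (λ w → (timeFactor k′ a d * (n ^ k′ * w)) ^ 2) work≡ ⟩
    (timeFactor k′ a d * (n ^ k′ * (n * (l * l * (l * l) * (l * l)) * (root * l)))) ^ 2
      ≡⟨ lemma₁ (timeFactor k′ a d) (n ^ k′) n l root ⟩
    timeFactor k′ a d * timeFactor k′ a d * (n ^ k′ * n ^ k′ * (n * n) * (l ^ 14 * (root * root)))
      ≤⟨ *-monoʳ-≤ (timeFactor k′ a d * timeFactor k′ a d) (*-monoʳ-≤ (n ^ k′ * n ^ k′ * (n * n))
           (*-mono-≤ (^-monoˡ-≤ 14 l≤) (square-root≤ (proj₂ (digits 2 n)) (≤-trans (s≤s z≤n) 2≤n)))) ⟩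
    timeFactor k′ a d * timeFactor k′ a d * (n ^ k′ * n ^ k′ * (n * n) * ((2 * log) ^ 14 * (4 * n)))
      ≡⟨ cong (λ z → timeFactor k′ a d * timeFactor k′ a d * (n ^ k′ * n ^ k′ * (n * n) * (z * (4 * n)))) (^-distribʳ-* 14 2 log) ⟩
    timeFactor k′ a d * timeFactor k′ a d * (n ^ k′ * n ^ k′ * (n * n) * (2 ^ 14 * log ^ 14 * (4 * n)))
      ≡⟨ lemma₂ (timeFactor k′ a d * timeFactor k′ a d) (n ^ k′) n (2 ^ 14) (log ^ 14) ⟩
    timeFactor k′ a d * timeFactor k′ a d * (4 * 2 ^ 14) * (n ^ k′ * n ^ k′ * (n * n * n) * log ^ 14)
      ≡⟨ cong (λ z → timeFactor k′ a d * timeFactor k′ a d * (4 * 2 ^ 14) * (z * log ^ 14)) exponent ⟩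
    timeFactor k′ a d * timeFactor k′ a d * (4 * 2 ^ 14) * (n ^ (2 * (2+ k′) ∸ 1) * log ^ 14) ∎
    where
    open ≤-Reasoning
    1≤exponent : 1 ≤ 2 * (2+ k′) ∸ 1
    1≤exponent = s≤s z≤n
    l≤ : l ≤ 2 * log
    l≤ = ≤-trans (lg≤2log (2+ k′) n 0 2≤n) (*-monoʳ-≤ 2 (⌊log₂⌋-mono-≤
      (≤-trans (≤-reflexive (sym (*-identityʳ n))) (^-monoʳ-≤ n {{n≢0}} 1≤exponent))))
    lemma₁ : ∀ c p n l r → c * (p * (n * (l * l * (l * l) * (l * l)) * (r * l))) * (c * (p * (n * (l * l * (l * l) * (l * l)) * (r * l))) * 1) ≡
      c * c * (p * p * (n * n) * (l * (l * (l * (l * (l * (l * (l * (l * (l * (l * (l * (l * (l * (l * 1))))))))))))) * (r * r)))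
    lemma₁ = solve-∀
    lemma₂ : ∀ c p n t g → c * (p * p * (n * n) * (t * g * (4 * n))) ≡ c * (4 * t) * (p * p * (n * n * n) * g)
    lemma₂ = solve-∀
    exponent : n ^ k′ * n ^ k′ * (n * n * n) ≡ n ^ (2 * (2+ k′) ∸ 1)
    exponent = trans (lemma₃ (n ^ k′ * n ^ k′) n) (trans (cong (n ^ 3 *_) (sym (^-distribˡ-+-* n k′ k′)))
      (trans (sym (^-distribˡ-+-* n 3 (k′ + k′))) (cong (n ^_) (sym (cong (_∸ 1) (lemma₄ k′))))))
      where
      lemma₃ : ∀ p n → p * (n * n * n) ≡ n * (n * (n * 1)) * p
      lemma₃ = solve-∀
      lemma₄ : ∀ k → 2 * (2+ k) ≡ suc (3 + (k + k))
      lemma₄ = solve-∀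

-- Logarithmic space.

levels≤2^ : ∀ {B x} r → B ≤ 2 ^ x → levels B r ≤ 2 ^ (x * 2 ^ r)
levels≤2^ {B} {x} zero    le = ≤-trans le (≤-reflexive (cong (2 ^_) (sym (*-identityʳ x))))
levels≤2^ {B} {x} (suc r) le = begin
  levels B r * levels B r                ≤⟨ *-mono-≤ (levels≤2^ {B} {x} r le) (levels≤2^ {B} {x} r le) ⟩
  2 ^ (x * 2 ^ r) * 2 ^ (x * 2 ^ r)      ≡⟨ sym (^-distribˡ-+-* 2 (x * 2 ^ r) (x * 2 ^ r)) ⟩
  2 ^ (x * 2 ^ r + x * 2 ^ r)            ≡⟨ cong (2 ^_) (lemma x (2 ^ r)) ⟩
  2 ^ (x * 2 ^ suc r)                    ∎
  where
  open ≤-Reasoning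
  lemma : ∀ x p → x * p + x * p ≡ x * (2 * p)
  lemma = solve-∀

2^+2^≤ : ∀ {a b} x y → a ≤ 2 ^ x → b ≤ 2 ^ y → a + b ≤ 2 ^ suc (x + y)
2^+2^≤ {a} {b} x y a≤ b≤ = ≤-trans (+-mono-≤ (≤-trans a≤ (^-monoʳ-≤ 2 (m≤m+n x y))) (≤-trans b≤ (^-monoʳ-≤ 2 (m≤n+m y x))))
  (≤-reflexive (cong (2 ^ (x + y) +_) (sym (+-identityʳ (2 ^ (x + y))))))

-- Bounds every number the program reads, computes a power of, or uses as a
-- literal, for all m ≤ a n^d.
sizeBound : (k a d n : ℕ) → ℕ
sizeBound k a d n = (8 + k + n) + (a * n ^ d + n ^ k)

sizeBound≤2^ : ∀ k a d n → 2 ≤ n → sizeBound k a d n ≤ 2 ^ ((12 + k + a + d + k) * Sizes.lgBits k n 0)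
sizeBound≤2^ k a d n 2≤n = ≤-trans
  (2^+2^≤ {8 + k + n} {a * n ^ d + n ^ k} (suc (8 + k + l)) (suc (a + l * d + l * k))
    (2^+2^≤ {8 + k} {n} (8 + k) l (<⇒≤ (n<2^n (8 + k))) (<⇒≤ (n<2^lg k n 0)))
    (2^+2^≤ (a + l * d) (l * k)
      (≤-trans (*-mono-≤ (<⇒≤ (n<2^n a)) (power≤2^ k n 0 d)) (≤-reflexive (sym (^-distribˡ-+-* 2 a (l * d)))))
      (power≤2^ k n 0 k)))
  (^-monoʳ-≤ 2 (begin
    suc (suc (8 + k + l) + suc (a + l * d + l * k))  ≡⟨ lemma₁ k l a d ⟩
    (11 + k + a) + (1 + d + k) * l                   ≤⟨ +-monoˡ-≤ ((1 + d + k) * l) (m≤m*n (11 + k + a) l {{>-nonZero 1≤l}}) ⟩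
    (11 + k + a) * l + (1 + d + k) * l               ≡⟨ lemma₂ k l a d ⟩
    (12 + k + a + d + k) * l                         ∎))
  where
  open ≤-Reasoning
  l : ℕ
  l = Sizes.lgBits k n 0
  1≤l : 1 ≤ l
  1≤l = n≢0⇒n>0 λ l≡0 → <⇒≱ (subst (λ z → n < 2 ^ z) l≡0 (n<2^lg k n 0)) (≤-trans (s≤s z≤n) 2≤n)
  lemma₁ : ∀ k l a d → suc (suc (8 + k + l) + suc (a + l * d + l * k)) ≡ (11 + k + a) + (1 + d + k) * l
  lemma₁ = solve-∀
  lemma₂ : ∀ k l a d → (11 + k + a) * l + (1 + d + k) * l ≡ (12 + k + a + d + k) * l
  lemma₂ = solve-∀

-- The logarithm of `levels B r`, that is of `B ^ 2 ^ r`, is `2 ^ r` times that of `B`. For fixed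
-- `k`, `a` and `d` the size bound is polynomial in `n`, and `R` and `r` are fixed by the program.
log-levels∈O : ∀ R r k a d → (λ n → R * suc ⌊log₂ levels (sizeBound k a d n) r ⌋) ∈O ⌊log₂_⌋
log-levels∈O R r k a d = R * (suc (c * 2 ^ r) * 2) , 2 , bounded
  where
  open ≤-Reasoning
  c : ℕ
  c = 12 + k + a + d + k
  bounded : ∀ n → 2 ≤ n → R * suc ⌊log₂ levels (sizeBound k a d n) r ⌋ ≤ R * (suc (c * 2 ^ r) * 2) * ⌊log₂ n ⌋
  bounded n 2≤n = begin
    R * suc ⌊log₂ levels (sizeBound k a d n) r ⌋
      ≤⟨ *-monoʳ-≤ R (s≤s (⌊log₂⌋-mono-≤ (levels≤2^ {x = c * l} r (sizeBound≤2^ k a d n 2≤n)))) ⟩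
    R * suc ⌊log₂ 2 ^ (c * l * 2 ^ r) ⌋
      ≡⟨ cong (λ z → R * suc z) (⌊log₂[2^n]⌋≡n (c * l * 2 ^ r)) ⟩
    R * suc (c * l * 2 ^ r)
      ≤⟨ *-monoʳ-≤ R (+-monoˡ-≤ (c * l * 2 ^ r) 1≤l) ⟩
    R * (l + c * l * 2 ^ r)
      ≡⟨ lemma₁ R l c (2 ^ r) ⟩
    R * (suc (c * 2 ^ r) * l)
      ≤⟨ *-monoʳ-≤ R (*-monoʳ-≤ (suc (c * 2 ^ r)) (lg≤2log k n 0 2≤n)) ⟩
    R * (suc (c * 2 ^ r) * (2 * ⌊log₂ n ⌋))
      ≡⟨ lemma₂ R (suc (c * 2 ^ r)) ⌊log₂ n ⌋ ⟩
    R * (suc (c * 2 ^ r) * 2) * ⌊log₂ n ⌋ ∎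
    where
    l : ℕ
    l = Sizes.lgBits k n 0
    1≤l : 1 ≤ l
    1≤l = n≢0⇒n>0 λ l≡0 → <⇒≱ (subst (λ z → n < 2 ^ z) l≡0 (n<2^lg k n 0)) (≤-trans (s≤s z≤n) 2≤n)
    lemma₁ : ∀ R l c p → R * (l + c * l * p) ≡ R * (suc (c * p) * l)
    lemma₁ = solve-∀
    lemma₂ : ∀ R s g → R * (s * (2 * g)) ≡ R * (s * 2) * g
    lemma₂ = solve-∀

abstract
  registerCount topRank : ℕ
  registerCount = 58
  topRank       = 13

  registerCount≡ : registerCount ≡ 58
  registerCount≡ = refl

  topRank≡ : topRank ≡ 13
  topRank≡ = refl

spaceBound : (k a d n : ℕ) → ℕ
spaceBound k a d n = registerCount * suc ⌊log₂ levels (sizeBound k a d n) topRank ⌋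

runs-in-space : ∀ {k n m} a d → m ≤ a * n ^ d → (w : Vectors k n m) (t : ℤ) → RunsInSpace kSum (instanceOf w t) (spaceBound k a d n)
runs-in-space {k} {n} {m} a d m≤ w t coins = Space.space≤ (instanceOf w t) (sizeBound k a d n)
  (≤-trans (≤-trans (m≤m+n 8 k) (m≤m+n (8 + k) n)) small≤)
  (≤-trans (≤-trans (m≤n+m k 8) (m≤m+n (8 + k) n)) small≤)
  (≤-trans (m≤n+m n (8 + k)) small≤)
  m≤B
  (λ x p → ≤-trans (read≤m w x p) m≤B)
  (≤-trans (m≤n+m (n ^ k) (a * n ^ d)) (m≤n+m (a * n ^ d + n ^ k) (8 + k + n)))
  coins registerCount≡ topRank≡
  where
  small≤ : 8 + k + n ≤ sizeBound k a d n
  small≤ = m≤m+n (8 + k + n) (a * n ^ d + n ^ k)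
  m≤B : m ≤ sizeBound k a d n
  m≤B = ≤-trans m≤ (≤-trans (m≤m+n (a * n ^ d) (n ^ k)) (m≤n+m (a * n ^ d + n ^ k) (8 + k + n)))

-- Success probability over lists and coins.

successes-of : (A : Algorithm) (I : Instance) (T : ℕ) → ℕ
successes-of A I T = ∑ (words bools T) (λ coins → 𝟙 (succeeds? A I (Vec.toList coins)))

success-probability : ∀ {A k n m T t} L →
  length (words (words (allFin m) n) k) * 2 ^ T ≤ L * ∑ (words (words (allFin m) n) k) (λ w → successes-of A (instanceOf w (t w)) T) →
  SucceedsWithProb≥1/ L A k n m T t
success-probability {A} {k} {n} {m} {T} {t} L le = begin
  length (sampleSpace k n m T)
    ≡⟨ trans (length-∑ (sampleSpace k n m T)) (trans (∑-cartesianProductWith _,_ Ω (words bools T) (λ _ → 1)) (∑-const Ω _)) ⟩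
  length Ω * ∑ (words bools T) (λ _ → 1)
    ≡⟨ cong (length Ω *_) (trans (sym (length-∑ (words bools T))) (length-words bools T)) ⟩
  length Ω * 2 ^ T
    ≤⟨ le ⟩
  L * ∑ Ω (λ w → successes-of A (instanceOf w (t w)) T)
    ≡⟨ cong (L *_) (sym (trans (length-filter success? (sampleSpace k n m T))
         (∑-cartesianProductWith _,_ Ω (words bools T) (λ s → 𝟙 (success? s))))) ⟩
  L * length (List.filter success? (sampleSpace k n m T)) ∎
  where
  open ≤-Reasoning
  Ω : List (Vectors k n m)
  Ω = words (words (allFin m) n) k
  success? : ∀ (s : Vectors k n m × Vec Bool T) → Dec (Succeeds A (instanceOf (proj₁ s) (t (proj₁ s))) (Vec.toList (proj₂ s)))
  success? (w , coins) = succeeds? A (instanceOf w (t w)) (Vec.toList coins)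

∑-heads : ∀ {A : Set} (Ω : List A) k (b : A → A → ℕ) →
  ∑ (words Ω (2+ k)) (λ v → b (Vec.head v) (Vec.head (Vec.tail v))) ≡ length (words Ω k) * ∑ Ω (λ x → ∑ Ω (b x))
∑-heads Ω k b = trans (∑-words-suc Ω (suc k) _) (trans
  (∑-cong Ω (λ x → trans (∑-words-suc Ω k _) (trans (∑-cong Ω (λ y → ∑-const (words Ω k) (b x y))) (∑-*ˡ Ω (length (words Ω k)) (b x)))))
  (∑-*ˡ Ω (length (words Ω k)) (λ x → ∑ Ω (b x))))

-- If a word succeeds at least half the time unless its first two letters are
-- bad, and at most half of the pairs are bad, a quarter of everything succeeds.
quarter-success : ∀ {A : Set} (Ω : List A) k (b : A → A → ℕ) (F : Vec A (2+ k) → ℕ) c →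
  (∀ x y v → b x y ≡ 0 → c ≤ 2 * F (x ∷ y ∷ v)) → 2 * ∑ Ω (λ x → ∑ Ω (b x)) ≤ length Ω * length Ω →
  length (words Ω (2+ k)) * c ≤ 4 * ∑ (words Ω (2+ k)) F
quarter-success Ω k b F c half rare = +-cancelʳ-≤ X X (4 * S) (begin
  X + X
    ≤⟨ +-mono-≤ X≤ X≤ ⟩
  2 * S + c * (M * β) + (2 * S + c * (M * β))
    ≡⟨ lemma₁ S c M β ⟩
  4 * S + c * M * (2 * β)
    ≤⟨ +-monoʳ-≤ (4 * S) (*-monoʳ-≤ (c * M) rare) ⟩
  4 * S + c * M * (N * N)
    ≡⟨ cong (4 * S +_) (trans (lemma₂ c M N) (cong (_* c) (sym length≡))) ⟩
  4 * S + X ∎)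
  where
  open ≤-Reasoning
  N M X S β : ℕ
  N = length Ω
  M = length (words Ω k)
  X = length (words Ω (2+ k)) * c
  S = ∑ (words Ω (2+ k)) F
  β = ∑ Ω (λ x → ∑ Ω (b x))
  length≡ : length (words Ω (2+ k)) ≡ N * (N * M)
  length≡ = trans (length-words Ω (2+ k)) (cong (λ z → N * (N * z)) (sym (length-words Ω k)))
  pointwise : ∀ v → c ≤ 2 * F v + c * b (Vec.head v) (Vec.head (Vec.tail v))
  pointwise (x ∷ y ∷ v) = go (b x y) refl
    where
    go : ∀ z → b x y ≡ z → c ≤ 2 * F (x ∷ y ∷ v) + c * z
    go zero    eq = ≤-trans (half x y v eq) (m≤m+n _ (c * 0))
    go (suc z) eq = ≤-trans (m≤m*n c (suc z)) (m≤n+m (c * suc z) _)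
  X≤ : X ≤ 2 * S + c * (M * β)
  X≤ = begin
    X
      ≡⟨ sym (∑-const (words Ω (2+ k)) c) ⟩
    ∑ (words Ω (2+ k)) (λ _ → c)
      ≤⟨ ∑-mono (words Ω (2+ k)) pointwise ⟩
    ∑ (words Ω (2+ k)) (λ v → 2 * F v + c * b (Vec.head v) (Vec.head (Vec.tail v)))
      ≡⟨ ∑-+ (words Ω (2+ k)) (λ v → 2 * F v) _ ⟩
    ∑ (words Ω (2+ k)) (λ v → 2 * F v) + ∑ (words Ω (2+ k)) (λ v → c * b (Vec.head v) (Vec.head (Vec.tail v)))
      ≡⟨ cong₂ _+_ (∑-*ˡ (words Ω (2+ k)) 2 F) (trans (∑-*ˡ (words Ω (2+ k)) c _) (cong (c *_) (∑-heads Ω k b))) ⟩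
    2 * S + c * (M * β) ∎
  lemma₁ : ∀ S c M β → 2 * S + c * (M * β) + (2 * S + c * (M * β)) ≡ 4 * S + c * M * (2 * β)
  lemma₁ = solve-∀
  lemma₂ : ∀ c M N → c * M * (N * N) ≡ N * (N * M) * c
  lemma₂ = solve-∀

term≤∑-words : ∀ {A : Set} (Ω : List A) x → (∀ f → f x ≤ ∑ Ω f) → ∀ n (F : Vec A n → ℕ) → F (Vec.replicate n x) ≤ ∑ (words Ω n) F
term≤∑-words Ω x pick zero    F = m≤m+n (F []) 0
term≤∑-words Ω x pick (suc n) F = ≤-trans (term≤∑-words Ω x pick n (λ v → F (x ∷ v)))
  (≤-trans (pick (λ a → ∑ (words Ω n) (λ v → F (a ∷ v)))) (≤-reflexive (sym (∑-words-suc Ω n F))))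

ones : ∀ {m} n {x} → x ∈ List.map (λ i → suc (toℕ i)) (Vec.toList (Vec.replicate n (Fin.zero {m}))) → x ≡ 1
ones (suc n) (here eq)  = eq
ones (suc n) (there x∈) = ones n x∈

ones-unique : ∀ {m} n k {s s′} → Pointwise _∈_ s (entries (Vec.replicate k (Vec.replicate n (Fin.zero {m})))) →
  Pointwise _∈_ s′ (entries (Vec.replicate k (Vec.replicate n (Fin.zero {m})))) → s ≡ s′
ones-unique n zero    []       []         = refl
ones-unique n (suc k) (x∈ ∷ p) (x′∈ ∷ p′) = cong₂ _∷_ (trans (ones n x∈) (sym (ones n x′∈))) (ones-unique n k p p′)

-- The output always consists of entries of the lists, so it is right when
-- there is nothing to choose.
unique-choice-succeeds : ∀ {k′ n m} .{{_ : NonZero n}} (w₁ w₂ : Vec (Fin m) n) (ws : Vec (Vec (Fin m) n) k′) (t : ℤ) →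
  (∀ {s s′} → Pointwise _∈_ s (entries (w₁ ∷ w₂ ∷ ws)) → Pointwise _∈_ s′ (entries (w₁ ∷ w₂ ∷ ws)) → s ≡ s′) →
  ∀ T → runTime (2+ k′) n m ≤ T → (coins : Vec Bool T) → Succeeds kSum (instanceOf (w₁ ∷ w₂ ∷ ws) t) (Vec.toList coins)
unique-choice-succeeds {k′} {n} {m} w₁ w₂ ws t unique T τ≤T coins (s , s∈ , sum≡) = go (sym T≡) coins
  where
  open Answers w₁ w₂ ws t
  open Program I (read≤m w) InRange InRange id (λ _ → 0) (λ _ → refl) (>-nonZero⁻¹ n , >-nonZero⁻¹ n)
  e : ℕ
  e = T ∸ runTime (2+ k′) n m
  T≡ : suc (Sizes.totalCost (2+ k′) n m + (emitCost k′ + e)) ≡ T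
  T≡ = trans (cong suc (sym (+-assoc (Sizes.totalCost (2+ k′) n m) _ e))) (m+[n∸m]≡n τ≤T)
  in-range : ∀ ρ → Final ρ → InRange (bestOf ρ)
  in-range ρ (u , b , i , walk , z , refl , ok) = ok
  correct : ∀ b → InRange b → Solution I (Emission.answer I (Setup.settled I) b)
  correct b (P<n , Q<n) = subst (Solution I) (unique s∈ (answer-member b P<n Q<n)) (s∈ , sum≡)
  go : ∀ {T} → T ≡ suc (Sizes.totalCost (2+ k′) n m + (emitCost k′ + e)) → (coins : Vec Bool T) →
    Solution I (Config.output (run kSum I (Vec.toList coins)))
  go refl coins =
    let outcome fin ex post _ = search-rand (λ j u _ i x y _ → rem-< _ n , rem-< _ n) 0 (λ _ _ → 0) (λ _ _ _ _ ()) 1 1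
                                  (no-wins (2 ^ Sizes.width (2+ k′) n m))
    in subst (Solution I) (sym (cong Config.output (proj₂ (run-program ex post e coins))))
         (correct _ (in-range _ (post _)))

-- The analysis needs n ≥ threshold; below it there are boundedly many inputs.
abstract
  threshold : ℕ
  threshold = 2 ^ 132

  threshold≡ : threshold ≡ 2 ^ 132
  threshold≡ = refl

-- Bounds the number of inputs below the threshold independently of `n`. One of them, in which all
-- entries are 1, succeeds for all coins, so `1 / fewInputs` is a success probability for small
-- positive `n`.
fewInputs : (k a d : ℕ) → ℕ
fewInputs k a d = (suc (a * threshold ^ d) ^ threshold) ^ k

module SuccessRate (k′ a d : ℕ) {n m : ℕ} (n≤m : n ≤ m) (m≤ : m ≤ a * n ^ d) (n∣m : n ∣ m)
                   (T : ℕ) (runTime≤T : runTime (2+ k′) n m ≤ T) (t : Vectors (2+ k′) n m → ℤ) where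

  private
    Ω : List (Vec (Fin m) n)
    Ω = words (allFin m) n

    inputs : List (Vectors (2+ k′) n m)
    inputs = words Ω (2+ k′)

    rate : Vectors (2+ k′) n m → ℕ
    rate w = successes-of kSum (instanceOf w (t w)) T

  large : threshold ≤ n → length inputs * 2 ^ T ≤ 4 * ∑ inputs rate
  large le = quarter-success Ω k′ badness rate (2 ^ T)
    (λ w₁ w₂ ws good → half-succeed w₁ w₂ ws (t (w₁ ∷ w₂ ∷ ws)) good T runTime≤T) badness-rare
    where
    instance
      n≢0 : NonZero n
      n≢0 = >-nonZero (≤-trans (≤-trans (>-nonZero⁻¹ (2 ^ 132) {{m^n≢0 2 132}}) (≤-reflexive (sym threshold≡))) le)
    open Large n∣m (Numerics.regime k′ n m n≤m (≤-trans (≤-reflexive (sym threshold≡)) le))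

  -- Without entries no instance is solvable, so success is vacuous.
  empty : n ≡ 0 → length inputs * 2 ^ T ≤ 1 * ∑ inputs rate
  empty n≡0 = begin
    length inputs * 2 ^ T        ≡⟨ sym (∑-const inputs (2 ^ T)) ⟩
    ∑ inputs (λ _ → 2 ^ T)       ≡⟨ ∑-cong inputs (λ w → sym (all-succeed kSum (instanceOf w (t w)) T (unsolvable n≡0 w (t w)))) ⟩
    ∑ inputs rate                ≡⟨ sym (*-identityˡ _) ⟩
    1 * ∑ inputs rate            ∎
    where
    open ≤-Reasoning
    unsolvable : ∀ {n m} → n ≡ 0 → (w : Vectors (2+ k′) n m) (t : ℤ) → ¬ Solvable (instanceOf w t)
    unsolvable refl ([] ∷ _) t (_ , () ∷ _ , _)

  small : n < threshold → 0 < n → length inputs * 2 ^ T ≤ fewInputs (2+ k′) a d * ∑ inputs rate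
  small n< 0<n = *-mono-≤ few (always (≤-trans 0<n n≤m) t)
    where
    instance
      n≢0 : NonZero n
      n≢0 = >-nonZero 0<n
    open ≤-Reasoning
    few : length inputs ≤ fewInputs (2+ k′) a d
    few = begin
      length inputs
        ≡⟨ trans (length-words Ω (2+ k′)) (cong (_^ (2+ k′)) (trans (length-words (allFin m) n) (cong (_^ n) (length-allFin m)))) ⟩
      (m ^ n) ^ (2+ k′)
        ≤⟨ ^-monoˡ-≤ (2+ k′) (^-monoˡ-≤ n (m≤n⇒m≤1+n (≤-trans m≤ (*-monoʳ-≤ a (^-monoˡ-≤ d (<⇒≤ n<)))))) ⟩
      (suc (a * threshold ^ d) ^ n) ^ (2+ k′)
        ≤⟨ ^-monoˡ-≤ (2+ k′) (^-monoʳ-≤ (suc (a * threshold ^ d)) (<⇒≤ n<)) ⟩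
      fewInputs (2+ k′) a d ∎
    always : 0 < m → (t : Vectors (2+ k′) n m → ℤ) → 2 ^ T ≤ ∑ inputs (λ w → successes-of kSum (instanceOf w (t w)) T)
    always (s≤s {n = m′} z≤n) t = begin
      2 ^ T
        ≡⟨ trans (sym (length-words bools T)) (length-∑ (words bools T)) ⟩
      ∑ (words bools T) (λ _ → 1)
        ≡⟨ ∑-cong (words bools T) (λ coins → sym (𝟙-yes (succeeds? kSum (instanceOf w (t w)) (Vec.toList coins))
             (unique-choice-succeeds v v (Vec.replicate k′ v) (t w) (ones-unique n (2+ k′)) T runTime≤T coins))) ⟩
      successes-of kSum (instanceOf w (t w)) T
        ≤⟨ term≤∑-words Ω v (term≤∑-words (allFin (suc m′)) Fin.zero (term≤∑ Fin.zero) n) (2+ k′) (λ w → successes-of kSum (instanceOf w (t w)) T) ⟩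
      ∑ inputs (λ w → successes-of kSum (instanceOf w (t w)) T) ∎
      where
      v : Vec (Fin (suc m′)) n
      v = Vec.replicate n Fin.zero
      w : Vectors (2+ k′) n (suc m′)
      w = Vec.replicate (2+ k′) v

  succeeds-often : SucceedsWithProb≥1/ (4 + fewInputs (2+ k′) a d) kSum (2+ k′) n m T t
  succeeds-often = success-probability {kSum} {2+ k′} {n} {m} {T} {t} (4 + fewInputs (2+ k′) a d) (go (threshold ≤? n) (n ≟ 0))
    where
    relax : ∀ {L} → L ≤ 4 + fewInputs (2+ k′) a d → length inputs * 2 ^ T ≤ L * ∑ inputs rate →
      length inputs * 2 ^ T ≤ (4 + fewInputs (2+ k′) a d) * ∑ inputs rate
    relax L≤ le = ≤-trans le (*-monoˡ-≤ (∑ inputs rate) L≤)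
    go : Dec (threshold ≤ n) → Dec (n ≡ 0) → length inputs * 2 ^ T ≤ (4 + fewInputs (2+ k′) a d) * ∑ inputs rate
    go (yes le) _         = relax (m≤m+n 4 _) (large le)
    go (no  _)  (yes n≡0) = relax (s≤s z≤n) (empty n≡0)
    go (no ¬le) (no n≢0)  = relax (m≤n+m _ 4) (small (≰⇒> ¬le) (n≢0⇒n>0 n≢0))

theorem4 :
  Σ[ A ∈ Algorithm ]
  ∀ (k : ℕ) → 2 ≤ k →
  ∀ (a d : ℕ) →
  Σ[ time ∈ (ℕ → ℕ) ] Σ[ space ∈ (ℕ → ℕ) ] Σ[ L ∈ ℕ ]
    (time ∈Õ√ (λ n → n ^ (2 * k ∸ 1))) ×
    (space ∈O ⌊log₂_⌋) ×
    (∀ (n m : ℕ) → n ≤ m → m ≤ a * n ^ d → n ∣ m →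
      (∀ (w : Vectors k n m) (t : ℤ) →
        RunsInTime A (instanceOf w t) (time n) ×
        RunsInSpace A (instanceOf w t) (space n)) ×
      (∀ (t : Vectors k n m → ℤ) →
        SucceedsWithProb≥1/ L A k n m (time n) t))
theorem4 = kSum , λ where
  (suc (suc k′)) _ a d →
    timeBound (2+ k′) a d , spaceBound (2+ k′) a d , 4 + fewInputs (2+ k′) a d ,
    (14 , timeFactor k′ a d * timeFactor k′ a d * (4 * 2 ^ 14) , 2 , λ n 2≤n → Time.timeBound² k′ a d n 2≤n) ,
    log-levels∈O registerCount topRank (2+ k′) a d ,
    λ n m n≤m m≤ n∣m →
      (λ w t → halts w t (timeBound (2+ k′) a d n) (runTime≤ (2+ k′) a d n m m≤) , runs-in-space a d m≤ w t) ,
      (λ t → SuccessRate.succeeds-often k′ a d n≤m m≤ n∣m (timeBound (2+ k′) a d n) (runTime≤ (2+ k′) a d n m m≤) t)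
  zero ()
  (suc zero) (s≤s ())
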